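{- Let $a,b,c,d,e,m$ be nonnegative integers, let $\pi=\Lambda(a,b,c,d,e,m)=\lambda/b^a$ be as in the context, and let $N=\sum_{(i,j)\in\lambda/b^a}(\lambda'_j-i)$. Then \[ s_{\pi}(1,q,q^2,\ldots)=q^{N}\prod_{i=1}^{a}\prod_{j=1}^{b}\prod_{k=1}^{c}\frac{1-q^{(m+1)(i+j+k-1)}}{1-q^{(m+1)(i+j+k-2)}}\;\prod_{(i,j)\in\lambda/(0^cb^a)}\frac{1}{1-q^{h_\lambda(i,j)}}. \]
   Context: Cells $(i,j)$: row $i$, column $j$. $\lambda'$ is the conjugate partition, $h_\lambda(i,j)=\lambda_i-i+\lambda'_j-j+1$ the hook length. $s_{\lambda/\mu}(1,q,q^2,\ldots)=\sum_T q^{\sum_{u}(T(u)-1)}$, the sum over semistandard Young tableaux $T$ of shape $\lambda/\mu$ with positive integer entries. The shape $\Lambda(a,b,c,d,e,m)$: set $\nu_i=d+(a+c-i)m$ ($1\le i\le a+c$), $\theta_j=e+(b+c-j)m$ ($1\le j\le b+c$); $\lambda$ is the partition whose diagram consists of cells $(i,j)$ with either ($i\le a+c$ and $j\le b+c+\nu_i$) or ($j\le b+c$ and $i\le a+c+\theta_j$); $\Lambda(a,b,c,d,e,m)=\lambda/b^a$ with $b^a=(b,\dots,b)$ ($a$ parts). The set $\lambda/(0^cb^a)$ denotes the cells of $\lambda$ not in $\{(i,j): c+1\le i\le c+a,\ 1\le j\le b\}$. -}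

module Defs where

open import Data.Bool using (Bool; true; false; _∧_; _∨_; not; if_then_else_)
open import Data.Nat using (ℕ; zero; suc; _+_; _*_; _∸_; _≤ᵇ_; _≡ᵇ_; _<ᵇ_)
open import Data.List using (List; []; _∷_; map; foldr; length; concatMap; zip; upTo; applyUpTo; filterᵇ)
open import Data.Bool.ListAction using (all; any)
open import Data.Nat.ListAction using (sum)
open import Data.Product using (_×_; _,_)
open import Data.Integer using (ℤ; +_) renaming (_+_ to _+ℤ_; _*_ to _*ℤ_; _-_ to _-ℤ_)

range1 : ℕ → List ℕ
range1 n = applyUpTo suc n

countᵇ : {A : Set} → (A → Bool) → List A → ℕ
countᵇ p xs = length (filterᵇ p xs)

sumℤ : List ℤ → ℤ
sumℤ = foldr _+ℤ_ (+ 0)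

-- Formal power series in q with integer coefficients:
-- a power series is its coefficient sequence  n ↦ [q^n] F.

PS : Set
PS = ℕ → ℤ

_⊛_ : PS → PS → PS
(f ⊛ g) n = sumℤ (map (λ k → f k *ℤ g (n ∸ k)) (upTo (suc n)))

infixl 7 _⊛_

qpow : ℕ → PS
qpow N n = if n ≡ᵇ N then + 1 else + 0

one : PS
one = qpow 0

prodPS : List PS → PS
prodPS = foldr _⊛_ one

oneMinusQ : ℕ → PS
oneMinusQ k n = qpow 0 n -ℤ qpow k n

-- the power series 1/(1 - q^h) = Σ_{t ≥ 0} q^{h t}   (used only for h ≥ 1)
invOneMinusQ : ℕ → PS
invOneMinusQ h n = if any (λ t → h * t ≡ᵇ n) (upTo (suc n)) then + 1 else + 0

-- The shape Λ(a,b,c,d,e,m) = λ / b^a.  Cells (i , j) are 1-indexed.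

Cell : Set
Cell = ℕ × ℕ

module Shape (a b c d e m : ℕ) where

  ν : ℕ → ℕ
  ν i = d + ((a + c) ∸ i) * m

  θ : ℕ → ℕ
  θ j = e + ((b + c) ∸ j) * m

  inλ : ℕ → ℕ → Bool
  inλ i j = ((1 ≤ᵇ i) ∧ (i ≤ᵇ a + c) ∧ (1 ≤ᵇ j) ∧ (j ≤ᵇ b + c + ν i))
          ∨ ((1 ≤ᵇ j) ∧ (j ≤ᵇ b + c) ∧ (1 ≤ᵇ i) ∧ (i ≤ᵇ a + c + θ j))

  -- bounds containing all cells of λ (number of rows / columns)
  R : ℕ
  R = a + c + e + (b + c) * m

  C : ℕ
  C = b + c + d + (a + c) * m

  box : List Cell
  box = concatMap (λ i → map (λ j → (i , j)) (range1 C)) (range1 R)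

  rowLen : ℕ → ℕ
  rowLen i = countᵇ (λ j → inλ i j) (range1 C)

  colLen : ℕ → ℕ
  colLen j = countᵇ (λ i → inλ i j) (range1 R)

  -- hook length h_λ(i,j) = λ_i - i + λ'_j - j + 1   (for cells of λ)
  hook : ℕ → ℕ → ℕ
  hook i j = (rowLen i + colLen j + 1) ∸ (i + j)

  inπ : ℕ → ℕ → Bool
  inπ i j = inλ i j ∧ not ((i ≤ᵇ a) ∧ (j ≤ᵇ b))

  cellsπ : List Cell
  cellsπ = filterᵇ (λ { (i , j) → inπ i j }) box

  inρ : ℕ → ℕ → Bool
  inρ i j = inλ i j ∧ not ((c + 1 ≤ᵇ i) ∧ (i ≤ᵇ c + a) ∧ (j ≤ᵇ b))

  cellsρ : List Cell
  cellsρ = filterᵇ (λ { (i , j) → inρ i j }) box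

  N : ℕ
  N = sum (map (λ { (i , j) → colLen j ∸ i }) cellsπ)

  -- Semistandard Young tableaux of shape π.
  -- A filling is a list of positive integers, one per cell of cellsπ (in order).

  fillings : ℕ → ℕ → List (List ℕ)
  fillings zero    M = [] ∷ []
  fillings (suc k) M = concatMap (λ t → map (t ∷_) (fillings k M)) (range1 M)

  compatible : Cell × ℕ → Cell × ℕ → Bool
  compatible ((i , j) , t) ((i' , j') , s) =
    (not ((i ≡ᵇ i') ∧ (j ≤ᵇ j')) ∨ (t ≤ᵇ s)) ∧
    (not ((j ≡ᵇ j') ∧ (i <ᵇ i')) ∨ (t <ᵇ s))

  isSSYT : List ℕ → Bool
  isSSYT ts = all (λ u → all (λ v → compatible u v) zs) zs
    where zs = zip cellsπ ts

  weight : List ℕ → ℕ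
  weight ts = sum (map (λ t → t ∸ 1) ts)

  -- s_π(1,q,q^2,...) as a power series: the coefficient of q^n is the number of
  -- SSYT T of shape π with Σ_u (T(u)-1) = n; such T have all entries ≤ n+1.
  sπ : PS
  sπ n = + countᵇ (λ ts → isSSYT ts ∧ (weight ts ≡ᵇ n))
                  (fillings (length cellsπ) (suc n))

  triples : List (ℕ × ℕ × ℕ)
  triples = concatMap (λ i → concatMap (λ j → map (λ k → (i , j , k)) (range1 c)) (range1 b)) (range1 a)

  rhs : PS
  rhs = qpow N
      ⊛ prodPS (map (λ { (i , j , k) → oneMinusQ ((m + 1) * (i + j + k ∸ 1)) }) triples)
      ⊛ prodPS (map (λ { (i , j , k) → invOneMinusQ ((m + 1) * (i + j + k ∸ 2)) }) triples)
      ⊛ prodPS (map (λ { (i , j) → invOneMinusQ (hook i j) }) cellsρ)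

{-# OPTIONS --safe #-}

-- Cut λ/b^a along the diagonal of content b − a.  Given the values on it, each of the two sides
-- is a chain of interlacing diagonals, the cells of b^a being filled by forced "ghost" entries.
-- Summing out one diagonal after another is a telescoping of geometric series inside a
-- determinant, and since the row ends form an arithmetic progression with difference m + 1, the
-- result is a Vandermonde determinant in powers of q^(m+1).  The product of the two Vandermonde
-- determinants does not change up to explicit factors when the ghosts of both sides are pooled on
-- one side.  That turns the sum over the diagonal into the one for a rectangle, and the latter is
-- evaluated by cutting the rectangle along another diagonal, where only one side remains.  The
-- resulting superfactorials in q^(m+1) are MacMahon's box product times a product of hooks.

module Submission where

open import Defs
open import Algebra.Bundles using (CommutativeRing; CommutativeMonoid)
import Algebra.Properties.Ring
import Algebra.Properties.Semiring.Exp
import Algebra.Solver.CommutativeMonoid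
import Algebra.Solver.Ring.NaturalCoefficients.Default as NaturalCoefficients
open import Data.Bool using (Bool; true; false; T; if_then_else_; _∧_; not; _∨_)
open import Data.Bool.ListAction using (any; all)
open import Data.Bool.Properties using (T-≡; ∧-assoc; T-∧; T-∨; T?; ∨-identityʳ; ∧-zeroʳ; ∧-identityʳ)
open import Data.Empty using (⊥-elim)
open import Data.Integer as ℤ using (ℤ; 0ℤ; 1ℤ)
import Data.Integer.Properties as ℤₚ
open import Data.Integer.Tactic.RingSolver using () renaming (solve-∀ to ℤ-solve)
open import Data.List using (List; []; _∷_; map; applyUpTo; upTo; foldr; _++_; _∷ʳ_; length; concatMap; zip; cartesianProduct; filterᵇ)
open import Data.List.Membership.Propositional using (_∈_; _∉_)
open import Data.List.Membership.Propositional.Properties using (∈-++⁺ˡ; ∈-++⁺ʳ; ∈-++⁻; ∈-cartesianProduct⁺; ∈-cartesianProduct⁻; ∈-applyUpTo⁺; ∈-applyUpTo⁻; ∈-filter⁺; ∈-filter⁻; ∈-map⁺; ∈-map⁻)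
open import Data.List.Membership.Propositional.Properties.WithK using (unique∧set⇒bag)
open import Data.List.Properties using (map-applyUpTo; map-∘; map-++; map-cong; length-map; length-++; ++-assoc; ++-identityʳ; map-id)
open import Data.List.Relation.Binary.BagAndSetEquality using (∼bag⇒↭)
open import Data.List.Relation.Binary.Permutation.Propositional as Perm using (_↭_)
open import Data.List.Relation.Binary.Permutation.Propositional.Properties using (map⁺)
open import Data.List.Relation.Binary.Pointwise as Pointwise using (Pointwise; []; _∷_)
open import Data.List.Relation.Unary.All as All using (All; []; _∷_)
import Data.List.Relation.Unary.All.Properties as Allₚ
open import Data.List.Relation.Unary.AllPairs using ([]; _∷_)
open import Data.List.Relation.Unary.Any as Any using (Any; here; there)
open import Data.List.Relation.Unary.Linked as Linked using (Linked; []; [-]; _∷_)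
open import Data.List.Relation.Unary.Unique.Propositional using (Unique)
import Data.List.Relation.Unary.Unique.Propositional.Properties as Uniqueₚ
open import Data.Nat as ℕ using (ℕ; zero; suc; _≤_; _<_; _∸_; _≡ᵇ_; s≤s; z≤n; _≤ᵇ_; _<ᵇ_; _⊔_)
open import Data.Nat.ListAction using (sum)
open import Data.Nat.ListAction.Properties using (sum-++; sum-↭)
import Data.Nat.Properties as ℕₚ
open import Data.Nat.Tactic.RingSolver using () renaming (solve-∀ to ℕ-solve)
open import Data.Product using (_,_; _×_; ∃; proj₁; proj₂; ∃₂)
open import Data.Product.Properties using (≡-dec)
open import Data.Sum as Sum using (_⊎_; inj₁; inj₂; [_,_]′)
open import Data.Unit using (tt; ⊤)
open import Function using (_∘_; id; Equivalence; mk⇔)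
open import Level using (0ℓ)
open import Relation.Binary.PropositionalEquality as ≡ using (_≡_; _≢_)
open import Relation.Nullary using (yes; no; ¬_; does; Dec)
open import Relation.Nullary.Decidable using (dec-true; dec-false)

-- No step divides: every denominator stays as a factor next to the sum it belongs to, and is
-- cancelled only at the end, where it is known to be a unit. The ring is ℤ[[q]] modulo q^L, and
-- entries are summed below a bound W with q^W = 0, so that all sums are finite while geometric
-- series still close up exactly. Since q is no unit there, leftover powers of q are removed
-- coefficientwise, at the cost of degrees; L therefore depends on the coefficient that is asked
-- for.
--
-- All entries are raised by b. Then the ghosts 0, ..., b - 1 of the lower side demand only that
-- entries are at least b, the ghosts b, ..., b + a - 1 of the upper side demand what strictness
-- down the first full column implies, and the two runs pool into 0, ..., a + b - 1 without a gap.
-- In the rectangle that results, the cut diagonal has weight d + e + 1, its own weight 1 plus the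
-- least exponents d and e of the two determinants, and every other diagonal has weight m + 1.
--
-- The exponent N is not followed through these steps: the accumulated powers of q are compared with
-- it at the end, as polynomials in the six parameters.

-- Truncated power series as a commutative ring

module PowerSeries where
  open ≡ using (refl; cong; cong₂; module ≡-Reasoning)

  _[_≡]_ : PS → ℕ → PS → Set
  f [ L ≡] g = ∀ n → n < L → f n ≡ g n

  -- The Cauchy product once more, by recursion on the degree while the first factor is shifted. In
  -- this form the ring axioms are plain inductions; `⊛-conv` carries them over to `_⊛_`.
  conv : PS → PS → PS
  conv f g zero    = f 0 ℤ.* g 0
  conv f g (suc n) = f 0 ℤ.* g (suc n) ℤ.+ conv (f ∘ suc) g n

  ⊛-conv : ∀ f g n → (f ⊛ g) n ≡ conv f g n
  ⊛-conv f g n = ≡.trans (cong sumℤ (map-applyUpTo id (λ k → f k ℤ.* g (n ∸ k)) (suc n))) (go f n)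
    where
    go : ∀ f n → sumℤ (applyUpTo (λ k → f k ℤ.* g (n ∸ k)) (suc n)) ≡ conv f g n
    go f zero    = ℤₚ.+-identityʳ _
    go f (suc n) = cong (λ z → f 0 ℤ.* g (suc n) ℤ.+ z) (go (f ∘ suc) n)

  conv-cong : ∀ {f f′ g g′} n → (∀ k → k ≤ n → f k ≡ f′ k) → (∀ k → k ≤ n → g k ≡ g′ k) →
              conv f g n ≡ conv f′ g′ n
  conv-cong zero    p r = cong₂ ℤ._*_ (p 0 z≤n) (r 0 z≤n)
  conv-cong (suc n) p r = cong₂ ℤ._+_ (cong₂ ℤ._*_ (p 0 z≤n) (r (suc n) ℕₚ.≤-refl))
    (conv-cong n (λ k k≤n → p (suc k) (s≤s k≤n)) (λ k k≤n → r k (ℕₚ.m≤n⇒m≤1+n k≤n)))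

  -- Mirrors the defining clause at the other end of the sum, which is what the induction for
  -- commutativity meets.
  conv-snoc : ∀ f g n → conv f g (suc n) ≡ conv f (g ∘ suc) n ℤ.+ f (suc n) ℤ.* g 0
  conv-snoc f g zero    = refl
  conv-snoc f g (suc n) = ≡.trans (cong (λ z → f 0 ℤ.* g (2 ℕ.+ n) ℤ.+ z) (conv-snoc (f ∘ suc) g n))
    (≡.sym (ℤₚ.+-assoc (f 0 ℤ.* g (2 ℕ.+ n)) (conv (f ∘ suc) (g ∘ suc) n) _))

  conv-comm : ∀ f g n → conv f g n ≡ conv g f n
  conv-comm f g zero    = ℤₚ.*-comm (f 0) (g 0)
  conv-comm f g (suc n) = ≡.trans
    (cong₂ ℤ._+_ (ℤₚ.*-comm (f 0) (g (suc n))) (conv-comm (f ∘ suc) g n))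
    (≡.trans (ℤₚ.+-comm (g (suc n) ℤ.* f 0) _) (≡.sym (conv-snoc g f n)))

  conv-+ˡ : ∀ f g h n → conv (λ k → f k ℤ.+ g k) h n ≡ conv f h n ℤ.+ conv g h n
  conv-+ˡ f g h zero    = ℤₚ.*-distribʳ-+ (h 0) (f 0) (g 0)
  conv-+ˡ f g h (suc n) = ≡.trans
    (cong₂ ℤ._+_ (ℤₚ.*-distribʳ-+ (h (suc n)) (f 0) (g 0)) (conv-+ˡ (f ∘ suc) (g ∘ suc) h n))
    (shuffle (f 0 ℤ.* h (suc n)) (g 0 ℤ.* h (suc n)) (conv (f ∘ suc) h n) (conv (g ∘ suc) h n))
    where
    shuffle : ∀ w x y z → w ℤ.+ x ℤ.+ (y ℤ.+ z) ≡ w ℤ.+ y ℤ.+ (x ℤ.+ z)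
    shuffle = ℤ-solve

  conv-*ˡ : ∀ x f h n → conv (λ k → x ℤ.* f k) h n ≡ x ℤ.* conv f h n
  conv-*ˡ x f h zero    = ℤₚ.*-assoc x (f 0) (h 0)
  conv-*ˡ x f h (suc n) = ≡.trans
    (cong₂ ℤ._+_ (ℤₚ.*-assoc x (f 0) (h (suc n))) (conv-*ˡ x (f ∘ suc) h n))
    (≡.sym (ℤₚ.*-distribˡ-+ x _ _))

  conv-assoc : ∀ f g h n → conv (conv f g) h n ≡ conv f (conv g h) n
  conv-assoc f g h zero    = ℤₚ.*-assoc (f 0) (g 0) (h 0)
  conv-assoc f g h (suc n) = begin
    f 0 ℤ.* g 0 ℤ.* h (suc n) ℤ.+ conv (λ k → f 0 ℤ.* g (suc k) ℤ.+ conv (f ∘ suc) g k) h n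
      ≡⟨ cong (λ z → f 0 ℤ.* g 0 ℤ.* h (suc n) ℤ.+ z)
           (≡.trans (conv-+ˡ (λ k → f 0 ℤ.* g (suc k)) (conv (f ∘ suc) g) h n)
                    (cong₂ ℤ._+_ (conv-*ˡ (f 0) (g ∘ suc) h n) (conv-assoc (f ∘ suc) g h n))) ⟩
    f 0 ℤ.* g 0 ℤ.* h (suc n) ℤ.+ (f 0 ℤ.* conv (g ∘ suc) h n ℤ.+ conv (f ∘ suc) (conv g h) n)
      ≡⟨ shuffle (f 0) (g 0) (h (suc n)) (conv (g ∘ suc) h n) (conv (f ∘ suc) (conv g h) n) ⟩
    f 0 ℤ.* (g 0 ℤ.* h (suc n) ℤ.+ conv (g ∘ suc) h n) ℤ.+ conv (f ∘ suc) (conv g h) n ∎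
    where
    open ≡-Reasoning
    shuffle : ∀ x y z u v → x ℤ.* y ℤ.* z ℤ.+ (x ℤ.* u ℤ.+ v) ≡ x ℤ.* (y ℤ.* z ℤ.+ u) ℤ.+ v
    shuffle = ℤ-solve

  conv-zeroˡ : ∀ g n → conv (λ _ → 0ℤ) g n ≡ 0ℤ
  conv-zeroˡ g zero    = refl
  conv-zeroˡ g (suc n) = ≡.trans (ℤₚ.+-identityˡ _) (conv-zeroˡ g n)

  conv-oneˡ : ∀ g n → conv one g n ≡ g n
  conv-oneˡ g zero    = ℤₚ.*-identityˡ (g 0)
  conv-oneˡ g (suc n) = ≡.trans (cong₂ ℤ._+_ (ℤₚ.*-identityˡ (g (suc n))) (conv-zeroˡ g n)) (ℤₚ.+-identityʳ _)

  _⊕_ : PS → PS → PS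
  (f ⊕ g) n = f n ℤ.+ g n

  ⊖_ : PS → PS
  (⊖ f) n = ℤ.- f n

  -- ℤ[[q]] / (q^L), carried by ℤ[[q]]
  truncated : ℕ → CommutativeRing 0ℓ 0ℓ
  truncated L = record
    { Carrier = PS
    ; _≈_ = _[ L ≡]_
    ; _+_ = _⊕_
    ; _*_ = _⊛_
    ; -_ = ⊖_
    ; 0# = λ _ → 0ℤ
    ; 1# = one
    ; isCommutativeRing = record
      { isRing = record
        { +-isAbelianGroup = record
          { isGroup = record
            { isMonoid = record
              { isSemigroup = record
                { isMagma = record
                  { isEquivalence = record
                    { refl = λ n _ → refl
                    ; sym = λ p n n<L → ≡.sym (p n n<L)
                    ; trans = λ p r n n<L → ≡.trans (p n n<L) (r n n<L) }
                  ; ∙-cong = λ p r n n<L → cong₂ ℤ._+_ (p n n<L) (r n n<L) }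
                ; assoc = λ f g h n _ → ℤₚ.+-assoc (f n) (g n) (h n) }
              ; identity = (λ f n _ → ℤₚ.+-identityˡ (f n)) , (λ f n _ → ℤₚ.+-identityʳ (f n)) }
            ; inverse = (λ f n _ → ℤₚ.+-inverseˡ (f n)) , (λ f n _ → ℤₚ.+-inverseʳ (f n))
            ; ⁻¹-cong = λ p n n<L → cong ℤ.-_ (p n n<L) }
          ; comm = λ f g n _ → ℤₚ.+-comm (f n) (g n) }
        ; *-cong = λ {f} {f′} {g} {g′} p r n n<L →
            ≡.trans (⊛-conv f g n) (≡.trans
              (conv-cong n (λ k k≤n → p k (ℕₚ.≤-<-trans k≤n n<L)) (λ k k≤n → r k (ℕₚ.≤-<-trans k≤n n<L)))
              (≡.sym (⊛-conv f′ g′ n)))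
        ; *-assoc = λ f g h n _ → assoc f g h n
        ; *-identity = (λ f n _ → ≡.trans (⊛-conv one f n) (conv-oneˡ f n))
                     , (λ f n _ → ≡.trans (comm f one n) (≡.trans (⊛-conv one f n) (conv-oneˡ f n)))
        ; distrib = (λ f g h n _ → ≡.trans (comm f (g ⊕ h) n)
                       (≡.trans (distribʳ f g h n) (cong₂ ℤ._+_ (comm g f n) (comm h f n))))
                  , (λ f g h n _ → distribʳ f g h n) }
      ; *-comm = λ f g n _ → comm f g n } }
    where
    comm : ∀ f g n → (f ⊛ g) n ≡ (g ⊛ f) n
    comm f g n = ≡.trans (⊛-conv f g n) (≡.trans (conv-comm f g n) (≡.sym (⊛-conv g f n)))
    assoc : ∀ f g h n → ((f ⊛ g) ⊛ h) n ≡ (f ⊛ (g ⊛ h)) n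
    assoc f g h n = ≡.trans (⊛-conv (f ⊛ g) h n) (≡.trans
      (conv-cong {g = h} n (λ k _ → ⊛-conv f g k) (λ _ _ → refl)) (≡.trans
      (conv-assoc f g h n) (≡.trans
      (conv-cong {f = f} n (λ _ _ → refl) (λ k _ → ≡.sym (⊛-conv g h k)))
      (≡.sym (⊛-conv f (g ⊛ h) n)))))
    distribʳ : ∀ f g h n → ((g ⊕ h) ⊛ f) n ≡ (g ⊛ f) n ℤ.+ (h ⊛ f) n
    distribʳ f g h n = ≡.trans (⊛-conv (g ⊕ h) f n) (≡.trans (conv-+ˡ g h f n)
      (≡.sym (cong₂ ℤ._+_ (⊛-conv g f n) (⊛-conv h f n))))

  qpow-⊛-+ : ∀ K g n → (qpow K ⊛ g) (K ℕ.+ n) ≡ g n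
  qpow-⊛-+ K g n = ≡.trans (⊛-conv (qpow K) g (K ℕ.+ n)) (go K)
    where
    go : ∀ K → conv (qpow K) g (K ℕ.+ n) ≡ g n
    go zero    = conv-oneˡ g n
    go (suc K) = ≡.trans (ℤₚ.+-identityˡ _) (go K)

  qpow-⊛-< : ∀ K g n → n < K → (qpow K ⊛ g) n ≡ 0ℤ
  qpow-⊛-< K g n n<K = ≡.trans (⊛-conv (qpow K) g n) (go K n n<K)
    where
    go : ∀ K n → n < K → conv (qpow K) g n ≡ 0ℤ
    go (suc K) zero    _         = refl
    go (suc K) (suc n) (s≤s n<K) = ≡.trans (ℤₚ.+-identityˡ _) (go K n n<K)

  -- Multiplication by q^K shifts coefficients, so undoing it costs exactly K degrees of precision.
  -- Inside the truncated ring this cancellation is impossible.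
  qpow-cancel : ∀ K {f g L} → (qpow K ⊛ f) [ K ℕ.+ L ≡] (qpow K ⊛ g) → f [ L ≡] g
  qpow-cancel K {f} {g} p n n<L = ≡.trans (≡.sym (qpow-⊛-+ K f n))
    (≡.trans (p (K ℕ.+ n) (ℕₚ.+-monoʳ-< K n<L)) (qpow-⊛-+ K g n))

  qpow-≢ : ∀ K n → ¬ n ≡ K → qpow K n ≡ 0ℤ
  qpow-≢ zero    zero    n≢K = ⊥-elim (n≢K refl)
  qpow-≢ zero    (suc n) n≢K = refl
  qpow-≢ (suc K) zero    n≢K = refl
  qpow-≢ (suc K) (suc n) n≢K = qpow-≢ K n (n≢K ∘ cong suc)

  qpow-homo : ∀ J K n → qpow (J ℕ.+ K) n ≡ (qpow J ⊛ qpow K) n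
  qpow-homo J K n with n ℕ.<? J
  ... | yes n<J = ≡.trans (qpow-≢ (J ℕ.+ K) n (λ { refl → ℕₚ.m+n≮m J K n<J })) (≡.sym (qpow-⊛-< J (qpow K) n n<J))
  ... | no n≮J = ≡.subst (λ n → qpow (J ℕ.+ K) n ≡ (qpow J ⊛ qpow K) n) (ℕₚ.m+[n∸m]≡n (ℕₚ.≮⇒≥ n≮J))
                   (≡.trans (shift J (n ∸ J)) (≡.sym (qpow-⊛-+ J (qpow K) (n ∸ J))))
    where
    shift : ∀ J k → qpow (J ℕ.+ K) (J ℕ.+ k) ≡ qpow K k
    shift zero    k = refl
    shift (suc J) k = shift J k

  any⇒ : ∀ (p : ℕ → Bool) f n → any p (applyUpTo f n) ≡ true → ∃ λ t → t < n × p (f t) ≡ true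
  any⇒ p f (suc n) eq with p (f 0) in e
  ... | true  = 0 , s≤s z≤n , e
  ... | false with any⇒ p (f ∘ suc) n eq
  ...   | t , t<n , e′ = suc t , s≤s t<n , e′

  ⇒any : ∀ (p : ℕ → Bool) f n t → t < n → p (f t) ≡ true → any p (applyUpTo f n) ≡ true
  ⇒any p f (suc n) zero    _         e rewrite e = refl
  ⇒any p f (suc n) (suc t) (s≤s t<n) e with p (f 0)
  ... | true  = refl
  ... | false = ⇒any p (f ∘ suc) n t t<n e

  ≡ᵇ-true : ∀ {m n} → m ≡ n → (m ≡ᵇ n) ≡ true
  ≡ᵇ-true {m} {n} e = Equivalence.to T-≡ (ℕₚ.≡⇒≡ᵇ m n e)

  inv-true : ∀ h n t → t ≤ n → h ℕ.* t ≡ n → invOneMinusQ h n ≡ 1ℤ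
  inv-true h n t t≤n e
    rewrite ⇒any (λ t → h ℕ.* t ≡ᵇ n) id (suc n) t (s≤s t≤n) (≡ᵇ-true e) = refl

  inv-false : ∀ h n → (∀ t → ¬ h ℕ.* t ≡ n) → invOneMinusQ h n ≡ 0ℤ
  inv-false h n no-t with any (λ t → h ℕ.* t ≡ᵇ n) (upTo (suc n)) in e
  ... | false = refl
  ... | true with any⇒ (λ t → h ℕ.* t ≡ᵇ n) id (suc n) e
  ...   | t , _ , e′ = ⊥-elim (no-t t (ℕₚ.≡ᵇ⇒≡ _ _ (Equivalence.from T-≡ e′)))

  inv-periodic : ∀ h n → invOneMinusQ (suc h) (suc h ℕ.+ n) ≡ invOneMinusQ (suc h) n
  inv-periodic h n with any (λ t → suc h ℕ.* t ≡ᵇ n) (upTo (suc n)) in e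
  ... | true with any⇒ (λ t → suc h ℕ.* t ≡ᵇ n) id (suc n) e
  ...   | t , s≤s t≤n , e′ = inv-true (suc h) (suc h ℕ.+ n) (suc t) (s≤s (ℕₚ.≤-trans t≤n (ℕₚ.m≤n+m n h)))
          (≡.trans (ℕₚ.*-suc (suc h) t) (cong (suc h ℕ.+_) (ℕₚ.≡ᵇ⇒≡ _ _ (Equivalence.from T-≡ e′))))
  inv-periodic h n | false = inv-false (suc h) (suc h ℕ.+ n) λ
    { zero    e₀ → ℕₚ.0≢1+n (≡.trans (≡.sym (ℕₚ.*-zeroʳ h)) e₀)
    ; (suc t) e₁ → contra t (ℕₚ.+-cancelˡ-≡ (suc h) _ _ (≡.trans (≡.sym (ℕₚ.*-suc (suc h) t)) e₁)) }
    where
    contra : ∀ t → ¬ suc h ℕ.* t ≡ n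
    contra t e₂ with ≡.trans (≡.sym (⇒any (λ t → suc h ℕ.* t ≡ᵇ n) id (suc n) t
                     (s≤s (≡.subst (t ≤_) e₂ (ℕₚ.m≤n*m t (suc h)))) (≡ᵇ-true e₂))) e
    ... | ()

  -- Two ranges of degrees: below 1 + h the shifted copy contributes nothing and the series agrees
  -- with 1; from there on the two copies cancel because the coefficients are periodic.
  oneMinusQ-inverse : ∀ h n → (oneMinusQ (suc h) ⊛ invOneMinusQ (suc h)) n ≡ one n
  oneMinusQ-inverse h n = begin
    (oneMinusQ (suc h) ⊛ g) n          ≡⟨ ⊛-conv (oneMinusQ (suc h)) g n ⟩
    conv (oneMinusQ (suc h)) g n       ≡⟨ conv-+ˡ one (λ k → ℤ.- qpow (suc h) k) g n ⟩
    conv one g n ℤ.+ conv (λ k → ℤ.- qpow (suc h) k) g n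
      ≡⟨ cong₂ ℤ._+_ (conv-oneˡ g n) (≡.trans
           (conv-cong {g = g} n (λ k _ → ≡.sym (ℤₚ.-1*i≡-i (qpow (suc h) k))) (λ _ _ → refl))
           (≡.trans (conv-*ˡ ℤ.-1ℤ (qpow (suc h)) g n) (ℤₚ.-1*i≡-i _))) ⟩
    g n ℤ.- conv (qpow (suc h)) g n    ≡⟨ cong (λ z → g n ℤ.- z) (≡.sym (⊛-conv (qpow (suc h)) g n)) ⟩
    g n ℤ.- (qpow (suc h) ⊛ g) n       ≡⟨ by-size ⟩
    one n ∎
    where
    open ≡-Reasoning
    g : PS
    g = invOneMinusQ (suc h)
    small : ∀ n → n < suc h → g n ≡ one n
    small zero    _   = inv-true (suc h) 0 0 z≤n (ℕₚ.*-zeroʳ h)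
    small (suc n) n<h = inv-false (suc h) (suc n) λ
      { zero    e → ℕₚ.0≢1+n (≡.trans (≡.sym (ℕₚ.*-zeroʳ h)) e)
      ; (suc t) e → ℕₚ.<⇒≱ n<h (≡.subst (suc h ≤_) e (ℕₚ.m≤m*n (suc h) (suc t))) }
    by-size : g n ℤ.- (qpow (suc h) ⊛ g) n ≡ one n
    by-size with n ℕ.<? suc h
    ... | yes n<h = ≡.trans (cong₂ (λ x y → x ℤ.- y) (small n n<h) (qpow-⊛-< (suc h) g n n<h)) (ℤₚ.+-identityʳ _)
    ... | no n≮h = ≡.subst (λ n → g n ℤ.- (qpow (suc h) ⊛ g) n ≡ one n) (ℕₚ.m+[n∸m]≡n (ℕₚ.≮⇒≥ n≮h))
      (≡.trans (cong₂ (λ x y → x ℤ.- y) (inv-periodic h (n ∸ suc h)) (qpow-⊛-+ (suc h) g (n ∸ suc h)))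
               (ℤₚ.+-inverseʳ (g (n ∸ suc h))))

-- Determinants by iterated contraction

module Determinants (R : CommutativeRing 0ℓ 0ℓ) where

  private
    module C = CommutativeRing R
  open C public using (refl; sym; trans; reflexive; +-cong; +-congˡ; +-congʳ; *-cong; *-congˡ; *-congʳ;
    +-identityˡ; +-identityʳ; *-identityˡ; *-identityʳ; zeroˡ; zeroʳ; +-comm; *-comm; +-assoc; *-assoc;
    distribˡ; distribʳ; setoid)
  open Algebra.Properties.Semiring.Exp C.semiring public using (_^_; ^-homo-*; ^-assocʳ; ^-congˡ; ^-congʳ)
  open import Relation.Binary.Reasoning.Setoid setoid public

  module MonoidSolver = Algebra.Solver.CommutativeMonoid C.*-commutativeMonoid
  open MonoidSolver public using (_⊕_; _⊜_)
  open NaturalCoefficients C.commutativeSemiring public using (solve; _:+_; _:*_; _:=_; con)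
  open C public using (Carrier; _≈_; _+_; _*_; 0#; 1#)

  -- Differences are written x + ε * y, so that the rearrangements below are semiring identities.
  ε : Carrier
  ε = C.- 1#

  +-inverse : ∀ x → x + ε * x ≈ 0#
  +-inverse x = trans (+-congˡ (trans (sym (-‿distribˡ-* 1# x)) (C.-‿cong (*-identityˡ x)))) (C.-‿inverseʳ x)
    where open Algebra.Properties.Ring C.ring using (-‿distribˡ-*)

  private
    ε0 : ε * 0# ≈ 0#
    ε0 = zeroʳ ε

  prod : {A : Set} → (A → Carrier) → List A → Carrier
  prod f = foldr (λ x y → f x * y) 1#

  prod-cong : {A : Set} {f g : A → Carrier} (xs : List A) → (∀ x → f x ≈ g x) → prod f xs ≈ prod g xs
  prod-cong []       e = refl
  prod-cong (x ∷ xs) e = *-cong (e x) (prod-cong xs e)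

  prod-++ : {A : Set} (f : A → Carrier) (xs ys : List A) → prod f (xs ++ ys) ≈ prod f xs * prod f ys
  prod-++ f []       ys = sym (*-identityˡ _)
  prod-++ f (x ∷ xs) ys = trans (*-congˡ (prod-++ f xs ys)) (sym (*-assoc _ _ _))

  prod-* : {A : Set} (f g : A → Carrier) (xs : List A) → prod (λ x → f x * g x) xs ≈ prod f xs * prod g xs
  prod-* f g []       = sym (*-identityˡ _)
  prod-* f g (x ∷ xs) = trans (*-congˡ (prod-* f g xs)) (shuffle (f x) (g x) _ _)
    where
    shuffle : ∀ a b c d → a * b * (c * d) ≈ a * c * (b * d)
    shuffle = solve 4 (λ a b c d → a :* b :* (c :* d) := a :* c :* (b :* d)) refl

  prod-map : {A B : Set} (f : B → Carrier) (g : A → B) (xs : List A) → prod f (map g xs) ≡ prod (f ∘ g) xs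
  prod-map f g []       = ≡.refl
  prod-map f g (x ∷ xs) = ≡.cong (f (g x) *_) (prod-map f g xs)

  -- ∂ c ω is the contraction of the alternating form ω by the covector c; a determinant is
  -- an iterated contraction, i.e. its Laplace expansion along the columns.
  module _ {A : Set} where

    ∂ : (A → Carrier) → (List A → Carrier) → (List A → Carrier)
    ∂ c ω []       = 0#
    ∂ c ω (r ∷ rs) = c r * ω rs + ε * ∂ c (λ rs′ → ω (r ∷ rs′)) rs

    unit : List A → Carrier
    unit []      = 1#
    unit (_ ∷ _) = 0#

    det : List A → List (A → Carrier) → Carrier
    det rs cs = foldr ∂ unit cs rs

    ∂-congᴾ : ∀ {c c′ ω ω′} {P : A → Set} → (∀ r → P r → c r ≈ c′ r) →
              (∀ rs → All P rs → ω rs ≈ ω′ rs) → ∀ {rs} → All P rs → ∂ c ω rs ≈ ∂ c′ ω′ rs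
    ∂-congᴾ p e []       = refl
    ∂-congᴾ p e (x ∷ xs) = +-cong (*-cong (p _ x) (e _ xs))
      (*-congˡ (∂-congᴾ p (λ rs ys → e _ (x ∷ ys)) xs))

    ∂-cong : ∀ {c c′ ω ω′} → (∀ r → c r ≈ c′ r) → (∀ rs → ω rs ≈ ω′ rs) → ∀ rs → ∂ c ω rs ≈ ∂ c′ ω′ rs
    ∂-cong p e []       = refl
    ∂-cong p e (r ∷ rs) = +-cong (*-cong (p r) (e rs)) (*-congˡ (∂-cong p (λ rs → e (r ∷ rs)) rs))

    det-congᴾ : ∀ {P : A → Set} {cs cs′} → Pointwise (λ c c′ → ∀ r → P r → c r ≈ c′ r) cs cs′ →
                ∀ {rs} → All P rs → det rs cs ≈ det rs cs′
    det-congᴾ []       ps = refl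
    det-congᴾ (e ∷ es) ps = ∂-congᴾ e (λ rs → det-congᴾ es {rs}) ps

    det-cong : ∀ {cs cs′} → Pointwise (λ c c′ → ∀ r → c r ≈ c′ r) cs cs′ → ∀ rs → det rs cs ≈ det rs cs′
    det-cong []       rs = refl
    det-cong (e ∷ es) rs = ∂-cong e (det-cong es) rs

    ∂-0 : ∀ c rs → ∂ c (λ _ → 0#) rs ≈ 0#
    ∂-0 c []       = refl
    ∂-0 c (r ∷ rs) = trans (+-cong (zeroʳ _) (trans (*-congˡ (∂-0 c rs)) ε0)) (+-identityˡ _)

    ∂-linear : ∀ c k ω ω′ rs → ∂ c (λ rs → k * ω rs + ω′ rs) rs ≈ k * ∂ c ω rs + ∂ c ω′ rs
    ∂-linear c k ω ω′ []       = sym (trans (+-identityʳ _) (zeroʳ _))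
    ∂-linear c k ω ω′ (r ∷ rs) = trans
      (+-congˡ (*-congˡ (∂-linear c k (λ rs → ω (r ∷ rs)) (λ rs → ω′ (r ∷ rs)) rs)))
      (shuffle ε (c r) k (ω rs) (ω′ rs) _ _)
      where
      shuffle : ∀ ε c k u v x y → c * (k * u + v) + ε * (k * x + y) ≈ k * (c * u + ε * x) + (c * v + ε * y)
      shuffle = solve 7 (λ ε c k u v x y → c :* (k :* u :+ v) :+ ε :* (k :* x :+ y) := k :* (c :* u :+ ε :* x) :+ (c :* v :+ ε :* y)) refl

    ∂-linear-col : ∀ c c′ k ω rs → ∂ (λ r → k * c r + c′ r) ω rs ≈ k * ∂ c ω rs + ∂ c′ ω rs
    ∂-linear-col c c′ k ω []       = sym (trans (+-identityʳ _) (zeroʳ _))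
    ∂-linear-col c c′ k ω (r ∷ rs) = trans
      (+-congˡ (*-congˡ (∂-linear-col c c′ k (λ rs → ω (r ∷ rs)) rs)))
      (shuffle ε (c r) (c′ r) k (ω rs) _ _)
      where
      shuffle : ∀ ε c c′ k u x y → (k * c + c′) * u + ε * (k * x + y) ≈ k * (c * u + ε * x) + (c′ * u + ε * y)
      shuffle = solve 7 (λ ε c c′ k u x y → (k :* c :+ c′) :* u :+ ε :* (k :* x :+ y) := k :* (c :* u :+ ε :* x) :+ (c′ :* u :+ ε :* y)) refl

    ∂-0-col : ∀ ω rs → ∂ (λ _ → 0#) ω rs ≈ 0#
    ∂-0-col ω []       = refl
    ∂-0-col ω (r ∷ rs) = trans (+-cong (zeroˡ _) (trans (*-congˡ (∂-0-col _ rs)) ε0)) (+-identityˡ _)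

    ∂-scale : ∀ k c ω rs → ∂ c (λ rs → k * ω rs) rs ≈ k * ∂ c ω rs
    ∂-scale k c ω rs = trans (∂-cong (λ _ → refl) (λ _ → sym (+-identityʳ _)) rs)
      (trans (∂-linear c k ω (λ _ → 0#) rs) (trans (+-congˡ (∂-0 c rs)) (+-identityʳ _)))

    ∂-scale-col : ∀ k c ω rs → ∂ (λ r → k * c r) ω rs ≈ k * ∂ c ω rs
    ∂-scale-col k c ω rs = trans (∂-cong (λ _ → sym (+-identityʳ _)) (λ _ → refl) rs)
      (trans (∂-linear-col c (λ _ → 0#) k ω rs) (trans (+-congˡ (∂-0-col ω rs)) (+-identityʳ _)))

    -- Expanding both contractions along the first row yields the term `c r * ∂ c ω rs` twice with
    -- opposite signs; what remains is the same claim for the form with `r` inserted, on a shorter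
    -- list.
    ∂∂≈0 : ∀ c ω rs → ∂ c (∂ c ω) rs ≈ 0#
    ∂∂≈0 c ω []       = refl
    ∂∂≈0 c ω (r ∷ rs) = begin
      c r * ∂ c ω rs + ε * ∂ c (λ rs → c r * ω rs + ε * ∂ c ω′ rs) rs
        ≈⟨ +-congˡ (*-congˡ (∂-linear c (c r) ω (λ rs → ε * ∂ c ω′ rs) rs)) ⟩
      c r * ∂ c ω rs + ε * (c r * ∂ c ω rs + ∂ c (λ rs → ε * ∂ c ω′ rs) rs)
        ≈⟨ +-congˡ (*-congˡ (+-congˡ (trans (∂-scale ε c (∂ c ω′) rs) (trans (*-congˡ (∂∂≈0 c ω′ rs)) ε0)))) ⟩
      c r * ∂ c ω rs + ε * (c r * ∂ c ω rs + 0#)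
        ≈⟨ +-congˡ (*-congˡ (+-identityʳ _)) ⟩
      c r * ∂ c ω rs + ε * (c r * ∂ c ω rs)
        ≈⟨ +-inverse _ ⟩
      0# ∎
      where
      ω′ : List A → Carrier
      ω′ rs = ω (r ∷ rs)

    _⊝_ : (A → Carrier) → (A → Carrier) → (A → Carrier)
    (c ⊝ c′) r = c r + ε * c′ r

    differences : List (A → Carrier) → List (A → Carrier)
    differences []            = []
    differences (c ∷ [])      = []
    differences (c ∷ c′ ∷ cs) = (c ⊝ c′) ∷ differences (c′ ∷ cs)

    differences⁺ : List (A → Carrier) → List (A → Carrier)
    differences⁺ []            = []
    differences⁺ (c ∷ [])      = c ∷ []
    differences⁺ (c ∷ c′ ∷ cs) = (c ⊝ c′) ∷ differences⁺ (c′ ∷ cs)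

    ∂-⊝ : ∀ c c′ ω rs → ∂ (c ⊝ c′) (∂ c′ ω) rs ≈ ∂ c (∂ c′ ω) rs
    ∂-⊝ c c′ ω rs = begin
      ∂ (λ r → c r + ε * c′ r) (∂ c′ ω) rs      ≈⟨ ∂-cong (λ r → +-comm _ _) (λ _ → refl) rs ⟩
      ∂ (λ r → ε * c′ r + c r) (∂ c′ ω) rs      ≈⟨ ∂-linear-col c′ c ε (∂ c′ ω) rs ⟩
      ε * ∂ c′ (∂ c′ ω) rs + ∂ c (∂ c′ ω) rs    ≈⟨ +-congʳ (trans (*-congˡ (∂∂≈0 c′ ω rs)) ε0) ⟩
      0# + ∂ c (∂ c′ ω) rs                      ≈⟨ +-identityˡ _ ⟩
      ∂ c (∂ c′ ω) rs                           ∎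

    -- The column subtracted from each column is still contracted further to the right, so by `∂∂≈0`
    -- the subtraction changes nothing.
    det-differences⁺ : ∀ cs rs → det rs (differences⁺ cs) ≈ det rs cs
    det-differences⁺ []            rs = refl
    det-differences⁺ (c ∷ [])      rs = refl
    det-differences⁺ (c ∷ c′ ∷ cs) rs = trans
      (∂-cong (λ _ → refl) (det-differences⁺ (c′ ∷ cs)) rs) (∂-⊝ c c′ (λ rs → det rs cs) rs)

    -- A column that vanishes at the last row never selects it, so this row stays at the end of
    -- every minor.
    ∂-snoc : ∀ c ω rs r* → c r* ≈ 0# → ∂ c ω (rs ∷ʳ r*) ≈ ∂ c (λ rs → ω (rs ∷ʳ r*)) rs
    ∂-snoc c ω []       r* e = trans (+-cong (trans (*-congʳ e) (zeroˡ _)) ε0) (+-identityˡ _)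
    ∂-snoc c ω (r ∷ rs) r* e = +-congˡ (*-congˡ (∂-snoc c (λ rs → ω (r ∷ rs)) rs r* e))

    ∂-unit-snoc : ∀ c rs r* → c r* ≈ 1# → ∂ c unit (rs ∷ʳ r*) ≈ unit rs
    ∂-unit-snoc c []       r* e = trans (+-cong (trans (*-congʳ e) (*-identityˡ _)) ε0) (+-identityʳ _)
    ∂-unit-snoc c (r ∷ rs) r* e = trans (+-cong (tail rs) (trans (*-congˡ (∂-0 c (rs ∷ʳ r*))) ε0)) (+-identityˡ _)
      where
      tail : ∀ rs → c r * unit (rs ∷ʳ r*) ≈ 0#
      tail []      = zeroʳ _
      tail (_ ∷ _) = zeroʳ _

    -- Subtracting neighbouring columns clears a row of ones except for its last entry.
    det-snoc-ones : ∀ c cs rs r* → All (λ c → c r* ≈ 1#) (c ∷ cs) →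
                    det (rs ∷ʳ r*) (c ∷ cs) ≈ det rs (differences (c ∷ cs))
    det-snoc-ones c cs rs r* ones = trans (sym (det-differences⁺ (c ∷ cs) (rs ∷ʳ r*))) (go c cs ones rs)
      where
      go : ∀ c cs → All (λ c → c r* ≈ 1#) (c ∷ cs) → ∀ rs →
           det (rs ∷ʳ r*) (differences⁺ (c ∷ cs)) ≈ det rs (differences (c ∷ cs))
      go c []        (e ∷ [])      rs = ∂-unit-snoc c rs r* e
      go c (c′ ∷ cs) (e ∷ e′ ∷ es) rs = trans
        (∂-snoc (c ⊝ c′) (λ rs → det rs (differences⁺ (c′ ∷ cs))) rs r*
          (trans (+-cong e (*-congˡ e′)) (+-inverse _)))
        (∂-cong (λ _ → refl) (go c′ cs (e′ ∷ es)) rs)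

    -- A contraction uses the scaling of the row it selects and leaves those of all other rows to
    -- the minor. To carry this through the expansion, `go` moves the scaling of each skipped row
    -- into the form, hence its generality in `ω`.
    det-scale-rows : ∀ s cs rs → det rs (map (λ c r → s r * c r) cs) ≈ prod s rs * det rs cs
    det-scale-rows s []       []       = sym (*-identityˡ _)
    det-scale-rows s []       (r ∷ rs) = sym (zeroʳ _)
    det-scale-rows s (c ∷ cs) rs       = go _ _ (det-scale-rows s cs) rs
      where
      go : ∀ ω ω′ → (∀ rs → ω rs ≈ prod s rs * ω′ rs) →
           ∀ rs → ∂ (λ r → s r * c r) ω rs ≈ prod s rs * ∂ c ω′ rs
      go ω ω′ e []       = sym (zeroʳ _)
      go ω ω′ e (r ∷ rs) = trans
        (+-cong (*-congˡ (e rs)) (*-congˡ (go (λ rs → ω (r ∷ rs)) (λ rs → s r * ω′ (r ∷ rs))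
          (λ rs → trans (e (r ∷ rs)) (shuffle₁ (s r) _ _)) rs)))
        (trans (+-congˡ (*-congˡ (*-congˡ (∂-scale (s r) c (λ rs → ω′ (r ∷ rs)) rs))))
          (shuffle₂ ε (s r) (c r) (prod s rs) (ω′ rs) _))
        where
        shuffle₁ : ∀ x y z → x * y * z ≈ y * (x * z)
        shuffle₁ = solve 3 (λ x y z → x :* y :* z := y :* (x :* z)) refl
        shuffle₂ : ∀ ε s c p u v → s * c * (p * u) + ε * (p * (s * v)) ≈ s * p * (c * u + ε * v)
        shuffle₂ = solve 6 (λ ε s c p u v → s :* c :* (p :* u) :+ ε :* (p :* (s :* v)) := s :* p :* (c :* u :+ ε :* v)) refl

    det-scale-cols : {P : Set} (k : P → Carrier) (col : P → A → Carrier) (ps : List P) (rs : List A) →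
                     det rs (map (λ p r → k p * col p r) ps) ≈ prod k ps * det rs (map col ps)
    det-scale-cols k col []       rs = sym (*-identityˡ _)
    det-scale-cols k col (p ∷ ps) rs = begin
      ∂ (λ r → k p * col p r) (λ rs → det rs (map (λ p r → k p * col p r) ps)) rs
        ≈⟨ ∂-scale-col (k p) (col p) _ rs ⟩
      k p * ∂ (col p) (λ rs → det rs (map (λ p r → k p * col p r) ps)) rs
        ≈⟨ *-congˡ (∂-cong (λ _ → refl) (det-scale-cols k col ps) rs) ⟩
      k p * ∂ (col p) (λ rs → prod k ps * det rs (map col ps)) rs
        ≈⟨ *-congˡ (∂-scale (prod k ps) (col p) _ rs) ⟩
      k p * (prod k ps * det rs (map col (p ∷ ps)))
        ≈⟨ *-assoc _ _ _ ⟨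
      k p * prod k ps * det rs (map col (p ∷ ps)) ∎

  ∂-map : {A B : Set} (g : A → B) (c : B → Carrier) (ω : List B → Carrier) (rs : List A) →
          ∂ c ω (map g rs) ≡ ∂ (c ∘ g) (ω ∘ map g) rs
  ∂-map g c ω []       = ≡.refl
  ∂-map g c ω (r ∷ rs) = ≡.cong (λ x → c (g r) * ω (map g rs) + ε * x) (∂-map g c (λ rs → ω (g r ∷ rs)) rs)

  det-map : {A B : Set} (g : A → B) (cs : List (B → Carrier)) (rs : List A) →
            det (map g rs) cs ≈ det rs (map (_∘ g) cs)
  det-map g []       []       = refl
  det-map g []       (r ∷ rs) = refl
  det-map g (c ∷ cs) rs = trans (reflexive (∂-map g c (λ rs → det rs cs) rs))
    (∂-cong (λ _ → refl) (det-map g cs) rs)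

-- Row ends and interlacing intervals

-- The list n - 1, ..., 1, 0, built by appending its zero because the determinants below are reduced
-- at their last row.
rows : ℕ → List ℕ
rows zero    = []
rows (suc n) = map suc (rows n) ∷ʳ 0

-- the distances at which the A rows end: d + (m+1)(A-1), …, d + (m+1), d
ends : ℕ → ℕ → ℕ → List ℕ
ends m zero    d       = []
ends m (suc A) zero    = map suc (ends m A m) ∷ʳ 0
ends m (suc A) (suc d) = map suc (ends m (suc A) d)

-- `ends` recurses diagonal by diagonal, as the summation does: a row at distance 0 is dropped, and
-- one step further out the next row has m steps left. What comes out is an arithmetic progression.
ends-rows : ∀ m A d → ends m A d ≡ map (λ i → d ℕ.+ suc m ℕ.* i) (rows A)
ends-rows m zero    d       = ≡.refl
ends-rows m (suc A) zero    = begin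
  map suc (ends m A m) ∷ʳ 0
    ≡⟨ ≡.cong (λ xs → map suc xs ∷ʳ 0) (ends-rows m A m) ⟩
  map suc (map (λ i → m ℕ.+ suc m ℕ.* i) (rows A)) ∷ʳ 0
    ≡⟨ ≡.cong₂ _∷ʳ_ (≡.trans (≡.sym (map-∘ (rows A))) (≡.trans (map-cong (λ i → ≡.sym (ℕₚ.*-suc (suc m) i)) (rows A)) (map-∘ (rows A)))) (≡.sym (ℕₚ.*-zeroʳ (suc m))) ⟩
  map (λ i → suc m ℕ.* i) (map suc (rows A)) ∷ʳ (suc m ℕ.* 0)
    ≡⟨ map-++ (λ i → suc m ℕ.* i) (map suc (rows A)) (0 ∷ []) ⟨
  map (λ i → suc m ℕ.* i) (rows (suc A)) ∎
  where open ≡.≡-Reasoning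
ends-rows m (suc A) (suc d) = ≡.trans (≡.cong (map suc) (ends-rows m (suc A) d)) (≡.sym (map-∘ (rows (suc A))))

between : ℕ → ℕ → ℕ → Bool
between lo hi t = (lo ≤ᵇ t) ∧ (t <ᵇ hi)

-- The ranges allowed to a diagonal that interlaces with `p`: p ≤ t < p′ for s = 0 and p < t ≤ p′
-- for s = 1, so that the shift exchanges the weak and the strict side.
intervals : ℕ → List ℕ → List (ℕ → Bool)
intervals s []           = []
intervals s (p ∷ [])     = []
intervals s (p ∷ p′ ∷ ps) = between (p ℕ.+ s) (p′ ℕ.+ s) ∷ intervals s (p′ ∷ ps)

-- The case in which the last row goes on: the next diagonal has one more entry, bounded only from
-- below.
intervals⁺ : ℕ → List ℕ → List (ℕ → Bool)
intervals⁺ s []            = []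
intervals⁺ s (p ∷ [])      = (p ℕ.+ s ≤ᵇ_) ∷ []
intervals⁺ s (p ∷ p′ ∷ ps) = between (p ℕ.+ s) (p′ ℕ.+ s) ∷ intervals⁺ s (p′ ∷ ps)

Sorted : List ℕ → Set
Sorted = Linked _≤_

Within : List (ℕ → Bool) → List ℕ → Set
Within = Pointwise (λ v t → T (v t))

≤ᵇ-suc : ∀ m n → (suc m ≤ᵇ suc n) ≡ (m ≤ᵇ n)
≤ᵇ-suc zero    n = ≡.refl
≤ᵇ-suc (suc m) n = ≡.refl

<ᵇ-not-≤ᵇ : ∀ m n → (m <ᵇ n) ≡ not (n ≤ᵇ m)
<ᵇ-not-≤ᵇ m       zero    = ≡.refl
<ᵇ-not-≤ᵇ zero    (suc n) = ≡.refl
<ᵇ-not-≤ᵇ (suc m) (suc n) = ≡.trans (<ᵇ-not-≤ᵇ m n) (≡.cong not (≡.sym (≤ᵇ-suc n m)))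

∧-T : ∀ {x y} → T (x ∧ y) → T x × T y
∧-T {true} {true} _ = tt , tt

between⇒ : ∀ lo hi t → T (between lo hi t) → lo ≤ t × t < hi
between⇒ lo hi t w = ℕₚ.≤ᵇ⇒≤ lo t (proj₁ (∧-T w)) , ℕₚ.<ᵇ⇒< t hi (proj₂ (∧-T {lo ≤ᵇ t} w))

-- Supplies the hypotheses of the next summation step, which wants a sorted diagonal with as many
-- entries as there are rows left.
within-intervals : ∀ s p {x} → Within (intervals s p) x → Sorted x × (∀ {A} → length p ≡ suc A → length x ≡ A)
within-intervals s []           []       = [] , λ ()
within-intervals s (p ∷ [])     []       = [] , λ { ≡.refl → ≡.refl }
within-intervals s (p ∷ p′ ∷ ps) {t ∷ x} (w ∷ ws) with within-intervals s (p′ ∷ ps) ws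
... | srt , len = glue ps ws srt , λ { ≡.refl → ≡.cong suc (len ≡.refl) }
  where
  glue : ∀ ps {x} → Within (intervals s (p′ ∷ ps)) x → Sorted x → Sorted (t ∷ x)
  glue []       []       srt = [-]
  glue (p″ ∷ ps) (w′ ∷ ws) srt =
    ℕₚ.≤-trans (ℕₚ.<⇒≤ (proj₂ (between⇒ (p ℕ.+ s) _ t w))) (proj₁ (between⇒ (p′ ℕ.+ s) (p″ ℕ.+ s) _ w′)) ∷ srt

within-intervals⁺ : ∀ s p {x} → Within (intervals⁺ s p) x → Sorted x × length x ≡ length p
within-intervals⁺ s []            []       = [] , ≡.refl
within-intervals⁺ s (p ∷ [])      (w ∷ []) = [-] , ≡.refl
within-intervals⁺ s (p ∷ p′ ∷ ps) {t ∷ x} (w ∷ ws) with within-intervals⁺ s (p′ ∷ ps) ws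
... | srt , len = glue ps ws srt , ≡.cong suc len
  where
  glue : ∀ ps {x} → Within (intervals⁺ s (p′ ∷ ps)) x → Sorted x → Sorted (t ∷ x)
  glue []        (w′ ∷ [])  srt =
    ℕₚ.≤-trans (ℕₚ.<⇒≤ (proj₂ (between⇒ (p ℕ.+ s) _ t w))) (ℕₚ.≤ᵇ⇒≤ (p′ ℕ.+ s) _ w′) ∷ srt
  glue (p″ ∷ ps) (w′ ∷ ws) srt =
    ℕₚ.≤-trans (ℕₚ.<⇒≤ (proj₂ (between⇒ (p ℕ.+ s) _ t w))) (proj₁ (between⇒ (p′ ℕ.+ s) (p″ ℕ.+ s) _ w′)) ∷ srt

-- Finite sums and geometric series

module Sums (R : CommutativeRing 0ℓ 0ℓ) where
  open Determinants R public

  Σ< : ℕ → (ℕ → Carrier) → Carrier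
  Σ< zero    f = 0#
  Σ< (suc n) f = f 0 + Σ< n (f ∘ suc)

  Σ<-cong< : ∀ n {f g} → (∀ t → t < n → f t ≈ g t) → Σ< n f ≈ Σ< n g
  Σ<-cong< zero    e = refl
  Σ<-cong< (suc n) e = +-cong (e 0 (s≤s z≤n)) (Σ<-cong< n (λ t t<n → e (suc t) (s≤s t<n)))

  Σ<-cong : ∀ n {f g} → (∀ t → f t ≈ g t) → Σ< n f ≈ Σ< n g
  Σ<-cong n e = Σ<-cong< n (λ t _ → e t)

  Σ<-0 : ∀ n → Σ< n (λ _ → 0#) ≈ 0#
  Σ<-0 zero    = refl
  Σ<-0 (suc n) = trans (+-identityˡ _) (Σ<-0 n)

  Σ<-+ : ∀ n f g → Σ< n (λ t → f t + g t) ≈ Σ< n f + Σ< n g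
  Σ<-+ zero    f g = sym (+-identityˡ _)
  Σ<-+ (suc n) f g = trans (+-congˡ (Σ<-+ n (f ∘ suc) (g ∘ suc))) (shuffle _ _ _ _)
    where
    shuffle : ∀ a b c d → (a + b) + (c + d) ≈ (a + c) + (b + d)
    shuffle = solve 4 (λ a b c d → (a :+ b) :+ (c :+ d) := (a :+ c) :+ (b :+ d)) refl

  Σ<-* : ∀ n k f → Σ< n (λ t → k * f t) ≈ k * Σ< n f
  Σ<-* zero    k f = sym (zeroʳ _)
  Σ<-* (suc n) k f = trans (+-congˡ (Σ<-* n k (f ∘ suc))) (sym (distribˡ _ _ _))

  Σ<-swap : ∀ n n′ (f : ℕ → ℕ → Carrier) → Σ< n (λ t → Σ< n′ (f t)) ≈ Σ< n′ (λ u → Σ< n (λ t → f t u))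
  Σ<-swap zero    n′ f = sym (Σ<-0 n′)
  Σ<-swap (suc n) n′ f = trans (+-congˡ (Σ<-swap n n′ (f ∘ suc))) (sym (Σ<-+ n′ (f 0) _))

  ind : Bool → Carrier
  ind true  = 1#
  ind false = 0#

  ind-∧ : ∀ x y → ind (x ∧ y) ≈ ind x * ind y
  ind-∧ true  y = sym (*-identityˡ _)
  ind-∧ false y = sym (zeroˡ _)

  ind-cong : ∀ x {y z} → (T x → y ≈ z) → ind x * y ≈ ind x * z
  ind-cong true  e = *-congˡ (e tt)
  ind-cong false e = trans (zeroˡ _) (sym (zeroˡ _))

  -- Writing a bounded range as a difference of two tails is what later produces differences of
  -- columns. The condition `lo ≤ hi` is the place where sortedness of the diagonal enters.
  ind-between : ∀ {lo hi} t → lo ≤ hi → ind (between lo hi t) ≈ ind (lo ≤ᵇ t) + ε * ind (hi ≤ᵇ t)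
  ind-between {lo} {hi} t lo≤hi rewrite <ᵇ-not-≤ᵇ t hi
    with lo ≤ᵇ t in e | hi ≤ᵇ t in e′
  ... | true  | true  = sym (+-inverse 1#)
  ... | true  | false = sym (trans (+-congˡ (zeroʳ _)) (+-identityʳ _))
  ... | false | false = sym (trans (+-congˡ (zeroʳ _)) (+-identityʳ _))
  ... | false | true  = ⊥-elim (≡.subst T e (ℕₚ.≤⇒≤ᵇ (ℕₚ.≤-trans lo≤hi (ℕₚ.≤ᵇ⇒≤ hi t (≡.subst T (≡.sym e′) tt)))))

  -- The exponent `lo ⊔ n` of the boundary term covers the empty range as well: for n ≤ lo both
  -- sides vanish.
  geometric-tail : ∀ n lo ζ → (1# + ε * ζ) * Σ< n (λ t → ind (lo ≤ᵇ t) * ζ ^ t) ≈ ζ ^ lo + ε * ζ ^ (lo ⊔ n)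
  geometric-tail zero    zero     ζ = trans (zeroʳ _) (sym (+-inverse _))
  geometric-tail zero    (suc lo) ζ = trans (zeroʳ _) (sym (+-inverse _))
  geometric-tail (suc n) zero     ζ = begin
    (1# + ε * ζ) * (1# * 1# + Σ< n (λ t → 1# * (ζ * ζ ^ t)))
      ≈⟨ *-congˡ (+-congˡ (trans (Σ<-cong n (λ t → shuffle₁ ζ (ζ ^ t))) (Σ<-* n ζ _))) ⟩
    (1# + ε * ζ) * (1# * 1# + ζ * Σ< n (λ t → 1# * ζ ^ t))
      ≈⟨ shuffle₂ ε ζ _ ⟩
    1# + ε * ζ + ζ * ((1# + ε * ζ) * Σ< n (λ t → 1# * ζ ^ t))
      ≈⟨ +-congˡ (*-congˡ (geometric-tail n zero ζ)) ⟩
    1# + ε * ζ + ζ * (1# + ε * ζ ^ n)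
      ≈⟨ shuffle₃ ε ζ (ζ ^ n) ⟩
    1# + ε * (ζ * ζ ^ n) + (ζ + ε * ζ)
      ≈⟨ trans (+-congˡ (+-inverse ζ)) (+-identityʳ _) ⟩
    1# + ε * (ζ * ζ ^ n) ∎
    where
    shuffle₁ : ∀ z w → 1# * (z * w) ≈ z * (1# * w)
    shuffle₁ = solve 2 (λ z w → con 1 :* (z :* w) := z :* (con 1 :* w)) refl
    shuffle₂ : ∀ e z w → (1# + e * z) * (1# * 1# + z * w) ≈ 1# + e * z + z * ((1# + e * z) * w)
    shuffle₂ = solve 3 (λ e z w → (con 1 :+ e :* z) :* (con 1 :* con 1 :+ z :* w) := con 1 :+ e :* z :+ z :* ((con 1 :+ e :* z) :* w)) refl
    shuffle₃ : ∀ e z w → 1# + e * z + z * (1# + e * w) ≈ 1# + e * (z * w) + (z + e * z)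
    shuffle₃ = solve 3 (λ e z w → con 1 :+ e :* z :+ z :* (con 1 :+ e :* w) := con 1 :+ e :* (z :* w) :+ (z :+ e :* z)) refl
  geometric-tail (suc n) (suc lo) ζ = begin
    (1# + ε * ζ) * (0# * 1# + Σ< n (λ t → ind (suc lo ≤ᵇ suc t) * (ζ * ζ ^ t)))
      ≈⟨ *-congˡ (+-congˡ (trans (Σ<-cong n (λ t → trans (*-congʳ (reflexive (≡.cong ind (≤ᵇ-suc lo t)))) (shuffle₁ ζ (ind (lo ≤ᵇ t)) (ζ ^ t)))) (Σ<-* n ζ _))) ⟩
    (1# + ε * ζ) * (0# * 1# + ζ * Σ< n (λ t → ind (lo ≤ᵇ t) * ζ ^ t))
      ≈⟨ shuffle₂ (1# + ε * ζ) ζ _ ⟩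
    ζ * ((1# + ε * ζ) * Σ< n (λ t → ind (lo ≤ᵇ t) * ζ ^ t))
      ≈⟨ *-congˡ (geometric-tail n lo ζ) ⟩
    ζ * (ζ ^ lo + ε * ζ ^ (lo ⊔ n))
      ≈⟨ shuffle₃ ε ζ _ _ ⟩
    ζ * ζ ^ lo + ε * (ζ * ζ ^ (lo ⊔ n)) ∎
    where
    shuffle₁ : ∀ z i w → i * (z * w) ≈ z * (i * w)
    shuffle₁ = solve 3 (λ z i w → i :* (z :* w) := z :* (i :* w)) refl
    shuffle₂ : ∀ x z w → x * (0# * 1# + z * w) ≈ z * (x * w)
    shuffle₂ = solve 3 (λ x z w → x :* (con 0 :* con 1 :+ z :* w) := z :* (x :* w)) refl
    shuffle₃ : ∀ e z w v → z * (w + e * v) ≈ z * w + e * (z * v)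
    shuffle₃ = solve 4 (λ e z w v → z :* (w :+ e :* v) := z :* w :+ e :* (z :* v)) refl

-- Summing out interlacing diagonals

module Interlacing (R : CommutativeRing 0ℓ 0ℓ) (q : CommutativeRing.Carrier R) (W : ℕ) where
  open Sums R public

  ΣI : List (ℕ → Bool) → (List ℕ → Carrier) → Carrier
  ΣI []       f = f []
  ΣI (v ∷ vs) f = Σ< W (λ t → ind (v t) * ΣI vs (λ ts → f (t ∷ ts)))

  ΣI-cong : ∀ vs {f g} → (∀ x → Within vs x → f x ≈ g x) → ΣI vs f ≈ ΣI vs g
  ΣI-cong []       e = e [] []
  ΣI-cong (v ∷ vs) e = Σ<-cong W (λ t → ind-cong (v t) (λ vt → ΣI-cong vs (λ x w → e (t ∷ x) (vt ∷ w))))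

  ΣI-* : ∀ vs k f → ΣI vs (λ x → k * f x) ≈ k * ΣI vs f
  ΣI-* []       k f = refl
  ΣI-* (v ∷ vs) k f = trans
    (Σ<-cong W (λ t → trans (*-congˡ (ΣI-* vs k (f ∘ (t ∷_)))) (shuffle _ k _))) (Σ<-* W k _)
    where
    shuffle : ∀ i k x → i * (k * x) ≈ k * (i * x)
    shuffle = solve 3 (λ i k x → i :* (k :* x) := k :* (i :* x)) refl

  module _ {A : Set} where

    ∂-Σ< : ∀ n (c : A → Carrier) (k : ℕ → Carrier) (ω : ℕ → List A → Carrier) rs →
           Σ< n (λ t → k t * ∂ c (ω t) rs) ≈ ∂ c (λ rs → Σ< n (λ t → k t * ω t rs)) rs
    ∂-Σ< zero    c k ω rs = sym (∂-0 c rs)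
    ∂-Σ< (suc n) c k ω rs = trans (+-congˡ (∂-Σ< n c (k ∘ suc) (ω ∘ suc) rs))
      (sym (∂-linear c (k 0) (ω 0) _ rs))

    ∂-Σ<-col : ∀ n (c : ℕ → A → Carrier) (k : ℕ → Carrier) (ω : List A → Carrier) rs →
               Σ< n (λ t → k t * ∂ (c t) ω rs) ≈ ∂ (λ r → Σ< n (λ t → k t * c t r)) ω rs
    ∂-Σ<-col zero    c k ω rs = sym (∂-0-col ω rs)
    ∂-Σ<-col (suc n) c k ω rs = trans (+-congˡ (∂-Σ<-col n (c ∘ suc) (k ∘ suc) ω rs))
      (sym (∂-linear-col (c 0) _ (k 0) ω rs))

    ∂-ΣI : ∀ vs (c : A → Carrier) (ω : List ℕ → List A → Carrier) rs →
           ΣI vs (λ x → ∂ c (ω x) rs) ≈ ∂ c (λ rs → ΣI vs (λ x → ω x rs)) rs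
    ∂-ΣI []       c ω rs = refl
    ∂-ΣI (v ∷ vs) c ω rs = trans
      (Σ<-cong W (λ t → *-congˡ (∂-ΣI vs c (λ x → ω (t ∷ x)) rs)))
      (∂-Σ< W c (ind ∘ v) (λ t rs → ΣI vs (λ x → ω (t ∷ x) rs)) rs)

    det-ΣI : ∀ vs (col : ℕ → A → Carrier) rs →
             ΣI vs (λ x → det rs (map col x)) ≈ det rs (map (λ v r → Σ< W (λ t → ind (v t) * col t r)) vs)
    det-ΣI []       col rs = refl
    det-ΣI (v ∷ vs) col rs = trans
      (Σ<-cong W (λ t → *-congˡ (trans (∂-ΣI vs (col t) (λ x rs → det rs (map col x)) rs)
        (∂-cong (λ _ → refl) (det-ΣI vs col) rs))))
      (∂-Σ<-col W col (ind ∘ v) (λ rs → det rs (map (λ v r → Σ< W (λ t → ind (v t) * col t r)) vs)) rs)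

  esum : (ℕ → ℕ) → ℕ → ℕ
  esum e zero    = 0
  esum e (suc n) = e 0 ℕ.+ esum (e ∘ suc) n

  -- Fillings of a straight shape cut along a diagonal carrying the values p: the next diagonal x
  -- interlaces with p (weakly on one side, strictly on the other, as chosen by s ∈ {0, 1}).
  -- Row i of the shape ends at distance d + (m+1)(A-1-i); diagonal k is weighted by q^(e k).
  cutSum : ℕ → ℕ → (ℕ → ℕ) → ℕ → ℕ → List ℕ → Carrier
  cutSum s m e zero    d       p = 1#
  cutSum s m e (suc A) zero    p = ΣI (intervals s p) (λ x → q ^ (e 0 ℕ.* sum x) * cutSum s m (e ∘ suc) A m x)
  cutSum s m e (suc A) (suc d) p = ΣI (intervals⁺ s p) (λ x → q ^ (e 0 ℕ.* sum x) * cutSum s m (e ∘ suc) (suc A) d x)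

  -- The column belonging to the entry `t`, in determinants whose rows are labelled by exponents
  -- `E`.
  ev : ℕ → ℕ → Carrier
  ev t E = q ^ (E ℕ.* t)

  -- One factor 1 - q^E for each of the D positions of a row, E being the total weight of the
  -- diagonals from that position to the end of the row. For constant weights this is a q-factorial.
  rowDenominator : (ℕ → ℕ) → ℕ → Carrier
  rowDenominator e zero    = 1#
  rowDenominator e (suc D) = (1# + ε * q ^ esum e (suc D)) * rowDenominator (e ∘ suc) D

  -- The power of q caused by the shift `s` of the interval endpoints: each summation contributes
  -- q^(E s) to the row with exponent E.
  rowTwist : ℕ → (ℕ → ℕ) → ℕ → Carrier
  rowTwist s e zero    = 1#
  rowTwist s e (suc D) = q ^ (esum e (suc D) ℕ.* s) * rowTwist s (e ∘ suc) D

  prod-^-sum : ∀ k x → prod (λ t → q ^ (k ℕ.* t)) x ≈ q ^ (k ℕ.* sum x)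
  prod-^-sum k []      = ^-congʳ q (≡.sym (ℕₚ.*-zeroʳ k))
  prod-^-sum k (t ∷ x) = trans (*-congˡ (prod-^-sum k x))
    (sym (trans (^-congʳ q (ℕₚ.*-distribˡ-+ k t (sum x))) (^-homo-* q (k ℕ.* t) (k ℕ.* sum x))))

  module _ (q^W≈0 : q ^ W ≈ 0#) where

    ev-vanish : ∀ {E t} → 0 < E → W ≤ t → ev t E ≈ 0#
    ev-vanish {suc E} {t} _ W≤t = begin
      q ^ (suc E ℕ.* t)                ≡⟨ ≡.cong (λ u → q ^ (u ℕ.+ E ℕ.* t)) (≡.sym (ℕₚ.m+[n∸m]≡n W≤t)) ⟩
      q ^ (W ℕ.+ (t ℕ.∸ W) ℕ.+ E ℕ.* t)  ≡⟨ ≡.cong (q ^_) (ℕₚ.+-assoc W (t ℕ.∸ W) (E ℕ.* t)) ⟩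
      q ^ (W ℕ.+ (t ℕ.∸ W ℕ.+ E ℕ.* t))  ≈⟨ ^-homo-* q W _ ⟩
      q ^ W * q ^ (t ℕ.∸ W ℕ.+ E ℕ.* t)  ≈⟨ trans (*-congʳ q^W≈0) (zeroˡ _) ⟩
      0# ∎

    ev-+ : ∀ p s E → ev (p ℕ.+ s) E ≈ q ^ (E ℕ.* s) * ev p E
    ev-+ p s E = trans (^-congʳ q (≡.trans (ℕₚ.*-distribˡ-+ E p s) (ℕₚ.+-comm (E ℕ.* p) (E ℕ.* s)))) (^-homo-* q (E ℕ.* s) (E ℕ.* p))

    -- The sum cut off at `W` behaves like the full geometric series: its boundary term is q to at
    -- least the power W because `E` is positive, hence zero.
    tail-column : ∀ {E} lo → 0 < E → (1# + ε * q ^ E) * Σ< W (λ t → ind (lo ≤ᵇ t) * ev t E) ≈ ev lo E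
    tail-column {E} lo 0<E = begin
      (1# + ε * q ^ E) * Σ< W (λ t → ind (lo ≤ᵇ t) * ev t E)
        ≈⟨ *-congˡ (Σ<-cong W (λ t → *-congˡ (sym (^-assocʳ q E t)))) ⟩
      (1# + ε * q ^ E) * Σ< W (λ t → ind (lo ≤ᵇ t) * (q ^ E) ^ t)
        ≈⟨ geometric-tail W lo (q ^ E) ⟩
      (q ^ E) ^ lo + ε * (q ^ E) ^ (lo ⊔ W)
        ≈⟨ +-cong (^-assocʳ q E lo) (*-congˡ (^-assocʳ q E (lo ⊔ W))) ⟩
      ev lo E + ε * ev (lo ⊔ W) E
        ≈⟨ +-congˡ (trans (*-congˡ (ev-vanish 0<E (ℕₚ.m≤n⊔m lo W))) (zeroʳ _)) ⟩
      ev lo E + 0#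
        ≈⟨ +-identityʳ _ ⟩
      ev lo E ∎

    between-column : ∀ {E lo hi} → 0 < E → lo ≤ hi →
      (1# + ε * q ^ E) * Σ< W (λ t → ind (between lo hi t) * ev t E) ≈ ev lo E + ε * ev hi E
    between-column {E} {lo} {hi} 0<E lo≤hi = begin
      k * Σ< W (λ t → ind (between lo hi t) * ev t E)
        ≈⟨ *-congˡ (Σ<-cong W (λ t → trans (*-congʳ (ind-between t lo≤hi)) (shuffle ε _ _ _))) ⟩
      k * Σ< W (λ t → ind (lo ≤ᵇ t) * ev t E + ε * (ind (hi ≤ᵇ t) * ev t E))
        ≈⟨ *-congˡ (trans (Σ<-+ W _ _) (+-congˡ (Σ<-* W ε _))) ⟩
      k * (Σ< W (λ t → ind (lo ≤ᵇ t) * ev t E) + ε * Σ< W (λ t → ind (hi ≤ᵇ t) * ev t E))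
        ≈⟨ shuffle₂ k ε _ _ ⟩
      k * Σ< W (λ t → ind (lo ≤ᵇ t) * ev t E) + ε * (k * Σ< W (λ t → ind (hi ≤ᵇ t) * ev t E))
        ≈⟨ +-cong (tail-column lo 0<E) (*-congˡ (tail-column hi 0<E)) ⟩
      ev lo E + ε * ev hi E ∎
      where
      k : Carrier
      k = 1# + ε * q ^ E
      shuffle : ∀ e x y z → (x + e * y) * z ≈ x * z + e * (y * z)
      shuffle = solve 4 (λ e x y z → (x :+ e :* y) :* z := x :* z :+ e :* (y :* z)) refl
      shuffle₂ : ∀ k e x y → k * (x + e * y) ≈ k * x + e * (k * y)
      shuffle₂ = solve 4 (λ k e x y → k :* (x :+ e :* y) := k :* x :+ e :* (k :* y)) refl

    private
      Scol : (ℕ → Bool) → ℕ → Carrier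
      Scol v E = Σ< W (λ t → ind (v t) * ev t E)

      _≈⁺_ : (ℕ → Carrier) → (ℕ → Carrier) → Set
      c ≈⁺ c′ = ∀ E → 0 < E → c E ≈ c′ E

      den : (ℕ → Carrier) → ℕ → Carrier
      den c E = (1# + ε * q ^ E) * c E

      tw : ℕ → (ℕ → Carrier) → ℕ → Carrier
      tw s c E = q ^ (E ℕ.* s) * c E

      gap : ∀ s {p p′} → p ≤ p′ → den (Scol (between (p ℕ.+ s) (p′ ℕ.+ s))) ≈⁺ tw s (ev p ⊝ ev p′)
      gap s {p} {p′} p≤p′ E 0<E = trans (between-column 0<E (ℕₚ.+-monoˡ-≤ s p≤p′))
        (trans (+-cong (ev-+ p s E) (*-congˡ (ev-+ p′ s E))) (shuffle (q ^ (E ℕ.* s)) ε _ _))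
        where
        shuffle : ∀ k e x y → k * x + e * (k * y) ≈ k * (x + e * y)
        shuffle = solve 4 (λ k e x y → k :* x :+ e :* (k :* y) := k :* (x :+ e :* y)) refl

      columns : ∀ s {p} → Sorted p → Pointwise _≈⁺_ (map den (map Scol (intervals s p))) (map (tw s) (differences (map ev p)))
      columns s []        = []
      columns s [-]       = []
      columns s (p≤p′ ∷ l) = gap s p≤p′ ∷ columns s l

      columns⁺ : ∀ s {p} → Sorted p → Pointwise _≈⁺_ (map den (map Scol (intervals⁺ s p))) (map (tw s) (differences⁺ (map ev p)))
      columns⁺ s []        = []
      columns⁺ s {p ∷ []} [-] = (λ E 0<E → trans (tail-column (p ℕ.+ s) 0<E) (ev-+ p s E)) ∷ []
      columns⁺ s (p≤p′ ∷ l) = gap s p≤p′ ∷ columns⁺ s l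

    -- Multilinearity moves the sum into the columns. There the factor 1 - q^E of row E turns the
    -- geometric series over an interval into the difference of the columns at its endpoints, and
    -- the shift of the endpoints into q^(E s).
    step : ∀ s {p rs} → Sorted p → All (0 <_) rs →
      prod (λ E → 1# + ε * q ^ E) rs * ΣI (intervals s p) (λ x → det rs (map ev x)) ≈
      prod (λ E → q ^ (E ℕ.* s)) rs * det rs (differences (map ev p))
    step s {p} {rs} srt pos = trans (*-congˡ (det-ΣI (intervals s p) ev rs))
      (trans (sym (det-scale-rows _ (map Scol (intervals s p)) rs))
      (trans (det-congᴾ (columns s srt) pos) (det-scale-rows _ (differences (map ev p)) rs)))

    -- The last interval is a full tail, so its column is not differenced; the columns are then
    -- `differences⁺`, which leave the determinant of the original columns.
    step⁺ : ∀ s {p rs} → Sorted p → All (0 <_) rs →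
      prod (λ E → 1# + ε * q ^ E) rs * ΣI (intervals⁺ s p) (λ x → det rs (map ev x)) ≈
      prod (λ E → q ^ (E ℕ.* s)) rs * det rs (map ev p)
    step⁺ s {p} {rs} srt pos = trans (*-congˡ (det-ΣI (intervals⁺ s p) ev rs))
      (trans (sym (det-scale-rows _ (map Scol (intervals⁺ s p)) rs))
      (trans (det-congᴾ (columns⁺ s srt) pos) (trans (det-scale-rows _ (differences⁺ (map ev p)) rs)
      (*-congˡ (det-differences⁺ (map ev p) rs)))))

    -- The weight scales the column of each entry t by q^(k t), and this is the same as raising
    -- every row exponent by k.
    det-weight : ∀ k rs x → q ^ (k ℕ.* sum x) * det rs (map ev x) ≈ det (map (k ℕ.+_) rs) (map ev x)
    det-weight k rs x = sym (begin
      det (map (k ℕ.+_) rs) (map ev x)                     ≈⟨ det-map (k ℕ.+_) (map ev x) rs ⟩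
      det rs (map (_∘ (k ℕ.+_)) (map ev x))                ≈⟨ det-cong (cols x) rs ⟩
      det rs (map (λ t E → q ^ (k ℕ.* t) * ev t E) x)      ≈⟨ det-scale-cols (λ t → q ^ (k ℕ.* t)) ev x rs ⟩
      prod (λ t → q ^ (k ℕ.* t)) x * det rs (map ev x)     ≈⟨ *-congʳ (prod-^-sum k x) ⟩
      q ^ (k ℕ.* sum x) * det rs (map ev x)                ∎)
      where
      cols : ∀ x → Pointwise (λ c c′ → ∀ E → c E ≈ c′ E) (map (_∘ (k ℕ.+_)) (map ev x)) (map (λ t E → q ^ (k ℕ.* t) * ev t E) x)
      cols []      = []
      cols (t ∷ x) = (λ E → trans (^-congʳ q (ℕₚ.*-distribʳ-+ t k E)) (^-homo-* q (k ℕ.* t) (E ℕ.* t))) ∷ cols x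

    private
      prod-suc : ∀ (f : ℕ → Carrier) (g g′ : ℕ → Carrier) → (∀ D → f (suc D) ≈ g (suc D) * g′ D) →
                 ∀ Ds → prod f (map suc Ds) ≈ prod g (map suc Ds) * prod g′ Ds
      prod-suc f g g′ e Ds = trans (reflexive (prod-map f suc Ds)) (trans (prod-cong Ds e)
        (trans (prod-* (g ∘ suc) g′ Ds) (*-congʳ (reflexive (≡.sym (prod-map g suc Ds))))))

      positive : ∀ {e : ℕ → ℕ} → (∀ k → 0 < e k) → ∀ Ds → All (0 <_) (map (esum e) (map suc Ds))
      positive pos []       = []
      positive pos (D ∷ Ds) = ℕₚ.≤-trans (pos 0) (ℕₚ.m≤m+n _ _) ∷ positive pos Ds

      -- One diagonal of the induction, common to both kinds of intervals. The factors of each row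
      -- split into the first one, consumed by the summation step, and the rest, consumed by the
      -- induction hypothesis under the sum.
      core : ∀ s e {Ds Φ} vs x-det (U : List ℕ → Carrier) →
        (∀ x → Within vs x → prod (rowDenominator (e ∘ suc)) Ds * U x ≈
                             prod (rowTwist s (e ∘ suc)) Ds * det (map (esum (e ∘ suc)) Ds) (map ev x)) →
        Φ ≡ map (esum e) (map suc Ds) →
        prod (λ E → 1# + ε * q ^ E) Φ * ΣI vs (λ x → det Φ (map ev x)) ≈ prod (λ E → q ^ (E ℕ.* s)) Φ * x-det →
        prod (rowDenominator e) (map suc Ds) * ΣI vs (λ x → q ^ (e 0 ℕ.* sum x) * U x) ≈
        prod (rowTwist s e) (map suc Ds) * x-det
      core s e {Ds} {Φ} vs x-det U ih ≡.refl st = begin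
        prod (rowDenominator e) (map suc Ds) * ΣI vs (λ x → q ^ (e 0 ℕ.* sum x) * U x)
          ≈⟨ *-congʳ (prod-suc _ (λ D → 1# + ε * q ^ esum e D) _ (λ _ → refl) Ds) ⟩
        prod (λ D → 1# + ε * q ^ esum e D) (map suc Ds) * PB * ΣI vs (λ x → q ^ (e 0 ℕ.* sum x) * U x)
          ≈⟨ trans (*-assoc _ _ _) (*-cong (reflexive (≡.sym (prod-map (λ E → 1# + ε * q ^ E) (esum e) (map suc Ds)))) (sym (ΣI-* vs PB _))) ⟩
        PA * ΣI vs (λ x → PB * (q ^ (e 0 ℕ.* sum x) * U x))
          ≈⟨ *-congˡ (ΣI-cong vs pointwise) ⟩
        PA * ΣI vs (λ x → TW * det Φ (map ev x))
          ≈⟨ trans (*-congˡ (ΣI-* vs TW _)) (swap PA TW _) ⟩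
        TW * (PA * ΣI vs (λ x → det Φ (map ev x)))
          ≈⟨ *-congˡ st ⟩
        TW * (prod (λ E → q ^ (E ℕ.* s)) Φ * x-det)
          ≈⟨ rearr TW _ _ ⟩
        prod (λ E → q ^ (E ℕ.* s)) Φ * TW * x-det
          ≈⟨ *-congʳ (*-congʳ (reflexive (prod-map (λ E → q ^ (E ℕ.* s)) (esum e) (map suc Ds)))) ⟩
        prod (λ D → q ^ (esum e D ℕ.* s)) (map suc Ds) * TW * x-det
          ≈⟨ *-congʳ (prod-suc _ (λ D → q ^ (esum e D ℕ.* s)) _ (λ _ → refl) Ds) ⟨
        prod (rowTwist s e) (map suc Ds) * x-det ∎
        where
        PA PB TW : Carrier
        PA = prod (λ E → 1# + ε * q ^ E) Φ
        PB = prod (rowDenominator (e ∘ suc)) Ds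
        TW = prod (rowTwist s (e ∘ suc)) Ds
        swap : ∀ a b c → a * (b * c) ≈ b * (a * c)
        swap = solve 3 (λ a b c → a :* (b :* c) := b :* (a :* c)) refl
        rearr : ∀ a b c → a * (b * c) ≈ b * a * c
        rearr = solve 3 (λ a b c → a :* (b :* c) := b :* a :* c) refl
        Φ≡ : map (e 0 ℕ.+_) (map (esum (e ∘ suc)) Ds) ≡ Φ
        Φ≡ = ≡.trans (≡.sym (map-∘ Ds)) (map-∘ Ds)
        pointwise : ∀ x → Within vs x → PB * (q ^ (e 0 ℕ.* sum x) * U x) ≈ TW * det Φ (map ev x)
        pointwise x w = trans (swap PB _ _) (trans (*-congˡ (ih x w)) (trans (swap _ TW _)
          (*-congˡ (trans (det-weight (e 0) (map (esum (e ∘ suc)) Ds) x)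
            (reflexive (≡.cong (λ r → det r (map ev x)) Φ≡))))))

    -- A row of the shape ending at distance D gives the determinant row with exponent `esum e D`. A
    -- row ending at distance 0 has exponent 0 and is a row of ones; deleting it replaces the
    -- columns by their differences, and these are exactly what the sum over bounded intervals
    -- leaves behind.
    cutSum-det : ∀ s m e A d p → (∀ k → 0 < e k) → length p ≡ A → Sorted p →
      prod (rowDenominator e) (ends m A d) * cutSum s m e A d p ≈
      prod (rowTwist s e) (ends m A d) * det (map (esum e) (ends m A d)) (map ev p)
    cutSum-det s m e zero    d       []       pos len srt = refl
    cutSum-det s m e (suc A) zero    (p₀ ∷ p) pos len srt = begin
      prod (rowDenominator e) (map suc Ds ∷ʳ 0) * cutSum s m e (suc A) zero (p₀ ∷ p)
        ≈⟨ *-congʳ (last-one (rowDenominator e) refl) ⟩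
      prod (rowDenominator e) (map suc Ds) * cutSum s m e (suc A) zero (p₀ ∷ p)
        ≈⟨ core s e (intervals s (p₀ ∷ p)) _ (cutSum s m (e ∘ suc) A m)
             (λ x w → let srt′ , len′ = within-intervals s (p₀ ∷ p) w in
                      cutSum-det s m (e ∘ suc) A m x (pos ∘ suc) (len′ len) srt′)
             ≡.refl (step s srt (positive pos Ds)) ⟩
      prod (rowTwist s e) (map suc Ds) * det (map (esum e) (map suc Ds)) (differences (map ev (p₀ ∷ p)))
        ≈⟨ *-cong (sym (last-one (rowTwist s e) refl)) (sym (det-snoc-ones (ev p₀) (map ev p) _ 0 (refl ∷ ones p))) ⟩
      prod (rowTwist s e) (map suc Ds ∷ʳ 0) * det (map (esum e) (map suc Ds) ∷ʳ 0) (map ev (p₀ ∷ p))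
        ≈⟨ *-congˡ (reflexive (≡.cong (λ r → det r (map ev (p₀ ∷ p))) (≡.sym (map-++ (esum e) (map suc Ds) (0 ∷ []))))) ⟩
      prod (rowTwist s e) (map suc Ds ∷ʳ 0) * det (map (esum e) (map suc Ds ∷ʳ 0)) (map ev (p₀ ∷ p)) ∎
      where
      Ds : List ℕ
      Ds = ends m A m
      last-one : ∀ (f : ℕ → Carrier) → f 0 ≈ 1# → prod f (map suc Ds ∷ʳ 0) ≈ prod f (map suc Ds)
      last-one f e = trans (prod-++ f (map suc Ds) (0 ∷ [])) (trans (*-congˡ (trans (*-identityʳ _) e)) (*-identityʳ _))
      ones : ∀ p → All (λ c → c 0 ≈ 1#) (map ev p)
      ones []      = []
      ones (_ ∷ p) = refl ∷ ones p
    cutSum-det s m e (suc A) (suc d) p pos len srt =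
      core s e (intervals⁺ s p) _ (cutSum s m (e ∘ suc) (suc A) d)
        (λ x w → let srt′ , len′ = within-intervals⁺ s p w in
                 cutSum-det s m (e ∘ suc) (suc A) d x (pos ∘ suc) (≡.trans len′ len) srt′)
        ≡.refl (step⁺ s srt (positive pos (ends m (suc A) d)))

-- The Vandermonde determinant

upFrom : ℕ → ℕ → List ℕ
upFrom s zero    = []
upFrom s (suc n) = s ∷ upFrom (suc s) n

length-upFrom : ∀ s n → length (upFrom s n) ≡ n
length-upFrom s zero    = ≡.refl
length-upFrom s (suc n) = ≡.cong suc (length-upFrom (suc s) n)

upFrom-++ : ∀ s n n′ → upFrom s (n ℕ.+ n′) ≡ upFrom s n ++ upFrom (s ℕ.+ n) n′
upFrom-++ s zero    n′ = ≡.cong (λ s → upFrom s n′) (≡.sym (ℕₚ.+-identityʳ s))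
upFrom-++ s (suc n) n′ = ≡.cong (s ∷_) (≡.trans (upFrom-++ (suc s) n n′)
  (≡.cong (λ k → upFrom (suc s) n ++ upFrom k n′) (≡.sym (ℕₚ.+-suc s n))))

rows-suc : ∀ n → rows (suc n) ≡ n ∷ rows n
rows-suc zero    = ≡.refl
rows-suc (suc n) = ≡.cong (λ xs → map suc xs ∷ʳ 0) (rows-suc n)

module Vandermonde (R : CommutativeRing 0ℓ 0ℓ) where
  open Determinants R

  vandermonde : List Carrier → Carrier
  vandermonde []       = 1#
  vandermonde (x ∷ xs) = prod (λ y → x + ε * y) xs * vandermonde xs

  private
   module _ (P : ℕ → Carrier) where

    -- the complete homogeneous symmetric polynomial of degree i in P s, …, P (s + l ∸ 1)
    h : ℕ → ℕ → ℕ → Carrier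
    h zero    s zero    = 1#
    h zero    s (suc i) = 0#
    h (suc l) s zero    = 1#
    h (suc l) s (suc i) = P s * h (suc l) s i + h l (suc s) (suc i)

    -- By symmetry of `h` in its variables: the last variable can be split off just as the
    -- definition splits off the first. `exchange` is this symmetry in the form the induction needs.
    h-last : ∀ l s i → h (suc l) s (suc i) ≈ P (s ℕ.+ l) * h (suc l) s i + h l s (suc i)
    h-last zero    s i = +-congʳ (*-congʳ (reflexive (≡.cong P (≡.sym (ℕₚ.+-identityʳ s)))))
    h-last (suc l) s i = begin
      P s * h (2 ℕ.+ l) s i + h (suc l) (suc s) (suc i)
        ≈⟨ +-congˡ (trans (h-last l (suc s) i) (+-congʳ (*-congʳ (reflexive (≡.cong P (≡.sym (ℕₚ.+-suc s l))))))) ⟩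
      P s * h (2 ℕ.+ l) s i + (P (s ℕ.+ suc l) * h (suc l) (suc s) i + h l (suc s) (suc i))
        ≈⟨ +-assoc _ _ _ ⟨
      P s * h (2 ℕ.+ l) s i + P (s ℕ.+ suc l) * h (suc l) (suc s) i + h l (suc s) (suc i)
        ≈⟨ +-congʳ (exchange i) ⟩
      P (s ℕ.+ suc l) * h (2 ℕ.+ l) s i + P s * h (suc l) s i + h l (suc s) (suc i)
        ≈⟨ +-assoc _ _ _ ⟩
      P (s ℕ.+ suc l) * h (2 ℕ.+ l) s i + (P s * h (suc l) s i + h l (suc s) (suc i)) ∎
      where
      exchange : ∀ i → P s * h (2 ℕ.+ l) s i + P (s ℕ.+ suc l) * h (suc l) (suc s) i ≈
                       P (s ℕ.+ suc l) * h (2 ℕ.+ l) s i + P s * h (suc l) s i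
      exchange zero    = +-comm _ _
      exchange (suc i) = begin
        P s * h (2 ℕ.+ l) s (suc i) + P (s ℕ.+ suc l) * h (suc l) (suc s) (suc i)
          ≈⟨ +-congʳ (*-congˡ (h-last (suc l) s i)) ⟩
        P s * (P (s ℕ.+ suc l) * h (2 ℕ.+ l) s i + h (suc l) s (suc i)) + P (s ℕ.+ suc l) * h (suc l) (suc s) (suc i)
          ≈⟨ shuffle (P s) (P (s ℕ.+ suc l)) _ _ _ ⟩
        P (s ℕ.+ suc l) * (P s * h (2 ℕ.+ l) s i + h (suc l) (suc s) (suc i)) + P s * h (suc l) s (suc i) ∎
        where
        shuffle : ∀ x y u v w → x * (y * u + v) + y * w ≈ y * (x * u + w) + x * v
        shuffle = solve 5 (λ x y u v w → x :* (y :* u :+ v) :+ y :* w := y :* (x :* u :+ w) :+ x :* v) refl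

    gap : ℕ → ℕ → Carrier
    gap l s = P s + ε * P (s ℕ.+ suc l)

    -- Expanding `h` over the union of the two windows of variables, once at its first and once at
    -- its last variable, and comparing. This is a divided difference obtained without division.
    h-difference : ∀ l s i → h (suc l) s (suc i) + ε * h (suc l) (suc s) (suc i) ≈ gap l s * h (2 ℕ.+ l) s i
    h-difference l s i = begin
      x + ε * y                        ≈⟨ +-identityˡ _ ⟨
      0# + (x + ε * y)                 ≈⟨ +-congʳ (zeroʳ _) ⟨
      y′ * 0# + (x + ε * y)            ≈⟨ +-congʳ (*-congˡ (+-inverse u)) ⟨
      y′ * (u + ε * u) + (x + ε * y)   ≈⟨ shuffle ε y′ u x y ⟩
      (y′ * u + x) + ε * (y′ * u + y)  ≈⟨ +-congʳ (h-last (suc l) s i) ⟨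
      (P s * u + y) + ε * (y′ * u + y) ≈⟨ shuffle₂ ε (P s) y′ u y ⟩
      (P s + ε * y′) * u + (y + ε * y) ≈⟨ trans (+-congˡ (+-inverse y)) (+-identityʳ _) ⟩
      (P s + ε * y′) * u               ∎
      where
      x y y′ u : Carrier
      x  = h (suc l) s (suc i)
      y  = h (suc l) (suc s) (suc i)
      y′ = P (s ℕ.+ suc l)
      u  = h (2 ℕ.+ l) s i
      shuffle : ∀ ε y′ u x y → y′ * (u + ε * u) + (x + ε * y) ≈ (y′ * u + x) + ε * (y′ * u + y)
      shuffle = solve 5 (λ ε y′ u x y → y′ :* (u :+ ε :* u) :+ (x :+ ε :* y) := (y′ :* u :+ x) :+ ε :* (y′ :* u :+ y)) refl
      shuffle₂ : ∀ ε p y′ u y → (p * u + y) + ε * (y′ * u + y) ≈ (p + ε * y′) * u + (y + ε * y)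
      shuffle₂ = solve 5 (λ ε p y′ u y → (p :* u :+ y) :+ ε :* (y′ :* u :+ y) := (p :+ ε :* y′) :* u :+ (y :+ ε :* y)) refl

    gaps : ℕ → ℕ → ℕ → Carrier
    gaps l s zero    = 1#
    gaps l s (suc n) = prod (gap l) (upFrom s n) * gaps (suc l) s n

    -- The degree-0 row consists of ones. Differencing the columns against it extracts the factors
    -- `gap l` and leaves the same determinant with windows one longer and degrees one lower.
    det-h : ∀ l s n → det (rows n) (map (h (suc l)) (upFrom s n)) ≈ gaps l s n
    det-h l s zero    = refl
    det-h l s (suc n) = begin
      det (rows (suc n)) (map (h (suc l)) (upFrom s (suc n)))
        ≈⟨ det-snoc-ones (h (suc l) s) (map (h (suc l)) (upFrom (suc s) n)) (map suc (rows n)) 0 (refl ∷ ones (upFrom (suc s) n)) ⟩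
      det (map suc (rows n)) (differences (map (h (suc l)) (upFrom s (suc n))))
        ≈⟨ det-map suc (differences (map (h (suc l)) (upFrom s (suc n)))) (rows n) ⟩
      det (rows n) (map (_∘ suc) (differences (map (h (suc l)) (upFrom s (suc n)))))
        ≈⟨ det-cong (cols s n) (rows n) ⟩
      det (rows n) (map (λ s i → gap l s * h (2 ℕ.+ l) s i) (upFrom s n))
        ≈⟨ det-scale-cols (gap l) (h (2 ℕ.+ l)) (upFrom s n) (rows n) ⟩
      prod (gap l) (upFrom s n) * det (rows n) (map (h (2 ℕ.+ l)) (upFrom s n))
        ≈⟨ *-congˡ (det-h (suc l) s n) ⟩
      gaps l s (suc n) ∎
      where
      ones : ∀ xs → All (λ c → c 0 ≈ 1#) (map (h (suc l)) xs)
      ones []       = []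
      ones (x ∷ xs) = refl ∷ ones xs
      cols : ∀ s n → Pointwise (λ c c′ → ∀ i → c i ≈ c′ i)
               (map (_∘ suc) (differences (map (h (suc l)) (upFrom s (suc n)))))
               (map (λ s i → gap l s * h (2 ℕ.+ l) s i) (upFrom s n))
      cols s zero    = []
      cols s (suc n) = h-difference l s ∷ cols (suc s) n

    prod< : ℕ → (ℕ → Carrier) → Carrier
    prod< zero    f = 1#
    prod< (suc n) f = f 0 * prod< n (f ∘ suc)

    prod<-cong : ∀ n {f g} → (∀ t → f t ≈ g t) → prod< n f ≈ prod< n g
    prod<-cong zero    e = refl
    prod<-cong (suc n) e = *-cong (e 0) (prod<-cong n (e ∘ suc))

    -- The elimination collects factors by the distance of their two indices; this regroups them by
    -- the smaller index, as in `vandermonde`.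
    gaps-first : ∀ l s n → gaps l s (suc n) ≈ prod< n (λ t → P s + ε * P (s ℕ.+ suc l ℕ.+ t)) * gaps l (suc s) n
    gaps-first l s zero    = refl
    gaps-first l s (suc n) = begin
      gap l s * G * gaps (suc l) s (suc n)
        ≈⟨ *-congˡ (gaps-first (suc l) s n) ⟩
      gap l s * G * (prod< n (λ t → P s + ε * P (s ℕ.+ suc (suc l) ℕ.+ t)) * gaps (suc l) (suc s) n)
        ≈⟨ shuffle _ _ _ _ ⟩
      gap l s * prod< n (λ t → P s + ε * P (s ℕ.+ suc (suc l) ℕ.+ t)) * (G * gaps (suc l) (suc s) n)
        ≈⟨ *-congʳ (*-cong (+-congˡ (*-congˡ (reflexive (≡.cong P (≡.sym (ℕₚ.+-identityʳ _))))))
             (prod<-cong n (λ t → +-congˡ (*-congˡ (reflexive (≡.cong P (index s l t))))))) ⟩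
      prod< (suc n) (λ t → P s + ε * P (s ℕ.+ suc l ℕ.+ t)) * gaps l (suc s) (suc n) ∎
      where
      G : Carrier
      G = prod (gap l) (upFrom (suc s) n)
      shuffle : ∀ a b c d → a * b * (c * d) ≈ a * c * (b * d)
      shuffle = solve 4 (λ a b c d → a :* b :* (c :* d) := a :* c :* (b :* d)) refl
      index : ∀ s l t → s ℕ.+ suc (suc l) ℕ.+ t ≡ s ℕ.+ suc l ℕ.+ suc t
      index = ℕ-solve

    nth-gaps : ∀ s xs → Pointwise (λ k x → P k ≈ x) (upFrom s (length xs)) xs → gaps 0 s (length xs) ≈ vandermonde xs
    nth-gaps s []       []       = refl
    nth-gaps s (x ∷ xs) (e ∷ es) = trans (gaps-first 0 s (length xs))
      (*-cong (go xs (suc s) es (λ t → ≡.cong (ℕ._+ t) (ℕₚ.+-comm s 1))) (nth-gaps (suc s) xs es))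
      where
      go : ∀ ys k → Pointwise (λ k x → P k ≈ x) (upFrom k (length ys)) ys → {f : ℕ → ℕ} → (∀ t → f t ≡ k ℕ.+ t) →
           prod< (length ys) (λ t → P s + ε * P (f t)) ≈ prod (λ y → x + ε * y) ys
      go []       k []         fe = refl
      go (y ∷ ys) k (e′ ∷ es′) fe = *-cong
        (+-cong e (*-congˡ (trans (reflexive (≡.cong P (≡.trans (fe 0) (ℕₚ.+-identityʳ k)))) e′)))
        (go ys (suc k) es′ (λ t → ≡.trans (fe (suc t)) (ℕₚ.+-suc k t)))

  nth : List Carrier → ℕ → Carrier
  nth []       _       = 0#
  nth (x ∷ xs) zero    = x
  nth (x ∷ xs) (suc t) = nth xs t

  -- Powers are the complete homogeneous polynomials in a single variable, so this is the case of
  -- windows of length one. The descending exponents in `rows` account for the absence of a sign.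
  det-vandermonde : ∀ xs → det (rows (length xs)) (map (λ x i → x ^ i) xs) ≈ vandermonde xs
  det-vandermonde xs = trans (det-cong (cols xs (upFrom 0 (length xs)) pw) (rows (length xs)))
    (trans (det-h (nth xs) 0 0 (length xs)) (nth-gaps (nth xs) 0 xs pw))
    where
    match : ∀ ys s → (∀ t → nth xs (s ℕ.+ t) ≡ nth ys t) → Pointwise (λ k x → nth xs k ≈ x) (upFrom s (length ys)) ys
    match []       s e = []
    match (y ∷ ys) s e = reflexive (≡.trans (≡.cong (nth xs) (≡.sym (ℕₚ.+-identityʳ s))) (e 0)) ∷
      match ys (suc s) (λ t → ≡.trans (≡.cong (nth xs) (≡.sym (ℕₚ.+-suc s t))) (e (suc t)))
    pw : Pointwise (λ k x → nth xs k ≈ x) (upFrom 0 (length xs)) xs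
    pw = match xs 0 (λ _ → ≡.refl)
    power : ∀ {k x} → nth xs k ≈ x → ∀ i → x ^ i ≈ h (nth xs) 1 k i
    power e zero    = refl
    power e (suc i) = trans (*-cong (sym e) (power e i)) (sym (+-identityʳ _))
    cols : ∀ ys ks → Pointwise (λ k x → nth xs k ≈ x) ks ys →
           Pointwise (λ c c′ → ∀ i → c i ≈ c′ i) (map (λ x i → x ^ i) ys) (map (h (nth xs) 1) ks)
    cols []       []       []       = []
    cols (y ∷ ys) (k ∷ ks) (e ∷ es) = power e ∷ cols ys ks es

-- Strictly increasing diagonals, and moving the cut of a rectangle

Increasing : List ℕ → Set
Increasing = Linked _<_

Increasing⇒Sorted : ∀ {p} → Increasing p → Sorted p
Increasing⇒Sorted = Linked.map ℕₚ.<⇒≤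

Empty : (ℕ → Bool) → Set
Empty v = ∀ t → v t ≡ false

between-empty : ∀ {lo hi} → ¬ lo < hi → Empty (between lo hi)
between-empty {lo} {hi} lo≮hi t with between lo hi t in e
... | false = ≡.refl
... | true  = let lo≤t , t<hi = between⇒ lo hi t (≡.subst T (≡.sym e) tt) in
              ⊥-elim (lo≮hi (ℕₚ.≤-<-trans lo≤t t<hi))

¬Increasing⇒empty : ∀ s p ps → ¬ Increasing (p ∷ ps) → Any Empty (intervals s (p ∷ ps))
¬Increasing⇒empty s p []        ¬inc = ⊥-elim (¬inc [-])
¬Increasing⇒empty s p (p′ ∷ ps) ¬inc with p ℕ.<? p′
... | yes p<p′ = there (¬Increasing⇒empty s p′ ps (λ inc → ¬inc (p<p′ ∷ inc)))
... | no p≮p′  = here (between-empty (λ lt → p≮p′ (ℕₚ.+-cancelʳ-< s p p′ lt)))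

¬Increasing⇒empty⁺ : ∀ s p ps → ¬ Increasing (p ∷ ps) → Any Empty (intervals⁺ s (p ∷ ps))
¬Increasing⇒empty⁺ s p []        ¬inc = ⊥-elim (¬inc [-])
¬Increasing⇒empty⁺ s p (p′ ∷ ps) ¬inc with p ℕ.<? p′
... | yes p<p′ = there (¬Increasing⇒empty⁺ s p′ ps (λ inc → ¬inc (p<p′ ∷ inc)))
... | no p≮p′  = here (between-empty (λ lt → p≮p′ (ℕₚ.+-cancelʳ-< s p p′ lt)))

Increasing-++ʳ : ∀ xs {ys} → Increasing (xs ++ ys) → Increasing ys
Increasing-++ʳ []       inc       = inc
Increasing-++ʳ (x ∷ []) [-]       = []
Increasing-++ʳ (x ∷ []) (_ ∷ inc) = inc
Increasing-++ʳ (x ∷ x′ ∷ xs) (_ ∷ inc) = Increasing-++ʳ (x′ ∷ xs) inc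

Increasing-upFrom-++ : ∀ s n {ys} → Increasing ys → (∀ {y ys′} → ys ≡ y ∷ ys′ → s ℕ.+ n ≤ y) → Increasing (upFrom s n ++ ys)
Increasing-upFrom-++ s zero    inc le = inc
Increasing-upFrom-++ s (suc zero) {[]}     inc le = [-]
Increasing-upFrom-++ s (suc zero) {y ∷ ys} inc le = ≡.subst (_≤ y) (ℕₚ.+-comm s 1) (le ≡.refl) ∷ inc
Increasing-upFrom-++ s (suc (suc n)) inc le = ℕₚ.≤-refl ∷
  Increasing-upFrom-++ (suc s) (suc n) inc (λ {y} e → ≡.subst (_≤ y) (ℕₚ.+-suc s (suc n)) (le e))

upFrom-++-bound : ∀ s n {y ys} → Increasing (upFrom s (suc n) ++ y ∷ ys) → s ℕ.+ suc n ≤ y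
upFrom-++-bound s zero    {y} (s<y ∷ _) = ≡.subst (_≤ y) (ℕₚ.+-comm 1 s) s<y
upFrom-++-bound s (suc n) {y} (_ ∷ inc) = ≡.subst (_≤ y) (≡.sym (ℕₚ.+-suc s (suc n))) (upFrom-++-bound (suc s) n inc)

within? : List (ℕ → Bool) → List ℕ → Bool
within? []       []       = true
within? (v ∷ vs) (t ∷ ts) = v t ∧ within? vs ts
within? _        _        = false

+1≤ᵇ : ∀ t u → (t ℕ.+ 1 ≤ᵇ u) ≡ (t <ᵇ u)
+1≤ᵇ t u rewrite ℕₚ.+-comm t 1 = ≡.refl

<ᵇ+1 : ∀ u t → (u <ᵇ t ℕ.+ 1) ≡ (u ≤ᵇ t)
<ᵇ+1 u t rewrite ℕₚ.+-comm t 1 with u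
... | zero  = ≡.refl
... | suc u = ≡.refl

-- Interlacing read from the other diagonal: t < u ≤ t′ says the same as u lying weakly below t′ and
-- strictly above t, so s = 0 becomes s = 1. The ghost in front leaves only a lower bound for the
-- first entry.
within-transpose : ∀ g y t x → length x ≡ length y →
  within? (intervals⁺ 0 (g ∷ y)) (t ∷ x) ≡ (g ≤ᵇ t) ∧ within? (intervals 1 (t ∷ x)) y
within-transpose g []      t []       len rewrite ℕₚ.+-identityʳ g = ≡.refl
within-transpose g (u ∷ y) t (t′ ∷ x) len
  rewrite ℕₚ.+-identityʳ g | ℕₚ.+-identityʳ u | within-transpose u y t′ x (ℕₚ.suc-injective len)
        | +1≤ᵇ t u | <ᵇ+1 u t′
        = ≡.trans (∧-assoc (g ≤ᵇ t) (t <ᵇ u) _) (≡.cong ((g ≤ᵇ t) ∧_) (≡.sym (∧-assoc (t <ᵇ u) (u ≤ᵇ t′) _)))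

length-intervals : ∀ s t x → length (intervals s (t ∷ x)) ≡ length x
length-intervals s t []       = ≡.refl
length-intervals s t (t′ ∷ x) = ≡.cong suc (length-intervals s t′ x)

length-intervals⁺ : ∀ s x → length (intervals⁺ s x) ≡ length x
length-intervals⁺ s []           = ≡.refl
length-intervals⁺ s (t ∷ [])     = ≡.refl
length-intervals⁺ s (t ∷ t′ ∷ x) = ≡.cong suc (length-intervals⁺ s (t′ ∷ x))

-- Weights of successive diagonals: `M` throughout, except `x` on the diagonal number c, counted
-- from one. For the rectangle below this is the first diagonal of full length.
marked : ℕ → ℕ → ℕ → ℕ → ℕ
marked M x zero          i       = M
marked M x (suc c)       (suc i) = marked M x c i
marked M x (suc zero)    zero    = x
marked M x (suc (suc c)) zero    = M

-- The exponent that ghosts contribute on the r diagonals up to the marked one. Each diagonal has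
-- one ghost fewer than the one before, and the marked one has g.
ghostWeight : ℕ → ℕ → ℕ → ℕ → ℕ
ghostWeight M x zero    g = 0
ghostWeight M x (suc r) g = marked M x (suc r) 0 ℕ.* sum (upFrom 0 (g ℕ.+ r)) ℕ.+ ghostWeight M x r g

module Evaluation (R : CommutativeRing 0ℓ 0ℓ) (q : CommutativeRing.Carrier R) (W : ℕ) where
  open Interlacing R q W public
  open Vandermonde R public

  ΣI-empty : ∀ vs f → Any Empty vs → ΣI vs f ≈ 0#
  ΣI-empty (v ∷ vs) f (here emp)  = trans (Σ<-cong W (λ t → trans (*-congʳ (reflexive (≡.cong ind (emp t)))) (zeroˡ _))) (Σ<-0 W)
  ΣI-empty (v ∷ vs) f (there any) = trans (Σ<-cong W (λ t → trans (*-congˡ (ΣI-empty vs (f ∘ (t ∷_)) any)) (zeroʳ _))) (Σ<-0 W)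

  -- Two neighbours without room between them give an empty interval. Sums over diagonals are
  -- thereby restricted to strictly increasing ones.
  cutSum-¬Increasing : ∀ s m e A d p → length p ≡ A → ¬ Increasing p → cutSum s m e A d p ≈ 0#
  cutSum-¬Increasing s m e zero    d       []      len ¬inc = ⊥-elim (¬inc [])
  cutSum-¬Increasing s m e (suc A) zero    (p₀ ∷ p) len ¬inc = ΣI-empty (intervals s (p₀ ∷ p)) _ (¬Increasing⇒empty s p₀ p ¬inc)
  cutSum-¬Increasing s m e (suc A) (suc d) (p₀ ∷ p) len ¬inc = ΣI-empty (intervals⁺ s (p₀ ∷ p)) _ (¬Increasing⇒empty⁺ s p₀ p ¬inc)

  ΣL : ℕ → (List ℕ → Carrier) → Carrier
  ΣL zero    f = f []
  ΣL (suc k) f = Σ< W (λ t → ΣL k (λ ts → f (t ∷ ts)))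

  ΣL-cong : ∀ k {f g} → (∀ x → length x ≡ k → f x ≈ g x) → ΣL k f ≈ ΣL k g
  ΣL-cong zero    e = e [] ≡.refl
  ΣL-cong (suc k) e = Σ<-cong W (λ t → ΣL-cong k (λ x len → e (t ∷ x) (≡.cong suc len)))

  ΣL-* : ∀ k r f → ΣL k (λ x → r * f x) ≈ r * ΣL k f
  ΣL-* zero    r f = refl
  ΣL-* (suc k) r f = trans (Σ<-cong W (λ t → ΣL-* k r (f ∘ (t ∷_)))) (Σ<-* W r _)

  ΣL-Σ< : ∀ k n (f : List ℕ → ℕ → Carrier) → ΣL k (λ x → Σ< n (f x)) ≈ Σ< n (λ t → ΣL k (λ x → f x t))
  ΣL-Σ< zero    n f = refl
  ΣL-Σ< (suc k) n f = trans (Σ<-cong W (λ t → ΣL-Σ< k n (f ∘ (t ∷_)))) (Σ<-swap W n _)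

  ΣL-swap : ∀ k k′ (f : List ℕ → List ℕ → Carrier) → ΣL k (λ x → ΣL k′ (f x)) ≈ ΣL k′ (λ y → ΣL k (λ x → f x y))
  ΣL-swap k zero     f = refl
  ΣL-swap k (suc k′) f = trans (ΣL-Σ< k W _) (Σ<-cong W (λ t → ΣL-swap k k′ (λ x y → f x (t ∷ y))))

  -- Moves the interlacing condition into an indicator, so that the sums over two diagonals range
  -- independently and can be exchanged.
  ΣI-ΣL : ∀ vs f → ΣI vs f ≈ ΣL (length vs) (λ x → ind (within? vs x) * f x)
  ΣI-ΣL []       f = sym (*-identityˡ _)
  ΣI-ΣL (v ∷ vs) f = Σ<-cong W (λ t → trans (*-congˡ (ΣI-ΣL vs (f ∘ (t ∷_))))
    (trans (sym (ΣL-* (length vs) (ind (v t)) _))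
      (ΣL-cong (length vs) (λ x _ → trans (sym (*-assoc _ _ _)) (*-congʳ (sym (ind-∧ (v t) _)))))))

  Σ<-single : ∀ n s (f : ℕ → Carrier) → s < n → Σ< n (λ t → ind (between (s ℕ.+ 0) (suc s ℕ.+ 0) t) * f t) ≈ f s
  Σ<-single n s f s<n rewrite ℕₚ.+-identityʳ s = go n s f s<n
    where
    go : ∀ n s (f : ℕ → Carrier) → s < n → Σ< n (λ t → ind (between s (suc s) t) * f t) ≈ f s
    go (suc n) zero    f s<n       = trans
      (+-cong (*-identityˡ _) (trans (Σ<-cong n (λ t → zeroˡ _)) (Σ<-0 n))) (+-identityʳ _)
    go (suc n) (suc s) f (s≤s s<n) = trans (+-cong (zeroˡ _)
      (Σ<-cong n (λ t → *-congʳ (reflexive (≡.cong (λ b → ind (b ∧ (t <ᵇ suc s))) (≤ᵇ-suc s t))))))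
      (trans (+-identityˡ _) (go n s (f ∘ suc) s<n))

  -- Consecutive ghosts leave a single value between them, so the next diagonal repeats all of them
  -- but the last, which survives only as a lower bound. The bound by `W` keeps the forced values
  -- inside the range of summation.
  forced : ∀ s g y F → s ℕ.+ g ≤ W →
    ΣI (intervals⁺ 0 (upFrom s (suc g) ++ y)) F ≈ ΣI (intervals⁺ 0 ((s ℕ.+ g) ∷ y)) (λ x → F (upFrom s g ++ x))
  forced s zero    y F le = reflexive (≡.cong (λ s → ΣI (intervals⁺ 0 (s ∷ y)) F) (≡.sym (ℕₚ.+-identityʳ s)))
  forced s (suc g) y F le = trans
    (Σ<-single W s (λ t → ΣI (intervals⁺ 0 (upFrom (suc s) (suc g) ++ y)) (F ∘ (t ∷_)))
      (ℕₚ.<-≤-trans (ℕₚ.m<m+n s (s≤s z≤n)) le))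
    (trans (forced (suc s) g y (F ∘ (s ∷_)) (≡.subst (_≤ W) (ℕₚ.+-suc s g) le))
      (reflexive (≡.cong (λ k → ΣI (intervals⁺ 0 (k ∷ y)) (λ x → F (s ∷ upFrom (suc s) g ++ x))) (≡.sym (ℕₚ.+-suc s g)))))

  -- The part of the rectangle that the moving cut has left behind: its diagonals shrink away from
  -- `y` and are read backwards, hence s = 1.
  triangle : ℕ → ℕ → List ℕ → Carrier
  triangle M k y = cutSum 1 0 (λ _ → M) k 0 y

  transfer : ∀ M k g F → g ≤ W → (∀ t x → length x ≡ k → t < g → F (upFrom 0 g ++ t ∷ x) ≈ 0#) →
    ΣL k (λ y → q ^ (M ℕ.* sum y) * (triangle M k y * ΣI (intervals⁺ 0 (upFrom 0 (suc g) ++ y)) F)) ≈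
    ΣL (suc k) (λ x → triangle M (suc k) x * F (upFrom 0 g ++ x))
  transfer M k g F g≤W zeros = begin
    ΣL k (λ y → q ^ (M ℕ.* sum y) * (triangle M k y * ΣI (intervals⁺ 0 (upFrom 0 (suc g) ++ y)) F))
      ≈⟨ ΣL-cong k (λ y len → trans (*-congˡ (*-congˡ (trans (forced 0 g y F g≤W) (ΣI-ΣL (intervals⁺ 0 (g ∷ y)) H)))) (trans (sym (*-assoc _ _ _))
           (trans (sym (ΣL-* (length (intervals⁺ 0 (g ∷ y))) (α y) _))
             (reflexive (≡.cong (λ n → ΣL n (λ x → α y * (ind (within? (intervals⁺ 0 (g ∷ y)) x) * H x)))
               (≡.trans (length-intervals⁺ 0 (g ∷ y)) (≡.cong suc len))))))) ⟩
    ΣL k (λ y → ΣL (suc k) (λ x → α y * (ind (within? (intervals⁺ 0 (g ∷ y)) x) * H x)))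
      ≈⟨ ΣL-swap k (suc k) (λ y x → α y * (ind (within? (intervals⁺ 0 (g ∷ y)) x) * H x)) ⟩
    ΣL (suc k) (λ x → ΣL k (λ y → α y * (ind (within? (intervals⁺ 0 (g ∷ y)) x) * H x)))
      ≈⟨ ΣL-cong (suc k) inner ⟩
    ΣL (suc k) (λ x → triangle M (suc k) x * H x) ∎
    where
    α : List ℕ → Carrier
    α y = q ^ (M ℕ.* sum y) * triangle M k y
    H : List ℕ → Carrier
    H x = F (upFrom 0 g ++ x)
    drop : ∀ t x → length x ≡ k → H (t ∷ x) * ind (g ≤ᵇ t) ≈ H (t ∷ x)
    drop t x len with g ≤ᵇ t in e
    ... | true  = *-identityʳ _
    ... | false = trans (zeroʳ _) (sym (zeros t x len (ℕₚ.≰⇒> λ g≤t → ≡.subst T e (ℕₚ.≤⇒≤ᵇ g≤t))))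
    inner : ∀ x → length x ≡ suc k → ΣL k (λ y → α y * (ind (within? (intervals⁺ 0 (g ∷ y)) x) * H x)) ≈ triangle M (suc k) x * H x
    inner (t ∷ x) len = begin
      ΣL k (λ y → α y * (ind (within? (intervals⁺ 0 (g ∷ y)) (t ∷ x)) * H (t ∷ x)))
        ≈⟨ ΣL-cong k (λ y len′ → trans (*-congˡ (*-congʳ (trans
             (reflexive (≡.cong ind (within-transpose g y t x (≡.trans (ℕₚ.suc-injective len) (≡.sym len′)))))
             (ind-∧ (g ≤ᵇ t) _)))) (shuffle (α y) _ _ _)) ⟩
      ΣL k (λ y → (H (t ∷ x) * ind (g ≤ᵇ t)) * (ind (within? (intervals 1 (t ∷ x)) y) * α y))
        ≈⟨ trans (ΣL-* k _ _) (*-cong (drop t x (ℕₚ.suc-injective len))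
             (reflexive (≡.cong (λ n → ΣL n (λ y → ind (within? (intervals 1 (t ∷ x)) y) * α y)) (≡.sym (≡.trans (length-intervals 1 t x) (ℕₚ.suc-injective len)))))) ⟩
      H (t ∷ x) * ΣL (length (intervals 1 (t ∷ x))) (λ y → ind (within? (intervals 1 (t ∷ x)) y) * α y)
        ≈⟨ trans (*-congˡ (sym (ΣI-ΣL (intervals 1 (t ∷ x)) α))) (*-comm _ _) ⟩
      triangle M (suc k) (t ∷ x) * H (t ∷ x) ∎
      where
      shuffle : ∀ a i j h → a * (i * j * h) ≈ (h * i) * (j * a)
      shuffle = solve 4 (λ a i j h → a :* (i :* j :* h) := (h :* i) :* (j :* a)) refl

  -- The rectangle cut along a diagonal of weight `v` with `g` ghosts and `k` free entries `y`:
  -- behind it the triangle, ahead of it a `cutSum` over `N` rows, the last of which still has `r`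
  -- steps to go.
  stage : ℕ → ℕ → ℕ → ℕ → (ℕ → ℕ) → ℕ → ℕ → Carrier
  stage M N k r e v g = ΣL k (λ y → q ^ (v ℕ.* sum y) * (triangle M k y * cutSum 0 0 e N r (upFrom 0 g ++ y)))

  -- Moves the cut by one diagonal. The ghosts of the new diagonal have fixed values, so their
  -- weight leaves the sum as a power of q; an entry below the last ghost makes that diagonal fail
  -- to increase.
  stage-suc : ∀ M N k r e g → N ≡ suc g ℕ.+ k → g ≤ W →
    stage M N k (suc r) e M (suc g) ≈ q ^ (e 0 ℕ.* sum (upFrom 0 g)) * stage M N (suc k) r (e ∘ suc) (e 0) g
  stage-suc M N k r e g ≡.refl g≤W = trans (transfer M k g F g≤W zeros)
    (trans (ΣL-cong (suc k) (λ x _ → trans (*-congˡ (*-congʳ (split x))) (shuffle (triangle M (suc k) x) _ _ (cutSum 0 0 (e ∘ suc) N r (upFrom 0 g ++ x)))))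
      (ΣL-* (suc k) _ (λ x → q ^ (e 0 ℕ.* sum x) * (triangle M (suc k) x * cutSum 0 0 (e ∘ suc) N r (upFrom 0 g ++ x)))))
    where
    F : List ℕ → Carrier
    F x = q ^ (e 0 ℕ.* sum x) * cutSum 0 0 (e ∘ suc) N r x
    zeros : ∀ t x → length x ≡ k → t < g → F (upFrom 0 g ++ t ∷ x) ≈ 0#
    zeros t x len t<g = trans (*-congˡ (cutSum-¬Increasing 0 0 (e ∘ suc) N r (upFrom 0 g ++ t ∷ x)
      (≡.trans (length-++ (upFrom 0 g)) (≡.trans (≡.cong₂ ℕ._+_ (length-upFrom 0 g) (≡.cong suc len)) (ℕₚ.+-suc g k)))
      (no-inc g t<g))) (zeroʳ _)
      where
      no-inc : ∀ g → t < g → ¬ Increasing (upFrom 0 g ++ t ∷ x)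
      no-inc (suc g) t<g inc = ℕₚ.<⇒≱ t<g (upFrom-++-bound 0 g inc)
    split : ∀ x → q ^ (e 0 ℕ.* sum (upFrom 0 g ++ x)) ≈ q ^ (e 0 ℕ.* sum (upFrom 0 g)) * q ^ (e 0 ℕ.* sum x)
    split x = trans (^-congʳ q (≡.trans (≡.cong (e 0 ℕ.*_) (sum-++ (upFrom 0 g) x)) (ℕₚ.*-distribˡ-+ (e 0) (sum (upFrom 0 g)) (sum x)))) (^-homo-* q (e 0 ℕ.* sum (upFrom 0 g)) (e 0 ℕ.* sum x))
    shuffle : ∀ l a b u → l * (a * b * u) ≈ a * (b * (l * u))
    shuffle = solve 4 (λ l a b u → l :* (a :* b :* u) := a :* (b :* (l :* u))) refl

  private
    lastWeight : ℕ → ℕ → ℕ → ℕ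
    lastWeight M x zero    = x
    lastWeight M x (suc r) = M

    marked-0 : ∀ M x r → marked M x (suc r) 0 ≡ lastWeight M x r
    marked-0 M x zero    = ≡.refl
    marked-0 M x (suc r) = ≡.refl

  stages : ∀ M x N k r g → N ≡ (g ℕ.+ r) ℕ.+ k → g ℕ.+ r ≤ W →
    stage M N k r (marked M x r) (lastWeight M x r) (g ℕ.+ r) ≈
    q ^ ghostWeight M x r g * stage M N (k ℕ.+ r) 0 (λ _ → M) x g
  stages M x N k zero    g Ne le rewrite ℕₚ.+-identityʳ g | ℕₚ.+-identityʳ k = sym (*-identityˡ _)
  stages M x N k (suc r) g Ne le rewrite ℕₚ.+-suc g r | ℕₚ.+-suc k r = begin
    stage M N k (suc r) (marked M x (suc r)) M (suc (g ℕ.+ r))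
      ≈⟨ stage-suc M N k r (marked M x (suc r)) (g ℕ.+ r) Ne (ℕₚ.≤-trans (ℕₚ.n≤1+n _) le) ⟩
    q ^ w * stage M N (suc k) r (marked M x r) (marked M x (suc r) 0) (g ℕ.+ r)
      ≈⟨ *-congˡ (trans (reflexive (≡.cong (λ v → stage M N (suc k) r (marked M x r) v (g ℕ.+ r)) (marked-0 M x r)))
           (stages M x N (suc k) r g (≡.trans Ne (≡.sym (ℕₚ.+-suc (g ℕ.+ r) k))) (ℕₚ.≤-trans (ℕₚ.n≤1+n _) le))) ⟩
    q ^ w * (q ^ ghostWeight M x r g * stage M N (suc k ℕ.+ r) 0 (λ _ → M) x g)
      ≈⟨ trans (sym (*-assoc _ _ _)) (*-congʳ (sym (^-homo-* q w _))) ⟩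
    q ^ (w ℕ.+ ghostWeight M x r g) * stage M N (suc k ℕ.+ r) 0 (λ _ → M) x g ∎
    where
    w : ℕ
    w = marked M x (suc r) 0 ℕ.* sum (upFrom 0 (g ℕ.+ r))

  -- A rectangle with n + c rows and c columns, cut along its first or along its last full diagonal.
  rectangle : ∀ M x n c → n ℕ.+ c ≤ W →
    cutSum 0 0 (marked M x c) (n ℕ.+ c) c (upFrom 0 (n ℕ.+ c)) ≈
    q ^ ghostWeight M x c n *
    ΣL c (λ y → q ^ (x ℕ.* sum y) * (triangle M c y * cutSum 0 0 (λ _ → M) (n ℕ.+ c) 0 (upFrom 0 n ++ y)))
  rectangle M x n c le = trans (sym stage₀) (stages M x (n ℕ.+ c) 0 c n (≡.sym (ℕₚ.+-identityʳ _)) le)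
    where
    stage₀ : stage M (n ℕ.+ c) 0 c (marked M x c) (lastWeight M x c) (n ℕ.+ c) ≈
            cutSum 0 0 (marked M x c) (n ℕ.+ c) c (upFrom 0 (n ℕ.+ c))
    stage₀ = trans (*-cong (^-congʳ q (ℕₚ.*-zeroʳ (lastWeight M x c))) (*-identityˡ _)) (trans (*-identityˡ _)
      (reflexive (≡.cong (cutSum 0 0 (marked M x c) (n ℕ.+ c) c) (++-identityʳ _))))

-- The sum over the main diagonal as a product

-- The smaller member summed over all pairs from s, ..., s + k - 1: the power that comes out of the
-- factors of a Vandermonde product.
vexp : ℕ → ℕ → ℕ
vexp s zero    = 0
vexp s (suc k) = s ℕ.* k ℕ.+ vexp (suc s) k

twistExp : ℕ → ℕ → ℕ
twistExp w zero    = 0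
twistExp w (suc D) = w ℕ.* suc D ℕ.+ twistExp w D

-- The total weight of the first c diagonals under `marked M x c`, which is the exponent of the
-- shortest row of the rectangle.
markedBase : ℕ → ℕ → ℕ → ℕ
markedBase M x zero    = 0
markedBase M x (suc c) = x ℕ.+ M ℕ.* c

-- The powers of q on the two sides of `diagonalSum-product`. On the left they come from the ghosts
-- of the rectangle, the Vandermonde product of the pooled ghosts and the strictness inside the
-- triangle. On the right they come from the strictness of the lower side, the ghosts weighted by d
-- and e, the least exponent of the recut rectangle, and three Vandermonde products.
leftExponent rightExponent : (a b c d e m : ℕ) → ℕ
leftExponent a b c d e m = ghostWeight (suc m) (suc (d ℕ.+ e)) c (b ℕ.+ a) ℕ.+ suc m ℕ.* vexp 0 (b ℕ.+ a) ℕ.+ sum (map (twistExp (suc m)) (rows c))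
rightExponent a b c d e m =
  sum (map (twistExp 1) (ends m (b ℕ.+ c) e)) ℕ.+ (d ℕ.* sum (upFrom b a) ℕ.+ e ℕ.* sum (upFrom 0 b))
  ℕ.+ suc m ℕ.* vexp b a ℕ.+ suc m ℕ.* vexp 0 b
  ℕ.+ markedBase (suc m) (suc (d ℕ.+ e)) c ℕ.* sum (upFrom 0 (b ℕ.+ a ℕ.+ c)) ℕ.+ suc m ℕ.* vexp 0 (b ℕ.+ a ℕ.+ c)

module Product (R : CommutativeRing 0ℓ 0ℓ) (q : CommutativeRing.Carrier R) (W : ℕ) where
  open Evaluation R q W public

  cross : List Carrier → List Carrier → Carrier
  cross xs ys = prod (λ x → prod (λ y → x + ε * y) ys) xs

  vandermonde-++ : ∀ xs ys → vandermonde (xs ++ ys) ≈ vandermonde xs * vandermonde ys * cross xs ys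
  vandermonde-++ []       ys = sym (trans (*-identityʳ _) (*-identityˡ _))
  vandermonde-++ (x ∷ xs) ys = trans (*-cong (prod-++ _ xs ys) (vandermonde-++ xs ys)) (shuffle _ _ _ _ _)
    where
    shuffle : ∀ a b c d e → a * b * (c * d * e) ≈ a * c * d * (b * e)
    shuffle = MonoidSolver.solve 5 (λ a b c d e → ((a ⊕ b) ⊕ ((c ⊕ d) ⊕ e)) ⊜ (((a ⊕ c) ⊕ d) ⊕ (b ⊕ e))) refl

  vdm : ℕ → List ℕ → Carrier
  vdm M ps = vandermonde (map (λ p → q ^ (M ℕ.* p)) ps)

  -- The cross factors are additive in the first list, so U and L ghosts can be pooled on one side.
  vdm-pool : ∀ M xs zs y → vdm M (xs ++ y) * vdm M (zs ++ y) * vdm M (zs ++ xs) ≈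
                           vdm M xs * vdm M zs * (vdm M ((zs ++ xs) ++ y) * vdm M y)
  vdm-pool M xs zs y = begin
    vdm M (xs ++ y) * vdm M (zs ++ y) * vdm M (zs ++ xs)
      ≈⟨ *-congʳ (*-cong (vdm-++ xs y) (vdm-++ zs y)) ⟩
    vdm M xs * vdm M y * X xs y * (vdm M zs * vdm M y * X zs y) * vdm M (zs ++ xs)
      ≈⟨ shuffle _ _ _ _ _ _ ⟩
    vdm M xs * vdm M zs * (vdm M (zs ++ xs) * vdm M y * (X zs y * X xs y) * vdm M y)
      ≈⟨ *-congˡ (*-congʳ (trans (*-congˡ (sym X-++)) (sym (vdm-++ (zs ++ xs) y)))) ⟩
    vdm M xs * vdm M zs * (vdm M ((zs ++ xs) ++ y) * vdm M y) ∎
    where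
    Q : ℕ → Carrier
    Q p = q ^ (M ℕ.* p)
    X : List ℕ → List ℕ → Carrier
    X u v = cross (map Q u) (map Q v)
    vdm-++ : ∀ u v → vdm M (u ++ v) ≈ vdm M u * vdm M v * X u v
    vdm-++ u v = trans (reflexive (≡.cong vandermonde (map-++ Q u v))) (vandermonde-++ (map Q u) (map Q v))
    X-++ : X (zs ++ xs) y ≈ X zs y * X xs y
    X-++ = trans (reflexive (≡.cong (λ l → cross l (map Q y)) (map-++ Q zs xs))) (prod-++ _ (map Q zs) (map Q xs))
    shuffle : ∀ a v x b z w → a * v * x * (b * v * z) * w ≈ a * b * (w * v * (z * x) * v)
    shuffle = MonoidSolver.solve 6 (λ a v x b z w → ((((a ⊕ v) ⊕ x) ⊕ ((b ⊕ v) ⊕ z)) ⊕ w) ⊜ ((a ⊕ b) ⊕ (((w ⊕ v) ⊕ (z ⊕ x)) ⊕ v))) refl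

  -- Exponents in arithmetic progression split the column of p into q^(D p) and the powers of q^(M
  -- p).
  det-vdm : ∀ D M ps → det (map (λ i → D ℕ.+ M ℕ.* i) (rows (length ps))) (map ev ps) ≈ q ^ (D ℕ.* sum ps) * vdm M ps
  det-vdm D M ps = begin
    det (map E (rows (length ps))) (map ev ps)             ≈⟨ det-map E (map ev ps) (rows (length ps)) ⟩
    det (rows (length ps)) (map (_∘ E) (map ev ps))        ≈⟨ det-cong (cols ps) (rows (length ps)) ⟩
    det (rows (length ps)) (map (λ p i → q ^ (D ℕ.* p) * (q ^ (M ℕ.* p)) ^ i) ps)
      ≈⟨ det-scale-cols (λ p → q ^ (D ℕ.* p)) (λ p i → (q ^ (M ℕ.* p)) ^ i) ps (rows (length ps)) ⟩
    prod (λ p → q ^ (D ℕ.* p)) ps * det (rows (length ps)) (map (λ p i → (q ^ (M ℕ.* p)) ^ i) ps)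
      ≈⟨ *-cong (prod-^-sum D ps) (trans (reflexive (≡.cong₂ (λ n cs → det (rows n) cs) (≡.sym (length-map _ ps)) (map-∘ ps)))
           (det-vandermonde (map (λ p → q ^ (M ℕ.* p)) ps))) ⟩
    q ^ (D ℕ.* sum ps) * vdm M ps ∎
    where
    E : ℕ → ℕ
    E i = D ℕ.+ M ℕ.* i
    arith : ∀ D M i p → (D ℕ.+ M ℕ.* i) ℕ.* p ≡ D ℕ.* p ℕ.+ M ℕ.* p ℕ.* i
    arith = ℕ-solve
    cols : ∀ ps → Pointwise (λ c c′ → ∀ i → c i ≈ c′ i) (map (_∘ E) (map ev ps)) (map (λ p i → q ^ (D ℕ.* p) * (q ^ (M ℕ.* p)) ^ i) ps)
    cols []       = []
    cols (p ∷ ps) = (λ i → trans (^-congʳ q (arith D M i p)) (trans (^-homo-* q (D ℕ.* p) (M ℕ.* p ℕ.* i))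
      (*-congˡ (sym (^-assocʳ q (M ℕ.* p) i))))) ∷ cols ps

  qfac : ℕ → ℕ → Carrier
  qfac M zero    = 1#
  qfac M (suc i) = (1# + ε * q ^ (M ℕ.* suc i)) * qfac M i

  superfac : ℕ → ℕ → Carrier
  superfac M n = prod (qfac M) (rows n)

  esum-const : ∀ w D → esum (λ _ → w) D ≡ w ℕ.* D
  esum-const w zero    = ≡.sym (ℕₚ.*-zeroʳ w)
  esum-const w (suc D) = ≡.trans (≡.cong (w ℕ.+_) (esum-const w D)) (≡.sym (ℕₚ.*-suc w D))

  rowDenominator-const : ∀ w D → rowDenominator (λ _ → w) D ≈ qfac w D
  rowDenominator-const w zero    = refl
  rowDenominator-const w (suc D) = *-cong (+-congˡ (*-congˡ (^-congʳ q (esum-const w (suc D))))) (rowDenominator-const w D)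

  rowTwist-0 : ∀ e Ds → prod (rowTwist 0 e) Ds ≈ 1#
  rowTwist-0 e Ds = trans (prod-cong Ds (go e)) (ones Ds)
    where
    go : ∀ e D → rowTwist 0 e D ≈ 1#
    go e zero    = refl
    go e (suc D) = trans (*-cong (^-congʳ q (ℕₚ.*-zeroʳ (esum e (suc D)))) (go (e ∘ suc) D)) (*-identityˡ _)
    ones : (Ds : List ℕ) → prod (λ _ → 1#) Ds ≈ 1#
    ones []       = refl
    ones (_ ∷ Ds) = trans (*-identityˡ _) (ones Ds)

  rowTwist-1 : ∀ w Ds → prod (rowTwist 1 (λ _ → w)) Ds ≈ q ^ sum (map (twistExp w) Ds)
  rowTwist-1 w []       = refl
  rowTwist-1 w (D ∷ Ds) = trans (*-cong (go D) (rowTwist-1 w Ds)) (sym (^-homo-* q (twistExp w D) _))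
    where
    go : ∀ D → rowTwist 1 (λ _ → w) D ≈ q ^ twistExp w D
    go zero    = refl
    go (suc D) = trans (*-cong (^-congʳ q (≡.trans (ℕₚ.*-identityʳ _) (esum-const w (suc D)))) (go D))
      (sym (^-homo-* q (w ℕ.* suc D) (twistExp w D)))

  -- Of the c + i positions of a row, those up to the marked diagonal see `x` exactly once in their
  -- partial sums; the last i see only `M` and form a `qfac`.
  marked-rest : ∀ M x c i → rowDenominator (marked M x c) (c ℕ.+ i) ≈
                prod (λ t → 1# + ε * q ^ (x ℕ.+ M ℕ.* (t ℕ.+ i))) (rows c) * qfac M i
  marked-base : ∀ M x c i → esum (marked M x c) (c ℕ.+ i) ≡ markedBase M x c ℕ.+ M ℕ.* i
  marked-base M x zero    i = esum-const M i
  marked-base M x (suc zero) i = ≡.trans (≡.cong (x ℕ.+_) (esum-const M i)) (≡.cong (ℕ._+ M ℕ.* i) (≡.sym (≡.trans (≡.cong (x ℕ.+_) (ℕₚ.*-zeroʳ M)) (ℕₚ.+-identityʳ x))))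
  marked-base M x (suc (suc c)) i = ≡.trans (≡.cong (M ℕ.+_) (marked-base M x (suc c) i)) (arith M x c i)
    where
    arith : ∀ M x c i → M ℕ.+ (x ℕ.+ M ℕ.* c ℕ.+ M ℕ.* i) ≡ x ℕ.+ M ℕ.* suc c ℕ.+ M ℕ.* i
    arith = ℕ-solve
  marked-rest M x zero    i = trans (rowDenominator-const M i) (sym (*-identityˡ _))
  marked-rest M x (suc c) i = begin
    (1# + ε * q ^ esum (marked M x (suc c)) (suc c ℕ.+ i)) * rowDenominator (marked M x c) (c ℕ.+ i)
      ≈⟨ *-cong (+-congˡ (*-congˡ (^-congʳ q (≡.trans (marked-base M x (suc c) i) (arith M x c i))))) (marked-rest M x c i) ⟩
    (1# + ε * q ^ (x ℕ.+ M ℕ.* (c ℕ.+ i))) * (prod f (rows c) * qfac M i)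
      ≈⟨ *-assoc _ _ _ ⟨
    prod f (c ∷ rows c) * qfac M i
      ≈⟨ *-congʳ (reflexive (≡.cong (prod f) (≡.sym (rows-suc c)))) ⟩
    prod f (rows (suc c)) * qfac M i ∎
    where
    f : ℕ → Carrier
    f t = 1# + ε * q ^ (x ℕ.+ M ℕ.* (t ℕ.+ i))
    arith : ∀ M x c i → x ℕ.+ M ℕ.* c ℕ.+ M ℕ.* i ≡ x ℕ.+ M ℕ.* (c ℕ.+ i)
    arith = ℕ-solve

  -- Each difference releases its smaller power of q. These exponents add up to `vexp`, and what is
  -- left depends only on differences of indices.
  vdm-upFrom : ∀ M s k → vdm M (upFrom s k) ≈ q ^ (M ℕ.* vexp s k) * superfac M k
  vdm-upFrom M s zero    = sym (trans (*-identityʳ _) (^-congʳ q (ℕₚ.*-zeroʳ M)))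
  vdm-upFrom M s (suc k) = begin
    prod (λ y → Q s + ε * y) (map Q (upFrom (suc s) k)) * vdm M (upFrom (suc s) k)
      ≈⟨ *-cong (trans (reflexive (prod-map _ Q (upFrom (suc s) k))) (first k (suc s) 0 (≡.sym (ℕₚ.+-identityʳ (suc s))))) (vdm-upFrom M (suc s) k) ⟩
    q ^ (M ℕ.* s ℕ.* k) * (1# * tail 0 k) * (q ^ (M ℕ.* vexp (suc s) k) * superfac M k)
      ≈⟨ shuffle _ _ _ _ ⟩
    q ^ (M ℕ.* s ℕ.* k) * q ^ (M ℕ.* vexp (suc s) k) * (tail 0 k * superfac M k)
      ≈⟨ *-cong (trans (sym (^-homo-* q (M ℕ.* s ℕ.* k) _)) (^-congʳ q (arith M s k (vexp (suc s) k))))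
           (*-congʳ (trans (sym (*-identityʳ _)) (tail-qfac 0 k))) ⟩
    q ^ (M ℕ.* vexp s (suc k)) * (qfac M k * superfac M k)
      ≈⟨ *-congˡ (reflexive (≡.cong (prod (qfac M)) (≡.sym (rows-suc k)))) ⟩
    q ^ (M ℕ.* vexp s (suc k)) * superfac M (suc k) ∎
    where
    Q : ℕ → Carrier
    Q p = q ^ (M ℕ.* p)
    tail : ℕ → ℕ → Carrier
    tail j zero    = 1#
    tail j (suc k) = (1# + ε * q ^ (M ℕ.* suc j)) * tail (suc j) k
    tail-qfac : ∀ j k → tail j k * qfac M j ≈ qfac M (j ℕ.+ k)
    tail-qfac j zero    = trans (*-identityˡ _) (reflexive (≡.cong (qfac M) (≡.sym (ℕₚ.+-identityʳ j))))
    tail-qfac j (suc k) = trans (shuffle′ _ _ _) (trans (tail-qfac (suc j) k) (reflexive (≡.cong (qfac M) (≡.sym (ℕₚ.+-suc j k)))))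
      where
      shuffle′ : ∀ a b c → a * b * c ≈ b * (a * c)
      shuffle′ = MonoidSolver.solve 3 (λ a b c → ((a ⊕ b) ⊕ c) ⊜ (b ⊕ (a ⊕ c))) refl
    arith : ∀ M s k v → M ℕ.* s ℕ.* k ℕ.+ M ℕ.* v ≡ M ℕ.* (s ℕ.* k ℕ.+ v)
    arith = ℕ-solve
    shuffle : ∀ a b c d → a * (1# * b) * (c * d) ≈ a * c * (b * d)
    shuffle = MonoidSolver.solve 4 (λ a b c d → ((a ⊕ (MonoidSolver.id ⊕ b)) ⊕ (c ⊕ d)) ⊜ ((a ⊕ c) ⊕ (b ⊕ d))) refl
    index : ∀ M s j → M ℕ.* (suc s ℕ.+ j) ≡ M ℕ.* s ℕ.+ M ℕ.* suc j
    index = ℕ-solve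
    first : ∀ k r j → r ≡ suc s ℕ.+ j → prod (λ r → Q s + ε * Q r) (upFrom r k) ≈ q ^ (M ℕ.* s ℕ.* k) * (1# * tail j k)
    first zero    r j e = sym (trans (*-congʳ (^-congʳ q (ℕₚ.*-zeroʳ (M ℕ.* s)))) (trans (*-identityˡ _) (*-identityˡ _)))
    first (suc k) r j ≡.refl = begin
      (Q s + ε * Q (suc s ℕ.+ j)) * prod (λ r → Q s + ε * Q r) (upFrom (suc (suc s ℕ.+ j)) k)
        ≈⟨ *-cong (trans (+-congˡ (*-congˡ (trans (^-congʳ q (index M s j)) (^-homo-* q (M ℕ.* s) _)))) (factor ε (Q s) _))
             (first k _ (suc j) (≡.sym (ℕₚ.+-suc (suc s) j))) ⟩
      Q s * (1# + ε * q ^ (M ℕ.* suc j)) * (q ^ (M ℕ.* s ℕ.* k) * (1# * tail (suc j) k))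
        ≈⟨ shuffle₂ _ _ _ _ ⟩
      Q s * q ^ (M ℕ.* s ℕ.* k) * (1# * tail j (suc k))
        ≈⟨ *-congʳ (trans (sym (^-homo-* q (M ℕ.* s) _)) (^-congʳ q (≡.sym (ℕₚ.*-suc (M ℕ.* s) k)))) ⟩
      q ^ (M ℕ.* s ℕ.* suc k) * (1# * tail j (suc k)) ∎
      where
      factor : ∀ e u v → u + e * (u * v) ≈ u * (1# + e * v)
      factor = solve 3 (λ e u v → u :+ e :* (u :* v) := u :* (con 1 :+ e :* v)) refl
      shuffle₂ : ∀ a b c d → a * b * (c * (1# * d)) ≈ a * c * (1# * (b * d))
      shuffle₂ = MonoidSolver.solve 4 (λ a b c d → ((a ⊕ b) ⊕ (c ⊕ (MonoidSolver.id ⊕ d))) ⊜ ((a ⊕ c) ⊕ (MonoidSolver.id ⊕ (b ⊕ d)))) refl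

  module _ (a b c d e m : ℕ) where

    -- The two sides above a common diagonal `y`. The ghosts are b, ..., b + a - 1 for the upper
    -- side and 0, ..., b - 1 for the lower one, so that together they form one gapless run.
    upperSum lowerSum : List ℕ → Carrier
    upperSum y = cutSum 0 m (λ _ → 1) (a ℕ.+ c) d (upFrom b a ++ y)
    lowerSum y = cutSum 1 m (λ _ → 1) (b ℕ.+ c) e (upFrom 0 b ++ y)

    diagonalSum : Carrier
    diagonalSum = ΣL c (λ y → q ^ sum y * (upperSum y * lowerSum y))

    -- The row factors through the marked diagonal, for a rectangle with a + b + c rows and c
    -- columns. They turn up again as hooks of λ in `rectangle-hooks`.
    rectangleHooks : Carrier
    rectangleHooks = prod (λ i → prod (λ t → 1# + ε * q ^ (suc (d ℕ.+ e) ℕ.+ suc m ℕ.* (t ℕ.+ i))) (rows c)) (rows (b ℕ.+ a ℕ.+ c))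

  module _ (q^W≈0 : q ^ W ≈ 0#) where

    cutSum-vdm : ∀ s m e A d D M p → (∀ k → 0 < e k) → (∀ i → esum e (d ℕ.+ suc m ℕ.* i) ≡ D ℕ.+ M ℕ.* i) →
      length p ≡ A → Increasing p →
      prod (rowDenominator e) (ends m A d) * cutSum s m e A d p ≈
      prod (rowTwist s e) (ends m A d) * (q ^ (D ℕ.* sum p) * vdm M p)
    cutSum-vdm s m e A d D M p pos exps ≡.refl inc = trans
      (cutSum-det q^W≈0 s m e A d p pos ≡.refl (Increasing⇒Sorted inc))
      (*-congˡ (trans (reflexive (≡.cong (λ rs → det rs (map ev p)) labels)) (det-vdm D M p)))
      where
      labels : map (esum e) (ends m (length p) d) ≡ map (λ i → D ℕ.+ M ℕ.* i) (rows (length p))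
      labels = ≡.trans (≡.cong (map (esum e)) (ends-rows m (length p) d))
        (≡.trans (≡.sym (map-∘ (rows (length p)))) (map-cong exps (rows (length p))))

    superfac-ends : ∀ M n → prod (rowDenominator (λ _ → M)) (ends 0 n 0) ≈ superfac M n
    superfac-ends M n = trans (prod-cong (ends 0 n 0) (rowDenominator-const M))
      (reflexive (≡.cong (prod (qfac M)) (ends-0 n)))
      where
      ends-0 : ∀ n → ends 0 n 0 ≡ rows n
      ends-0 n = ≡.trans (ends-rows 0 n 0) (≡.trans (map-cong ℕₚ.*-identityˡ (rows n)) (map-id (rows n)))

    twist-ends : ∀ M n → prod (rowTwist 1 (λ _ → M)) (ends 0 n 0) ≈ q ^ sum (map (twistExp M) (rows n))
    twist-ends M n = trans (rowTwist-1 M (ends 0 n 0)) (^-congʳ q (≡.cong (λ xs → sum (map (twistExp M) xs))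
      (≡.trans (ends-rows 0 n 0) (≡.trans (map-cong ℕₚ.*-identityˡ (rows n)) (map-id (rows n))))))

    module _ (a b c d e m : ℕ) where

      private
        M x n N : ℕ
        M = suc m
        x = suc (d ℕ.+ e)
        n = b ℕ.+ a
        N = n ℕ.+ c

        upperSum′ lowerSum′ : List ℕ → Carrier
        upperSum′ = upperSum a b c d e m
        lowerSum′ = lowerSum a b c d e m

      private
        DU DL Tc TL : Carrier
        DU = prod (qfac 1) (ends m (a ℕ.+ c) d)
        DL = prod (qfac 1) (ends m (b ℕ.+ c) e)
        TL = q ^ sum (map (twistExp 1) (ends m (b ℕ.+ c) e))
        Tc = q ^ sum (map (twistExp M) (rows c))

        straightSum : List ℕ → Carrier
        straightSum y = cutSum 0 0 (λ _ → M) N 0 (upFrom 0 n ++ y)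

        su : ℕ
        su = d ℕ.* sum (upFrom b a) ℕ.+ e ℕ.* sum (upFrom 0 b)

        K₁ : Carrier
        K₁ = TL * q ^ su * vdm M (upFrom b a) * vdm M (upFrom 0 b) * superfac M N * superfac M c

        length-ghost : ∀ s k {y} → length y ≡ c → length (upFrom s k ++ y) ≡ k ℕ.+ c
        length-ghost s k len = ≡.trans (length-++ (upFrom s k)) (≡.cong₂ ℕ._+_ (length-upFrom s k) len)

        esum-1 : ∀ d i → esum (λ _ → 1) (d ℕ.+ suc m ℕ.* i) ≡ d ℕ.+ suc m ℕ.* i
        esum-1 d i = ≡.trans (esum-const 1 (d ℕ.+ suc m ℕ.* i)) (ℕₚ.*-identityˡ _)

        esum-M : ∀ i → esum (λ _ → M) (1 ℕ.* i) ≡ M ℕ.* i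
        esum-M i = ≡.trans (esum-const M (1 ℕ.* i)) (≡.cong (M ℕ.*_) (ℕₚ.*-identityˡ i))

        first-bound : ∀ k {y₀ y} → Increasing (upFrom 0 k ++ y₀ ∷ y) → k ≤ y₀
        first-bound zero    inc = z≤n
        first-bound (suc k) inc = upFrom-++-bound 0 k inc

        pooled : ∀ y → upFrom 0 n ++ y ≡ upFrom 0 b ++ (upFrom b a ++ y)
        pooled y = ≡.trans (≡.cong (_++ y) (upFrom-++ 0 b a)) (++-assoc (upFrom 0 b) (upFrom b a) y)

        -- Both sides become Vandermonde products, their ghosts are pooled, and the same evaluation
        -- read backwards yields the triangle and the straight side of a rectangle. The weight of
        -- the diagonal becomes `x`: 1 of its own, d and e from the two determinants.
        increasing-case : ∀ y → length y ≡ c → Increasing (upFrom 0 n ++ y) →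
          (DU * DL * vdm M (upFrom 0 n) * Tc) * (q ^ sum y * (upperSum′ y * lowerSum′ y)) ≈
          K₁ * (q ^ (x ℕ.* sum y) * (triangle M c y * straightSum y))
        increasing-case y len inc = begin
          (DU * DL * vdm M (upFrom 0 n) * Tc) * (q ^ sum y * (upperSum′ y * lowerSum′ y))
            ≈⟨ shuffle₁ _ _ _ _ _ _ _ ⟩
          vdm M (upFrom 0 n) * Tc * q ^ sum y * ((DU * upperSum′ y) * (DL * lowerSum′ y))
            ≈⟨ *-congˡ (*-cong hU hL) ⟩
          vdm M (upFrom 0 n) * Tc * q ^ sum y *
            ((q ^ (d ℕ.* sum pU) * vdm M pU) * (TL * (q ^ (e ℕ.* sum pL) * vdm M pL)))
            ≈⟨ shuffle₂ _ _ _ _ _ _ _ _ ⟩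
          Tc * TL * (q ^ sum y * q ^ (d ℕ.* sum pU) * q ^ (e ℕ.* sum pL)) * (vdm M pU * vdm M pL * vdm M (upFrom 0 n))
            ≈⟨ *-cong (*-congˡ exponents) pool ⟩
          Tc * TL * (q ^ su * q ^ (x ℕ.* sum y)) * (vdm M (upFrom b a) * vdm M (upFrom 0 b) * (vdm M pn * vdm M y))
            ≈⟨ shuffle₃ _ _ _ _ _ _ _ _ ⟩
          TL * q ^ su * vdm M (upFrom b a) * vdm M (upFrom 0 b) * q ^ (x ℕ.* sum y) * ((Tc * vdm M y) * vdm M pn)
            ≈⟨ *-congˡ (*-cong hc hN) ⟨
          TL * q ^ su * vdm M (upFrom b a) * vdm M (upFrom 0 b) * q ^ (x ℕ.* sum y) *
            ((superfac M c * triangle M c y) * (superfac M N * straightSum y))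
            ≈⟨ shuffle₄ _ _ _ _ _ _ _ _ _ ⟩
          K₁ * (q ^ (x ℕ.* sum y) * (triangle M c y * straightSum y)) ∎
          where
          pU pL pn : List ℕ
          pU = upFrom b a ++ y
          pL = upFrom 0 b ++ y
          pn = upFrom 0 n ++ y
          incU : Increasing pU
          incU = Increasing-++ʳ (upFrom 0 b) (≡.subst Increasing (pooled y) inc)
          incy : Increasing y
          incy = Increasing-++ʳ (upFrom b a) incU
          incL : Increasing pL
          incL = Increasing-upFrom-++ 0 b incy
            (λ { ≡.refl → ℕₚ.≤-trans (ℕₚ.m≤m+n b a) (first-bound n inc) })
          hU : DU * upperSum′ y ≈ q ^ (d ℕ.* sum pU) * vdm M pU
          hU = trans (*-congʳ (sym (prod-cong (ends m (a ℕ.+ c) d) (rowDenominator-const 1))))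
            (trans (cutSum-vdm 0 m (λ _ → 1) (a ℕ.+ c) d d M pU (λ _ → s≤s z≤n) (esum-1 d) (length-ghost b a len) incU)
            (trans (*-congʳ (rowTwist-0 (λ _ → 1) (ends m (a ℕ.+ c) d))) (*-identityˡ _)))
          hL : DL * lowerSum′ y ≈ TL * (q ^ (e ℕ.* sum pL) * vdm M pL)
          hL = trans (*-congʳ (sym (prod-cong (ends m (b ℕ.+ c) e) (rowDenominator-const 1))))
            (trans (cutSum-vdm 1 m (λ _ → 1) (b ℕ.+ c) e e M pL (λ _ → s≤s z≤n) (esum-1 e) (length-ghost 0 b len) incL)
            (*-congʳ (rowTwist-1 1 (ends m (b ℕ.+ c) e))))
          hN : superfac M N * straightSum y ≈ vdm M pn
          hN = trans (*-congʳ (sym (superfac-ends M N)))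
            (trans (cutSum-vdm 0 0 (λ _ → M) N 0 0 M pn (λ _ → s≤s z≤n) esum-M (length-ghost 0 n len) inc)
            (trans (*-cong (rowTwist-0 (λ _ → M) (ends 0 N 0)) (*-identityˡ _)) (*-identityˡ _)))
          hc : superfac M c * triangle M c y ≈ Tc * vdm M y
          hc = trans (*-congʳ (sym (superfac-ends M c)))
            (trans (cutSum-vdm 1 0 (λ _ → M) c 0 0 M y (λ _ → s≤s z≤n) esum-M len incy)
            (*-cong (twist-ends M c) (*-identityˡ _)))
          pool : vdm M pU * vdm M pL * vdm M (upFrom 0 n) ≈
                 vdm M (upFrom b a) * vdm M (upFrom 0 b) * (vdm M pn * vdm M y)
          pool = trans (*-congˡ (reflexive (≡.cong (vdm M) (upFrom-++ 0 b a))))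
            (trans (vdm-pool M (upFrom b a) (upFrom 0 b) y)
            (*-congˡ (*-congʳ (reflexive (≡.cong (λ l → vdm M (l ++ y)) (≡.sym (upFrom-++ 0 b a)))))))
          arith : ∀ s u l d e → s ℕ.+ d ℕ.* (u ℕ.+ s) ℕ.+ e ℕ.* (l ℕ.+ s) ≡ d ℕ.* u ℕ.+ e ℕ.* l ℕ.+ suc (d ℕ.+ e) ℕ.* s
          arith = ℕ-solve
          exponents : q ^ sum y * q ^ (d ℕ.* sum pU) * q ^ (e ℕ.* sum pL) ≈ q ^ su * q ^ (x ℕ.* sum y)
          exponents = trans (*-congʳ (sym (^-homo-* q (sum y) (d ℕ.* sum pU))))
            (trans (sym (^-homo-* q (sum y ℕ.+ d ℕ.* sum pU) (e ℕ.* sum pL)))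
            (trans (^-congʳ q (≡.trans (≡.cong₂ (λ u l → sum y ℕ.+ d ℕ.* u ℕ.+ e ℕ.* l) (sum-++ (upFrom b a) y) (sum-++ (upFrom 0 b) y))
                     (arith (sum y) (sum (upFrom b a)) (sum (upFrom 0 b)) d e)))
            (^-homo-* q su (x ℕ.* sum y))))
          shuffle₁ : ∀ du dl v t p u l → (du * dl * v * t) * (p * (u * l)) ≈ v * t * p * ((du * u) * (dl * l))
          shuffle₁ = MonoidSolver.solve 7 (λ du dl v t p u l → ((((du ⊕ dl) ⊕ v) ⊕ t) ⊕ (p ⊕ (u ⊕ l))) ⊜ (((v ⊕ t) ⊕ p) ⊕ ((du ⊕ u) ⊕ (dl ⊕ l)))) refl
          shuffle₂ : ∀ v t p eu vu tl el vl → v * t * p * ((eu * vu) * (tl * (el * vl))) ≈ t * tl * (p * eu * el) * (vu * vl * v)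
          shuffle₂ = MonoidSolver.solve 8 (λ v t p eu vu tl el vl → (((v ⊕ t) ⊕ p) ⊕ ((eu ⊕ vu) ⊕ (tl ⊕ (el ⊕ vl)))) ⊜ (((t ⊕ tl) ⊕ ((p ⊕ eu) ⊕ el)) ⊕ ((vu ⊕ vl) ⊕ v))) refl
          shuffle₃ : ∀ t tl s p va vb vn vy → t * tl * (s * p) * (va * vb * (vn * vy)) ≈ tl * s * va * vb * p * ((t * vy) * vn)
          shuffle₃ = MonoidSolver.solve 8 (λ t tl s p va vb vn vy → (((t ⊕ tl) ⊕ (s ⊕ p)) ⊕ ((va ⊕ vb) ⊕ (vn ⊕ vy))) ⊜ (((((tl ⊕ s) ⊕ va) ⊕ vb) ⊕ p) ⊕ ((t ⊕ vy) ⊕ vn))) refl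
          shuffle₄ : ∀ tl s va vb p fc lc fn un → tl * s * va * vb * p * ((fc * lc) * (fn * un)) ≈ (tl * s * va * vb * fn * fc) * (p * (lc * un))
          shuffle₄ = MonoidSolver.solve 9 (λ tl s va vb p fc lc fn un → (((((tl ⊕ s) ⊕ va) ⊕ vb) ⊕ p) ⊕ ((fc ⊕ lc) ⊕ (fn ⊕ un))) ⊜ ((((((tl ⊕ s) ⊕ va) ⊕ vb) ⊕ fn) ⊕ fc) ⊕ (p ⊕ (lc ⊕ un)))) refl

        -- Both sides vanish: if `y` does not continue the pooled ghosts increasingly, it already
        -- fails to continue those of the upper or those of the lower side.
        zero-case : ∀ y → length y ≡ c → ¬ Increasing (upFrom 0 n ++ y) →
          (DU * DL * vdm M (upFrom 0 n) * Tc) * (q ^ sum y * (upperSum′ y * lowerSum′ y)) ≈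
          K₁ * (q ^ (x ℕ.* sum y) * (triangle M c y * straightSum y))
        zero-case y len ¬inc = trans (annihilate _ _ left) (sym (annihilate _ _ (trans (*-congˡ
          (cutSum-¬Increasing 0 0 (λ _ → M) N 0 (upFrom 0 n ++ y) (length-ghost 0 n len) ¬inc)) (zeroʳ _))))
          where
          annihilate : ∀ k p {z} → z ≈ 0# → k * (p * z) ≈ 0#
          annihilate k p e = trans (*-congˡ (trans (*-congˡ e) (zeroʳ p))) (zeroʳ k)
          reassemble : Increasing (upFrom b a ++ y) → Increasing (upFrom 0 b ++ y) → Increasing (upFrom 0 n ++ y)
          reassemble incU incL = Increasing-upFrom-++ 0 n (Increasing-++ʳ (upFrom b a) incU) (bound a incU incL)
            where
            bound : ∀ a → Increasing (upFrom b a ++ y) → Increasing (upFrom 0 b ++ y) → ∀ {y₀ y′} → y ≡ y₀ ∷ y′ → b ℕ.+ a ≤ y₀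
            -- For a = 0 the upper ghosts give no bound on the first entry, and the lower ones
            -- supply it.
            bound zero    incU incL ≡.refl = ≡.subst (_≤ _) (≡.sym (ℕₚ.+-identityʳ b)) (first-bound b incL)
            bound (suc a) incU incL ≡.refl = upFrom-++-bound b a incU
          left : upperSum′ y * lowerSum′ y ≈ 0#
          left with Linked.linked? ℕ._<?_ (upFrom b a ++ y) | Linked.linked? ℕ._<?_ (upFrom 0 b ++ y)
          ... | no ¬U  | _      = trans (*-congʳ (cutSum-¬Increasing 0 m _ (a ℕ.+ c) d _ (length-ghost b a len) ¬U)) (zeroˡ _)
          ... | yes _  | no ¬L  = trans (*-congˡ (cutSum-¬Increasing 1 m _ (b ℕ.+ c) e _ (length-ghost 0 b len) ¬L)) (zeroʳ _)
          ... | yes iU | yes iL = ⊥-elim (¬inc (reassemble iU iL))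

      -- The common factor `superfac M N` enters on one side as the denominator of the straight side
      -- and on the other within the denominators of the recut rectangle. It is kept until units are
      -- available.
      diagonalSum-product : N ≤ W →
        superfac M N * (rectangleHooks a b c d e m * prod (qfac 1) (ends m (a ℕ.+ c) d) * prod (qfac 1) (ends m (b ℕ.+ c) e) * superfac M n
          * (q ^ leftExponent a b c d e m * diagonalSum a b c d e m)) ≈
        superfac M N * (q ^ rightExponent a b c d e m * (superfac M a * superfac M b * superfac M c * superfac M N))
      diagonalSum-product N≤W = begin
        superfac M N * (rectangleHooks a b c d e m * DU * DL * superfac M n * (q ^ leftExponent a b c d e m * diagonalSum a b c d e m))
          ≈⟨ *-congˡ (*-congˡ (*-congʳ (trans (^-homo-* q (gh ℕ.+ M ℕ.* vexp 0 n) _) (*-congʳ (^-homo-* q gh _))))) ⟩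
        superfac M N * (rectangleHooks a b c d e m * DU * DL * superfac M n * (q ^ gh * q ^ (M ℕ.* vexp 0 n) * Tc * diagonalSum a b c d e m))
          ≈⟨ shuffle₁ _ _ _ _ _ _ _ _ _ ⟩
        (rectangleHooks a b c d e m * superfac M N) * (q ^ gh * ((DU * DL * (q ^ (M ℕ.* vexp 0 n) * superfac M n) * Tc) * diagonalSum a b c d e m))
          ≈⟨ *-congˡ (*-congˡ (*-congʳ (*-congʳ (*-congˡ (vdm-upFrom M 0 n))))) ⟨
        (rectangleHooks a b c d e m * superfac M N) * (q ^ gh * ((DU * DL * vdm M (upFrom 0 n) * Tc) * diagonalSum a b c d e m))
          ≈⟨ *-congˡ (*-congˡ summed) ⟩
        (rectangleHooks a b c d e m * superfac M N) * (q ^ gh * (K₁ * straight))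
          ≈⟨ shuffle₂ _ _ _ _ _ ⟩
        K₁ * ((rectangleHooks a b c d e m * superfac M N) * (q ^ gh * straight))
          -- Recut so that the starting diagonal consists of ghosts only, the rectangle is a single
          -- `cutSum`, with no diagonal left to sum over.
          ≈⟨ *-congˡ (*-cong (sym denominators) (sym (rectangle M x n c N≤W))) ⟩
        K₁ * (prod (rowDenominator (marked M x c)) (ends 0 N c) * cutSum 0 0 (marked M x c) N c (upFrom 0 N))
          ≈⟨ *-congˡ (trans (cutSum-vdm 0 0 (marked M x c) N c (markedBase M x c) M (upFrom 0 N) (positive c) exps (length-upFrom 0 N) incN)
               (trans (*-congʳ (rowTwist-0 (marked M x c) (ends 0 N c))) (*-identityˡ _))) ⟩
        K₁ * (q ^ (markedBase M x c ℕ.* sum (upFrom 0 N)) * vdm M (upFrom 0 N))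
          ≈⟨ *-cong (*-congʳ (*-congʳ (*-cong (*-congˡ (vdm-upFrom M b a)) (vdm-upFrom M 0 b)))) (*-congˡ (vdm-upFrom M 0 N)) ⟩
        TL * q ^ su * (q ^ (M ℕ.* vexp b a) * superfac M a) * (q ^ (M ℕ.* vexp 0 b) * superfac M b) * superfac M N * superfac M c *
          (q ^ (markedBase M x c ℕ.* sum (upFrom 0 N)) * (q ^ (M ℕ.* vexp 0 N) * superfac M N))
          ≈⟨ shuffle₃ _ _ _ _ _ _ _ _ _ _ ⟩
        superfac M N * (TL * q ^ su * q ^ (M ℕ.* vexp b a) * q ^ (M ℕ.* vexp 0 b) *
          q ^ (markedBase M x c ℕ.* sum (upFrom 0 N)) * q ^ (M ℕ.* vexp 0 N)
          * (superfac M a * superfac M b * superfac M c * superfac M N))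
          ≈⟨ *-congˡ (*-congʳ (sym powers)) ⟩
        superfac M N * (q ^ rightExponent a b c d e m * (superfac M a * superfac M b * superfac M c * superfac M N)) ∎
        where
        gh : ℕ
        gh = ghostWeight M x c n
        straight : Carrier
        straight = ΣL c (λ y → q ^ (x ℕ.* sum y) * (triangle M c y * straightSum y))
        summed : (DU * DL * vdm M (upFrom 0 n) * Tc) * diagonalSum a b c d e m ≈ K₁ * straight
        summed = trans (sym (ΣL-* c _ _)) (trans (ΣL-cong c pointwise) (ΣL-* c K₁ _))
          where
          pointwise : ∀ y → length y ≡ c →
            (DU * DL * vdm M (upFrom 0 n) * Tc) * (q ^ sum y * (upperSum′ y * lowerSum′ y)) ≈
            K₁ * (q ^ (x ℕ.* sum y) * (triangle M c y * straightSum y))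
          pointwise y len with Linked.linked? ℕ._<?_ (upFrom 0 n ++ y)
          ... | yes inc = increasing-case y len inc
          ... | no ¬inc = zero-case y len ¬inc
        positive : ∀ c k → 0 < marked M x c k
        positive zero          k       = s≤s z≤n
        positive (suc c)       (suc k) = positive c k
        positive (suc zero)    zero    = s≤s z≤n
        positive (suc (suc c)) zero    = s≤s z≤n
        exps : ∀ i → esum (marked M x c) (c ℕ.+ 1 ℕ.* i) ≡ markedBase M x c ℕ.+ M ℕ.* i
        exps i = ≡.trans (≡.cong (λ i → esum (marked M x c) (c ℕ.+ i)) (ℕₚ.*-identityˡ i)) (marked-base M x c i)
        incN : Increasing (upFrom 0 N)
        incN = ≡.subst Increasing (++-identityʳ (upFrom 0 N)) (Increasing-upFrom-++ 0 N [] (λ ()))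
        denominators : prod (rowDenominator (marked M x c)) (ends 0 N c) ≈ rectangleHooks a b c d e m * superfac M N
        denominators = trans (reflexive (≡.trans (≡.cong (prod (rowDenominator (marked M x c))) (ends-rows 0 N c)) (prod-map _ _ (rows N))))
          (trans (prod-cong (rows N) (λ i → trans (reflexive (≡.cong (λ i → rowDenominator (marked M x c) (c ℕ.+ i)) (ℕₚ.*-identityˡ i))) (marked-rest M x c i)))
          (prod-* _ (qfac M) (rows N)))
        powers : q ^ rightExponent a b c d e m ≈ TL * q ^ su * q ^ (M ℕ.* vexp b a) * q ^ (M ℕ.* vexp 0 b) *
          q ^ (markedBase M x c ℕ.* sum (upFrom 0 N)) * q ^ (M ℕ.* vexp 0 N)
        powers = trans (^-homo-* q (tl ℕ.+ su ℕ.+ M ℕ.* vexp b a ℕ.+ M ℕ.* vexp 0 b ℕ.+ bs) _) (*-congʳ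
          (trans (^-homo-* q (tl ℕ.+ su ℕ.+ M ℕ.* vexp b a ℕ.+ M ℕ.* vexp 0 b) bs) (*-congʳ
          (trans (^-homo-* q (tl ℕ.+ su ℕ.+ M ℕ.* vexp b a) _) (*-congʳ
          (trans (^-homo-* q (tl ℕ.+ su) _) (*-congʳ (^-homo-* q tl su))))))))
          where
          tl bs : ℕ
          tl = sum (map (twistExp 1) (ends m (b ℕ.+ c) e))
          bs = markedBase M x c ℕ.* sum (upFrom 0 N)
        shuffle₁ : ∀ sN R u l sn g v t s → sN * (R * u * l * sn * (g * v * t * s)) ≈ (R * sN) * (g * ((u * l * (v * sn) * t) * s))
        shuffle₁ = MonoidSolver.solve 9 (λ sN R u l sn g v t s → (sN ⊕ ((((R ⊕ u) ⊕ l) ⊕ sn) ⊕ (((g ⊕ v) ⊕ t) ⊕ s))) ⊜ ((R ⊕ sN) ⊕ (g ⊕ ((((u ⊕ l) ⊕ (v ⊕ sn)) ⊕ t) ⊕ s)))) refl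
        shuffle₂ : ∀ R sN g k s → (R * sN) * (g * (k * s)) ≈ k * ((R * sN) * (g * s))
        shuffle₂ = MonoidSolver.solve 5 (λ R sN g k s → ((R ⊕ sN) ⊕ (g ⊕ (k ⊕ s))) ⊜ (k ⊕ ((R ⊕ sN) ⊕ (g ⊕ s)))) refl
        shuffle₃ : ∀ tl s va fa vb fb fN fc bs vN → tl * s * (va * fa) * (vb * fb) * fN * fc * (bs * (vN * fN)) ≈ fN * (tl * s * va * vb * bs * vN * (fa * fb * fc * fN))
        shuffle₃ = MonoidSolver.solve 10 (λ tl s va fa vb fb fN fc bs vN → ((((((tl ⊕ s) ⊕ (va ⊕ fa)) ⊕ (vb ⊕ fb)) ⊕ fN) ⊕ fc) ⊕ (bs ⊕ (vN ⊕ fN))) ⊜ (fN ⊕ ((((((tl ⊕ s) ⊕ va) ⊕ vb) ⊕ bs) ⊕ vN) ⊕ (((fa ⊕ fb) ⊕ fc) ⊕ fN)))) refl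

-- Sums over fillings of a list of cells

Filling : Set
Filling = Cell → ℕ

_≟ᶜ_ : (c c′ : Cell) → Dec (c ≡ c′)
_≟ᶜ_ = ≡-dec ℕ._≟_ ℕ._≟_

_[_↦_] : Filling → Cell → ℕ → Filling
(τ [ c ↦ t ]) c′ = if does (c ≟ᶜ c′) then t else τ c′

update-same : ∀ τ c t → (τ [ c ↦ t ]) c ≡ t
update-same τ c t rewrite dec-true (c ≟ᶜ c) ≡.refl = ≡.refl

update-other : ∀ τ {c c′} t → c ≢ c′ → (τ [ c ↦ t ]) c′ ≡ τ c′
update-other τ {c} {c′} t c≢c′ rewrite dec-false (c ≟ᶜ c′) c≢c′ = ≡.refl

AgreeOff : List Cell → Filling → Filling → Set
AgreeOff cs τ τ′ = ∀ c → c ∉ cs → τ′ c ≡ τ c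

AgreeOff-∷ : ∀ {c cs τ t τ′} → AgreeOff cs (τ [ c ↦ t ]) τ′ → AgreeOff (c ∷ cs) τ τ′
AgreeOff-∷ {c} {cs} {τ} {t} agree c′ c′∉ =
  ≡.trans (agree c′ (c′∉ ∘ there)) (update-other τ t (λ c≡c′ → c′∉ (here (≡.sym c≡c′))))

AgreeOff-head : ∀ {c cs τ t τ′} → c ∉ cs → AgreeOff cs (τ [ c ↦ t ]) τ′ → τ′ c ≡ t
AgreeOff-head {c} {τ = τ} {t} c∉ agree = ≡.trans (agree c c∉) (update-same τ c t)

module Assignments (R : CommutativeRing 0ℓ 0ℓ) (q : CommutativeRing.Carrier R) (W : ℕ) where
  open Product R q W public

  ΣF : List Cell → Filling → (Filling → Carrier) → Carrier
  ΣF []       τ f = f τ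
  ΣF (c ∷ cs) τ f = Σ< W (λ t → ΣF cs (τ [ c ↦ t ]) f)

  -- Updates at different cells commute only pointwise, so reordering the cells calls for summands
  -- that respect pointwise equality.
  Extensional : (Filling → Carrier) → Set
  Extensional f = ∀ τ τ′ → (∀ c → τ c ≡ τ′ c) → f τ ≈ f τ′

  ΣF-cong : ∀ cs τ {f g} → (∀ τ′ → AgreeOff cs τ τ′ → f τ′ ≈ g τ′) → ΣF cs τ f ≈ ΣF cs τ g
  ΣF-cong []       τ e = e τ (λ _ _ → ≡.refl)
  ΣF-cong (c ∷ cs) τ e = Σ<-cong W (λ t → ΣF-cong cs (τ [ c ↦ t ]) (λ τ′ agree → e τ′ (AgreeOff-∷ agree)))

  ΣF-0 : ∀ cs τ {f} → (∀ τ′ → AgreeOff cs τ τ′ → f τ′ ≈ 0#) → ΣF cs τ f ≈ 0#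
  ΣF-0 []       τ e = e τ (λ _ _ → ≡.refl)
  ΣF-0 (c ∷ cs) τ e = trans (Σ<-cong W (λ t → ΣF-0 cs (τ [ c ↦ t ]) (λ τ′ agree → e τ′ (AgreeOff-∷ agree)))) (Σ<-0 W)

  ΣF-* : ∀ cs τ k f → ΣF cs τ (λ τ → k * f τ) ≈ k * ΣF cs τ f
  ΣF-* []       τ k f = refl
  ΣF-* (c ∷ cs) τ k f = trans (Σ<-cong W (λ t → ΣF-* cs (τ [ c ↦ t ]) k f)) (Σ<-* W k _)

  ΣF-++ : ∀ cs cs′ τ f → ΣF (cs ++ cs′) τ f ≈ ΣF cs τ (λ τ → ΣF cs′ τ f)
  ΣF-++ []       cs′ τ f = refl
  ΣF-++ (c ∷ cs) cs′ τ f = Σ<-cong W (λ t → ΣF-++ cs cs′ (τ [ c ↦ t ]) f)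

  ΣF-pull : ∀ cs τ (g f : Filling → Carrier) → (∀ τ′ → AgreeOff cs τ τ′ → g τ′ ≈ g τ) → ΣF cs τ (λ τ → g τ * f τ) ≈ g τ * ΣF cs τ f
  ΣF-pull cs τ g f inv = trans (ΣF-cong cs τ (λ τ′ agree → *-congʳ (inv τ′ agree))) (ΣF-* cs τ (g τ) f)

  ΣF-ext : ∀ cs {τ τ′} f → Extensional f → (∀ c → τ c ≡ τ′ c) → ΣF cs τ f ≈ ΣF cs τ′ f
  ΣF-ext []       f ext e = ext _ _ e
  ΣF-ext (c ∷ cs) f ext e = Σ<-cong W (λ t → ΣF-ext cs f ext (λ c′ → ≡.cong (λ v → if does (c ≟ᶜ c′) then t else v) (e c′)))

  ΣF-↭ : ∀ {cs cs′} τ f → Extensional f → cs ↭ cs′ → ΣF cs τ f ≈ ΣF cs′ τ f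
  ΣF-↭ τ f ext Perm.refl            = refl
  ΣF-↭ τ f ext (Perm.prep c p)      = Σ<-cong W (λ t → ΣF-↭ (τ [ c ↦ t ]) f ext p)
  ΣF-↭ τ f ext (Perm.trans p p′)    = trans (ΣF-↭ τ f ext p) (ΣF-↭ τ f ext p′)
  ΣF-↭ τ f ext (Perm.swap {xs} {ys} c c′ p) with c ≟ᶜ c′
  ... | yes ≡.refl = Σ<-cong W (λ t → Σ<-cong W (λ u → ΣF-↭ ((τ [ c ↦ t ]) [ c ↦ u ]) f ext p))
  ... | no c≢c′ = trans
    (Σ<-cong W (λ t → Σ<-cong W (λ u → trans (ΣF-↭ ((τ [ c ↦ t ]) [ c′ ↦ u ]) f ext p) (ΣF-ext ys f ext (commute t u)))))
    (Σ<-swap W W (λ t u → ΣF ys ((τ [ c′ ↦ u ]) [ c ↦ t ]) f))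
    where
    commute : ∀ t u x → ((τ [ c ↦ t ]) [ c′ ↦ u ]) x ≡ ((τ [ c′ ↦ u ]) [ c ↦ t ]) x
    commute t u x with c ≟ᶜ x | c′ ≟ᶜ x
    ... | yes ≡.refl | yes ≡.refl = ⊥-elim (c≢c′ ≡.refl)
    ... | yes _      | no _       = ≡.refl
    ... | no _       | yes _      = ≡.refl
    ... | no _       | no _       = ≡.refl

  Σ<-only : ∀ n k (f : ℕ → Carrier) → k < n → (∀ t → t ≢ k → f t ≈ 0#) → Σ< n f ≈ f k
  Σ<-only (suc n) zero    f k<n       e = trans (+-congˡ (trans (Σ<-cong n (λ t → e (suc t) (λ ()))) (Σ<-0 n))) (+-identityʳ _)
  Σ<-only (suc n) (suc k) f (s≤s k<n) e = trans (+-congʳ (e 0 (λ ())))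
    (trans (+-identityˡ _) (Σ<-only n k (f ∘ suc) k<n (λ t t≢k → e (suc t) (t≢k ∘ ℕₚ.suc-injective))))

  Σ<-window : ∀ n b K (f : ℕ → Carrier) → b ℕ.+ K ≤ n → (∀ t → ¬ (b ≤ t × t < b ℕ.+ K) → f t ≈ 0#) →
              Σ< n f ≈ Σ< K (λ u → f (b ℕ.+ u))
  Σ<-window n       zero    zero    f le       e = trans (Σ<-cong n (λ t → e t (λ ()))) (Σ<-0 n)
  Σ<-window (suc n) zero    (suc K) f (s≤s le) e = +-congˡ (Σ<-window n 0 K (f ∘ suc) le
    (λ t ¬w → e (suc t) (λ { (_ , s≤s t<K) → ¬w (z≤n , t<K) })))
  Σ<-window (suc n) (suc b) K       f (s≤s le) e = trans (+-congʳ (e 0 (λ ()))) (trans (+-identityˡ _)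
    (Σ<-window n b K (f ∘ suc) le (λ t ¬w → e (suc t) (λ { (s≤s b≤t , s≤s t<K) → ¬w (b≤t , t<K) }))))

  ΣList : {A : Set} → (A → Carrier) → List A → Carrier
  ΣList f = foldr (λ x y → f x + y) 0#

  ΣList-++ : {A : Set} (f : A → Carrier) (xs ys : List A) → ΣList f (xs ++ ys) ≈ ΣList f xs + ΣList f ys
  ΣList-++ f []       ys = sym (+-identityˡ _)
  ΣList-++ f (x ∷ xs) ys = trans (+-congˡ (ΣList-++ f xs ys)) (sym (+-assoc _ _ _))

  ΣList-map : {A B : Set} (f : B → Carrier) (g : A → B) (xs : List A) → ΣList f (map g xs) ≈ ΣList (f ∘ g) xs
  ΣList-map f g []       = refl
  ΣList-map f g (x ∷ xs) = +-congˡ (ΣList-map f g xs)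

  ΣList-concatMap-applyUpTo : {A : Set} (f : A → Carrier) (g : ℕ → List A) (k : ℕ → ℕ) (n : ℕ) →
    ΣList f (concatMap g (applyUpTo k n)) ≈ Σ< n (λ t → ΣList f (g (k t)))
  ΣList-concatMap-applyUpTo f g k zero    = refl
  ΣList-concatMap-applyUpTo f g k (suc n) = trans (ΣList-++ f (g (k 0)) _)
    (+-congˡ (ΣList-concatMap-applyUpTo f g (k ∘ suc) n))

  module _ (b K : ℕ) (le : b ℕ.+ K ≤ W)
           (fillings : ℕ → ℕ → List (List ℕ))
           (fillings-0 : ∀ M → fillings 0 M ≡ [] ∷ [])
           (fillings-suc : ∀ k M → fillings (suc k) M ≡ concatMap (λ t → map (t ∷_) (fillings k M)) (range1 M)) where

    InWindow : ℕ → Set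
    InWindow t = b ≤ t × t < b ℕ.+ K

    -- Passes from functions on cells to the enumeration by lists. Only entries from b to b + K - 1
    -- contribute; lowered by b and raised by one they are the entries of that enumeration.
    ΣF-fillings : ∀ cs → Unique cs → ∀ τ f h →
      (∀ τ′ → AgreeOff cs τ τ′ → (∀ c → c ∈ cs → InWindow (τ′ c)) → f τ′ ≈ h (map (λ c → suc (τ′ c ∸ b)) cs)) →
      (∀ τ′ → AgreeOff cs τ τ′ → ∀ c → c ∈ cs → ¬ InWindow (τ′ c) → f τ′ ≈ 0#) →
      ΣF cs τ f ≈ ΣList h (fillings (length cs) K)
    ΣF-fillings [] [] τ f h inside outside = begin
      f τ                     ≈⟨ inside τ (λ _ _ → ≡.refl) (λ _ ()) ⟩
      h []                    ≈⟨ +-identityʳ _ ⟨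
      h [] + 0#               ≡⟨ ≡.cong (ΣList h) (fillings-0 K) ⟨
      ΣList h (fillings 0 K)  ∎
    ΣF-fillings (c ∷ cs) (c∉cs ∷ uniq) τ f h inside outside = begin
      Σ< W (λ t → ΣF cs (τ [ c ↦ t ]) f)
        ≈⟨ Σ<-window W b K _ le (λ t ¬w → ΣF-0 cs (τ [ c ↦ t ]) (λ τ′ agree →
             outside τ′ (AgreeOff-∷ agree) c (here ≡.refl) (≡.subst (¬_ ∘ InWindow) (≡.sym (AgreeOff-head fresh agree)) ¬w))) ⟩
      Σ< K (λ u → ΣF cs (τ [ c ↦ b ℕ.+ u ]) f)
        ≈⟨ Σ<-cong< K (λ u u<K → ΣF-fillings cs uniq (τ [ c ↦ b ℕ.+ u ]) f (h ∘ (suc u ∷_))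
             (λ τ′ agree win → trans (inside τ′ (AgreeOff-∷ agree)
                 (λ { _ (here ≡.refl) → ≡.subst InWindow (≡.sym (AgreeOff-head fresh agree)) (ℕₚ.m≤m+n b u , ℕₚ.+-monoʳ-< b u<K)
                    ; c′ (there c′∈) → win c′ c′∈ }))
               (reflexive (≡.cong (λ v → h (suc v ∷ map (λ c → suc (τ′ c ∸ b)) cs))
                 (≡.trans (≡.cong (_∸ b) (AgreeOff-head fresh agree)) (ℕₚ.m+n∸m≡n b u)))))
             (λ τ′ agree c′ c′∈ ¬w → outside τ′ (AgreeOff-∷ agree) c′ (there c′∈) ¬w)) ⟩
      Σ< K (λ u → ΣList (h ∘ (suc u ∷_)) (fillings (length cs) K))
        ≈⟨ Σ<-cong K (λ u → sym (ΣList-map h (suc u ∷_) (fillings (length cs) K))) ⟩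
      Σ< K (λ u → ΣList h (map (suc u ∷_) (fillings (length cs) K)))
        ≈⟨ ΣList-concatMap-applyUpTo h (λ t → map (t ∷_) (fillings (length cs) K)) suc K ⟨
      ΣList h (concatMap (λ t → map (t ∷_) (fillings (length cs) K)) (range1 K))
        ≡⟨ ≡.cong (ΣList h) (fillings-suc (length cs) K) ⟨
      ΣList h (fillings (length (c ∷ cs)) K) ∎
      where
      fresh : c ∉ cs
      fresh = Allₚ.All¬⇒¬Any c∉cs

-- One side of the main diagonal, cell by cell

-- One side of the main diagonal: position (i , k) is row i at distance k.  The positions with
-- i + k < α lie in the removed rectangle and carry the forced value γ + i + s * k; the others
-- are cells of the shape.
module Side (α γ s m : ℕ) (cellOf : ℕ → ℕ → Cell) where

  -- A ghost value meets both interlacing conditions with its ghost neighbours tightly: they leave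
  -- an interval of length one, so that the conditions themselves force it.
  value : Filling → ℕ → ℕ → ℕ
  value τ i k = if i ℕ.+ k <ᵇ α then γ ℕ.+ i ℕ.+ s ℕ.* k else τ (cellOf i (i ℕ.+ k ∸ α))

  value-ghost : ∀ τ {i k} → i ℕ.+ k < α → value τ i k ≡ γ ℕ.+ i ℕ.+ s ℕ.* k
  value-ghost τ {i} {k} lt with i ℕ.+ k <ᵇ α in e
  ... | true  = ≡.refl
  ... | false = ⊥-elim (≡.subst T e (ℕₚ.<⇒<ᵇ lt))

  value-real : ∀ τ {i k} → α ≤ i ℕ.+ k → value τ i k ≡ τ (cellOf i (i ℕ.+ k ∸ α))
  value-real τ {i} {k} le with i ℕ.+ k <ᵇ α in e
  ... | false = ≡.refl
  ... | true  = ⊥-elim (ℕₚ.<⇒≱ (ℕₚ.<ᵇ⇒< (i ℕ.+ k) α (≡.subst T (≡.sym e) tt)) le)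

  values : Filling → ℕ → ℕ → ℕ → List ℕ
  values τ k i zero    = []
  values τ k i (suc r) = value τ i k ∷ values τ k (suc i) r

  length-values : ∀ τ k i r → length (values τ k i r) ≡ r
  length-values τ k i zero    = ≡.refl
  length-values τ k i (suc r) = ≡.cong suc (length-values τ k (suc i) r)

  diagonal : ℕ → ℕ → ℕ → List Cell
  diagonal k i zero    = []
  diagonal k i (suc r) = if i ℕ.+ k <ᵇ α then diagonal k (suc i) r
                         else cellOf i (i ℕ.+ k ∸ α) ∷ diagonal k (suc i) r

  -- `cells`, `ok` and `weight` repeat the recursion of `cutSum`, recording the summation variables,
  -- the conditions and the exponent of a single filling.
  cells : ℕ → ℕ → ℕ → List Cell
  cells zero    d       k = []
  cells (suc A) zero    k = diagonal (suc k) 0 A ++ cells A m (suc k)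
  cells (suc A) (suc d) k = diagonal (suc k) 0 (suc A) ++ cells (suc A) d (suc k)

  ok : ℕ → ℕ → ℕ → Filling → Bool
  ok zero    d       k τ = true
  ok (suc A) zero    k τ = within? (intervals s (values τ k 0 (suc A))) (values τ (suc k) 0 A) ∧ ok A m (suc k) τ
  ok (suc A) (suc d) k τ = within? (intervals⁺ s (values τ k 0 (suc A))) (values τ (suc k) 0 (suc A)) ∧ ok (suc A) d (suc k) τ

  weight : ℕ → ℕ → ℕ → Filling → ℕ
  weight zero    d       k τ = 0
  weight (suc A) zero    k τ = sum (values τ (suc k) 0 A) ℕ.+ weight A m (suc k) τ
  weight (suc A) (suc d) k τ = sum (values τ (suc k) 0 (suc A)) ℕ.+ weight (suc A) d (suc k) τ

  ∈-diagonal⁻ : ∀ k i r {c} → c ∈ diagonal k i r → ∃ λ i′ → i ≤ i′ × i′ < i ℕ.+ r × α ≤ i′ ℕ.+ k × c ≡ cellOf i′ (i′ ℕ.+ k ∸ α)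
  ∈-diagonal⁻ k i (suc r) c∈ with i ℕ.+ k <ᵇ α in e
  ∈-diagonal⁻ k i (suc r) c∈ | true with ∈-diagonal⁻ k (suc i) r c∈
  ... | i′ , le , lt , real , eq = i′ , ℕₚ.≤-trans (ℕₚ.n≤1+n i) le , ≡.subst (i′ <_) (≡.sym (ℕₚ.+-suc i r)) lt , real , eq
  ∈-diagonal⁻ k i (suc r) (here ≡.refl) | false =
    i , ℕₚ.≤-refl , ℕₚ.m<m+n i (s≤s z≤n) , ℕₚ.≮⇒≥ (λ lt → ≡.subst T e (ℕₚ.<⇒<ᵇ lt)) , ≡.refl
  ∈-diagonal⁻ k i (suc r) (there c∈) | false with ∈-diagonal⁻ k (suc i) r c∈
  ... | i′ , le , lt , real , eq = i′ , ℕₚ.≤-trans (ℕₚ.n≤1+n i) le , ≡.subst (i′ <_) (≡.sym (ℕₚ.+-suc i r)) lt , real , eq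

  -- row i reaches distance r; both sides are moved so that no subtraction occurs
  record Reaches (A d i r : ℕ) : Set where
    constructor reaches
    field
      row-exists : i < A
      in-row     : r ℕ.+ suc m ℕ.* suc i ≤ d ℕ.+ suc m ℕ.* A
  open Reaches

  reaches-0 : ∀ {A d i} → i < A → Reaches A d i 0
  reaches-0 {A} {d} i<A = reaches i<A (ℕₚ.≤-trans (ℕₚ.*-monoʳ-≤ (suc m) i<A) (ℕₚ.m≤n+m _ d))

  reaches-zero⁻ : ∀ {A i r} → Reaches (suc A) 0 i (suc r) → Reaches A m i r
  reaches-zero⁻ {A} {i} {r} (reaches i<1+A le) = reaches i<A (ℕₚ.≤-pred (≡.subst (suc (r ℕ.+ suc m ℕ.* suc i) ≤_) (ℕₚ.*-suc (suc m) A) le))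
    where
    i<A : i < A
    i<A = ℕₚ.≤-pred (ℕₚ.*-cancelˡ-< (suc m) (suc i) (suc A) (ℕₚ.<-≤-trans (s≤s (ℕₚ.m≤n+m _ r)) le))

  reaches-zero⁺ : ∀ {A i r} → Reaches A m i r → Reaches (suc A) 0 i (suc r)
  reaches-zero⁺ {A} {i} {r} (reaches i<A le) = reaches (ℕₚ.<-trans i<A ℕₚ.≤-refl) (≡.subst (suc (r ℕ.+ suc m ℕ.* suc i) ≤_) (≡.sym (ℕₚ.*-suc (suc m) A)) (s≤s le))

  reaches-suc⁻ : ∀ {A d i r} → Reaches A (suc d) i (suc r) → Reaches A d i r
  reaches-suc⁻ (reaches i<A (s≤s le)) = reaches i<A le

  reaches-suc⁺ : ∀ {A d i r} → Reaches A d i r → Reaches A (suc d) i (suc r)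
  reaches-suc⁺ (reaches i<A le) = reaches i<A (s≤s le)

  ∈-cells-reaches⁻ : ∀ A d k {c} → c ∈ cells A d k →
    ∃₂ λ i r → Reaches A d i (suc r) × α ≤ i ℕ.+ suc (k ℕ.+ r) × c ≡ cellOf i (i ℕ.+ suc (k ℕ.+ r) ∸ α)
  ∈-cells-reaches⁻ (suc A) zero    k {c} c∈ = [
    (λ c∈ˡ → let i , _ , i<A , real , eq = ∈-diagonal⁻ (suc k) 0 A c∈ˡ in
             i , 0 , reaches-zero⁺ (reaches-0 i<A) ,
             ≡.subst (λ k → α ≤ i ℕ.+ suc k × c ≡ cellOf i (i ℕ.+ suc k ∸ α)) (≡.sym (ℕₚ.+-identityʳ k)) (real , eq)) ,
    (λ c∈ʳ → let i , r , reg , rest = ∈-cells-reaches⁻ A m (suc k) c∈ʳ in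
             i , suc r , reaches-zero⁺ reg ,
             ≡.subst (λ k → α ≤ i ℕ.+ suc k × c ≡ cellOf i (i ℕ.+ suc k ∸ α)) (≡.sym (ℕₚ.+-suc k r)) rest)
    ]′ (∈-++⁻ (diagonal (suc k) 0 A) c∈)
  ∈-cells-reaches⁻ (suc A) (suc d) k {c} c∈ = [
    (λ c∈ˡ → let i , _ , i<A , real , eq = ∈-diagonal⁻ (suc k) 0 (suc A) c∈ˡ in
             i , 0 , reaches-suc⁺ (reaches-0 i<A) ,
             ≡.subst (λ k → α ≤ i ℕ.+ suc k × c ≡ cellOf i (i ℕ.+ suc k ∸ α)) (≡.sym (ℕₚ.+-identityʳ k)) (real , eq)) ,
    (λ c∈ʳ → let i , r , reg , rest = ∈-cells-reaches⁻ (suc A) d (suc k) c∈ʳ in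
             i , suc r , reaches-suc⁺ reg ,
             ≡.subst (λ k → α ≤ i ℕ.+ suc k × c ≡ cellOf i (i ℕ.+ suc k ∸ α)) (≡.sym (ℕₚ.+-suc k r)) rest)
    ]′ (∈-++⁻ (diagonal (suc k) 0 (suc A)) c∈)

  ∈-cells⁻ : ∀ A d k {c} → c ∈ cells A d k → ∃₂ λ i k′ → k < k′ × α ≤ i ℕ.+ k′ × c ≡ cellOf i (i ℕ.+ k′ ∸ α)
  ∈-cells⁻ A d k c∈ = let i , r , _ , real , eq = ∈-cells-reaches⁻ A d k c∈ in i , suc (k ℕ.+ r) , s≤s (ℕₚ.m≤m+n k r) , real , eq

  ∈-diagonal⁺ : ∀ k i n i′ → i ≤ i′ → i′ < i ℕ.+ n → α ≤ i′ ℕ.+ k → cellOf i′ (i′ ℕ.+ k ∸ α) ∈ diagonal k i n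
  ∈-diagonal⁺ k i zero    i′ le lt real = ⊥-elim (ℕₚ.<⇒≱ lt (ℕₚ.≤-trans (ℕₚ.≤-reflexive (ℕₚ.+-identityʳ i)) le))
  ∈-diagonal⁺ k i (suc n) i′ le lt real with i ℕ.+ k <ᵇ α in e | ℕₚ.m≤n⇒m<n∨m≡n le
  ... | true  | inj₁ i<i′   = ∈-diagonal⁺ k (suc i) n i′ i<i′ (≡.subst (i′ <_) (ℕₚ.+-suc i n) lt) real
  ... | true  | inj₂ ≡.refl = ⊥-elim (ℕₚ.<⇒≱ (ℕₚ.<ᵇ⇒< (i ℕ.+ k) α (≡.subst T (≡.sym e) tt)) real)
  ... | false | inj₁ i<i′   = there (∈-diagonal⁺ k (suc i) n i′ i<i′ (≡.subst (i′ <_) (ℕₚ.+-suc i n) lt) real)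
  ... | false | inj₂ ≡.refl = here ≡.refl

  ∈-cells⁺ : ∀ A d k i r → Reaches A d i (suc r) → α ≤ i ℕ.+ suc (k ℕ.+ r) → cellOf i (i ℕ.+ suc (k ℕ.+ r) ∸ α) ∈ cells A d k
  ∈-cells⁺ zero    d       k i r       (reaches () _) real
  ∈-cells⁺ (suc A) zero    k i zero    reg real rewrite ℕₚ.+-identityʳ k =
    ∈-++⁺ˡ (∈-diagonal⁺ (suc k) 0 A i z≤n (row-exists (reaches-zero⁻ reg)) real)
  ∈-cells⁺ (suc A) zero    k i (suc r) reg real rewrite ℕₚ.+-suc k r =
    ∈-++⁺ʳ (diagonal (suc k) 0 A) (∈-cells⁺ A m (suc k) i r (reaches-zero⁻ reg) real)
  ∈-cells⁺ (suc A) (suc d) k i zero    reg real rewrite ℕₚ.+-identityʳ k =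
    ∈-++⁺ˡ (∈-diagonal⁺ (suc k) 0 (suc A) i z≤n (row-exists reg) real)
  ∈-cells⁺ (suc A) (suc d) k i (suc r) reg real rewrite ℕₚ.+-suc k r =
    ∈-++⁺ʳ (diagonal (suc k) 0 (suc A)) (∈-cells⁺ (suc A) d (suc k) i r (reaches-suc⁻ reg) real)

  module _ (cellOf-injective : ∀ {i r i′ r′} → cellOf i r ≡ cellOf i′ r′ → i ≡ i′ × r ≡ r′) where

    distance-injective : ∀ {i k i′ k′} → α ≤ i ℕ.+ k → α ≤ i′ ℕ.+ k′ →
      cellOf i (i ℕ.+ k ∸ α) ≡ cellOf i′ (i′ ℕ.+ k′ ∸ α) → i ≡ i′ × k ≡ k′
    distance-injective {i} {k} {i′} {k′} le le′ e with cellOf-injective e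
    ... | ≡.refl , r≡ = ≡.refl , ℕₚ.+-cancelˡ-≡ i k k′ (ℕₚ.∸-cancelʳ-≡ le le′ r≡)

    diagonal-fresh : ∀ k i r → α ≤ i ℕ.+ k → cellOf i (i ℕ.+ k ∸ α) ∉ diagonal k (suc i) r
    diagonal-fresh k i r real c∈ = let i′ , i< , _ , real′ , eq = ∈-diagonal⁻ k (suc i) r c∈ in
      ℕₚ.<⇒≢ i< (proj₁ (distance-injective real real′ eq))

    diagonal-unique : ∀ k i r → Unique (diagonal k i r)
    diagonal-unique k i zero    = []
    diagonal-unique k i (suc r) with i ℕ.+ k <ᵇ α in e
    ... | true  = diagonal-unique k (suc i) r
    ... | false = Allₚ.¬Any⇒All¬ _ (diagonal-fresh k i r (ℕₚ.≮⇒≥ (λ lt → ≡.subst T e (ℕₚ.<⇒<ᵇ lt)))) ∷ diagonal-unique k (suc i) r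

    disjoint : ∀ n A d k {c} → ¬ (c ∈ diagonal (suc k) 0 n × c ∈ cells A d (suc k))
    disjoint n A d k (c∈ , c∈′) =
      let i , _ , _ , real , eq = ∈-diagonal⁻ (suc k) 0 n c∈
          i′ , k′ , lt , real′ , eq′ = ∈-cells⁻ A d (suc k) c∈′
      in ℕₚ.<⇒≢ lt (proj₂ (distance-injective real real′ (≡.trans (≡.sym eq) eq′)))

    cells-unique : ∀ A d k → Unique (cells A d k)
    cells-unique zero    d       k = []
    cells-unique (suc A) zero    k = Uniqueₚ.++⁺ (diagonal-unique (suc k) 0 A) (cells-unique A m (suc k)) (disjoint A A m k)
    cells-unique (suc A) (suc d) k = Uniqueₚ.++⁺ (diagonal-unique (suc k) 0 (suc A)) (cells-unique (suc A) d (suc k)) (disjoint (suc A) (suc A) d k)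

  values-cong : ∀ {τ τ′} k i r → (∀ i → value τ i k ≡ value τ′ i k) → values τ k i r ≡ values τ′ k i r
  values-cong k i zero    e = ≡.refl
  values-cong k i (suc r) e = ≡.cong₂ _∷_ (e i) (values-cong k (suc i) r e)

  value-cong : ∀ {τ τ′} i k → (α ≤ i ℕ.+ k → τ (cellOf i (i ℕ.+ k ∸ α)) ≡ τ′ (cellOf i (i ℕ.+ k ∸ α))) → value τ i k ≡ value τ′ i k
  value-cong i k e with i ℕ.+ k <ᵇ α in eq
  ... | true  = ≡.refl
  ... | false = e (ℕₚ.≮⇒≥ (λ lt → ≡.subst T eq (ℕₚ.<⇒<ᵇ lt)))

  ok-cong : ∀ {τ τ′} A d k → (∀ i k → value τ i k ≡ value τ′ i k) → ok A d k τ ≡ ok A d k τ′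
  ok-cong zero    d       k e = ≡.refl
  ok-cong (suc A) zero    k e = ≡.cong₂ _∧_ (≡.cong₂ (λ p x → within? (intervals s p) x)
    (values-cong k 0 (suc A) (λ i → e i k)) (values-cong (suc k) 0 A (λ i → e i (suc k)))) (ok-cong A m (suc k) e)
  ok-cong (suc A) (suc d) k e = ≡.cong₂ _∧_ (≡.cong₂ (λ p x → within? (intervals⁺ s p) x)
    (values-cong k 0 (suc A) (λ i → e i k)) (values-cong (suc k) 0 (suc A) (λ i → e i (suc k)))) (ok-cong (suc A) d (suc k) e)

  weight-cong : ∀ {τ τ′} A d k → (∀ i k → value τ i k ≡ value τ′ i k) → weight A d k τ ≡ weight A d k τ′
  weight-cong zero    d       k e = ≡.refl
  weight-cong (suc A) zero    k e = ≡.cong₂ ℕ._+_ (≡.cong sum (values-cong (suc k) 0 A (λ i → e i (suc k)))) (weight-cong A m (suc k) e)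
  weight-cong (suc A) (suc d) k e = ≡.cong₂ ℕ._+_ (≡.cong sum (values-cong (suc k) 0 (suc A) (λ i → e i (suc k)))) (weight-cong (suc A) d (suc k) e)

  LowerOk UpperOk : Filling → ℕ → ℕ → Set
  LowerOk τ i k = value τ i k ℕ.+ s ≤ value τ i (suc k)
  UpperOk τ i k = value τ i (suc k) < value τ (suc i) k ℕ.+ s

  -- The conditions of `ok` listed per position instead of per diagonal, which makes them comparable
  -- with the conditions on a tableau. The upper condition is asked only where the next row reaches
  -- the preceding diagonal.
  LocallyOk : ℕ → ℕ → ℕ → Filling → Set
  LocallyOk A d k τ = ∀ i r → Reaches A d i (suc r) →
    LowerOk τ i (k ℕ.+ r) × (Reaches A d (suc i) r → UpperOk τ i (k ℕ.+ r))

  private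
    within⇒ : ∀ τ k i n → T (within? (intervals s (values τ k i (suc n))) (values τ (suc k) i n)) →
      ∀ i′ → i ≤ i′ → i′ < i ℕ.+ n → LowerOk τ i′ k × UpperOk τ i′ k
    within⇒ τ k i zero    w i′ le lt = ⊥-elim (ℕₚ.<⇒≱ lt (ℕₚ.≤-trans (ℕₚ.≤-reflexive (ℕₚ.+-identityʳ i)) le))
    within⇒ τ k i (suc n) w i′ le lt with ∧-T {between (value τ i k ℕ.+ s) (value τ (suc i) k ℕ.+ s) (value τ i (suc k))} w | ℕₚ.m≤n⇒m<n∨m≡n le
    ... | w₀ , _  | inj₂ ≡.refl = between⇒ _ _ (value τ i (suc k)) w₀
    ... | _  , ws | inj₁ i<i′   = within⇒ τ k (suc i) n ws i′ i<i′ (≡.subst (i′ <_) (ℕₚ.+-suc i n) lt)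

    within⁺⇒ : ∀ τ k i n → T (within? (intervals⁺ s (values τ k i (suc n))) (values τ (suc k) i (suc n))) →
      ∀ i′ → i ≤ i′ → i′ < i ℕ.+ suc n → LowerOk τ i′ k × (suc i′ < i ℕ.+ suc n → UpperOk τ i′ k)
    within⁺⇒ τ k i n w i′ le lt with ℕₚ.m≤n⇒m<n∨m≡n le
    within⁺⇒ τ k i zero    w i′ le lt | inj₁ i<i′ = ⊥-elim (ℕₚ.<⇒≱ lt (ℕₚ.≤-trans (ℕₚ.≤-reflexive (ℕₚ.+-comm i 1)) i<i′))
    within⁺⇒ τ k i zero    w i′ le lt | inj₂ ≡.refl =
      ℕₚ.≤ᵇ⇒≤ _ _ (proj₁ (∧-T {value τ i k ℕ.+ s ≤ᵇ value τ i (suc k)} w)) ,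
      λ lt′ → ⊥-elim (ℕₚ.<⇒≱ lt′ (ℕₚ.≤-reflexive (ℕₚ.+-comm i 1)))
    within⁺⇒ τ k i (suc n) w i′ le lt | inj₂ ≡.refl =
      let lo , up = between⇒ _ _ (value τ i (suc k)) (proj₁ (∧-T {between (value τ i k ℕ.+ s) (value τ (suc i) k ℕ.+ s) (value τ i (suc k))} w)) in lo , λ _ → up
    within⁺⇒ τ k i (suc n) w i′ le lt | inj₁ i<i′ =
      let lo , up = within⁺⇒ τ k (suc i) n (proj₂ (∧-T {between (value τ i k ℕ.+ s) (value τ (suc i) k ℕ.+ s) (value τ i (suc k))} w)) i′ i<i′ (≡.subst (i′ <_) (ℕₚ.+-suc i (suc n)) lt)
      in lo , λ lt′ → up (≡.subst (suc i′ <_) (ℕₚ.+-suc i (suc n)) lt′)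

    T-∧-intro : ∀ {x y} → T x → T y → T (x ∧ y)
    T-∧-intro {true} _ ty = ty

    ⇒between : ∀ {lo hi t} → lo ≤ t → t < hi → T (between lo hi t)
    ⇒between lo hi = T-∧-intro (ℕₚ.≤⇒≤ᵇ lo) (ℕₚ.<⇒<ᵇ hi)

    ⇒within : ∀ τ k i n → (∀ i′ → i ≤ i′ → i′ < i ℕ.+ n → LowerOk τ i′ k × UpperOk τ i′ k) →
      T (within? (intervals s (values τ k i (suc n))) (values τ (suc k) i n))
    ⇒within τ k i zero    f = tt
    ⇒within τ k i (suc n) f = let lo , up = f i ℕₚ.≤-refl (ℕₚ.m<m+n i (s≤s z≤n)) in T-∧-intro
      (⇒between lo up)
      (⇒within τ k (suc i) n (λ i′ le lt → f i′ (ℕₚ.<⇒≤ le) (≡.subst (i′ <_) (≡.sym (ℕₚ.+-suc i n)) lt)))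

    ⇒within⁺ : ∀ τ k i n → (∀ i′ → i ≤ i′ → i′ < i ℕ.+ suc n → LowerOk τ i′ k × (suc i′ < i ℕ.+ suc n → UpperOk τ i′ k)) →
      T (within? (intervals⁺ s (values τ k i (suc n))) (values τ (suc k) i (suc n)))
    ⇒within⁺ τ k i zero    f = T-∧-intro (ℕₚ.≤⇒≤ᵇ (proj₁ (f i ℕₚ.≤-refl (ℕₚ.m<m+n i (s≤s z≤n))))) tt
    ⇒within⁺ τ k i (suc n) f = let lo , up = f i ℕₚ.≤-refl (ℕₚ.m<m+n i (s≤s z≤n)) in T-∧-intro
      (⇒between lo (up (≡.subst (_< i ℕ.+ suc (suc n)) (ℕₚ.+-comm i 1) (ℕₚ.+-monoʳ-< i (s≤s (s≤s z≤n))))))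
      (⇒within⁺ τ k (suc i) n (λ i′ le lt → let lo , up = f i′ (ℕₚ.<⇒≤ le) (≡.subst (i′ <_) (≡.sym (ℕₚ.+-suc i (suc n))) lt)
         in lo , λ lt′ → up (≡.subst (suc i′ <_) (≡.sym (ℕₚ.+-suc i (suc n))) lt′)))

  ok⇒LocallyOk : ∀ A d k τ → T (ok A d k τ) → LocallyOk A d k τ
  ok⇒LocallyOk (suc A) zero    k τ w i zero    reg rewrite ℕₚ.+-identityʳ k =
    let lo , up = within⇒ τ k 0 A (proj₁ (∧-T {within? (intervals s (values τ k 0 (suc A))) (values τ (suc k) 0 A)} w)) i z≤n (row-exists (reaches-zero⁻ reg)) in lo , λ _ → up
  ok⇒LocallyOk (suc A) zero    k τ w i (suc r) reg rewrite ℕₚ.+-suc k r =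
    let lo , up = ok⇒LocallyOk A m (suc k) τ (proj₂ (∧-T {within? (intervals s (values τ k 0 (suc A))) (values τ (suc k) 0 A)} w)) i r (reaches-zero⁻ reg)
    in lo , λ reg′ → up (reaches-zero⁻ reg′)
  ok⇒LocallyOk (suc A) (suc d) k τ w i zero    reg rewrite ℕₚ.+-identityʳ k =
    let lo , up = within⁺⇒ τ k 0 A (proj₁ (∧-T {within? (intervals⁺ s (values τ k 0 (suc A))) (values τ (suc k) 0 (suc A))} w)) i z≤n (row-exists reg)
    in lo , λ reg′ → up (row-exists reg′)
  ok⇒LocallyOk (suc A) (suc d) k τ w i (suc r) reg rewrite ℕₚ.+-suc k r =
    let lo , up = ok⇒LocallyOk (suc A) d (suc k) τ (proj₂ (∧-T {within? (intervals⁺ s (values τ k 0 (suc A))) (values τ (suc k) 0 (suc A))} w)) i r (reaches-suc⁻ reg)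
    in lo , λ reg′ → up (reaches-suc⁻ reg′)

  LocallyOk⇒ok : ∀ A d k τ → LocallyOk A d k τ → T (ok A d k τ)
  LocallyOk⇒ok zero    d       k τ f = tt
  LocallyOk⇒ok (suc A) zero    k τ f = T-∧-intro
    (⇒within τ k 0 A (λ i _ i<A → let lo , up = ≡.subst (λ k → LowerOk τ i k × (Reaches (suc A) 0 (suc i) 0 → UpperOk τ i k)) (ℕₚ.+-identityʳ k) (f i 0 (reaches-zero⁺ (reaches-0 i<A))) in lo , up (reaches-0 (s≤s i<A))))
    (LocallyOk⇒ok A m (suc k) τ (λ i r reg → let lo , up = ≡.subst (λ k → LowerOk τ i k × (Reaches (suc A) 0 (suc i) (suc r) → UpperOk τ i k)) (ℕₚ.+-suc k r) (f i (suc r) (reaches-zero⁺ reg)) in lo , λ reg′ → up (reaches-zero⁺ reg′)))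
  LocallyOk⇒ok (suc A) (suc d) k τ f = T-∧-intro
    (⇒within⁺ τ k 0 A (λ i _ i<A → let lo , up = ≡.subst (λ k → LowerOk τ i k × (Reaches (suc A) (suc d) (suc i) 0 → UpperOk τ i k)) (ℕₚ.+-identityʳ k) (f i 0 (reaches-suc⁺ (reaches-0 i<A))) in lo , λ lt → up (reaches-0 lt)))
    (LocallyOk⇒ok (suc A) d (suc k) τ (λ i r reg → let lo , up = ≡.subst (λ k → LowerOk τ i k × (Reaches (suc A) (suc d) (suc i) (suc r) → UpperOk τ i k)) (ℕₚ.+-suc k r) (f i (suc r) (reaches-suc⁺ reg)) in lo , λ reg′ → up (reaches-suc⁺ reg′)))

  -- The total of the ghost values beyond diagonal `k` when that diagonal holds `g` of them; the
  -- number drops by one per diagonal.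
  ghosts : ℕ → ℕ → ℕ
  ghosts zero    k = 0
  ghosts (suc g) k = sum (map (λ i → γ ℕ.+ i ℕ.+ s ℕ.* suc k) (upFrom 0 g)) ℕ.+ ghosts g (suc k)

  weight-ghosts : ∀ A d k τ → α ≤ A ℕ.+ k → weight A d k τ ≡ ghosts (α ∸ k) k ℕ.+ sum (map τ (cells A d k))
  private
    ghostSum : ℕ → ℕ → ℕ → ℕ
    ghostSum k i zero    = 0
    ghostSum k i (suc r) = if i ℕ.+ k <ᵇ α then γ ℕ.+ i ℕ.+ s ℕ.* k ℕ.+ ghostSum k (suc i) r else ghostSum k (suc i) r

    values-sum : ∀ τ k i r → sum (values τ k i r) ≡ ghostSum k i r ℕ.+ sum (map τ (diagonal k i r))
    values-sum τ k i zero    = ≡.refl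
    values-sum τ k i (suc r) with i ℕ.+ k <ᵇ α
    ... | true  = ≡.trans (≡.cong (γ ℕ.+ i ℕ.+ s ℕ.* k ℕ.+_) (values-sum τ k (suc i) r)) (≡.sym (ℕₚ.+-assoc (γ ℕ.+ i ℕ.+ s ℕ.* k) _ _))
    ... | false = ≡.trans (≡.cong (τ (cellOf i (i ℕ.+ k ∸ α)) ℕ.+_) (values-sum τ k (suc i) r)) (arith (τ (cellOf i (i ℕ.+ k ∸ α))) (ghostSum k (suc i) r) _)
      where
      arith : ∀ x y z → x ℕ.+ (y ℕ.+ z) ≡ y ℕ.+ (x ℕ.+ z)
      arith = ℕ-solve

    -- Either `g` ghosts are still to come, or the position lies past the last ghost; there the
    -- equation with the truncated subtraction may fail, hence the second alternative.
    ghostSum-upFrom : ∀ k i r g → i ℕ.+ g ≡ α ∸ k ⊎ (α ≤ i ℕ.+ k × g ≡ 0) → g ≤ r → ghostSum k i r ≡ sum (map (λ i → γ ℕ.+ i ℕ.+ s ℕ.* k) (upFrom i g))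
    ghostSum-upFrom k i zero    zero    eq le = ≡.refl
    ghostSum-upFrom k i (suc r) zero    eq le with i ℕ.+ k <ᵇ α in e
    ... | false = ghostSum-upFrom k (suc i) r zero (inj₂ (ℕₚ.≤-trans (real eq) (ℕₚ.n≤1+n _) , ≡.refl)) z≤n
      where
      real : i ℕ.+ 0 ≡ α ∸ k ⊎ (α ≤ i ℕ.+ k × 0 ≡ 0) → α ≤ i ℕ.+ k
      real _ = ℕₚ.≮⇒≥ (λ lt → ≡.subst T e (ℕₚ.<⇒<ᵇ lt))
    ... | true = ⊥-elim (ℕₚ.<⇒≱ (ℕₚ.<ᵇ⇒< (i ℕ.+ k) α (≡.subst T (≡.sym e) tt)) (real eq))
      where
      real : i ℕ.+ 0 ≡ α ∸ k ⊎ (α ≤ i ℕ.+ k × 0 ≡ 0) → α ≤ i ℕ.+ k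
      real (inj₂ (le , _)) = le
      real (inj₁ eq) = ℕₚ.≤-trans (ℕₚ.m≤n+m∸n α k) (ℕₚ.≤-reflexive (≡.trans (≡.cong (k ℕ.+_) (≡.trans (≡.sym eq) (ℕₚ.+-identityʳ i))) (ℕₚ.+-comm k i)))
    ghostSum-upFrom k i (suc r) (suc g) (inj₁ eq) (s≤s le) with i ℕ.+ k <ᵇ α in e
    ... | true  = ≡.cong (γ ℕ.+ i ℕ.+ s ℕ.* k ℕ.+_) (ghostSum-upFrom k (suc i) r g (inj₁ (≡.trans (≡.sym (ℕₚ.+-suc i g)) eq)) le)
    ... | false = ⊥-elim (≡.subst T e (ℕₚ.<⇒<ᵇ (ℕₚ.≰⇒> λ α≤ → ℕₚ.m+1+n≰m i (ℕₚ.≤-trans (ℕₚ.≤-reflexive eq) (ℕₚ.m≤n+o⇒m∸n≤o α k (≡.subst (α ≤_) (ℕₚ.+-comm i k) α≤))))))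

    ghosts-step : ∀ A k → α ≤ A ℕ.+ suc k → ghostSum (suc k) 0 A ℕ.+ ghosts (α ∸ suc k) (suc k) ≡ ghosts (α ∸ k) k
    ghosts-step A k le with α ∸ k in e
    ... | zero rewrite ℕₚ.m≤n⇒m∸n≡0 (ℕₚ.≤-trans (ℕₚ.m∸n≡0⇒m≤n e) (ℕₚ.n≤1+n k)) =
      ≡.trans (ℕₚ.+-identityʳ _) (ghostSum-upFrom (suc k) 0 A 0 (inj₂ (ℕₚ.≤-trans (ℕₚ.m∸n≡0⇒m≤n e) (ℕₚ.n≤1+n k) , ≡.refl)) z≤n)
    ... | suc g rewrite ≡.trans (≡.sym (ℕₚ.pred[m∸n]≡m∸[1+n] α k)) (≡.cong ℕ.pred e) =
      ≡.cong (ℕ._+ ghosts g (suc k)) (ghostSum-upFrom (suc k) 0 A g (inj₁ (≡.sym g≡)) (≡.subst (_≤ A) g≡ (ℕₚ.m≤n+o⇒m∸n≤o α (suc k) (≡.subst (α ≤_) (ℕₚ.+-comm A (suc k)) le))))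
      where
      g≡ : α ∸ suc k ≡ g
      g≡ = ≡.trans (≡.sym (ℕₚ.pred[m∸n]≡m∸[1+n] α k)) (≡.cong ℕ.pred e)

    weight-step : ∀ A A′ d′ k τ → α ≤ A ℕ.+ suc k →
      weight A′ d′ (suc k) τ ≡ ghosts (α ∸ suc k) (suc k) ℕ.+ sum (map τ (cells A′ d′ (suc k))) →
      sum (values τ (suc k) 0 A) ℕ.+ weight A′ d′ (suc k) τ ≡
      ghosts (α ∸ k) k ℕ.+ sum (map τ (diagonal (suc k) 0 A ++ cells A′ d′ (suc k)))
    weight-step A A′ d′ k τ le ih = begin
      sum (values τ (suc k) 0 A) ℕ.+ weight A′ d′ (suc k) τ
        ≡⟨ ≡.cong₂ ℕ._+_ (values-sum τ (suc k) 0 A) ih ⟩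
      ghostSum (suc k) 0 A ℕ.+ sum (map τ D) ℕ.+ (ghosts (α ∸ suc k) (suc k) ℕ.+ sum (map τ E))
        ≡⟨ arith (ghostSum (suc k) 0 A) (sum (map τ D)) (ghosts (α ∸ suc k) (suc k)) (sum (map τ E)) ⟩
      ghostSum (suc k) 0 A ℕ.+ ghosts (α ∸ suc k) (suc k) ℕ.+ (sum (map τ D) ℕ.+ sum (map τ E))
        ≡⟨ ≡.cong₂ ℕ._+_ (ghosts-step A k le) (≡.sym (≡.trans (≡.cong sum (map-++ τ D E)) (sum-++ (map τ D) (map τ E)))) ⟩
      ghosts (α ∸ k) k ℕ.+ sum (map τ (D ++ E)) ∎
      where
      open ≡.≡-Reasoning
      D E : List Cell
      D = diagonal (suc k) 0 A
      E = cells A′ d′ (suc k)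
      arith : ∀ x y z w → x ℕ.+ y ℕ.+ (z ℕ.+ w) ≡ x ℕ.+ z ℕ.+ (y ℕ.+ w)
      arith = ℕ-solve

  weight-ghosts zero    d       k τ le rewrite ℕₚ.m≤n⇒m∸n≡0 le = ≡.refl
  weight-ghosts (suc A) zero    k τ le = weight-step A A m k τ le′ (weight-ghosts A m (suc k) τ le′)
    where
    le′ : α ≤ A ℕ.+ suc k
    le′ = ≡.subst (α ≤_) (≡.sym (ℕₚ.+-suc A k)) le
  weight-ghosts (suc A) (suc d) k τ le = weight-step (suc A) (suc A) d k τ le′ (weight-ghosts (suc A) d (suc k) τ le′)
    where
    le′ : α ≤ suc A ℕ.+ suc k
    le′ = ℕₚ.≤-trans le (ℕₚ.+-monoʳ-≤ (suc A) (ℕₚ.n≤1+n k))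

-- Summing one side as a chain of diagonals

module SideSum (R : CommutativeRing 0ℓ 0ℓ) (q : CommutativeRing.Carrier R) (W : ℕ)
               (α γ s m : ℕ) (cellOf : ℕ → ℕ → Cell)
               (cellOf-injective : ∀ {i r i′ r′} → cellOf i r ≡ cellOf i′ r′ → i ≡ i′ × r ≡ r′)
               (s≤1 : s ≤ 1) (γ+α≤W : γ ℕ.+ α ≤ W) where
  open Assignments R q W
  open Side α γ s m cellOf hiding (distance-injective; diagonal-fresh)

  private
    distance-injective : ∀ {i k i′ k′} → α ≤ i ℕ.+ k → α ≤ i′ ℕ.+ k′ →
      cellOf i (i ℕ.+ k ∸ α) ≡ cellOf i′ (i′ ℕ.+ k′ ∸ α) → i ≡ i′ × k ≡ k′
    distance-injective = Side.distance-injective α γ s m cellOf cellOf-injective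

  value-agree : ∀ {τ τ′} A d k₀ {k} i → k ≤ k₀ → AgreeOff (cells A d k₀) τ τ′ → value τ′ i k ≡ value τ i k
  value-agree {τ} {τ′} A d k₀ {k} i k≤ agree = value-cong {τ′} {τ} i k (λ real → agree _ (λ c∈ →
    let i′ , k′ , lt , real′ , eq = ∈-cells⁻ A d k₀ c∈
    in ℕₚ.<⇒≱ lt (≡.subst (_≤ k₀) (proj₂ (distance-injective real real′ eq)) k≤)))

  GhostsForced : ℕ → ℕ → List ℕ → Set
  GhostsForced k i []      = ⊤
  GhostsForced k i (t ∷ x) = (i ℕ.+ k < α → t ≡ γ ℕ.+ i ℕ.+ s ℕ.* k) × GhostsForced k (suc i) x

  ghost<W : ∀ {i k} → i ℕ.+ k < α → γ ℕ.+ i ℕ.+ s ℕ.* k < W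
  ghost<W {i} {k} lt = ℕₚ.≤-<-trans
    (ℕₚ.≤-trans (ℕₚ.+-monoʳ-≤ (γ ℕ.+ i) (ℕₚ.≤-trans (ℕₚ.*-monoˡ-≤ k s≤1) (ℕₚ.≤-reflexive (ℕₚ.*-identityˡ k)))) (ℕₚ.≤-reflexive (ℕₚ.+-assoc γ i k)))
    (ℕₚ.<-≤-trans (ℕₚ.+-monoʳ-< γ lt) γ+α≤W)

  -- Replaces the sum over the cells of a diagonal by one over all lists of its length: at a ghost
  -- position every value but the forced one contributes zero.
  ΣF-diagonal : ∀ k i r τ (h : List ℕ → Carrier) → (∀ x → length x ≡ r → ¬ GhostsForced k i x → h x ≈ 0#) →
    ΣF (diagonal k i r) τ (λ τ → h (values τ k i r)) ≈ ΣL r h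
  ΣF-diagonal k i zero    τ h zeros = refl
  ΣF-diagonal k i (suc r) τ h zeros with i ℕ.+ k <ᵇ α in e
  ... | true  = begin
    ΣF (diagonal k (suc i) r) τ (λ τ → h (g ∷ values τ k (suc i) r))
      ≈⟨ ΣF-diagonal k (suc i) r τ (h ∘ (g ∷_)) (λ x len ¬f → zeros (g ∷ x) (≡.cong suc len) (¬f ∘ proj₂)) ⟩
    ΣL r (h ∘ (g ∷_))
      ≈⟨ Σ<-only W g (λ t → ΣL r (h ∘ (t ∷_))) (ghost<W lt) (λ t t≢ → trans
           (ΣL-cong r (λ x len → trans (zeros (t ∷ x) (≡.cong suc len) (λ f → t≢ (proj₁ f lt))) (sym (zeroˡ 0#))))
           (trans (ΣL-* r 0# (λ _ → 0#)) (zeroˡ _))) ⟨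
    Σ< W (λ t → ΣL r (h ∘ (t ∷_))) ∎
    where
    g : ℕ
    g = γ ℕ.+ i ℕ.+ s ℕ.* k
    lt : i ℕ.+ k < α
    lt = ℕₚ.<ᵇ⇒< (i ℕ.+ k) α (≡.subst T (≡.sym e) tt)
  ... | false = Σ<-cong W (λ t → trans
    (ΣF-cong (diagonal k (suc i) r) (τ [ c ↦ t ]) (λ τ′ agree → reflexive (≡.cong (λ v → h (v ∷ values τ′ k (suc i) r))
      (AgreeOff-head fresh agree))))
    (ΣF-diagonal k (suc i) r (τ [ c ↦ t ]) (h ∘ (t ∷_)) (λ x len ¬f → zeros (t ∷ x) (≡.cong suc len) (¬f ∘ proj₂))))
    where
    c : Cell
    c = cellOf i (i ℕ.+ k ∸ α)
    real : α ≤ i ℕ.+ k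
    real = ℕₚ.≮⇒≥ (λ lt → ≡.subst T e (ℕₚ.<⇒<ᵇ lt))
    fresh : c ∉ diagonal k (suc i) r
    fresh = Side.diagonal-fresh α γ s m cellOf cellOf-injective k i r real

  private
    squeeze : ∀ i k {t} → i ℕ.+ suc k < α → T (between (γ ℕ.+ i ℕ.+ s ℕ.* k ℕ.+ s) (γ ℕ.+ suc i ℕ.+ s ℕ.* k ℕ.+ s) t) →
              t ≡ γ ℕ.+ i ℕ.+ s ℕ.* suc k
    squeeze i k {t} lt w with between⇒ (γ ℕ.+ i ℕ.+ s ℕ.* k ℕ.+ s) (γ ℕ.+ suc i ℕ.+ s ℕ.* k ℕ.+ s) t w
    ... | lo , hi = ≡.trans (ℕₚ.≤-antisym (ℕₚ.≤-pred (≡.subst (t <_) (arith γ i s k) hi)) lo) (arith′ γ i s k)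
      where
      arith : ∀ γ i s k → γ ℕ.+ suc i ℕ.+ s ℕ.* k ℕ.+ s ≡ suc (γ ℕ.+ i ℕ.+ s ℕ.* k ℕ.+ s)
      arith = ℕ-solve
      arith′ : ∀ γ i s k → γ ℕ.+ i ℕ.+ s ℕ.* k ℕ.+ s ≡ γ ℕ.+ i ℕ.+ s ℕ.* suc k
      arith′ = ℕ-solve

    forced-head : ∀ τ k i {t} → T (between (value τ i k ℕ.+ s) (value τ (suc i) k ℕ.+ s) t) → i ℕ.+ suc k < α → t ≡ γ ℕ.+ i ℕ.+ s ℕ.* suc k
    forced-head τ k i {t} w lt = squeeze i k lt (≡.subst₂ (λ u v → T (between (u ℕ.+ s) (v ℕ.+ s) t))
      (value-ghost τ (ℕₚ.<-trans (ℕₚ.+-monoʳ-< i ℕₚ.≤-refl) lt)) (value-ghost τ (≡.subst (_< α) (ℕₚ.+-suc i k) lt)) w)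

    all-real : ∀ k i x → α ≤ i ℕ.+ k → GhostsForced k i x
    all-real k i []      le = tt
    all-real k i (t ∷ x) le = (λ lt → ⊥-elim (ℕₚ.<⇒≱ lt le)) , all-real k (suc i) x (ℕₚ.≤-trans le (ℕₚ.n≤1+n _))

    forced-intervals : ∀ τ k i r x → T (within? (intervals s (values τ k i (suc r))) x) → GhostsForced (suc k) i x
    forced-intervals τ k i zero    []      w = tt
    forced-intervals τ k i (suc r) (t ∷ x) w = forced-head τ k i (proj₁ (∧-T {between (value τ i k ℕ.+ s) (value τ (suc i) k ℕ.+ s) t} w)) , forced-intervals τ k (suc i) r x (proj₂ (∧-T {between (value τ i k ℕ.+ s) (value τ (suc i) k ℕ.+ s) t} w))

    forced-intervals⁺ : ∀ τ k i r x → α ≤ i ℕ.+ suc r ℕ.+ k → T (within? (intervals⁺ s (values τ k i (suc r))) x) → GhostsForced (suc k) i x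
    forced-intervals⁺ τ k i zero    (t ∷ x) le w = all-real (suc k) i (t ∷ x) (≡.subst (α ≤_) (arith i k) le)
      where
      arith : ∀ i k → i ℕ.+ 1 ℕ.+ k ≡ i ℕ.+ suc k
      arith = ℕ-solve
    forced-intervals⁺ τ k i (suc r) (t ∷ x) le w = forced-head τ k i (proj₁ (∧-T {between (value τ i k ℕ.+ s) (value τ (suc i) k ℕ.+ s) t} w)) ,
      forced-intervals⁺ τ k (suc i) r x (≡.subst (α ≤_) (≡.cong (ℕ._+ k) (ℕₚ.+-suc i (suc r))) le) (proj₂ (∧-T {between (value τ i k ℕ.+ s) (value τ (suc i) k ℕ.+ s) t} w))

  sideTerm : ℕ → ℕ → ℕ → Filling → Carrier
  sideTerm A d k τ = ind (ok A d k τ) * q ^ weight A d k τ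

  private
    -- One diagonal of `ΣF-side`, common to both cases. The cells further out are summed first, with
    -- this diagonal fixed; the result depends on the filling only through the values on the
    -- diagonal, which are then summed as a list.
    layer : ∀ n A′ d′ k τ (vs : List ℕ → List (ℕ → Bool)) p (okAll : Filling → Bool) (wtAll : Filling → ℕ) →
      (∀ τ′ → AgreeOff (diagonal (suc k) 0 n ++ cells A′ d′ (suc k)) τ τ′ →
        okAll τ′ ≡ within? (vs p) (values τ′ (suc k) 0 n) ∧ ok A′ d′ (suc k) τ′) →
      (∀ τ′ → wtAll τ′ ≡ sum (values τ′ (suc k) 0 n) ℕ.+ weight A′ d′ (suc k) τ′) →
      length (vs p) ≡ n →
      (∀ x → T (within? (vs p) x) → GhostsForced (suc k) 0 x) →
      (U : List ℕ → Carrier) →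
      (∀ τ → ΣF (cells A′ d′ (suc k)) τ (sideTerm A′ d′ (suc k)) ≈ U (values τ (suc k) 0 n)) →
      ΣF (diagonal (suc k) 0 n ++ cells A′ d′ (suc k)) τ (λ τ → ind (okAll τ) * q ^ wtAll τ) ≈
      ΣI (vs p) (λ x → q ^ (1 ℕ.* sum x) * U x)
    layer n A′ d′ k τ vs p okAll wtAll ok≡ wt≡ len forced U ih = begin
      ΣF (D ++ E) τ (λ τ → ind (okAll τ) * q ^ wtAll τ)
        ≈⟨ ΣF-cong (D ++ E) τ (λ τ′ agree → trans
             (*-cong (trans (reflexive (≡.cong ind (ok≡ τ′ agree))) (ind-∧ (within? (vs p) (xs τ′)) _))
                     (trans (^-congʳ q (wt≡ τ′)) (^-homo-* q (sum (xs τ′)) _)))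
             (shuffle _ _ _ _)) ⟩
      ΣF (D ++ E) τ (λ τ → g (xs τ) * sideTerm A′ d′ (suc k) τ)
        ≈⟨ ΣF-++ D E τ _ ⟩
      ΣF D τ (λ τ → ΣF E τ (λ τ → g (xs τ) * sideTerm A′ d′ (suc k) τ))
        ≈⟨ ΣF-cong D τ (λ τ′ _ → trans (ΣF-pull E τ′ (g ∘ xs) (sideTerm A′ d′ (suc k))
             (λ τ″ agree → reflexive (≡.cong g (values-cong (suc k) 0 n (λ i → value-agree A′ d′ (suc k) i ℕₚ.≤-refl agree)))))
             (*-congˡ (ih τ′))) ⟩
      ΣF D τ (λ τ → g (xs τ) * U (xs τ))
        ≈⟨ ΣF-diagonal (suc k) 0 n τ (λ x → g x * U x) zeros ⟩
      ΣL n (λ x → g x * U x)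
        ≈⟨ ΣL-cong n (λ x _ → trans (*-assoc _ _ _) (*-congˡ (*-congʳ (^-congʳ q (≡.sym (ℕₚ.*-identityˡ (sum x))))))) ⟩
      ΣL n (λ x → ind (within? (vs p) x) * (q ^ (1 ℕ.* sum x) * U x))
        ≡⟨ ≡.cong (λ l → ΣL l (λ x → ind (within? (vs p) x) * (q ^ (1 ℕ.* sum x) * U x))) len ⟨
      ΣL (length (vs p)) (λ x → ind (within? (vs p) x) * (q ^ (1 ℕ.* sum x) * U x))
        ≈⟨ ΣI-ΣL (vs p) _ ⟨
      ΣI (vs p) (λ x → q ^ (1 ℕ.* sum x) * U x) ∎
      where
      D E : List Cell
      D = diagonal (suc k) 0 n
      E = cells A′ d′ (suc k)
      xs : Filling → List ℕ
      xs τ = values τ (suc k) 0 n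
      g : List ℕ → Carrier
      g x = ind (within? (vs p) x) * q ^ sum x
      shuffle : ∀ a b c d → a * b * (c * d) ≈ a * c * (b * d)
      shuffle = MonoidSolver.solve 4 (λ a b c d → ((a ⊕ b) ⊕ (c ⊕ d)) ⊜ ((a ⊕ c) ⊕ (b ⊕ d))) refl
      zeros : ∀ x → length x ≡ n → ¬ GhostsForced (suc k) 0 x → g x * U x ≈ 0#
      zeros x _ ¬f with within? (vs p) x in e
      ... | true  = ⊥-elim (¬f (forced x (≡.subst T (≡.sym e) tt)))
      ... | false = trans (*-congʳ (zeroˡ _)) (zeroˡ _)

    outer-agree : ∀ n A′ d′ k {τ τ′} → AgreeOff (diagonal (suc k) 0 n ++ cells A′ d′ (suc k)) τ τ′ → ∀ i → value τ′ i k ≡ value τ i k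
    outer-agree n A′ d′ k {τ} {τ′} agree i = value-cong {τ′} {τ} i k (λ real → agree _ (λ c∈ →
      [ (λ c∈ˡ → let i′ , _ , _ , real′ , eq = ∈-diagonal⁻ (suc k) 0 n c∈ˡ in
                 ℕₚ.1+n≢n (≡.sym (proj₂ (distance-injective real real′ eq))))
      , (λ c∈ʳ → let i′ , k′ , lt , real′ , eq = ∈-cells⁻ A′ d′ (suc k) c∈ʳ in
                 ℕₚ.<⇒≢ (ℕₚ.<-trans ℕₚ.≤-refl lt) (proj₂ (distance-injective real real′ eq)))
      ]′ (∈-++⁻ (diagonal (suc k) 0 n) c∈)))

  -- The bound on `α` keeps ghosts out of the last row of the next diagonal when that row goes on:
  -- its entry has no upper bound, so nothing would force a ghost there.
  ΣF-side : ∀ A d k τ → α ≤ A ℕ.+ k → ΣF (cells A d k) τ (sideTerm A d k) ≈ cutSum s m (λ _ → 1) A d (values τ k 0 A)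
  ΣF-side zero    d       k τ le = *-identityˡ _
  ΣF-side (suc A) zero    k τ le = layer A A m k τ (intervals s) (values τ k 0 (suc A)) (ok (suc A) 0 k) (weight (suc A) 0 k)
    (λ τ′ agree → ≡.cong (λ p → within? (intervals s p) (values τ′ (suc k) 0 A) ∧ ok A m (suc k) τ′)
      (values-cong k 0 (suc A) (outer-agree A A m k agree)))
    (λ _ → ≡.refl)
    (≡.trans (length-intervals s (value τ 0 k) (values τ k 1 A)) (length-values τ k 1 A))
    (forced-intervals τ k 0 A)
    (cutSum s m (λ _ → 1) A m)
    (λ τ → ΣF-side A m (suc k) τ (≡.subst (α ≤_) (≡.sym (ℕₚ.+-suc A k)) le))
  ΣF-side (suc A) (suc d) k τ le = layer (suc A) (suc A) d k τ (intervals⁺ s) (values τ k 0 (suc A)) (ok (suc A) (suc d) k) (weight (suc A) (suc d) k)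
    (λ τ′ agree → ≡.cong (λ p → within? (intervals⁺ s p) (values τ′ (suc k) 0 (suc A)) ∧ ok (suc A) d (suc k) τ′)
      (values-cong k 0 (suc A) (outer-agree (suc A) (suc A) d k agree)))
    (λ _ → ≡.refl)
    (≡.trans (length-intervals⁺ s (values τ k 0 (suc A))) (length-values τ k 0 (suc A)))
    (λ x → forced-intervals⁺ τ k 0 A x le)
    (cutSum s m (λ _ → 1) (suc A) d)
    (λ τ → ΣF-side (suc A) d (suc k) τ (ℕₚ.≤-trans le (ℕₚ.+-monoʳ-≤ (suc A) (ℕₚ.n≤1+n k))))

-- Geometry of the shape

-- Membership in λ with 0-based coordinates; transposition swaps (α, d) with (β, e).
module Geometry (c m : ℕ) where

  InΛ : ℕ → ℕ → ℕ → ℕ → ℕ → ℕ → Set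
  InΛ α β d e i j = (i < α ℕ.+ c × j < β ℕ.+ c ℕ.+ (d ℕ.+ (α ℕ.+ c ∸ suc i) ℕ.* m))
                  ⊎ (j < β ℕ.+ c × i < α ℕ.+ c ℕ.+ (e ℕ.+ (β ℕ.+ c ∸ suc j) ℕ.* m))

  -- With w = α + c - (i + 1), the row extends d + w m columns past the rectangle. Measured from the
  -- main diagonal, which falls behind by one column per row upwards, this is the distance d + (m +
  -- 1) w.
  arm-cell : ∀ {α} β {d i k r} → i ℕ.+ k ≡ α ℕ.+ r → i < α ℕ.+ c → k ℕ.+ suc m ℕ.* suc i ≤ d ℕ.+ suc m ℕ.* (α ℕ.+ c) →
             β ℕ.+ r < β ℕ.+ c ℕ.+ (d ℕ.+ (α ℕ.+ c ∸ suc i) ℕ.* m)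
  arm-cell {α} β {d} {i} {k} {r} eq i<A le = ℕₚ.+-cancelˡ-≤ α _ _
    (≡.subst₂ _≤_ lhs rhs (s≤s (ℕₚ.+-monoʳ-≤ β (ℕₚ.+-monoʳ-≤ i k≤))))
    where
    w : ℕ
    w = α ℕ.+ c ∸ suc i
    w≡ : suc i ℕ.+ w ≡ α ℕ.+ c
    w≡ = ℕₚ.m+[n∸m]≡n i<A
    split : ∀ d m i w → d ℕ.+ suc m ℕ.* (suc i ℕ.+ w) ≡ d ℕ.+ suc m ℕ.* w ℕ.+ suc m ℕ.* suc i
    split = ℕ-solve
    k≤ : k ≤ d ℕ.+ suc m ℕ.* w
    k≤ = ℕₚ.+-cancelʳ-≤ (suc m ℕ.* suc i) k _ (≡.subst (k ℕ.+ suc m ℕ.* suc i ≤_)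
           (≡.trans (≡.cong (λ x → d ℕ.+ suc m ℕ.* x) (≡.sym w≡)) (split d m i w)) le)
    arith₁ : ∀ α β r → suc (β ℕ.+ (α ℕ.+ r)) ≡ α ℕ.+ suc (β ℕ.+ r)
    arith₁ = ℕ-solve
    lhs : suc (β ℕ.+ (i ℕ.+ k)) ≡ α ℕ.+ suc (β ℕ.+ r)
    lhs = ≡.trans (≡.cong (λ x → suc (β ℕ.+ x)) eq) (arith₁ α β r)
    arith₂ : ∀ β i d m w → suc (β ℕ.+ (i ℕ.+ (d ℕ.+ suc m ℕ.* w))) ≡ β ℕ.+ (suc i ℕ.+ w) ℕ.+ (d ℕ.+ w ℕ.* m)
    arith₂ = ℕ-solve
    arith₃ : ∀ α β c x → β ℕ.+ (α ℕ.+ c) ℕ.+ x ≡ α ℕ.+ (β ℕ.+ c ℕ.+ x)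
    arith₃ = ℕ-solve
    rhs : suc (β ℕ.+ (i ℕ.+ (d ℕ.+ suc m ℕ.* w))) ≡ α ℕ.+ (β ℕ.+ c ℕ.+ (d ℕ.+ w ℕ.* m))
    rhs = ≡.trans (arith₂ β i d m w) (≡.trans (≡.cong (λ x → β ℕ.+ x ℕ.+ (d ℕ.+ w ℕ.* m)) w≡) (arith₃ α β c (d ℕ.+ w ℕ.* m)))

  arm-reach : ∀ {α} β {d i k r} → i ℕ.+ k ≡ α ℕ.+ r → i < α ℕ.+ c →
              β ℕ.+ r < β ℕ.+ c ℕ.+ (d ℕ.+ (α ℕ.+ c ∸ suc i) ℕ.* m) → k ℕ.+ suc m ℕ.* suc i ≤ d ℕ.+ suc m ℕ.* (α ℕ.+ c)
  arm-reach {α} β {d} {i} {k} {r} eq i<A lt = ≡.subst (k ℕ.+ suc m ℕ.* suc i ≤_)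
    (≡.trans (≡.sym (split d m i w)) (≡.cong (λ x → d ℕ.+ suc m ℕ.* x) w≡))
    (ℕₚ.+-monoˡ-≤ (suc m ℕ.* suc i) (ℕₚ.+-cancelˡ-≤ (suc i) k _ (≡.subst₂ _≤_ lhs rhs (ℕₚ.+-monoʳ-≤ α (ℕₚ.+-cancelˡ-≤ β _ _ lt′)))))
    where
    w : ℕ
    w = α ℕ.+ c ∸ suc i
    w≡ : suc i ℕ.+ w ≡ α ℕ.+ c
    w≡ = ℕₚ.m+[n∸m]≡n i<A
    split : ∀ d m i w → d ℕ.+ suc m ℕ.* (suc i ℕ.+ w) ≡ d ℕ.+ suc m ℕ.* w ℕ.+ suc m ℕ.* suc i
    split = ℕ-solve
    lt′ : β ℕ.+ suc r ≤ β ℕ.+ (c ℕ.+ (d ℕ.+ w ℕ.* m))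
    lt′ = ≡.subst₂ _≤_ (≡.sym (ℕₚ.+-suc β r)) (ℕₚ.+-assoc β c _) lt
    lhs : α ℕ.+ suc r ≡ suc i ℕ.+ k
    lhs = ≡.trans (ℕₚ.+-suc α r) (≡.cong suc (≡.sym eq))
    arith : ∀ i d m w → suc i ℕ.+ w ℕ.+ (d ℕ.+ w ℕ.* m) ≡ suc i ℕ.+ (d ℕ.+ suc m ℕ.* w)
    arith = ℕ-solve
    rhs : α ℕ.+ (c ℕ.+ (d ℕ.+ w ℕ.* m)) ≡ suc i ℕ.+ (d ℕ.+ suc m ℕ.* w)
    rhs = ≡.trans (≡.sym (ℕₚ.+-assoc α c _)) (≡.trans (≡.cong (ℕ._+ (d ℕ.+ w ℕ.* m)) (≡.sym w≡)) (arith i d m w))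

  -- A cell on this side that belongs to the shape through the other arm's condition lies in one of
  -- the columns below β + c, hence in a row above α + c as well.
  side-reach : ∀ {α β d e i k r} → i ℕ.+ k ≡ α ℕ.+ r → InΛ α β d e i (β ℕ.+ r) →
               i < α ℕ.+ c × k ℕ.+ suc m ℕ.* suc i ≤ d ℕ.+ suc m ℕ.* (α ℕ.+ c)
  side-reach {α} {β} eq (inj₁ (i<A , lt)) = i<A , arm-reach β eq i<A lt
  side-reach {α} {β} {d} {e} {i} {k} {r} eq (inj₂ (lt , _)) = i<A , arm-reach β {d = d} eq i<A (ℕₚ.<-≤-trans lt (ℕₚ.m≤m+n _ _))
    where
    r<c : r < c
    r<c = ℕₚ.+-cancelˡ-< β r c lt
    i<A : i < α ℕ.+ c
    i<A = ℕₚ.≤-<-trans (ℕₚ.≤-trans (ℕₚ.m≤m+n i k) (ℕₚ.≤-reflexive eq)) (ℕₚ.+-monoʳ-< α r<c)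

  locate : ∀ {α β i j} → ¬ (i < α × j < β) → i ℕ.+ β ≤ j ℕ.+ α → ∃₂ λ r k → j ≡ β ℕ.+ r × i ℕ.+ k ≡ α ℕ.+ r
  locate {α} {β} {i} {j} outside le = r , k , j≡ , ℕₚ.m+[n∸m]≡n i≤
    where
    β≤j : β ≤ j
    β≤j = ℕₚ.≮⇒≥ λ j<β → outside (ℕₚ.+-cancelʳ-< β i α (ℕₚ.≤-<-trans le (≡.subst (j ℕ.+ α <_) (ℕₚ.+-comm β α) (ℕₚ.+-monoˡ-< α j<β))) , j<β)
    r k : ℕ
    r = j ∸ β
    k = α ℕ.+ r ∸ i
    j≡ : j ≡ β ℕ.+ r
    j≡ = ≡.sym (ℕₚ.m+[n∸m]≡n β≤j)
    arith : ∀ α β r → β ℕ.+ r ℕ.+ α ≡ α ℕ.+ r ℕ.+ β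
    arith = ℕ-solve
    i≤ : i ≤ α ℕ.+ r
    i≤ = ℕₚ.+-cancelʳ-≤ β i (α ℕ.+ r) (≡.subst (i ℕ.+ β ≤_) (≡.trans (≡.cong (ℕ._+ α) j≡) (arith α β r)) le)

  shrinkʳ : ∀ {α β d e i j j′} → j ≤ j′ → InΛ α β d e i j′ → InΛ α β d e i j
  shrinkʳ j≤ (inj₁ (i< , j′<)) = inj₁ (i< , ℕₚ.≤-<-trans j≤ j′<)
  shrinkʳ {α} {β} {d} {e} j≤ (inj₂ (j′< , i<)) = inj₂ (ℕₚ.≤-<-trans j≤ j′< ,
    ℕₚ.<-≤-trans i< (ℕₚ.+-monoʳ-≤ (α ℕ.+ c) (ℕₚ.+-monoʳ-≤ e (ℕₚ.*-monoˡ-≤ m (ℕₚ.∸-monoʳ-≤ (β ℕ.+ c) (s≤s j≤))))))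

  shrinkˡ : ∀ {α β d e i i′ j} → i ≤ i′ → InΛ α β d e i′ j → InΛ α β d e i j
  shrinkˡ i≤ p = Sum.swap (shrinkʳ i≤ (Sum.swap p))

all⇒ : {A : Set} (p : A → Bool) (xs : List A) → T (all p xs) → ∀ {x} → x ∈ xs → T (p x)
all⇒ p (x ∷ xs) t (here ≡.refl) = proj₁ (∧-T t)
all⇒ p (x ∷ xs) t (there x∈)    = all⇒ p xs (proj₂ (∧-T {p x} t)) x∈

⇒all : {A : Set} (p : A → Bool) (xs : List A) → (∀ {x} → x ∈ xs → T (p x)) → T (all p xs)
⇒all p []       f = tt
⇒all p (x ∷ xs) f = Equivalence.from T-∧ (f (here ≡.refl) , ⇒all p xs (f ∘ there))

-- Semistandard tableaux and the cut along the main diagonal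

module Tableaux (a b c d e m : ℕ) where
  open Shape a b c d e m
  open Geometry c m

  A B : ℕ
  A = a ℕ.+ c
  B = b ℕ.+ c

  cellᵁ cellᴸ : ℕ → ℕ → Cell
  cellᵁ i r = suc i , suc (b ℕ.+ r)
  cellᴸ j r = suc (a ℕ.+ r) , suc j

  cellᵁ-injective : ∀ {i r i′ r′} → cellᵁ i r ≡ cellᵁ i′ r′ → i ≡ i′ × r ≡ r′
  cellᵁ-injective e = ℕₚ.suc-injective (≡.cong proj₁ e) , ℕₚ.+-cancelˡ-≡ b _ _ (ℕₚ.suc-injective (≡.cong proj₂ e))

  cellᴸ-injective : ∀ {j r j′ r′} → cellᴸ j r ≡ cellᴸ j′ r′ → j ≡ j′ × r ≡ r′
  cellᴸ-injective e = ℕₚ.suc-injective (≡.cong proj₂ e) , ℕₚ.+-cancelˡ-≡ a _ _ (ℕₚ.suc-injective (≡.cong proj₁ e))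

  module U = Side a b 0 m cellᵁ
  module L = Side b 0 1 m cellᴸ

  record Inπ (i j : ℕ) : Set where
    constructor inside
    field
      inΛ     : InΛ a b d e i j
      outside : ¬ (i < a × j < b)
  open Inπ

  private
    T-not : ∀ {x} → T (not x) → ¬ T x
    T-not {false} _ ()

    ⇒T-not : ∀ {x} → ¬ T x → T (not x)
    ⇒T-not {true}  f = ⊥-elim (f tt)
    ⇒T-not {false} f = tt

    inλ⇒ : ∀ i j → T (inλ (suc i) (suc j)) → InΛ a b d e i j
    inλ⇒ i j t with Equivalence.to (T-∨ {(i <ᵇ A) ∧ (j <ᵇ B ℕ.+ ν (suc i))}) t
    ... | inj₁ t₁ = let x , y = ∧-T {i <ᵇ A} t₁ in inj₁ (ℕₚ.<ᵇ⇒< i A x , ℕₚ.<ᵇ⇒< j _ y)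
    ... | inj₂ t₂ = let x , y = ∧-T {j <ᵇ B} t₂ in inj₂ (ℕₚ.<ᵇ⇒< j B x , ℕₚ.<ᵇ⇒< i _ y)

    ⇒inλ : ∀ i j → InΛ a b d e i j → T (inλ (suc i) (suc j))
    ⇒inλ i j (inj₁ (x , y)) = Equivalence.from (T-∨ {(i <ᵇ A) ∧ (j <ᵇ B ℕ.+ ν (suc i))})
      (inj₁ (Equivalence.from T-∧ (ℕₚ.<⇒<ᵇ x , ℕₚ.<⇒<ᵇ y)))
    ⇒inλ i j (inj₂ (x , y)) = Equivalence.from (T-∨ {(i <ᵇ A) ∧ (j <ᵇ B ℕ.+ ν (suc i))})
      (inj₂ (Equivalence.from T-∧ (ℕₚ.<⇒<ᵇ x , ℕₚ.<⇒<ᵇ y)))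

  box-cartesian : box ≡ cartesianProduct (range1 R) (range1 C)
  box-cartesian = go (range1 R)
    where
    go : ∀ is → concatMap (λ i → map (λ j → (i , j)) (range1 C)) is ≡ cartesianProduct is (range1 C)
    go []       = ≡.refl
    go (i ∷ is) = ≡.cong (map (i ,_) (range1 C) ++_) (go is)

  inΛ-bounds : ∀ {i j} → InΛ a b d e i j → i < R × j < C
  inΛ-bounds {i} {j} (inj₁ (x , y)) =
    ℕₚ.<-≤-trans x (ℕₚ.≤-trans (ℕₚ.m≤m+n A e) (ℕₚ.m≤m+n _ _)) ,
    ℕₚ.<-≤-trans y (ℕₚ.≤-trans (ℕₚ.+-monoʳ-≤ B (ℕₚ.+-monoʳ-≤ d (ℕₚ.*-monoˡ-≤ m (ℕₚ.m∸n≤m A (suc i)))))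
      (ℕₚ.≤-reflexive (≡.sym (ℕₚ.+-assoc B d _))))
  inΛ-bounds {i} {j} (inj₂ (x , y)) =
    ℕₚ.<-≤-trans y (ℕₚ.≤-trans (ℕₚ.+-monoʳ-≤ A (ℕₚ.+-monoʳ-≤ e (ℕₚ.*-monoˡ-≤ m (ℕₚ.m∸n≤m B (suc j)))))
      (ℕₚ.≤-reflexive (≡.sym (ℕₚ.+-assoc A e _)))) ,
    ℕₚ.<-≤-trans x (ℕₚ.≤-trans (ℕₚ.m≤m+n B d) (ℕₚ.m≤m+n _ _))

  ∈π⁺ : ∀ {i j} → Inπ i j → (suc i , suc j) ∈ cellsπ
  ∈π⁺ {i} {j} (inside p out) = ∈-filter⁺ (λ c → T? _)
    (≡.subst ((suc i , suc j) ∈_) (≡.sym box-cartesian)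
      (∈-cartesianProduct⁺ (∈-applyUpTo⁺ suc (proj₁ (inΛ-bounds p))) (∈-applyUpTo⁺ suc (proj₂ (inΛ-bounds p)))))
    (Equivalence.from T-∧ (⇒inλ i j p , ⇒T-not (λ t → let x , y = ∧-T {i <ᵇ a} t in out (ℕₚ.<ᵇ⇒< i a x , ℕₚ.<ᵇ⇒< j b y))))

  ∈π⁻ : ∀ {x} → x ∈ cellsπ → ∃₂ λ i j → x ≡ (suc i , suc j) × Inπ i j
  ∈π⁻ {x} x∈ with ∈-filter⁻ (λ c → T? _) {xs = box} x∈
  ... | x∈box , t with ∈-cartesianProduct⁻ (range1 R) (range1 C) (≡.subst (x ∈_) box-cartesian x∈box)
  ... | i∈ , j∈ with ∈-applyUpTo⁻ suc i∈ | ∈-applyUpTo⁻ suc j∈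
  ... | i , _ , ≡.refl | j , _ , ≡.refl = i , j , ≡.refl ,
    inside (inλ⇒ i j (proj₁ (∧-T {inλ (suc i) (suc j)} t)))
      (λ { (x , y) → T-not (proj₂ (∧-T {inλ (suc i) (suc j)} t)) (Equivalence.from T-∧ (ℕₚ.<⇒<ᵇ x , ℕₚ.<⇒<ᵇ y)) })

  cellsπ-unique : Unique cellsπ
  cellsπ-unique = Uniqueₚ.filter⁺ (λ c → T? _) (≡.subst Unique (≡.sym box-cartesian)
    (Uniqueₚ.cartesianProduct⁺ (range-unique R) (range-unique C)))
    where
    range-unique : ∀ n → Unique (range1 n)
    range-unique n = Uniqueₚ.applyUpTo⁺₁ suc n (λ i<j _ e → ℕₚ.<⇒≢ i<j (ℕₚ.suc-injective e))

  onᵁ : ∀ {i k r} → i ℕ.+ k ≡ a ℕ.+ r → Inπ i (b ℕ.+ r) → U.Reaches A d i k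
  onᵁ eq p = let i<A , le = side-reach eq (inΛ p) in U.reaches i<A le

  onᴸ : ∀ {j k r} → j ℕ.+ k ≡ b ℕ.+ r → Inπ (a ℕ.+ r) j → L.Reaches B e j k
  onᴸ eq p = let j<B , le = side-reach eq (Sum.swap (inΛ p)) in L.reaches j<B le

  fromᵁ : ∀ {i k r} → i ℕ.+ k ≡ a ℕ.+ r → U.Reaches A d i k → Inπ i (b ℕ.+ r)
  fromᵁ {r = r} eq (U.reaches i<A le) = inside (inj₁ (i<A , arm-cell b {d = d} eq i<A le)) (λ { (_ , lt) → ℕₚ.m+n≮m b r lt })

  fromᴸ : ∀ {j k r} → j ℕ.+ k ≡ b ℕ.+ r → L.Reaches B e j k → Inπ (a ℕ.+ r) j
  fromᴸ {r = r} eq (L.reaches j<B le) = inside (inj₂ (j<B , arm-cell a {d = e} eq j<B le)) (λ { (lt , _) → ℕₚ.m+n≮m a r lt })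

  -- The main diagonal counts as distance 0 of the upper side; the lower side starts at distance 1.
  data Located : ℕ → ℕ → Set where
    upper : ∀ i k r → i ℕ.+ k ≡ a ℕ.+ r → Located i (b ℕ.+ r)
    lower : ∀ j k r → j ℕ.+ suc k ≡ b ℕ.+ r → Located (a ℕ.+ r) j

  located : ∀ {i j} → Inπ i j → Located i j
  located {i} {j} (inside p out) with i ℕ.+ b ℕ.≤? j ℕ.+ a
  ... | yes le with locate out le
  ...   | r , k , ≡.refl , eq = upper i k r eq
  located {i} {j} (inside p out) | no ¬le with locate {b} {a} {j} {i} (λ { (x , y) → out (y , x) }) (ℕₚ.<⇒≤ (ℕₚ.≰⇒> ¬le))
  ...   | r , suc k , ≡.refl , eq = lower j k r eq
  ...   | r , zero , ≡.refl , eq = ⊥-elim (¬le (ℕₚ.≤-reflexive (≡.trans (arith a r b) (≡.trans (≡.cong (ℕ._+ a) (≡.sym eq)) (≡.cong (ℕ._+ a) (ℕₚ.+-identityʳ j))))))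
    where
    arith : ∀ a r b → a ℕ.+ r ℕ.+ b ≡ b ℕ.+ r ℕ.+ a
    arith = ℕ-solve

  main : ℕ → ℕ → List Cell
  main r zero    = []
  main r (suc n) = (suc (a ℕ.+ r) , suc (b ℕ.+ r)) ∷ main (suc r) n

  ∈-main⁻ : ∀ r n {x} → x ∈ main r n → ∃ λ r′ → r ≤ r′ × r′ < r ℕ.+ n × x ≡ (suc (a ℕ.+ r′) , suc (b ℕ.+ r′))
  ∈-main⁻ r (suc n) (here ≡.refl) = r , ℕₚ.≤-refl , ℕₚ.m<m+n r (s≤s z≤n) , ≡.refl
  ∈-main⁻ r (suc n) (there x∈) = let r′ , le , lt , eq = ∈-main⁻ (suc r) n x∈ in
    r′ , ℕₚ.<⇒≤ le , ≡.subst (r′ <_) (≡.sym (ℕₚ.+-suc r n)) lt , eq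

  ∈-main⁺ : ∀ r n r′ → r ≤ r′ → r′ < r ℕ.+ n → (suc (a ℕ.+ r′) , suc (b ℕ.+ r′)) ∈ main r n
  ∈-main⁺ r zero    r′ le lt = ⊥-elim (ℕₚ.<⇒≱ lt (ℕₚ.≤-trans (ℕₚ.≤-reflexive (ℕₚ.+-identityʳ r)) le))
  ∈-main⁺ r (suc n) r′ le lt with ℕₚ.m≤n⇒m<n∨m≡n le
  ... | inj₁ r<r′   = there (∈-main⁺ (suc r) n r′ r<r′ (≡.subst (r′ <_) (ℕₚ.+-suc r n) lt))
  ... | inj₂ ≡.refl = here ≡.refl

  main-unique : ∀ r n → Unique (main r n)
  main-unique r zero    = []
  main-unique r (suc n) = Allₚ.¬Any⇒All¬ _ (λ x∈ → let r′ , le , _ , eq = ∈-main⁻ (suc r) n x∈ in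
    ℕₚ.<⇒≢ le (ℕₚ.+-cancelˡ-≡ a r r′ (ℕₚ.suc-injective (≡.cong proj₁ eq)))) ∷ main-unique (suc r) n

  cut : List Cell
  cut = main 0 c ++ U.cells A d 0 ++ L.cells B e 0

  -- In cut coordinates, row + b + k = column + a on the upper side and row + b = column + a + k on the lower one.
  keyᵁ : ∀ {x} → x ∈ U.cells A d 0 → ∃ λ k → proj₁ x ℕ.+ b ℕ.+ suc k ≡ proj₂ x ℕ.+ a
  keyᵁ x∈ with U.∈-cells-reaches⁻ A d 0 x∈
  ... | i , k , _ , real , ≡.refl = k , (begin
    suc i ℕ.+ b ℕ.+ suc k                           ≡⟨ arith₁ i b k ⟩
    suc b ℕ.+ (i ℕ.+ suc k)                         ≡⟨ ≡.cong (suc b ℕ.+_) (ℕₚ.m∸n+n≡m real) ⟨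
    suc b ℕ.+ (i ℕ.+ suc k ∸ a ℕ.+ a)               ≡⟨ ℕₚ.+-assoc (suc b) (i ℕ.+ suc k ∸ a) a ⟨
    suc (b ℕ.+ (i ℕ.+ suc k ∸ a)) ℕ.+ a             ∎)
    where
    open ≡.≡-Reasoning
    arith₁ : ∀ i b k → suc i ℕ.+ b ℕ.+ suc k ≡ suc b ℕ.+ (i ℕ.+ suc k)
    arith₁ = ℕ-solve

  keyᴸ : ∀ {x} → x ∈ L.cells B e 0 → ∃ λ k → proj₁ x ℕ.+ b ≡ proj₂ x ℕ.+ a ℕ.+ suc k
  keyᴸ x∈ with L.∈-cells-reaches⁻ B e 0 x∈
  ... | j , k , _ , real , ≡.refl = k , (begin
    suc (a ℕ.+ (j ℕ.+ suc k ∸ b)) ℕ.+ b             ≡⟨ ℕₚ.+-assoc (suc a) (j ℕ.+ suc k ∸ b) b ⟩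
    suc a ℕ.+ (j ℕ.+ suc k ∸ b ℕ.+ b)               ≡⟨ ≡.cong (suc a ℕ.+_) (ℕₚ.m∸n+n≡m real) ⟩
    suc a ℕ.+ (j ℕ.+ suc k)                         ≡⟨ arith₁ j a k ⟩
    suc j ℕ.+ a ℕ.+ suc k                           ∎)
    where
    open ≡.≡-Reasoning
    arith₁ : ∀ j a k → suc a ℕ.+ (j ℕ.+ suc k) ≡ suc j ℕ.+ a ℕ.+ suc k
    arith₁ = ℕ-solve

  keyᴹ : ∀ {x} → x ∈ main 0 c → proj₁ x ℕ.+ b ≡ proj₂ x ℕ.+ a
  keyᴹ x∈ with ∈-main⁻ 0 c x∈
  ... | r , _ , _ , ≡.refl = arith a b r
    where
    arith : ∀ a b r → suc (a ℕ.+ r) ℕ.+ b ≡ suc (b ℕ.+ r) ℕ.+ a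
    arith = ℕ-solve

  cut-unique : Unique cut
  cut-unique = Uniqueₚ.++⁺ (main-unique 0 c)
    (Uniqueₚ.++⁺ (U.cells-unique cellᵁ-injective A d 0) (L.cells-unique cellᴸ-injective B e 0) disjointᵁᴸ)
    disjointᴹ
    where
    disjointᵁᴸ : ∀ {x} → ¬ (x ∈ U.cells A d 0 × x ∈ L.cells B e 0)
    disjointᵁᴸ (x∈ , x∈′) with keyᵁ x∈ | keyᴸ x∈′
    ... | k , p | k′ , p′ = ℕₚ.m+1+n≢m _ (≡.trans (≡.sym (ℕₚ.+-assoc _ (suc k′) (suc k))) (≡.trans (≡.cong (ℕ._+ suc k) (≡.sym p′)) p))
    disjointᴹ : ∀ {x} → ¬ (x ∈ main 0 c × x ∈ U.cells A d 0 ++ L.cells B e 0)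
    disjointᴹ (x∈ , x∈′) with ∈-++⁻ (U.cells A d 0) x∈′
    ... | inj₁ u∈ = let k , p = keyᵁ u∈ in ℕₚ.m+1+n≢m _ (≡.trans p (≡.sym (keyᴹ x∈)))
    ... | inj₂ l∈ = let k , p = keyᴸ l∈ in ℕₚ.m+1+n≢m _ (≡.trans (≡.sym p) (keyᴹ x∈))

  π⊆cut : ∀ {x} → x ∈ cellsπ → x ∈ cut
  π⊆cut x∈ with ∈π⁻ x∈
  ... | i , j , ≡.refl , p with located p
  ...   | lower j k r eq = ∈-++⁺ʳ (main 0 c) (∈-++⁺ʳ (U.cells A d 0) (≡.subst (λ r → (suc (a ℕ.+ r) , suc j) ∈ L.cells B e 0)
          (≡.trans (≡.cong (_∸ b) eq) (ℕₚ.m+n∸m≡n b r))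
          (L.∈-cells⁺ B e 0 j k (onᴸ eq p) (≡.subst (b ≤_) (≡.sym eq) (ℕₚ.m≤m+n b r)))))
  ...   | upper i (suc k) r eq = ∈-++⁺ʳ (main 0 c) (∈-++⁺ˡ (≡.subst (λ r → (suc i , suc (b ℕ.+ r)) ∈ U.cells A d 0)
          (≡.trans (≡.cong (_∸ a) eq) (ℕₚ.m+n∸m≡n a r))
          (U.∈-cells⁺ A d 0 i k (onᵁ eq p) (≡.subst (a ≤_) (≡.sym eq) (ℕₚ.m≤m+n a r)))))
  ...   | upper i zero r eq with ≡.trans (≡.sym (ℕₚ.+-identityʳ i)) eq
  ...     | ≡.refl = ∈-++⁺ˡ (∈-main⁺ 0 c r z≤n (ℕₚ.+-cancelˡ-< a r c (U.Reaches.row-exists (onᵁ eq p))))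

  cut⊆π : ∀ {x} → x ∈ cut → x ∈ cellsπ
  cut⊆π x∈ with ∈-++⁻ (main 0 c) x∈
  ... | inj₁ x∈ᴹ with ∈-main⁻ 0 c x∈ᴹ
  ...   | r , _ , r<c , ≡.refl = ∈π⁺ (fromᵁ (ℕₚ.+-identityʳ _) (U.reaches-0 (ℕₚ.+-monoʳ-< a r<c)))
  cut⊆π x∈ | inj₂ x∈′ with ∈-++⁻ (U.cells A d 0) x∈′
  ...   | inj₁ x∈ᵁ with U.∈-cells-reaches⁻ A d 0 x∈ᵁ
  ...     | i , k , reg , real , ≡.refl = ∈π⁺ (fromᵁ (≡.sym (ℕₚ.m+[n∸m]≡n real)) reg)
  cut⊆π x∈ | inj₂ x∈′ | inj₂ x∈ᴸ with L.∈-cells-reaches⁻ B e 0 x∈ᴸ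
  ...     | j , k , reg , real , ≡.refl = ∈π⁺ (fromᴸ (≡.sym (ℕₚ.m+[n∸m]≡n real)) reg)

  cellsπ↭cut : cellsπ ↭ cut
  cellsπ↭cut = ∼bag⇒↭ (unique∧set⇒bag cellsπ-unique cut-unique (mk⇔ π⊆cut cut⊆π))

  record Semistandard (τ : Filling) : Set where
    field
      row : ∀ {i j j′} → Inπ i j → Inπ i j′ → j ≤ j′ → τ (suc i , suc j) ≤ τ (suc i , suc j′)
      col : ∀ {i i′ j} → Inπ i j → Inπ i′ j → i < i′ → τ (suc i , suc j) < τ (suc i′ , suc j)

  stepʳ : ∀ {i j j′} → j < j′ → Inπ i j → Inπ i j′ → Inπ i (suc j)
  stepʳ j<j′ p p′ = inside (shrinkʳ {a} {b} {d} {e} j<j′ (inΛ p′)) (λ { (x , y) → outside p (x , ℕₚ.<-trans ℕₚ.≤-refl y) })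

  stepᶜ : ∀ {i i′ j} → i < i′ → Inπ i j → Inπ i′ j → Inπ (suc i) j
  stepᶜ i<i′ p p′ = inside (shrinkˡ {a} {b} {d} {e} i<i′ (inΛ p′)) (λ { (x , y) → outside p (ℕₚ.<-trans ℕₚ.≤-refl x , y) })

  module _ (τ : Filling) where

    valueᵁ : ∀ {i k r} → i ℕ.+ k ≡ a ℕ.+ r → U.value τ i k ≡ τ (suc i , suc (b ℕ.+ r))
    valueᵁ {i} {k} {r} eq = ≡.trans (U.value-real τ (≡.subst (a ≤_) (≡.sym eq) (ℕₚ.m≤m+n a r)))
      (≡.cong (λ r → τ (suc i , suc (b ℕ.+ r))) (≡.trans (≡.cong (_∸ a) eq) (ℕₚ.m+n∸m≡n a r)))

    valueᴸ : ∀ {j k r} → j ℕ.+ k ≡ b ℕ.+ r → L.value τ j k ≡ τ (suc (a ℕ.+ r) , suc j)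
    valueᴸ {j} {k} {r} eq = ≡.trans (L.value-real τ (≡.subst (b ≤_) (≡.sym eq) (ℕₚ.m≤m+n b r)))
      (≡.cong (λ r → τ (suc (a ℕ.+ r) , suc j)) (≡.trans (≡.cong (_∸ b) eq) (ℕₚ.m+n∸m≡n b r)))

    module _ (okᵁ : U.LocallyOk A d 0 τ) (okᴸ : L.LocallyOk B e 0 τ) where

      -- On the upper side a step to the right goes one diagonal outwards, which is `LowerOk` with s
      -- = 0. On the lower side it goes to the next column and one diagonal inwards, which is
      -- `UpperOk`, weak because s = 1.
      adjacent-row : ∀ {i j} → Inπ i j → Inπ i (suc j) → τ (suc i , suc j) ≤ τ (suc i , suc (suc j))
      adjacent-row p p′ with located p
      ... | upper i k r eq = ≡.subst₂ _≤_ (≡.trans (ℕₚ.+-identityʳ _) (valueᵁ eq)) (≡.trans (valueᵁ eq′) (≡.cong (λ j → τ (suc i , suc j)) (ℕₚ.+-suc b r)))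
            (proj₁ (okᵁ i k (onᵁ eq′ (≡.subst (Inπ i) (≡.sym (ℕₚ.+-suc b r)) p′))))
        where
        eq′ : i ℕ.+ suc k ≡ a ℕ.+ suc r
        eq′ = ≡.trans (ℕₚ.+-suc i k) (≡.trans (≡.cong suc eq) (≡.sym (ℕₚ.+-suc a r)))
      ... | lower j k r eq = ℕₚ.≤-pred (≡.subst₂ _<_ (valueᴸ eq) (≡.trans (ℕₚ.+-comm _ 1) (≡.cong suc (valueᴸ eq′)))
            (proj₂ (okᴸ j k (onᴸ eq p)) (onᴸ eq′ p′)))
        where
        eq′ : suc j ℕ.+ k ≡ b ℕ.+ r
        eq′ = ≡.trans (≡.sym (ℕₚ.+-suc j k)) eq

      adjacent-col : ∀ {i j} → Inπ i j → Inπ (suc i) j → τ (suc i , suc j) < τ (suc (suc i) , suc j)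
      adjacent-col p p′ with located p
      ... | upper i (suc k) r eq = ≡.subst₂ _<_ (valueᵁ eq) (≡.trans (ℕₚ.+-identityʳ _) (valueᵁ eq′))
            (proj₂ (okᵁ i k (onᵁ eq p)) (onᵁ eq′ p′))
        where
        eq′ : suc i ℕ.+ k ≡ a ℕ.+ r
        eq′ = ≡.trans (≡.sym (ℕₚ.+-suc i k)) eq
      -- From a cell of the main diagonal the step down enters the lower side.
      ... | upper i zero r eq with ≡.trans (≡.sym (ℕₚ.+-identityʳ i)) eq
      ...   | ≡.refl = lower-step p p′ (b ℕ.+ r) 0 r (ℕₚ.+-identityʳ _) ≡.refl
        where
        lower-step : ∀ {i j} → Inπ i j → Inπ (suc i) j → ∀ j₀ k r → j₀ ℕ.+ k ≡ b ℕ.+ r → (i , j) ≡ (a ℕ.+ r , j₀) → τ (suc i , suc j) < τ (suc (suc i) , suc j)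
        lower-step p p′ j k r eq ≡.refl = ≡.subst₂ _≤_ (≡.trans (ℕₚ.+-comm _ 1) (≡.cong suc (valueᴸ eq))) (≡.trans (valueᴸ eq′) (≡.cong (λ i → τ (suc i , suc j)) (ℕₚ.+-suc a r)))
          (proj₁ (okᴸ j k (onᴸ eq′ (≡.subst (λ i → Inπ i j) (≡.sym (ℕₚ.+-suc a r)) p′))))
          where
          eq′ : j ℕ.+ suc k ≡ b ℕ.+ suc r
          eq′ = ≡.trans (ℕₚ.+-suc j k) (≡.trans (≡.cong suc eq) (≡.sym (ℕₚ.+-suc b r)))
      adjacent-col p p′ | lower j k r eq = ≡.subst₂ _≤_ (≡.trans (ℕₚ.+-comm _ 1) (≡.cong suc (valueᴸ eq))) (≡.trans (valueᴸ eq′) (≡.cong (λ i → τ (suc i , suc j)) (ℕₚ.+-suc a r)))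
          (proj₁ (okᴸ j (suc k) (onᴸ eq′ (≡.subst (λ i → Inπ i j) (≡.sym (ℕₚ.+-suc a r)) p′))))
        where
        eq′ : j ℕ.+ suc (suc k) ≡ b ℕ.+ suc r
        eq′ = ≡.trans (ℕₚ.+-suc j (suc k)) (≡.trans (≡.cong suc eq) (≡.sym (ℕₚ.+-suc b r)))

      LocallyOk⇒Semistandard : Semistandard τ
      LocallyOk⇒Semistandard = record { row = λ {i} {j} {j′} p p′ le → row-chain (j′ ∸ j) p p′ (ℕₚ.m+[n∸m]≡n le)
                                      ; col = λ {i} {i′} {j} p p′ lt → col-chain (i′ ∸ suc i) p p′ (≡.trans (ℕₚ.+-suc i _) (ℕₚ.m+[n∸m]≡n lt)) }
        where
        row-chain : ∀ n {i j j′} → Inπ i j → Inπ i j′ → j ℕ.+ n ≡ j′ → τ (suc i , suc j) ≤ τ (suc i , suc j′)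
        row-chain zero    {i} {j} p p′ eq = ℕₚ.≤-reflexive (≡.cong (λ j → τ (suc i , suc j)) (≡.trans (≡.sym (ℕₚ.+-identityʳ j)) eq))
        row-chain (suc n) {i} {j} p p′ eq = ℕₚ.≤-trans (adjacent-row p q) (row-chain n q p′ (≡.trans (≡.sym (ℕₚ.+-suc j n)) eq))
          where
          q : Inπ i (suc j)
          q = stepʳ (≡.subst (j <_) eq (ℕₚ.m<m+n j (s≤s z≤n))) p p′
        col-chain : ∀ n {i i′ j} → Inπ i j → Inπ i′ j → i ℕ.+ suc n ≡ i′ → τ (suc i , suc j) < τ (suc i′ , suc j)
        col-chain zero    {i} {i′} {j} p p′ eq with ≡.trans (ℕₚ.+-comm 1 i) eq
        ... | ≡.refl = adjacent-col p p′
        col-chain (suc n) {i} {i′} {j} p p′ eq = ℕₚ.<-trans (adjacent-col p q) (col-chain n q p′ (≡.trans (≡.sym (ℕₚ.+-suc i (suc n))) eq))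
          where
          q : Inπ (suc i) j
          q = stepᶜ (≡.subst (i <_) eq (ℕₚ.m<m+n i (s≤s z≤n))) p p′

      -- The bound starts at 0 in the corner and is carried along by the interlacing steps. At a
      -- cell of the shape j + k is at least b, which is what is wanted.
      lower-bound : ∀ j k → L.Reaches B e j k → j ℕ.+ k ≤ L.value τ j k
      lower-bound zero    zero    reg = z≤n
      lower-bound (suc j) zero    reg = ≡.subst (_≤ L.value τ (suc j) 0) (≡.trans (ℕₚ.+-comm j 1) (≡.sym (ℕₚ.+-identityʳ (suc j))))
        (ℕₚ.≤-pred (ℕₚ.≤-<-trans (lower-bound j 1 reg′) (≡.subst (L.value τ j 1 <_) (ℕₚ.+-comm _ 1) (proj₂ (okᴸ j 0 reg′) reg))))
        where
        reg′ : L.Reaches B e j 1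
        reg′ = L.reaches (ℕₚ.<-trans ℕₚ.≤-refl (L.Reaches.row-exists reg)) (ℕₚ.≤-trans (ℕₚ.*-monoʳ-< (suc m) (ℕₚ.n<1+n (suc j))) (L.Reaches.in-row reg))
      lower-bound j (suc k) reg = ≡.subst (_≤ L.value τ j (suc k)) (≡.trans (ℕₚ.+-comm (j ℕ.+ k) 1) (≡.sym (ℕₚ.+-suc j k)))
        (ℕₚ.≤-trans (ℕₚ.+-monoˡ-≤ 1 (lower-bound j k (L.reaches (L.Reaches.row-exists reg) (ℕₚ.≤-trans (ℕₚ.n≤1+n _) (L.Reaches.in-row reg)))))
          (proj₁ (okᴸ j k reg)))

      upper-bound : ∀ i k → U.Reaches A d i k → b ℕ.+ i ≤ U.value τ i k
      upper-bound zero    zero    reg with a ℕ.≟ 0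
      ... | no a≢0 = ℕₚ.≤-reflexive (≡.trans (≡.sym (ℕₚ.+-identityʳ _)) (≡.sym (U.value-ghost τ (ℕₚ.n≢0⇒n>0 a≢0))))
      -- when a = 0 the first main cell is bounded by the ghosts of the lower side
      ... | yes a≡0 = ≡.subst (b ℕ.+ 0 ≤_) (≡.trans (valueᴸ {r = 0} ≡.refl) (≡.trans (≡.cong₂ (λ i j → τ (suc i , suc j)) (≡.trans (ℕₚ.+-identityʳ a) a≡0) (≡.sym (ℕₚ.+-identityʳ b)))
            (≡.sym (valueᵁ (≡.sym (≡.trans (ℕₚ.+-identityʳ a) a≡0))))))
            (lower-bound b 0 (L.reaches-0 (≡.subst (_< b ℕ.+ c) (ℕₚ.+-identityʳ b) (ℕₚ.+-monoʳ-< b (≡.subst (0 <_) (≡.cong (ℕ._+ c) a≡0) (U.Reaches.row-exists reg))))))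
      upper-bound (suc i) zero    reg = ≡.subst (_≤ U.value τ (suc i) 0) (≡.sym (ℕₚ.+-suc b i))
        (ℕₚ.≤-<-trans (upper-bound i 1 reg′) (≡.subst (U.value τ i 1 <_) (ℕₚ.+-identityʳ _) (proj₂ (okᵁ i 0 reg′) reg)))
        where
        reg′ : U.Reaches A d i 1
        reg′ = U.reaches (ℕₚ.<-trans ℕₚ.≤-refl (U.Reaches.row-exists reg)) (ℕₚ.≤-trans (ℕₚ.*-monoʳ-< (suc m) (ℕₚ.n<1+n (suc i))) (U.Reaches.in-row reg))
      upper-bound i (suc k) reg = ℕₚ.≤-trans (upper-bound i k (U.reaches (U.Reaches.row-exists reg) (ℕₚ.≤-trans (ℕₚ.n≤1+n _) (U.Reaches.in-row reg))))
        (≡.subst (_≤ U.value τ i (suc k)) (ℕₚ.+-identityʳ _) (proj₁ (okᵁ i k reg)))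

      LocallyOk⇒≥b : ∀ {i j} → Inπ i j → b ≤ τ (suc i , suc j)
      LocallyOk⇒≥b p with located p
      ... | upper i k r eq = ≡.subst (b ≤_) (valueᵁ eq) (ℕₚ.≤-trans (ℕₚ.m≤m+n b i) (upper-bound i k (onᵁ eq p)))
      ... | lower j k r eq = ≡.subst (b ≤_) (valueᴸ eq) (ℕₚ.≤-trans (ℕₚ.≤-trans (ℕₚ.m≤m+n b r) (ℕₚ.≤-reflexive (≡.sym eq))) (lower-bound j (suc k) (onᴸ eq p)))

    module _ (ss : Semistandard τ) (≥b : ∀ {i j} → Inπ i j → b ≤ τ (suc i , suc j)) where
      open Semistandard ss

      private
        -- The first column beside the removed rectangle is complete, so strictness down it,
        -- starting from an entry of at least b, already gives the bound that the ghost of that row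
        -- would impose.
        column-b : ∀ i → Inπ i b → b ℕ.+ i ≤ τ (suc i , suc b)
        column-b zero    p = ≡.subst (_≤ τ (1 , suc b)) (≡.sym (ℕₚ.+-identityʳ b)) (≥b p)
        column-b (suc i) p = ≡.subst (_≤ τ (suc (suc i) , suc b)) (≡.sym (ℕₚ.+-suc b i)) (ℕₚ.≤-<-trans (column-b i q) (col q p ℕₚ.≤-refl))
          where
          q : Inπ i b
          q = inside (shrinkˡ {a} {b} {d} {e} (ℕₚ.n≤1+n i) (inΛ p)) (λ { (_ , lt) → ℕₚ.<-irrefl ≡.refl lt })

        real : ∀ {α x} → ¬ x < α → x ≡ α ℕ.+ (x ∸ α)
        real ¬lt = ≡.sym (ℕₚ.m+[n∸m]≡n (ℕₚ.≮⇒≥ ¬lt))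

      -- Conditions among ghosts hold by the choice of their values, those among cells by
      -- semistandardness. The only mixed case is a ghost followed by a cell of column `b`, settled
      -- by `column-b`.
      Semistandard⇒okᵁ : U.LocallyOk A d 0 τ
      Semistandard⇒okᵁ i k reg = lo , up
        where
        reg₀ : U.Reaches A d i k
        reg₀ = U.reaches (U.Reaches.row-exists reg) (ℕₚ.≤-trans (ℕₚ.n≤1+n _) (U.Reaches.in-row reg))
        lo : U.LowerOk τ i k
        lo with i ℕ.+ k ℕ.<? a | i ℕ.+ suc k ℕ.<? a
        ... | yes g | yes g′ = ℕₚ.≤-reflexive (≡.trans (ℕₚ.+-identityʳ _) (≡.trans (U.value-ghost τ g) (≡.sym (U.value-ghost τ g′))))
        ... | no ¬g | yes g′ = ⊥-elim (¬g (ℕₚ.<-trans (ℕₚ.+-monoʳ-< i ℕₚ.≤-refl) g′))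
        ... | yes g | no ¬g′ = ≡.subst₂ _≤_ (≡.sym (≡.trans (ℕₚ.+-identityʳ _) (≡.trans (U.value-ghost τ g) (ℕₚ.+-identityʳ _))))
              (≡.sym (≡.trans (valueᵁ eq) (≡.cong (λ j → τ (suc i , suc j)) (ℕₚ.+-identityʳ b))))
              (column-b i (≡.subst (Inπ i) (ℕₚ.+-identityʳ b) (fromᵁ eq reg)))
          where
          eq : i ℕ.+ suc k ≡ a ℕ.+ 0
          eq = ≡.trans (ℕₚ.≤-antisym (≡.subst (_≤ a) (≡.sym (ℕₚ.+-suc i k)) g) (ℕₚ.≮⇒≥ ¬g′)) (≡.sym (ℕₚ.+-identityʳ a))
        ... | no ¬g | no ¬g′ = ≡.subst₂ _≤_ (≡.sym (≡.trans (ℕₚ.+-identityʳ _) (valueᵁ (real ¬g)))) (≡.sym (valueᵁ (real ¬g′)))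
              (row (fromᵁ (real ¬g) reg₀) (fromᵁ (real ¬g′) reg) (ℕₚ.+-monoʳ-≤ b (ℕₚ.∸-monoˡ-≤ a (ℕₚ.+-monoʳ-≤ i (ℕₚ.n≤1+n k)))))
        up : U.Reaches A d (suc i) k → U.UpperOk τ i k
        up reg′ with i ℕ.+ suc k ℕ.<? a
        ... | yes g = ≡.subst₂ _<_ (≡.sym (U.value-ghost τ g)) (≡.sym (≡.trans (ℕₚ.+-identityʳ _) (U.value-ghost τ (≡.subst (_< a) (ℕₚ.+-suc i k) g))))
              (ℕₚ.≤-reflexive (arith b i))
          where
          arith : ∀ b i → suc (b ℕ.+ i ℕ.+ 0) ≡ b ℕ.+ suc i ℕ.+ 0
          arith = ℕ-solve
        ... | no ¬g = ≡.subst₂ _<_ (≡.sym (valueᵁ (real ¬g))) (≡.sym (≡.trans (ℕₚ.+-identityʳ _) (valueᵁ eq)))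
              (col (fromᵁ (real ¬g) reg) (fromᵁ eq reg′) ℕₚ.≤-refl)
          where
          eq : suc i ℕ.+ k ≡ a ℕ.+ (i ℕ.+ suc k ∸ a)
          eq = ≡.trans (≡.sym (ℕₚ.+-suc i k)) (real ¬g)

      -- In the mixed case the ghost has value b - 1, so its strict demand on the cell is precisely
      -- that the entry be at least b.
      Semistandard⇒okᴸ : L.LocallyOk B e 0 τ
      Semistandard⇒okᴸ j k reg = lo , up
        where
        reg₀ : L.Reaches B e j k
        reg₀ = L.reaches (L.Reaches.row-exists reg) (ℕₚ.≤-trans (ℕₚ.n≤1+n _) (L.Reaches.in-row reg))
        arith : ∀ j k → 0 ℕ.+ j ℕ.+ 1 ℕ.* k ℕ.+ 1 ≡ 0 ℕ.+ j ℕ.+ 1 ℕ.* suc k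
        arith = ℕ-solve
        lo : L.LowerOk τ j k
        lo with j ℕ.+ k ℕ.<? b | j ℕ.+ suc k ℕ.<? b
        ... | yes g | yes g′ = ℕₚ.≤-reflexive (≡.trans (≡.cong (ℕ._+ 1) (L.value-ghost τ g)) (≡.trans (arith j k) (≡.sym (L.value-ghost τ g′))))
        ... | no ¬g | yes g′ = ⊥-elim (¬g (ℕₚ.<-trans (ℕₚ.+-monoʳ-< j ℕₚ.≤-refl) g′))
        ... | yes g | no ¬g′ = ≡.subst₂ _≤_ (≡.sym (≡.trans (≡.cong (ℕ._+ 1) (L.value-ghost τ g)) (≡.trans (arith j k) (≡.trans (≡.cong (j ℕ.+_) (ℕₚ.*-identityˡ (suc k))) b≡)))) (≡.sym (valueᴸ (≡.trans b≡ (≡.sym (ℕₚ.+-identityʳ b)))))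
              (≥b (fromᴸ (≡.trans b≡ (≡.sym (ℕₚ.+-identityʳ b))) reg))
          where
          b≡ : j ℕ.+ suc k ≡ b
          b≡ = ℕₚ.≤-antisym (≡.subst (_≤ b) (≡.sym (ℕₚ.+-suc j k)) g) (ℕₚ.≮⇒≥ ¬g′)
        ... | no ¬g | no ¬g′ = ≡.subst₂ _≤_ (≡.sym (≡.trans (ℕₚ.+-comm _ 1) (≡.cong suc (valueᴸ (real ¬g))))) (≡.sym (valueᴸ (real ¬g′)))
              (col (fromᴸ (real ¬g) reg₀) (fromᴸ (real ¬g′) reg)
                (ℕₚ.+-monoʳ-< a (ℕₚ.∸-monoˡ-< (ℕₚ.+-monoʳ-< j ℕₚ.≤-refl) (ℕₚ.≮⇒≥ ¬g))))
        up : L.Reaches B e (suc j) k → L.UpperOk τ j k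
        up reg′ with j ℕ.+ suc k ℕ.<? b
        ... | yes g = ≡.subst₂ _<_ (≡.sym (L.value-ghost τ g)) (≡.sym (≡.cong (ℕ._+ 1) (L.value-ghost τ (≡.subst (_< b) (ℕₚ.+-suc j k) g))))
              (ℕₚ.≤-reflexive (arith′ j k))
          where
          arith′ : ∀ j k → suc (0 ℕ.+ j ℕ.+ 1 ℕ.* suc k) ≡ 0 ℕ.+ suc j ℕ.+ 1 ℕ.* k ℕ.+ 1
          arith′ = ℕ-solve
        ... | no ¬g = ≡.subst₂ _<_ (≡.sym (valueᴸ (real ¬g))) (≡.sym (≡.trans (ℕₚ.+-comm _ 1) (≡.cong suc (valueᴸ eq))))
              (s≤s (row (fromᴸ (real ¬g) reg) (fromᴸ eq reg′) (ℕₚ.n≤1+n j)))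
          where
          eq : suc j ℕ.+ k ≡ b ℕ.+ (j ℕ.+ suc k ∸ b)
          eq = ≡.trans (≡.sym (ℕₚ.+-suc j k)) (real ¬g)

  private
    zip-map : ∀ (τ : Filling) cs → zip cs (map τ cs) ≡ map (λ x → x , τ x) cs
    zip-map τ []       = ≡.refl
    zip-map τ (x ∷ cs) = ≡.cong ((x , τ x) ∷_) (zip-map τ cs)

    implies : ∀ {x y} → T (not x ∨ y) → T x → T y
    implies {true} t _ = t

    ⇒implies : ∀ {x y} → (T x → T y) → T (not x ∨ y)
    ⇒implies {true}  f = f tt
    ⇒implies {false} f = tt

  allPairs : List (Cell × ℕ) → Bool
  allPairs zs = all (λ u → all (λ v → compatible u v) zs) zs

  isSSYT⇒Semistandard : ∀ τ → T (isSSYT (map τ cellsπ)) → Semistandard τ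
  isSSYT⇒Semistandard τ t = record
    { row = λ {i} {j} {j′} p p′ le → ℕₚ.≤ᵇ⇒≤ _ _ (implies (proj₁ (∧-T {not ((i ≡ᵇ i) ∧ (suc j ≤ᵇ suc j′)) ∨ _} (pair p p′)))
        (Equivalence.from T-∧ (ℕₚ.≡⇒≡ᵇ i i ≡.refl , ℕₚ.≤⇒≤ᵇ (s≤s le))))
    ; col = λ {i} {i′} {j} p p′ lt → ℕₚ.<ᵇ⇒< _ _ (implies (proj₂ (∧-T {not ((i ≡ᵇ i′) ∧ (suc j ≤ᵇ suc j)) ∨ _} (pair p p′)))
        (Equivalence.from T-∧ (ℕₚ.≡⇒≡ᵇ j j ≡.refl , ℕₚ.<⇒<ᵇ (s≤s lt)))) }
    where
    t′ : T (allPairs (map (λ x → x , τ x) cellsπ))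
    t′ = ≡.subst (T ∘ allPairs) (zip-map τ cellsπ) t
    pair : ∀ {i j i′ j′} → Inπ i j → Inπ i′ j′ →
      T (compatible ((suc i , suc j) , τ (suc i , suc j)) ((suc i′ , suc j′) , τ (suc i′ , suc j′)))
    pair {i} {j} {i′} {j′} p p′ = all⇒ (λ v → compatible ((suc i , suc j) , τ (suc i , suc j)) v) (map (λ x → x , τ x) cellsπ)
      (all⇒ (λ u → all (λ v → compatible u v) (map (λ x → x , τ x) cellsπ)) (map (λ x → x , τ x) cellsπ) t′ (∈-map⁺ _ (∈π⁺ p))) (∈-map⁺ _ (∈π⁺ p′))

  Semistandard⇒isSSYT : ∀ τ → Semistandard τ → T (isSSYT (map τ cellsπ))
  Semistandard⇒isSSYT τ ss = ≡.subst (T ∘ allPairs) (≡.sym (zip-map τ cellsπ)) (⇒all _ zs (λ u∈ → ⇒all _ zs (λ v∈ → pair u∈ v∈)))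
    where
    open Semistandard ss
    zs : List (Cell × ℕ)
    zs = map (λ x → x , τ x) cellsπ
    pair : ∀ {u v} → u ∈ zs → v ∈ zs → T (compatible u v)
    pair u∈ v∈ with ∈-map⁻ _ u∈ | ∈-map⁻ _ v∈
    ... | x , x∈ , ≡.refl | y , y∈ , ≡.refl with ∈π⁻ x∈ | ∈π⁻ y∈
    ... | i , j , ≡.refl , p | i′ , j′ , ≡.refl , p′ = Equivalence.from T-∧
      ( ⇒implies {(i ≡ᵇ i′) ∧ (suc j ≤ᵇ suc j′)} (λ t → let x , y = ∧-T {i ≡ᵇ i′} t in ℕₚ.≤⇒≤ᵇ (same-row (ℕₚ.≡ᵇ⇒≡ i i′ x) (ℕₚ.≤-pred (ℕₚ.≤ᵇ⇒≤ (suc j) (suc j′) y))))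
      , ⇒implies {(j ≡ᵇ j′) ∧ (suc i <ᵇ suc i′)} (λ t → let x , y = ∧-T {j ≡ᵇ j′} t in ℕₚ.<⇒<ᵇ (same-col (ℕₚ.≡ᵇ⇒≡ j j′ x) (ℕₚ.≤-pred (ℕₚ.<ᵇ⇒< (suc i) (suc i′) y)))) )
      where
      same-row : i ≡ i′ → j ≤ j′ → τ (suc i , suc j) ≤ τ (suc i′ , suc j′)
      same-row ≡.refl le = row p p′ le
      same-col : j ≡ j′ → i < i′ → τ (suc i , suc j) < τ (suc i′ , suc j′)
      same-col ≡.refl lt = col p p′ lt

T-iff : ∀ {x y} → (T x → T y) → (T y → T x) → x ≡ y
T-iff {true}  {true}  f g = ≡.refl
T-iff {true}  {false} f g = ⊥-elim (f _)
T-iff {false} {true}  f g = ⊥-elim (g _)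
T-iff {false} {false} f g = ≡.refl

-- From tableaux to the diagonal sum

module CutSum (R : CommutativeRing 0ℓ 0ℓ) (q : CommutativeRing.Carrier R) (W : ℕ) (a b c d e m : ℕ)
              (b+a≤W : b ℕ.+ a ≤ W) where
  open Assignments R q W
  open Shape a b c d e m using (cellsπ; fillings; isSSYT) renaming (weight to weightπ)
  open Tableaux a b c d e m
  module SU = SideSum R q W a b 0 m cellᵁ cellᵁ-injective z≤n b+a≤W
  module SL = SideSum R q W b 0 1 m cellᴸ cellᴸ-injective ℕₚ.≤-refl (ℕₚ.≤-trans (ℕₚ.m≤m+n b a) b+a≤W)

  admissible : Filling → Bool
  admissible τ = U.ok A d 0 τ ∧ L.ok B e 0 τ

  term : Filling → Carrier
  term τ = ind (admissible τ) * q ^ sum (map τ cellsπ)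

  ghostTotal : ℕ
  ghostTotal = U.ghosts a 0 ℕ.+ L.ghosts b 0

  private
    value-ext : ∀ {τ τ′ : Filling} → (∀ x → τ x ≡ τ′ x) → (∀ i k → U.value τ i k ≡ U.value τ′ i k) × (∀ i k → L.value τ i k ≡ L.value τ′ i k)
    value-ext {τ} {τ′} e = (λ i k → U.value-cong {τ} {τ′} i k (λ _ → e _)) , (λ i k → L.value-cong {τ} {τ′} i k (λ _ → e _))

    map-ext : ∀ {τ τ′ : Filling} cs → (∀ x → x ∈ cs → τ x ≡ τ′ x) → map τ cs ≡ map τ′ cs
    map-ext []       e = ≡.refl
    map-ext (x ∷ cs) e = ≡.cong₂ _∷_ (e x (here ≡.refl)) (map-ext cs (λ y y∈ → e y (there y∈)))

    term-ext : Extensional term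
    term-ext τ τ′ eq = *-cong
      (reflexive (≡.cong ind (≡.cong₂ _∧_ (U.ok-cong A d 0 (proj₁ (value-ext eq))) (L.ok-cong B e 0 (proj₂ (value-ext eq))))))
      (^-congʳ q (≡.cong sum (map-ext cellsπ (λ x _ → eq x))))

    mainSum : Filling → ℕ
    mainSum τ = sum (map τ (main 0 c))

    -- The power `ghostTotal` makes up for the ghosts that are included in the weights of the two
    -- sides but are not cells of the shape.
    term-split : ∀ τ → q ^ ghostTotal * term τ ≈ (q ^ mainSum τ * SU.sideTerm A d 0 τ) * SL.sideTerm B e 0 τ
    term-split τ = begin
      q ^ ghostTotal * (ind (admissible τ) * q ^ sum (map τ cellsπ))
        ≈⟨ *-congˡ (*-congʳ (ind-∧ (U.ok A d 0 τ) _)) ⟩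
      q ^ ghostTotal * (ind (U.ok A d 0 τ) * ind (L.ok B e 0 τ) * q ^ sum (map τ cellsπ))
        ≈⟨ shuffle₁ _ _ _ _ ⟩
      ind (U.ok A d 0 τ) * ind (L.ok B e 0 τ) * (q ^ ghostTotal * q ^ sum (map τ cellsπ))
        ≈⟨ *-congˡ powers ⟩
      ind (U.ok A d 0 τ) * ind (L.ok B e 0 τ) * (q ^ mainSum τ * q ^ U.weight A d 0 τ * q ^ L.weight B e 0 τ)
        ≈⟨ shuffle₂ _ _ _ _ _ ⟩
      (q ^ mainSum τ * SU.sideTerm A d 0 τ) * SL.sideTerm B e 0 τ ∎
      where
      shuffle₁ : ∀ g i j s → g * (i * j * s) ≈ i * j * (g * s)
      shuffle₁ = MonoidSolver.solve 4 (λ g i j s → (g ⊕ ((i ⊕ j) ⊕ s)) ⊜ ((i ⊕ j) ⊕ (g ⊕ s))) refl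
      shuffle₂ : ∀ i j x u l → i * j * (x * u * l) ≈ (x * (i * u)) * (j * l)
      shuffle₂ = MonoidSolver.solve 5 (λ i j x u l → ((i ⊕ j) ⊕ ((x ⊕ u) ⊕ l)) ⊜ ((x ⊕ (i ⊕ u)) ⊕ (j ⊕ l))) refl
      sumU sumL : ℕ
      sumU = sum (map τ (U.cells A d 0))
      sumL = sum (map τ (L.cells B e 0))
      arith : ∀ g h x u l → g ℕ.+ h ℕ.+ (x ℕ.+ (u ℕ.+ l)) ≡ x ℕ.+ (g ℕ.+ u) ℕ.+ (h ℕ.+ l)
      arith = ℕ-solve
      total : sum (map τ cellsπ) ≡ mainSum τ ℕ.+ (sumU ℕ.+ sumL)
      total = ≡.trans (sum-↭ (map⁺ τ cellsπ↭cut)) (≡.trans (≡.cong sum (map-++ τ (main 0 c) _)) (≡.trans (sum-++ (map τ (main 0 c)) _)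
        (≡.cong (mainSum τ ℕ.+_) (≡.trans (≡.cong sum (map-++ τ (U.cells A d 0) _)) (sum-++ (map τ (U.cells A d 0)) _)))))
      exponents : ghostTotal ℕ.+ sum (map τ cellsπ) ≡ mainSum τ ℕ.+ U.weight A d 0 τ ℕ.+ L.weight B e 0 τ
      exponents = ≡.trans (≡.cong (ghostTotal ℕ.+_) total) (≡.trans (arith (U.ghosts a 0) (L.ghosts b 0) (mainSum τ) sumU sumL)
        (≡.cong₂ (λ u l → mainSum τ ℕ.+ u ℕ.+ l)
          (≡.sym (U.weight-ghosts A d 0 τ (≡.subst (a ≤_) (≡.sym (ℕₚ.+-identityʳ A)) (ℕₚ.m≤m+n a c))))
          (≡.sym (L.weight-ghosts B e 0 τ (≡.subst (b ≤_) (≡.sym (ℕₚ.+-identityʳ B)) (ℕₚ.m≤m+n b c))))))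
      powers : q ^ ghostTotal * q ^ sum (map τ cellsπ) ≈ q ^ mainSum τ * q ^ U.weight A d 0 τ * q ^ L.weight B e 0 τ
      powers = trans (sym (^-homo-* q ghostTotal _)) (trans (^-congʳ q exponents)
        (trans (^-homo-* q (mainSum τ ℕ.+ U.weight A d 0 τ) _) (*-congʳ (^-homo-* q (mainSum τ) _))))

    keyᵁ-value : ∀ {i k} → a ≤ i ℕ.+ k → suc i ℕ.+ b ℕ.+ k ≡ suc (b ℕ.+ (i ℕ.+ k ∸ a)) ℕ.+ a
    keyᵁ-value {i} {k} real = ≡.trans (arith i b k) (≡.trans (≡.cong (suc b ℕ.+_) (≡.sym (ℕₚ.m∸n+n≡m real))) (≡.sym (ℕₚ.+-assoc (suc b) (i ℕ.+ k ∸ a) a)))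
      where
      arith : ∀ i b k → suc i ℕ.+ b ℕ.+ k ≡ suc b ℕ.+ (i ℕ.+ k)
      arith = ℕ-solve

    main∉ᴸ : ∀ {x} → x ∈ main 0 c → x ∉ L.cells B e 0
    main∉ᴸ x∈ l∈ = let k , p = keyᴸ l∈ in ℕₚ.m+1+n≢m _ (≡.trans (≡.sym p) (keyᴹ x∈))

    main∉ᵁ : ∀ {x} → x ∈ main 0 c → x ∉ U.cells A d 0
    main∉ᵁ x∈ u∈ = let k , p = keyᵁ u∈ in ℕₚ.m+1+n≢m _ (≡.trans p (≡.sym (keyᴹ x∈)))

    U-value-agree : ∀ {τ τ′} → AgreeOff (L.cells B e 0) τ τ′ → ∀ i k → U.value τ′ i k ≡ U.value τ i k
    U-value-agree {τ} {τ′} agree i k = U.value-cong {τ′} {τ} i k (λ real → agree _ (λ l∈ →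
      let k′ , p = keyᴸ l∈ in ℕₚ.m+1+n≢m (suc i ℕ.+ b) {k ℕ.+ k′} (≡.trans (arith (suc i ℕ.+ b) k k′)
        (≡.trans (≡.cong (ℕ._+ suc k′) (keyᵁ-value {i} {k} real)) (≡.sym p)))))
      where
      arith : ∀ x k k′ → x ℕ.+ suc (k ℕ.+ k′) ≡ x ℕ.+ k ℕ.+ suc k′
      arith = ℕ-solve

    valuesᵁ : ∀ τ → U.values τ 0 0 A ≡ upFrom b a ++ map τ (main 0 c)
    valuesᵁ τ = ghosts 0 a (≡.sym (ℕₚ.+-identityʳ b)) ≡.refl
      where
      reals : ∀ r n i → i ≡ a ℕ.+ r → U.values τ 0 i n ≡ map τ (main r n)
      reals r zero    i eq = ≡.refl
      reals r (suc n) i ≡.refl = ≡.cong₂ _∷_ (valueᵁ τ (ℕₚ.+-identityʳ _)) (reals (suc r) n _ (≡.sym (ℕₚ.+-suc a r)))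
      ghosts : ∀ {k} i n → k ≡ b ℕ.+ i → i ℕ.+ n ≡ a → U.values τ 0 i (n ℕ.+ c) ≡ upFrom k n ++ map τ (main 0 c)
      ghosts i zero    _ eq = reals 0 c i (≡.trans (≡.sym (ℕₚ.+-identityʳ i)) (≡.trans eq (≡.sym (ℕₚ.+-identityʳ a))))
      ghosts i (suc n) ≡.refl eq = ≡.cong₂ _∷_
        (≡.trans (U.value-ghost τ (≡.subst (i ℕ.+ 0 <_) eq (ℕₚ.+-monoʳ-< i (s≤s z≤n)))) (ℕₚ.+-identityʳ _))
        (ghosts (suc i) n (≡.sym (ℕₚ.+-suc b i)) (≡.trans (≡.sym (ℕₚ.+-suc i n)) eq))

    valuesᴸ : ∀ τ → L.values τ 0 0 B ≡ upFrom 0 b ++ map τ (main 0 c)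
    valuesᴸ τ = ghosts 0 b ≡.refl
      where
      reals : ∀ r n j → j ≡ b ℕ.+ r → L.values τ 0 j n ≡ map τ (main r n)
      reals r zero    j eq = ≡.refl
      reals r (suc n) j ≡.refl = ≡.cong₂ _∷_ (valueᴸ τ (ℕₚ.+-identityʳ _)) (reals (suc r) n _ (≡.sym (ℕₚ.+-suc b r)))
      ghosts : ∀ j n → j ℕ.+ n ≡ b → L.values τ 0 j (n ℕ.+ c) ≡ upFrom j n ++ map τ (main 0 c)
      ghosts j zero    eq = reals 0 c j (≡.trans (≡.sym (ℕₚ.+-identityʳ j)) (≡.trans eq (≡.sym (ℕₚ.+-identityʳ b))))
      ghosts j (suc n) eq = ≡.cong₂ _∷_
        (≡.trans (L.value-ghost τ (≡.subst (j ℕ.+ 0 <_) eq (ℕₚ.+-monoʳ-< j (s≤s z≤n)))) (ℕₚ.+-identityʳ _))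
        (ghosts (suc j) n (≡.trans (≡.sym (ℕₚ.+-suc j n)) eq))

  ΣF-unique : ∀ cs → Unique cs → ∀ τ h → ΣF cs τ (λ τ → h (map τ cs)) ≈ ΣL (length cs) h
  ΣF-unique []       []            τ h = refl
  ΣF-unique (x ∷ cs) (x∉cs ∷ uniq) τ h = Σ<-cong W (λ t → trans
    (ΣF-cong cs (τ [ x ↦ t ]) (λ τ′ agree → reflexive (≡.cong (λ v → h (v ∷ map τ′ cs)) (AgreeOff-head (Allₚ.All¬⇒¬Any x∉cs) agree))))
    (ΣF-unique cs uniq (τ [ x ↦ t ]) (h ∘ (t ∷_))))

  -- Once the main diagonal is fixed the two sides do not interact, so each is summed with the other
  -- pulled out as a constant.
  ΣF-cut : ∀ τ → q ^ ghostTotal * ΣF cellsπ τ term ≈ diagonalSum a b c d e m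
  ΣF-cut τ = begin
    q ^ ghostTotal * ΣF cellsπ τ term
      ≈⟨ *-congˡ (ΣF-↭ τ term term-ext cellsπ↭cut) ⟩
    q ^ ghostTotal * ΣF cut τ term
      ≈⟨ ΣF-* cut τ (q ^ ghostTotal) term ⟨
    ΣF cut τ (λ τ → q ^ ghostTotal * term τ)
      ≈⟨ ΣF-cong cut τ (λ τ′ _ → term-split τ′) ⟩
    ΣF cut τ (λ τ → g₁ τ * SL.sideTerm B e 0 τ)
      ≈⟨ trans (ΣF-++ (main 0 c) _ τ _) (ΣF-cong (main 0 c) τ (λ τ′ _ → ΣF-++ (U.cells A d 0) (L.cells B e 0) τ′ _)) ⟩
    ΣF (main 0 c) τ (λ τ → ΣF (U.cells A d 0) τ (λ τ → ΣF (L.cells B e 0) τ (λ τ → g₁ τ * SL.sideTerm B e 0 τ)))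
      ≈⟨ ΣF-cong (main 0 c) τ (λ τ′ _ → trans (ΣF-cong (U.cells A d 0) τ′ (λ τ″ _ → sumᴸ τ″)) (sumᵁ τ′)) ⟩
    ΣF (main 0 c) τ (λ τ → h (map τ (main 0 c)))
      ≈⟨ ΣF-unique (main 0 c) (main-unique 0 c) τ h ⟩
    ΣL (length (main 0 c)) h
      ≡⟨ ≡.cong (λ n → ΣL n h) (length-main 0 c) ⟩
    diagonalSum a b c d e m ∎
    where
    h : List ℕ → Carrier
    h y = q ^ sum y * (upperSum a b c d e m y * lowerSum a b c d e m y)
    g₁ g₂ : Filling → Carrier
    g₁ τ = q ^ mainSum τ * SU.sideTerm A d 0 τ
    g₂ τ = q ^ mainSum τ * lowerSum a b c d e m (map τ (main 0 c))
    length-main : ∀ r n → length (main r n) ≡ n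
    length-main r zero    = ≡.refl
    length-main r (suc n) = ≡.cong suc (length-main (suc r) n)
    shuffle : ∀ x u l → x * u * l ≈ (x * l) * u
    shuffle = MonoidSolver.solve 3 (λ x u l → ((x ⊕ u) ⊕ l) ⊜ ((x ⊕ l) ⊕ u)) refl
    sumᴸ : ∀ τ → ΣF (L.cells B e 0) τ (λ τ → g₁ τ * SL.sideTerm B e 0 τ) ≈ g₂ τ * SU.sideTerm A d 0 τ
    sumᴸ τ = trans (ΣF-pull (L.cells B e 0) τ g₁ (SL.sideTerm B e 0) (λ τ′ agree → *-cong
        (^-congʳ q (≡.cong sum (map-ext (main 0 c) (λ x x∈ → agree x (main∉ᴸ x∈)))))
        (*-cong (reflexive (≡.cong ind (U.ok-cong A d 0 (U-value-agree agree)))) (^-congʳ q (U.weight-cong A d 0 (U-value-agree agree))))))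
      (trans (*-congˡ (trans (SL.ΣF-side B e 0 τ (≡.subst (b ≤_) (≡.sym (ℕₚ.+-identityʳ B)) (ℕₚ.m≤m+n b c)))
        (reflexive (≡.cong (cutSum 1 m (λ _ → 1) B e) (valuesᴸ τ))))) (shuffle _ _ _))
    sumᵁ : ∀ τ → ΣF (U.cells A d 0) τ (λ τ → g₂ τ * SU.sideTerm A d 0 τ) ≈ h (map τ (main 0 c))
    sumᵁ τ = trans (ΣF-pull (U.cells A d 0) τ g₂ (SU.sideTerm A d 0) (λ τ′ agree →
        let main≡ = map-ext (main 0 c) (λ x x∈ → agree x (main∉ᵁ x∈)) in *-cong (^-congʳ q (≡.cong sum main≡))
          (reflexive (≡.cong (lowerSum a b c d e m) main≡))))
      (trans (*-congˡ (trans (SU.ΣF-side A d 0 τ (≡.subst (a ≤_) (≡.sym (ℕₚ.+-identityʳ A)) (ℕₚ.m≤m+n a c)))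
        (reflexive (≡.cong (cutSum 0 m (λ _ → 1) A d) (valuesᵁ τ))))) (trans (shuffle _ _ _) (*-assoc _ _ _)))

  module _ (K : ℕ) (b+K≤W : b ℕ.+ K ≤ W) (vanish : q ^ (b ℕ.* length cellsπ ℕ.+ K) ≈ 0#) where

    tableauTerm : List ℕ → Carrier
    tableauTerm ts = ind (isSSYT ts) * q ^ weightπ ts

    private
      lowered : Filling → Filling
      lowered τ x = suc (τ x ∸ b)

      sum-lowered : ∀ τ (cs : List Cell) → (∀ x → x ∈ cs → b ≤ τ x) → sum (map τ cs) ≡ b ℕ.* length cs ℕ.+ weightπ (map (lowered τ) cs)
      sum-lowered τ []       ≥b = ≡.sym (≡.trans (ℕₚ.+-identityʳ _) (ℕₚ.*-zeroʳ b))
      sum-lowered τ (x ∷ cs) ≥b = ≡.trans (≡.cong₂ ℕ._+_ (≡.sym (ℕₚ.m+[n∸m]≡n (≥b x (here ≡.refl)))) (sum-lowered τ cs (λ y y∈ → ≥b y (there y∈))))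
        (arith b (τ x ∸ b) (length cs) (weightπ (map (lowered τ) cs)))
        where
        arith : ∀ b t l w → b ℕ.+ t ℕ.+ (b ℕ.* l ℕ.+ w) ≡ b ℕ.* suc l ℕ.+ (t ℕ.+ w)
        arith = ℕ-solve

      -- One entry beyond the window, together with b for each other cell, already reaches the
      -- exponent at which powers of q vanish.
      sum-large : ∀ τ (cs : List Cell) → (∀ x → x ∈ cs → b ≤ τ x) → ∀ {x} → x ∈ cs → b ℕ.+ K ≤ τ x → b ℕ.* length cs ℕ.+ K ≤ sum (map τ cs)
      sum-large τ (y ∷ cs) ≥b (here ≡.refl) le = ≡.subst (_≤ τ y ℕ.+ sum (map τ cs)) (arith b K (length cs))
        (ℕₚ.+-mono-≤ le (all-large cs (λ z z∈ → ≥b z (there z∈))))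
        where
        arith : ∀ b K l → b ℕ.+ K ℕ.+ b ℕ.* l ≡ b ℕ.* suc l ℕ.+ K
        arith = ℕ-solve
        all-large : ∀ (cs : List Cell) → (∀ x → x ∈ cs → b ≤ τ x) → b ℕ.* length cs ≤ sum (map τ cs)
        all-large []       _  = ℕₚ.≤-reflexive (ℕₚ.*-zeroʳ b)
        all-large (z ∷ cs) ≥b = ≡.subst (_≤ τ z ℕ.+ sum (map τ cs)) (≡.sym (ℕₚ.*-suc b (length cs)))
          (ℕₚ.+-mono-≤ (≥b z (here ≡.refl)) (all-large cs (λ w w∈ → ≥b w (there w∈))))
      sum-large τ (y ∷ cs) ≥b (there x∈) le = ≡.subst (_≤ τ y ℕ.+ sum (map τ cs)) (arith b K (length cs))
        (ℕₚ.+-mono-≤ (≥b y (here ≡.refl)) (sum-large τ cs (λ z z∈ → ≥b z (there z∈)) x∈ le))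
        where
        arith : ∀ b K l → b ℕ.+ (b ℕ.* l ℕ.+ K) ≡ b ℕ.* suc l ℕ.+ K
        arith = ℕ-solve

      locally : ∀ τ → T (admissible τ) → U.LocallyOk A d 0 τ × L.LocallyOk B e 0 τ
      locally τ t = let u , l = ∧-T {U.ok A d 0 τ} t in U.ok⇒LocallyOk A d 0 τ u , L.ok⇒LocallyOk B e 0 τ l

      admissible⇒≥b : ∀ τ → T (admissible τ) → ∀ x → x ∈ cellsπ → b ≤ τ x
      admissible⇒≥b τ t x x∈ with ∈π⁻ x∈ | locally τ t
      ... | i , j , ≡.refl , p | u , l = LocallyOk⇒≥b τ u l p

      -- When all entries are at least b, lowering by b preserves and reflects every inequality, and
      -- the ghosts ask for nothing more.
      admissible≡isSSYT : ∀ τ → (∀ x → x ∈ cellsπ → b ≤ τ x) → admissible τ ≡ isSSYT (map (lowered τ) cellsπ)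
      admissible≡isSSYT τ ≥b = T-iff
        (λ t → let u , l = locally τ t
                   open Semistandard (LocallyOk⇒Semistandard τ u l) in
          Semistandard⇒isSSYT (lowered τ) (record
            { row = λ p p′ le → s≤s (ℕₚ.∸-monoˡ-≤ b (row p p′ le))
            ; col = λ p p′ lt → s≤s (ℕₚ.∸-monoˡ-< (col p p′ lt) (≥b′ p)) }))
        (λ t → let open Semistandard (isSSYT⇒Semistandard (lowered τ) t)
                   ss : Semistandard τ
                   ss = record
                     { row = λ p p′ le → raise-≤ (≥b′ p′) (ℕₚ.≤-pred (row p p′ le))
                     ; col = λ p p′ lt → ℕₚ.≰⇒> (λ y≤x → ℕₚ.<⇒≱ (ℕₚ.≤-pred (col p p′ lt)) (ℕₚ.∸-monoˡ-≤ b y≤x)) }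
               in Equivalence.from T-∧ (U.LocallyOk⇒ok A d 0 τ (Semistandard⇒okᵁ τ ss ≥b′) , L.LocallyOk⇒ok B e 0 τ (Semistandard⇒okᴸ τ ss ≥b′)))
        where
        raise-≤ : ∀ {x y} → b ≤ y → x ∸ b ≤ y ∸ b → x ≤ y
        raise-≤ {x} {y} b≤y le = ℕₚ.≤-trans (ℕₚ.m≤n+m∸n x b) (ℕₚ.≤-trans (ℕₚ.+-monoʳ-≤ b le) (ℕₚ.≤-reflexive (ℕₚ.m+[n∸m]≡n b≤y)))
        ≥b′ : ∀ {i j} → Inπ i j → b ≤ τ (suc i , suc j)
        ≥b′ p = ≥b _ (∈π⁺ p)

    ΣF-tableaux : ∀ τ → ΣF cellsπ τ term ≈ q ^ (b ℕ.* length cellsπ) * ΣList tableauTerm (fillings (length cellsπ) K)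
    ΣF-tableaux τ = trans (ΣF-fillings b K b+K≤W fillings (λ _ → ≡.refl) (λ _ _ → ≡.refl) cellsπ cellsπ-unique τ term
        (λ ts → q ^ (b ℕ.* length cellsπ) * tableauTerm ts) inside-window outside-window)
      (ΣList-* _ (fillings (length cellsπ) K))
      where
      ΣList-* : ∀ k (xs : List (List ℕ)) → ΣList (λ ts → k * tableauTerm ts) xs ≈ k * ΣList tableauTerm xs
      ΣList-* k []       = sym (zeroʳ k)
      ΣList-* k (x ∷ xs) = trans (+-congˡ (ΣList-* k xs)) (sym (distribˡ _ _ _))
      shuffle : ∀ i g w → i * (g * w) ≈ g * (i * w)
      shuffle = MonoidSolver.solve 3 (λ i g w → (i ⊕ (g ⊕ w)) ⊜ (g ⊕ (i ⊕ w))) refl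
      inside-window : ∀ τ′ → AgreeOff cellsπ τ τ′ → (∀ x → x ∈ cellsπ → b ≤ τ′ x × τ′ x < b ℕ.+ K) →
        term τ′ ≈ q ^ (b ℕ.* length cellsπ) * tableauTerm (map (lowered τ′) cellsπ)
      inside-window τ′ _ win = trans (*-cong (reflexive (≡.cong ind (admissible≡isSSYT τ′ (λ x x∈ → proj₁ (win x x∈)))))
          (trans (^-congʳ q (sum-lowered τ′ cellsπ (λ x x∈ → proj₁ (win x x∈)))) (^-homo-* q (b ℕ.* length cellsπ) _)))
        (shuffle _ _ _)
      outside-window : ∀ τ′ → AgreeOff cellsπ τ τ′ → ∀ x → x ∈ cellsπ → ¬ (b ≤ τ′ x × τ′ x < b ℕ.+ K) → term τ′ ≈ 0#
      outside-window τ′ _ x x∈ ¬win with admissible τ′ in eq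
      ... | false = zeroˡ _
      ... | true  = trans (*-congˡ (begin
          q ^ S                           ≡⟨ ≡.cong (q ^_) (ℕₚ.m+[n∸m]≡n large) ⟨
          q ^ (V ℕ.+ (S ∸ V))             ≈⟨ ^-homo-* q V (S ∸ V) ⟩
          q ^ V * q ^ (S ∸ V)             ≈⟨ trans (*-congʳ vanish) (zeroˡ _) ⟩
          0#                              ∎)) (zeroʳ _)
        where
        S V : ℕ
        S = sum (map τ′ cellsπ)
        V = b ℕ.* length cellsπ ℕ.+ K
        ≥b : ∀ x → x ∈ cellsπ → b ≤ τ′ x
        ≥b = admissible⇒≥b τ′ (≡.subst T (≡.sym eq) _)
        large : V ≤ S
        large = sum-large τ′ cellsπ ≥b x∈ (ℕₚ.≮⇒≥ (λ lt → ¬win (≥b x x∈ , lt)))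

    tableaux-diagonal : q ^ ghostTotal * (q ^ (b ℕ.* length cellsπ) * ΣList tableauTerm (fillings (length cellsπ) K)) ≈ diagonalSum a b c d e m
    tableaux-diagonal = trans (*-congˡ (sym (ΣF-tableaux (λ _ → 0)))) (ΣF-cut (λ _ → 0))

    diagonal-tableaux : ∀ l → q ^ l * diagonalSum a b c d e m ≈
      q ^ (l ℕ.+ (ghostTotal ℕ.+ b ℕ.* length cellsπ)) * ΣList tableauTerm (fillings (length cellsπ) K)
    diagonal-tableaux l = trans (*-congˡ (trans (sym tableaux-diagonal)
        (trans (sym (*-assoc _ _ _)) (*-congʳ (sym (^-homo-* q ghostTotal _))))))
      (trans (sym (*-assoc _ _ _)) (*-congʳ (sym (^-homo-* q l _))))

-- Products over ranges, MacMahon's box product and the arms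

<ᵇ-true : ∀ {m n} → m < n → (m <ᵇ n) ≡ true
<ᵇ-true {m} {n} lt with m <ᵇ n in e
... | true  = ≡.refl
... | false = ⊥-elim (≡.subst T e (ℕₚ.<⇒<ᵇ lt))

<ᵇ-false : ∀ {m n} → n ≤ m → (m <ᵇ n) ≡ false
<ᵇ-false {m} {n} le with m <ᵇ n in e
... | false = ≡.refl
... | true  = ⊥-elim (ℕₚ.<⇒≱ (ℕₚ.<ᵇ⇒< m n (≡.subst T (≡.sym e) _)) le)

module Fold (M : CommutativeMonoid 0ℓ 0ℓ) where
  open CommutativeMonoid M renaming (ε to 𝟙)
  private
    module S = Algebra.Solver.CommutativeMonoid M
    open S using (_⊕_; _⊜_)

  -- Kept general in the monoid: multiplicative for products of 1 - q^h, additive for counting and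
  -- for the exponent N.
  ⨀ : ℕ → (ℕ → Carrier) → Carrier
  ⨀ zero    f = 𝟙
  ⨀ (suc n) f = f 0 ∙ ⨀ n (f ∘ suc)

  ⨀-cong< : ∀ n {f g} → (∀ t → t < n → f t ≈ g t) → ⨀ n f ≈ ⨀ n g
  ⨀-cong< zero    e = refl
  ⨀-cong< (suc n) e = ∙-cong (e 0 (s≤s z≤n)) (⨀-cong< n (λ t t<n → e (suc t) (s≤s t<n)))

  ⨀-cong : ∀ n {f g} → (∀ t → f t ≈ g t) → ⨀ n f ≈ ⨀ n g
  ⨀-cong n e = ⨀-cong< n (λ t _ → e t)

  ⨀-𝟙 : ∀ n {f} → (∀ t → t < n → f t ≈ 𝟙) → ⨀ n f ≈ 𝟙
  ⨀-𝟙 zero    e = refl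
  ⨀-𝟙 (suc n) e = trans (∙-cong (e 0 (s≤s z≤n)) (⨀-𝟙 n (λ t t<n → e (suc t) (s≤s t<n)))) (identityˡ _)

  ⨀-∙ : ∀ n f g → ⨀ n (λ t → f t ∙ g t) ≈ ⨀ n f ∙ ⨀ n g
  ⨀-∙ zero    f g = sym (identityˡ _)
  ⨀-∙ (suc n) f g = trans (∙-congˡ (⨀-∙ n (f ∘ suc) (g ∘ suc)))
    (S.solve 4 (λ a b c d → ((a ⊕ b) ⊕ (c ⊕ d)) ⊜ ((a ⊕ c) ⊕ (b ⊕ d))) refl _ _ _ _)

  ⨀-+ : ∀ m n f → ⨀ (m ℕ.+ n) f ≈ ⨀ m f ∙ ⨀ n (λ t → f (m ℕ.+ t))
  ⨀-+ zero    n f = sym (identityˡ _)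
  ⨀-+ (suc m) n f = trans (∙-congˡ (⨀-+ m n (f ∘ suc))) (sym (assoc _ _ _))

  ⨀-swap : ∀ m n (f : ℕ → ℕ → Carrier) → ⨀ m (λ i → ⨀ n (f i)) ≈ ⨀ n (λ j → ⨀ m (λ i → f i j))
  ⨀-swap zero    n f = sym (⨀-𝟙 n (λ _ _ → refl))
  ⨀-swap (suc m) n f = trans (∙-congˡ (⨀-swap m n (f ∘ suc))) (sym (⨀-∙ n (f 0) _))

  ⨀-snoc : ∀ n f → ⨀ (suc n) f ≈ ⨀ n f ∙ f n
  ⨀-snoc zero    f = comm _ _
  ⨀-snoc (suc n) f = trans (∙-congˡ (⨀-snoc n (f ∘ suc))) (sym (assoc _ _ _))

  ⨀-reverse : ∀ n f → ⨀ n (λ i → f (n ℕ.∸ suc i)) ≈ ⨀ n f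
  ⨀-reverse zero    f = refl
  ⨀-reverse (suc n) f = trans (∙-congˡ (⨀-reverse n f)) (trans (comm _ _) (sym (⨀-snoc n f)))

  ⨀-blocks : ∀ w m f → ⨀ (w ℕ.* m) f ≈ ⨀ w (λ u → ⨀ m (λ v → f (u ℕ.* m ℕ.+ v)))
  ⨀-blocks zero    m f = refl
  ⨀-blocks (suc w) m f = trans (⨀-+ m (w ℕ.* m) f) (∙-congˡ (trans (⨀-blocks w m (λ t → f (m ℕ.+ t)))
    (⨀-cong w (λ u → ⨀-cong m (λ v → reflexive (≡.cong f (≡.sym (ℕₚ.+-assoc m (u ℕ.* m) v))))))))

  ⨀-truncate : ∀ {k n} f → k ≤ n → ⨀ n (λ t → if t <ᵇ k then f t else 𝟙) ≈ ⨀ k f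
  ⨀-truncate {zero}  {n}     f le       = ⨀-𝟙 n (λ _ _ → refl)
  ⨀-truncate {suc k} {suc n} f (s≤s le) = ∙-congˡ (⨀-truncate (f ∘ suc) le)

  foldList : {A : Set} → (A → Carrier) → List A → Carrier
  foldList g = foldr (λ x y → g x ∙ y) 𝟙

  foldList-++ : {A : Set} (g : A → Carrier) (xs ys : List A) → foldList g (xs ++ ys) ≈ foldList g xs ∙ foldList g ys
  foldList-++ g []       ys = sym (identityˡ _)
  foldList-++ g (x ∷ xs) ys = trans (∙-congˡ (foldList-++ g xs ys)) (sym (assoc _ _ _))

  foldList-filterᵇ : {A : Set} (g : A → Carrier) (p : A → Bool) (xs : List A) →
    foldList g (filterᵇ p xs) ≈ foldList (λ x → if p x then g x else 𝟙) xs
  foldList-filterᵇ g p []       = refl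
  foldList-filterᵇ g p (x ∷ xs) with p x
  ... | true  = ∙-congˡ (foldList-filterᵇ g p xs)
  ... | false = trans (foldList-filterᵇ g p xs) (sym (identityˡ _))

  foldList-applyUpTo : {A : Set} (g : A → Carrier) (f : ℕ → A) (n : ℕ) → foldList g (applyUpTo f n) ≈ ⨀ n (g ∘ f)
  foldList-applyUpTo g f zero    = refl
  foldList-applyUpTo g f (suc n) = ∙-congˡ (foldList-applyUpTo g (f ∘ suc) n)

  foldList-map : {A B : Set} (g : B → Carrier) (f : A → B) (xs : List A) → foldList g (map f xs) ≈ foldList (g ∘ f) xs
  foldList-map g f []       = refl
  foldList-map g f (x ∷ xs) = ∙-congˡ (foldList-map g f xs)

  foldList-concatMap : {A : Set} (g : A → Carrier) (f : ℕ → List A) (k : ℕ → ℕ) (n : ℕ) →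
    foldList g (concatMap f (applyUpTo k n)) ≈ ⨀ n (λ t → foldList g (f (k t)))
  foldList-concatMap g f k zero    = refl
  foldList-concatMap g f k (suc n) = trans (foldList-++ g (f (k 0)) _) (∙-congˡ (foldList-concatMap g f (k ∘ suc) n))

  foldList-grid : (g : ℕ × ℕ → Carrier) (m n : ℕ) →
    foldList g (concatMap (λ i → map (λ j → (i , j)) (applyUpTo suc n)) (applyUpTo suc m)) ≈ ⨀ m (λ i → ⨀ n (λ j → g (suc i , suc j)))
  foldList-grid g m n = trans (foldList-concatMap g _ suc m)
    (⨀-cong m (λ i → trans (foldList-map g _ (applyUpTo suc n)) (foldList-applyUpTo _ suc n)))

module Products (R : CommutativeRing 0ℓ 0ℓ) (q : CommutativeRing.Carrier R) (W : ℕ) where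
  open Product R q W public

  open Fold (CommutativeRing.*-commutativeMonoid R) public using (foldList; foldList-filterᵇ; foldList-grid; foldList-concatMap; foldList-map; foldList-applyUpTo)
    renaming (⨀ to Π<; ⨀-cong< to Π<-cong<; ⨀-cong to Π<-cong; ⨀-𝟙 to Π<-1; ⨀-∙ to Π<-*; ⨀-+ to Π<-+; ⨀-swap to Π<-swap;
              ⨀-snoc to Π<-snoc; ⨀-blocks to Π<-blocks; ⨀-truncate to Π<-truncate; ⨀-reverse to Π<-reverse)

  Π<-rows : ∀ n f → Π< n f ≈ prod f (rows n)
  Π<-rows zero    f = refl
  Π<-rows (suc n) f = trans (Π<-snoc n f) (trans (*-comm _ _) (trans (*-congˡ (Π<-rows n f)) (reflexive (≡.cong (prod f) (≡.sym (rows-suc n))))))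

  [1-_] : ℕ → Carrier
  [1- h ] = 1# + ε * q ^ h

  [1-]-cong : ∀ {h h′} → h ≡ h′ → [1- h ] ≈ [1- h′ ]
  [1-]-cong e = reflexive (≡.cong [1-_] e)

  qfac-rising : ∀ M n k → Π< k (λ j → [1- M ℕ.* (n ℕ.+ j ℕ.+ 1) ]) * qfac M n ≈ qfac M (n ℕ.+ k)
  qfac-rising M n zero    = trans (*-identityˡ _) (reflexive (≡.cong (qfac M) (≡.sym (ℕₚ.+-identityʳ n))))
  qfac-rising M n (suc k) = begin
    Π< (suc k) (λ j → [1- M ℕ.* (n ℕ.+ j ℕ.+ 1) ]) * qfac M n
      ≈⟨ *-congʳ (Π<-snoc k _) ⟩
    Π< k (λ j → [1- M ℕ.* (n ℕ.+ j ℕ.+ 1) ]) * [1- M ℕ.* (n ℕ.+ k ℕ.+ 1) ] * qfac M n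
      ≈⟨ shuffle _ _ _ ⟩
    [1- M ℕ.* (n ℕ.+ k ℕ.+ 1) ] * (Π< k (λ j → [1- M ℕ.* (n ℕ.+ j ℕ.+ 1) ]) * qfac M n)
      ≈⟨ *-cong ([1-]-cong (≡.cong (M ℕ.*_) (ℕₚ.+-comm (n ℕ.+ k) 1))) (qfac-rising M n k) ⟩
    qfac M (suc (n ℕ.+ k))
      ≡⟨ ≡.cong (qfac M) (ℕₚ.+-suc n k) ⟨
    qfac M (n ℕ.+ suc k) ∎
    where
    shuffle : ∀ a b c → a * b * c ≈ b * (a * c)
    shuffle = MonoidSolver.solve 3 (λ a b c → ((a ⊕ b) ⊕ c) ⊜ (b ⊕ (a ⊕ c))) refl

  qfac-falling : ∀ n k → Π< k (λ j → [1- k ℕ.+ n ∸ j ]) * qfac 1 n ≈ qfac 1 (k ℕ.+ n)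
  qfac-falling n zero    = *-identityˡ _
  qfac-falling n (suc k) = trans (*-assoc _ _ _) (*-cong ([1-]-cong (≡.sym (ℕₚ.*-identityˡ (suc (k ℕ.+ n))))) (qfac-falling n k))

  superfac-+ : ∀ M b n → Π< n (λ i → qfac M (b ℕ.+ i)) * superfac M b ≈ superfac M (b ℕ.+ n)
  superfac-+ M b n = trans (*-comm _ _) (trans (*-congʳ (sym (Π<-rows b (qfac M)))) (trans (sym (Π<-+ b n (qfac M))) (Π<-rows (b ℕ.+ n) (qfac M))))

  module _ (M a b c : ℕ) where

    private
      g : ℕ → Carrier
      g s = [1- M ℕ.* s ]

      P : ℕ → Carrier
      P s = Π< a (λ i → Π< b (λ j → g (s ℕ.+ i ℕ.+ j ℕ.+ 1)))

    boxNumerator boxDenominator : Carrier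
    boxNumerator   = Π< a (λ i → Π< b (λ j → Π< c (λ k → g (i ℕ.+ j ℕ.+ k ℕ.+ 2))))
    boxDenominator = Π< a (λ i → Π< b (λ j → Π< c (λ k → g (i ℕ.+ j ℕ.+ k ℕ.+ 1))))

    private
      -- For fixed i and j the numerator is the denominator moved by one in k, so only the two ends
      -- survive; over all i and j they form `P c` and `P 0`.
      telescope : boxNumerator * P 0 ≈ boxDenominator * P c
      telescope = trans (sym (Π<-* a _ _)) (trans (Π<-cong a (λ i → trans (sym (Π<-* b _ _)) (trans (Π<-cong b (λ j → go i j)) (Π<-* b _ _)))) (Π<-* a _ _))
        where
        arith₁ : ∀ i j → i ℕ.+ j ℕ.+ 1 ≡ i ℕ.+ j ℕ.+ 0 ℕ.+ 1
        arith₁ = ℕ-solve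
        arith₂ : ∀ i j k → i ℕ.+ j ℕ.+ k ℕ.+ 2 ≡ i ℕ.+ j ℕ.+ suc k ℕ.+ 1
        arith₂ = ℕ-solve
        arith₃ : ∀ i j c → i ℕ.+ j ℕ.+ c ℕ.+ 1 ≡ c ℕ.+ i ℕ.+ j ℕ.+ 1
        arith₃ = ℕ-solve
        go : ∀ i j → Π< c (λ k → g (i ℕ.+ j ℕ.+ k ℕ.+ 2)) * g (i ℕ.+ j ℕ.+ 1) ≈ Π< c (λ k → g (i ℕ.+ j ℕ.+ k ℕ.+ 1)) * g (c ℕ.+ i ℕ.+ j ℕ.+ 1)
        go i j = begin
          Π< c (λ k → g (i ℕ.+ j ℕ.+ k ℕ.+ 2)) * g (i ℕ.+ j ℕ.+ 1)
            ≈⟨ trans (*-comm _ _) (*-cong (reflexive (≡.cong g (arith₁ i j))) (Π<-cong c (λ k → reflexive (≡.cong g (arith₂ i j k))))) ⟩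
          Π< (suc c) (λ k → g (i ℕ.+ j ℕ.+ k ℕ.+ 1))
            ≈⟨ Π<-snoc c _ ⟩
          Π< c (λ k → g (i ℕ.+ j ℕ.+ k ℕ.+ 1)) * g (i ℕ.+ j ℕ.+ c ℕ.+ 1)
            ≈⟨ *-congˡ (reflexive (≡.cong g (arith₃ i j c))) ⟩
          Π< c (λ k → g (i ℕ.+ j ℕ.+ k ℕ.+ 1)) * g (c ℕ.+ i ℕ.+ j ℕ.+ 1) ∎

      P-qfac : ∀ s → P s * Π< a (λ i → qfac M (s ℕ.+ i)) ≈ Π< a (λ i → qfac M (s ℕ.+ b ℕ.+ i))
      P-qfac s = trans (sym (Π<-* a _ _)) (Π<-cong a (λ i → trans (qfac-rising M (s ℕ.+ i) b) (reflexive (≡.cong (qfac M) (arith s i b)))))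
        where
        arith : ∀ s i b → s ℕ.+ i ℕ.+ b ≡ s ℕ.+ b ℕ.+ i
        arith = ℕ-solve

      -- Each row of `P s` is a ratio of two q-factorials of consecutive index ranges, and the
      -- ratios of all rows combine into superfactorials.
      P-superfac : ∀ s → P s * superfac M (s ℕ.+ a) * superfac M (s ℕ.+ b) ≈ superfac M (s ℕ.+ b ℕ.+ a) * superfac M s
      P-superfac s = begin
        P s * superfac M (s ℕ.+ a) * superfac M (s ℕ.+ b)
          ≈⟨ *-congʳ (*-congˡ (sym (superfac-+ M s a))) ⟩
        P s * (Π< a (λ i → qfac M (s ℕ.+ i)) * superfac M s) * superfac M (s ℕ.+ b)
          ≈⟨ shuffle _ _ _ _ ⟩
        (P s * Π< a (λ i → qfac M (s ℕ.+ i))) * superfac M (s ℕ.+ b) * superfac M s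
          ≈⟨ *-congʳ (trans (*-congʳ (P-qfac s)) (superfac-+ M (s ℕ.+ b) a)) ⟩
        superfac M (s ℕ.+ b ℕ.+ a) * superfac M s ∎
        where
        shuffle : ∀ p x y z → p * (x * y) * z ≈ (p * x) * z * y
        shuffle = MonoidSolver.solve 4 (λ p x y z → ((p ⊕ (x ⊕ y)) ⊕ z) ⊜ (((p ⊕ x) ⊕ z) ⊕ y)) refl

    -- The box product as H(a) H(b) H(c) H(a + b + c) over H(a + b) H(a + c) H(b + c) in
    -- superfactorials H, cross-multiplied.
    macMahon : boxNumerator * (superfac M (b ℕ.+ a) * superfac M (a ℕ.+ c) * superfac M (b ℕ.+ c)) ≈
               boxDenominator * (superfac M a * superfac M b * superfac M c * superfac M (b ℕ.+ a ℕ.+ c))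
    macMahon = begin
      boxNumerator * (superfac M (b ℕ.+ a) * superfac M (a ℕ.+ c) * superfac M (b ℕ.+ c))
        ≈⟨ *-congˡ (*-congʳ (*-congʳ (trans (sym (*-identityʳ _)) (sym (P-superfac 0))))) ⟩
      boxNumerator * (P 0 * superfac M a * superfac M b * superfac M (a ℕ.+ c) * superfac M (b ℕ.+ c))
        ≈⟨ shuffle₁ _ _ _ _ _ _ ⟩
      boxNumerator * P 0 * (superfac M a * superfac M b * (superfac M (a ℕ.+ c) * superfac M (b ℕ.+ c)))
        ≈⟨ *-congʳ telescope ⟩
      boxDenominator * P c * (superfac M a * superfac M b * (superfac M (a ℕ.+ c) * superfac M (b ℕ.+ c)))
        ≈⟨ shuffle₂ _ _ _ _ _ _ ⟩
      boxDenominator * (superfac M a * superfac M b * (P c * superfac M (a ℕ.+ c) * superfac M (b ℕ.+ c)))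
        ≈⟨ *-congˡ (*-congˡ (trans (*-cong (*-congˡ (sf (ℕₚ.+-comm a c))) (sf (ℕₚ.+-comm b c))) (trans (P-superfac c) (*-congʳ (sf (arith a b c)))))) ⟩
      boxDenominator * (superfac M a * superfac M b * (superfac M (b ℕ.+ a ℕ.+ c) * superfac M c))
        ≈⟨ shuffle₃ _ _ _ _ _ ⟩
      boxDenominator * (superfac M a * superfac M b * superfac M c * superfac M (b ℕ.+ a ℕ.+ c)) ∎
      where
      sf : ∀ {x y} → x ≡ y → superfac M x ≈ superfac M y
      sf e = reflexive (≡.cong (superfac M) e)
      arith : ∀ a b c → c ℕ.+ b ℕ.+ a ≡ b ℕ.+ a ℕ.+ c
      arith = ℕ-solve
      shuffle₁ : ∀ n p x y z w → n * (p * x * y * z * w) ≈ n * p * (x * y * (z * w))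
      shuffle₁ = MonoidSolver.solve 6 (λ n p x y z w → (n ⊕ ((((p ⊕ x) ⊕ y) ⊕ z) ⊕ w)) ⊜ ((n ⊕ p) ⊕ ((x ⊕ y) ⊕ (z ⊕ w)))) refl
      shuffle₂ : ∀ n p x y z w → n * p * (x * y * (z * w)) ≈ n * (x * y * (p * z * w))
      shuffle₂ = MonoidSolver.solve 6 (λ n p x y z w → ((n ⊕ p) ⊕ ((x ⊕ y) ⊕ (z ⊕ w))) ⊜ (n ⊕ ((x ⊕ y) ⊕ ((p ⊕ z) ⊕ w)))) refl
      shuffle₃ : ∀ n x y z w → n * (x * y * (z * w)) ≈ n * (x * y * w * z)
      shuffle₃ = MonoidSolver.solve 5 (λ n x y z w → (n ⊕ ((x ⊕ y) ⊕ (z ⊕ w))) ⊜ (n ⊕ (((x ⊕ y) ⊕ w) ⊕ z))) refl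

  -- The hook lengths in a row of length d + w m are 1, …, d + w (m+1) except the multiples t (m+1), 1 ≤ t ≤ w.
  module _ (m : ℕ) where

    private
      blocks : ∀ w → Π< w (λ u → Π< m (λ v → [1- suc m ℕ.* (w ∸ suc u) ℕ.+ (m ∸ v) ])) * qfac (suc m) w ≈ qfac 1 (suc m ℕ.* w)
      blocks zero    = trans (*-identityˡ _) (reflexive (≡.cong (qfac 1) (≡.sym (ℕₚ.*-zeroʳ (suc m)))))
      blocks (suc w) = begin
        Π< m (λ v → [1- suc m ℕ.* w ℕ.+ (m ∸ v) ]) * Π< w (λ u → Π< m (λ v → [1- suc m ℕ.* (w ∸ suc u) ℕ.+ (m ∸ v) ])) *
          ([1- suc m ℕ.* suc w ] * qfac (suc m) w)
          ≈⟨ shuffle _ _ _ _ ⟩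
        [1- suc m ℕ.* suc w ] * (Π< m (λ v → [1- suc m ℕ.* w ℕ.+ (m ∸ v) ]) *
          (Π< w (λ u → Π< m (λ v → [1- suc m ℕ.* (w ∸ suc u) ℕ.+ (m ∸ v) ])) * qfac (suc m) w))
          ≈⟨ *-cong ([1-]-cong (arith m w)) (*-cong (Π<-cong< m (λ v v<m → [1-]-cong (reorder v (ℕₚ.<⇒≤ v<m)))) (blocks w)) ⟩
        [1- 1 ℕ.* suc (m ℕ.+ suc m ℕ.* w) ] * (Π< m (λ v → [1- m ℕ.+ suc m ℕ.* w ∸ v ]) * qfac 1 (suc m ℕ.* w))
          ≈⟨ *-congˡ (qfac-falling (suc m ℕ.* w) m) ⟩
        qfac 1 (suc (m ℕ.+ suc m ℕ.* w))
          ≡⟨ ≡.cong (qfac 1) (ℕₚ.*-suc (suc m) w) ⟨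
        qfac 1 (suc m ℕ.* suc w) ∎
        where
        arith : ∀ m w → suc m ℕ.* suc w ≡ 1 ℕ.* suc (m ℕ.+ suc m ℕ.* w)
        arith = ℕ-solve
        reorder : ∀ v → v ≤ m → suc m ℕ.* w ℕ.+ (m ∸ v) ≡ m ℕ.+ suc m ℕ.* w ∸ v
        reorder v v≤m = ≡.trans (≡.sym (ℕₚ.+-∸-assoc (suc m ℕ.* w) v≤m)) (≡.cong (_∸ v) (ℕₚ.+-comm (suc m ℕ.* w) m))
        shuffle : ∀ a b c d → a * b * (c * d) ≈ c * (a * (b * d))
        shuffle = MonoidSolver.solve 4 (λ a b c d → ((a ⊕ b) ⊕ (c ⊕ d)) ⊜ (c ⊕ (a ⊕ (b ⊕ d)))) refl

    arm-row : ∀ d w (h : ℕ → ℕ) → (∀ j → j < d → h j ≡ d ℕ.+ suc m ℕ.* w ∸ j) →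
      (∀ u v → u < w → v < m → h (d ℕ.+ (u ℕ.* m ℕ.+ v)) ≡ suc m ℕ.* (w ∸ suc u) ℕ.+ (m ∸ v)) →
      Π< (d ℕ.+ w ℕ.* m) (λ j → [1- h j ]) * qfac (suc m) w ≈ qfac 1 (d ℕ.+ suc m ℕ.* w)
    arm-row d w h first rest = begin
      Π< (d ℕ.+ w ℕ.* m) (λ j → [1- h j ]) * qfac (suc m) w
        ≈⟨ *-congʳ (trans (Π<-+ d (w ℕ.* m) _) (*-cong (Π<-cong< d (λ j j<d → [1-]-cong (first j j<d)))
             (trans (Π<-blocks w m _) (Π<-cong< w (λ u u<w → Π<-cong< m (λ v v<m → [1-]-cong (rest u v u<w v<m))))))) ⟩
      Π< d (λ j → [1- d ℕ.+ suc m ℕ.* w ∸ j ]) * Π< w (λ u → Π< m (λ v → [1- suc m ℕ.* (w ∸ suc u) ℕ.+ (m ∸ v) ])) * qfac (suc m) w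
        ≈⟨ trans (*-assoc _ _ _) (*-congˡ (blocks w)) ⟩
      Π< d (λ j → [1- d ℕ.+ suc m ℕ.* w ∸ j ]) * qfac 1 (suc m ℕ.* w)
        ≈⟨ qfac-falling (suc m ℕ.* w) d ⟩
      qfac 1 (d ℕ.+ suc m ℕ.* w) ∎

    -- The multiples of m + 1 missing among the hooks of row i form a q-factorial in q^(m+1); over
    -- all rows these make up the superfactorial on the left.
    arm : ∀ A d (h : ℕ → ℕ → ℕ) (cl : ℕ → ℕ) →
      (∀ i j → i < A → j < d ℕ.+ (A ∸ suc i) ℕ.* m → h i j ≡ d ℕ.+ (A ∸ suc i) ℕ.* m ℕ.+ cl j ∸ (i ℕ.+ j ℕ.+ 1)) →
      (∀ j → j < d → cl j ≡ A) → (∀ u v → u < A → v < m → cl (d ℕ.+ (u ℕ.* m ℕ.+ v)) ≡ A ∸ suc u) →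
      Π< A (λ i → Π< (d ℕ.+ (A ∸ suc i) ℕ.* m) (λ j → [1- h i j ])) * superfac (suc m) A ≈ prod (qfac 1) (ends m A d)
    arm A d h cl hook cl₀ cl₁ = begin
      Π< A (λ i → Π< (d ℕ.+ (A ∸ suc i) ℕ.* m) (λ j → [1- h i j ])) * superfac (suc m) A
        ≈⟨ *-congˡ (trans (sym (Π<-rows A (qfac (suc m)))) (sym (Π<-reverse A (qfac (suc m))))) ⟩
      Π< A (λ i → Π< (d ℕ.+ (A ∸ suc i) ℕ.* m) (λ j → [1- h i j ])) * Π< A (λ i → qfac (suc m) (A ∸ suc i))
        ≈⟨ Π<-* A _ _ ⟨
      Π< A (λ i → Π< (d ℕ.+ (A ∸ suc i) ℕ.* m) (λ j → [1- h i j ]) * qfac (suc m) (A ∸ suc i))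
        ≈⟨ Π<-cong< A (λ i i<A → arm-row d (A ∸ suc i) (h i) (first i i<A) (rest i i<A)) ⟩
      Π< A (λ i → qfac 1 (d ℕ.+ suc m ℕ.* (A ∸ suc i)))
        ≈⟨ trans (Π<-reverse A (λ w → qfac 1 (d ℕ.+ suc m ℕ.* w))) (Π<-rows A _) ⟩
      prod (λ w → qfac 1 (d ℕ.+ suc m ℕ.* w)) (rows A)
        ≡⟨ ≡.trans (≡.cong (prod (qfac 1)) (ends-rows m A d)) (prod-map (qfac 1) _ (rows A)) ⟨
      prod (qfac 1) (ends m A d) ∎
      where
      split : ∀ {i} → i < A → A ≡ suc i ℕ.+ (A ∸ suc i)
      split i<A = ≡.sym (ℕₚ.m+[n∸m]≡n i<A)
      first : ∀ i → i < A → ∀ j → j < d → h i j ≡ d ℕ.+ suc m ℕ.* (A ∸ suc i) ∸ j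
      first i i<A j j<d = ≡.trans (hook i j i<A (ℕₚ.<-≤-trans j<d (ℕₚ.m≤m+n d _)))
        (≡.trans (≡.cong₂ _∸_ (≡.trans (≡.cong (d ℕ.+ w ℕ.* m ℕ.+_) (≡.trans (cl₀ j j<d) (split i<A))) (arith₁ d w m i)) (arith₂ i j))
          (ℕₚ.[m+n]∸[m+o]≡n∸o (suc i) (d ℕ.+ suc m ℕ.* w) j))
        where
        w : ℕ
        w = A ∸ suc i
        arith₁ : ∀ d w m i → d ℕ.+ w ℕ.* m ℕ.+ (suc i ℕ.+ w) ≡ suc i ℕ.+ (d ℕ.+ suc m ℕ.* w)
        arith₁ = ℕ-solve
        arith₂ : ∀ i j → i ℕ.+ j ℕ.+ 1 ≡ suc i ℕ.+ j
        arith₂ = ℕ-solve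
      rest : ∀ i → i < A → ∀ u v → u < A ∸ suc i → v < m → h i (d ℕ.+ (u ℕ.* m ℕ.+ v)) ≡ suc m ℕ.* (A ∸ suc i ∸ suc u) ℕ.+ (m ∸ v)
      rest i i<A u v u<w v<m = ≡.trans (hook i _ i<A (ℕₚ.+-monoʳ-< d inside))
        (≡.trans (≡.cong (λ x → d ℕ.+ w ℕ.* m ℕ.+ x ∸ (i ℕ.+ (d ℕ.+ (u ℕ.* m ℕ.+ v)) ℕ.+ 1)) (cl₁ u v (ℕₚ.<-≤-trans u<w (ℕₚ.m∸n≤m A (suc i))) v<m))
        (≡.trans (≡.cong (_∸ (i ℕ.+ (d ℕ.+ (u ℕ.* m ℕ.+ v)) ℕ.+ 1)) (≡.trans (≡.cong₂ (λ x y → d ℕ.+ x ℕ.* m ℕ.+ y) w≡ A∸≡)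
            (≡.trans (arith₁ d u t m i) (≡.cong (λ x → d ℕ.+ (u ℕ.* m ℕ.+ (i ℕ.+ 1 ℕ.+ (suc m ℕ.* t ℕ.+ x)))) (≡.sym (ℕₚ.m+[n∸m]≡n (ℕₚ.<⇒≤ v<m)))))))
        (≡.trans (≡.cong (_∸ (i ℕ.+ (d ℕ.+ (u ℕ.* m ℕ.+ v)) ℕ.+ 1)) (arith₂ d (u ℕ.* m) i (suc m ℕ.* t) v (m ∸ v))) (ℕₚ.m+n∸m≡n (i ℕ.+ (d ℕ.+ (u ℕ.* m ℕ.+ v)) ℕ.+ 1) _))))
        where
        w t : ℕ
        w = A ∸ suc i
        t = w ∸ suc u
        w≡ : w ≡ suc u ℕ.+ t
        w≡ = ≡.sym (ℕₚ.m+[n∸m]≡n u<w)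
        inside : u ℕ.* m ℕ.+ v < w ℕ.* m
        inside = ℕₚ.<-≤-trans (ℕₚ.+-monoʳ-< (u ℕ.* m) v<m) (ℕₚ.≤-trans (ℕₚ.≤-reflexive (ℕₚ.+-comm (u ℕ.* m) m)) (ℕₚ.*-monoˡ-≤ m u<w))
        arith₀ : ∀ i u t → suc i ℕ.+ (suc u ℕ.+ t) ≡ suc u ℕ.+ (suc i ℕ.+ t)
        arith₀ = ℕ-solve
        A∸≡ : A ∸ suc u ≡ suc i ℕ.+ t
        A∸≡ = ≡.trans (≡.cong (_∸ suc u) (≡.trans (split i<A) (≡.trans (≡.cong (suc i ℕ.+_) w≡) (arith₀ i u t)))) (ℕₚ.m+n∸m≡n (suc u) (suc i ℕ.+ t))
        arith₁ : ∀ d u t m i → d ℕ.+ (suc u ℕ.+ t) ℕ.* m ℕ.+ (suc i ℕ.+ t) ≡ d ℕ.+ (u ℕ.* m ℕ.+ (i ℕ.+ 1 ℕ.+ (suc m ℕ.* t ℕ.+ m)))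
        arith₁ = ℕ-solve
        arith₂ : ∀ d um i mt v r → d ℕ.+ (um ℕ.+ (i ℕ.+ 1 ℕ.+ (mt ℕ.+ (v ℕ.+ r)))) ≡ i ℕ.+ (d ℕ.+ (um ℕ.+ v)) ℕ.+ 1 ℕ.+ (mt ℕ.+ r)
        arith₂ = ℕ-solve

  -- The hooks depend only on w + v, so the region without its a by b corner may be rearranged: the
  -- part with w ≥ a and v ≥ c, transposed and moved, extends the c columns from a + c to a + b + c
  -- rows.
  rectangle-hooks : ∀ a b c d e m →
    Π< (a ℕ.+ c) (λ w → Π< (b ℕ.+ c) (λ v → if (w <ᵇ a) ∧ not (v <ᵇ c) then 1# else [1- suc (d ℕ.+ e) ℕ.+ suc m ℕ.* (w ℕ.+ v) ])) ≈
    rectangleHooks a b c d e m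
  rectangle-hooks a b c d e m = begin
    Π< (a ℕ.+ c) (λ w → Π< (b ℕ.+ c) (G w))
      ≈⟨ Π<-cong (a ℕ.+ c) (λ w → trans (reflexive (≡.cong (λ n → Π< n (G w)) (ℕₚ.+-comm b c))) (trans (Π<-+ c b (G w))
           (*-cong (Π<-cong< c (λ v v<c → reflexive (near w v v<c))) (Π<-cong b (λ v → reflexive (far w v)))))) ⟩
    Π< (a ℕ.+ c) (λ w → Π< c (λ v → F (w ℕ.+ v)) * Π< b (λ v → if w <ᵇ a then 1# else F (w ℕ.+ (c ℕ.+ v))))
      ≈⟨ Π<-* (a ℕ.+ c) _ _ ⟩
    Π< (a ℕ.+ c) (λ w → Π< c (λ v → F (w ℕ.+ v))) * Π< (a ℕ.+ c) (λ w → Π< b (λ v → if w <ᵇ a then 1# else F (w ℕ.+ (c ℕ.+ v))))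
      ≈⟨ *-congˡ (trans (Π<-+ a c _) (trans (*-cong (Π<-1 a (λ w w<a → Π<-1 b (λ v _ → reflexive (≡.cong (λ x → if x then 1# else F (w ℕ.+ (c ℕ.+ v))) (<ᵇ-true w<a)))))
           (Π<-cong c (λ w → Π<-cong b (λ v → reflexive (≡.trans (≡.cong (λ x → if x then 1# else F (a ℕ.+ w ℕ.+ (c ℕ.+ v))) (<ᵇ-false (ℕₚ.m≤m+n a w))) (≡.cong F (arith a w c v))))))) (*-identityˡ _))) ⟩
    Π< (a ℕ.+ c) (λ w → Π< c (λ v → F (w ℕ.+ v))) * Π< c (λ t → Π< b (λ u → F (t ℕ.+ (a ℕ.+ c ℕ.+ u))))
      ≈⟨ *-cong (Π<-cong (a ℕ.+ c) (λ w → Π<-cong c (λ v → reflexive (≡.cong F (ℕₚ.+-comm w v))))) (Π<-swap c b _) ⟩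
    Π< (a ℕ.+ c) (λ i → Π< c (λ t → F (t ℕ.+ i))) * Π< b (λ u → Π< c (λ t → F (t ℕ.+ (a ℕ.+ c ℕ.+ u))))
      ≈⟨ Π<-+ (a ℕ.+ c) b (λ i → Π< c (λ t → F (t ℕ.+ i))) ⟨
    Π< (a ℕ.+ c ℕ.+ b) (λ i → Π< c (λ t → F (t ℕ.+ i)))
      ≡⟨ ≡.cong (λ n → Π< n (λ i → Π< c (λ t → F (t ℕ.+ i)))) (arith′ a b c) ⟩
    Π< (b ℕ.+ a ℕ.+ c) (λ i → Π< c (λ t → F (t ℕ.+ i)))
      ≈⟨ trans (Π<-cong (b ℕ.+ a ℕ.+ c) (λ i → Π<-rows c _)) (Π<-rows (b ℕ.+ a ℕ.+ c) _) ⟩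
    rectangleHooks a b c d e m ∎
    where
    F : ℕ → Carrier
    F s = [1- suc (d ℕ.+ e) ℕ.+ suc m ℕ.* s ]
    G : ℕ → ℕ → Carrier
    G w v = if (w <ᵇ a) ∧ not (v <ᵇ c) then 1# else F (w ℕ.+ v)
    near : ∀ w v → v < c → G w v ≡ F (w ℕ.+ v)
    near w v v<c rewrite <ᵇ-true v<c with w <ᵇ a
    ... | true  = ≡.refl
    ... | false = ≡.refl
    far : ∀ w v → G w (c ℕ.+ v) ≡ (if w <ᵇ a then 1# else F (w ℕ.+ (c ℕ.+ v)))
    far w v rewrite <ᵇ-false (ℕₚ.m≤m+n c v) with w <ᵇ a
    ... | true  = ≡.refl
    ... | false = ≡.refl
    arith : ∀ a w c v → a ℕ.+ w ℕ.+ (c ℕ.+ v) ≡ w ℕ.+ (a ℕ.+ c ℕ.+ v)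
    arith = ℕ-solve
    arith′ : ∀ a b c → a ℕ.+ c ℕ.+ b ≡ b ℕ.+ a ℕ.+ c
    arith′ = ℕ-solve

-- Row lengths, column lengths and hooks of λ

<ᵇ-+ : ∀ n x y → (n ℕ.+ x <ᵇ n ℕ.+ y) ≡ (x <ᵇ y)
<ᵇ-+ zero    x y = ≡.refl
<ᵇ-+ (suc n) x y = <ᵇ-+ n x y

count-initial : ∀ (p : ℕ → Bool) n {k} → k ≤ n → (∀ i → i < n → p (suc i) ≡ (i <ᵇ k)) → countᵇ p (range1 n) ≡ k
count-initial p n {k} = go suc n k
  where
  go : ∀ (f : ℕ → ℕ) n k → k ≤ n → (∀ i → i < n → p (f i) ≡ (i <ᵇ k)) → countᵇ p (applyUpTo f n) ≡ k
  go f zero    zero    le       e = ≡.refl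
  go f (suc n) zero    le       e rewrite e 0 (s≤s z≤n) = go (f ∘ suc) n 0 z≤n (λ i i<n → e (suc i) (s≤s i<n))
  go f (suc n) (suc k) (s≤s le) e rewrite e 0 (s≤s z≤n) = ≡.cong suc (go (f ∘ suc) n k le (λ i i<n → e (suc i) (s≤s i<n)))

-- the length of column d + u m + v of the staircase-like partition with rows d + (A ∸ suc i) m, i < A
leg : ∀ A d m u v i → v < m → ((i <ᵇ A) ∧ (d ℕ.+ (u ℕ.* m ℕ.+ v) <ᵇ d ℕ.+ (A ∸ suc i) ℕ.* m)) ≡ (i <ᵇ A ∸ suc u)
leg A d m u v i v<m = T-iff
  (λ t → let i<A , lt = ∧-T {i <ᵇ A} t in ℕₚ.<⇒<ᵇ (to (ℕₚ.<ᵇ⇒< i A i<A) (ℕₚ.+-cancelˡ-< d _ _ (ℕₚ.<ᵇ⇒< _ _ lt))))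
  (λ t → let i<A , lt = from (ℕₚ.<ᵇ⇒< i _ t) in Equivalence.from T-∧ (ℕₚ.<⇒<ᵇ i<A , ℕₚ.<⇒<ᵇ (ℕₚ.+-monoʳ-< d lt)))
  where
  to : i < A → u ℕ.* m ℕ.+ v < (A ∸ suc i) ℕ.* m → i < A ∸ suc u
  to i<A lt = ℕₚ.m+n≤o⇒m≤o∸n (suc i) (≡.subst (suc i ℕ.+ suc u ≤_) (ℕₚ.m+[n∸m]≡n i<A) (ℕₚ.+-monoʳ-≤ (suc i) u<w))
    where
    u<w : u < A ∸ suc i
    u<w = ℕₚ.*-cancelʳ-< m u (A ∸ suc i) (ℕₚ.≤-<-trans (ℕₚ.m≤m+n (u ℕ.* m) v) lt)
  from : i < A ∸ suc u → i < A × u ℕ.* m ℕ.+ v < (A ∸ suc i) ℕ.* m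
  from lt = ℕₚ.<-≤-trans lt (ℕₚ.m∸n≤m A (suc u)) ,
    ℕₚ.<-≤-trans (ℕₚ.+-monoʳ-< (u ℕ.* m) v<m) (ℕₚ.≤-trans (ℕₚ.≤-reflexive (ℕₚ.+-comm (u ℕ.* m) m)) (ℕₚ.*-monoˡ-≤ m u<w))
    where
    u<w : suc u ≤ A ∸ suc i
    u<w = ℕₚ.m+n≤o⇒m≤o∸n (suc u) (ℕₚ.≤-trans (ℕₚ.≤-reflexive (ℕₚ.+-comm (suc u) (suc i)))
      (ℕₚ.≤-trans (ℕₚ.+-monoˡ-≤ (suc u) lt) (ℕₚ.≤-reflexive (ℕₚ.m∸n+n≡m 1+u≤A))))
      where
      1+u≤A : suc u ≤ A
      1+u≤A = ℕₚ.≮⇒≥ (λ A<1+u → ℕₚ.n≮0 (≡.subst (i <_) (ℕₚ.m≤n⇒m∸n≡0 (ℕₚ.<⇒≤ A<1+u)) lt))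

leg₀ : ∀ A d m j i → j < d → ((i <ᵇ A) ∧ (j <ᵇ d ℕ.+ (A ∸ suc i) ℕ.* m)) ≡ (i <ᵇ A)
leg₀ A d m j i j<d rewrite <ᵇ-true (ℕₚ.<-≤-trans j<d (ℕₚ.m≤m+n d ((A ∸ suc i) ℕ.* m))) = ∧-identityʳ _

module Lengths (a b c d e m : ℕ) where
  open Shape a b c d e m

  A B : ℕ
  A = a ℕ.+ c
  B = b ℕ.+ c

  R′ C′ : ℕ
  R′ = e ℕ.+ B ℕ.* m
  C′ = d ℕ.+ A ℕ.* m

  R≡ : R ≡ A ℕ.+ R′
  R≡ = ℕₚ.+-assoc A e (B ℕ.* m)

  C≡ : C ≡ B ℕ.+ C′
  C≡ = ℕₚ.+-assoc B d (A ℕ.* m)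

  ν≤C′ : ∀ i → ν i ≤ C′
  ν≤C′ i = ℕₚ.+-monoʳ-≤ d (ℕₚ.*-monoˡ-≤ m (ℕₚ.m∸n≤m A i))

  θ≤R′ : ∀ j → θ j ≤ R′
  θ≤R′ j = ℕₚ.+-monoʳ-≤ e (ℕₚ.*-monoˡ-≤ m (ℕₚ.m∸n≤m B j))

  inλ-row : ∀ {i} j → i < A → inλ (suc i) (suc j) ≡ (j <ᵇ B ℕ.+ ν (suc i))
  inλ-row {i} j i<A rewrite <ᵇ-true i<A with j ℕ.<? B
  ... | yes j<B rewrite <ᵇ-true (ℕₚ.<-≤-trans j<B (ℕₚ.m≤m+n B (ν (suc i)))) = ≡.refl
  ... | no j≮B rewrite <ᵇ-false (ℕₚ.≮⇒≥ j≮B) = ∨-identityʳ _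

  inλ-col : ∀ i {j} → j < B → inλ (suc i) (suc j) ≡ (i <ᵇ A ℕ.+ θ (suc j))
  inλ-col i {j} j<B rewrite <ᵇ-true j<B with i ℕ.<? A
  ... | yes i<A rewrite <ᵇ-true i<A | <ᵇ-true (ℕₚ.<-≤-trans j<B (ℕₚ.m≤m+n B (ν (suc i)))) | <ᵇ-true (ℕₚ.<-≤-trans i<A (ℕₚ.m≤m+n A (θ (suc j)))) = ≡.refl
  ... | no i≮A rewrite <ᵇ-false (ℕₚ.≮⇒≥ i≮A) = ≡.refl

  inλ-right : ∀ i j → inλ (suc i) (suc (B ℕ.+ j)) ≡ (i <ᵇ A) ∧ (j <ᵇ ν (suc i))
  inλ-right i j rewrite <ᵇ-false (ℕₚ.m≤m+n B j) | <ᵇ-+ B j (ν (suc i)) = ∨-identityʳ _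

  inλ-below : ∀ i j → inλ (suc (A ℕ.+ i)) (suc j) ≡ (j <ᵇ B) ∧ (i <ᵇ θ (suc j))
  inλ-below i j rewrite <ᵇ-false (ℕₚ.m≤m+n A i) | <ᵇ-+ A i (θ (suc j)) = ≡.refl

  rowLen-top : ∀ {i} → i < A → rowLen (suc i) ≡ B ℕ.+ ν (suc i)
  rowLen-top {i} i<A = count-initial (inλ (suc i)) C (≡.subst (B ℕ.+ ν (suc i) ≤_) (≡.sym C≡) (ℕₚ.+-monoʳ-≤ B (ν≤C′ (suc i)))) (λ j _ → inλ-row j i<A)

  colLen-left : ∀ {j} → j < B → colLen (suc j) ≡ A ℕ.+ θ (suc j)
  colLen-left {j} j<B = count-initial (λ i → inλ i (suc j)) R (≡.subst (A ℕ.+ θ (suc j) ≤_) (≡.sym R≡) (ℕₚ.+-monoʳ-≤ A (θ≤R′ (suc j)))) (λ i _ → inλ-col i j<B)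

  private
    A≤R : A ≤ R
    A≤R = ≡.subst (A ≤_) (≡.sym R≡) (ℕₚ.m≤m+n A R′)
    B≤C : B ≤ C
    B≤C = ≡.subst (B ≤_) (≡.sym C≡) (ℕₚ.m≤m+n B C′)

  colLen-right₀ : ∀ j → j < d → colLen (suc (B ℕ.+ j)) ≡ A
  colLen-right₀ j j<d = count-initial (λ i → inλ i (suc (B ℕ.+ j))) R A≤R (λ i _ → ≡.trans (inλ-right i j) (leg₀ A d m j i j<d))

  colLen-right₁ : ∀ u v → u < A → v < m → colLen (suc (B ℕ.+ (d ℕ.+ (u ℕ.* m ℕ.+ v)))) ≡ A ∸ suc u
  colLen-right₁ u v _ v<m = count-initial (λ i → inλ i (suc (B ℕ.+ (d ℕ.+ (u ℕ.* m ℕ.+ v))))) R (ℕₚ.≤-trans (ℕₚ.m∸n≤m A (suc u)) A≤R)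
    (λ i _ → ≡.trans (inλ-right i _) (leg A d m u v i v<m))

  rowLen-below₀ : ∀ i → i < e → rowLen (suc (A ℕ.+ i)) ≡ B
  rowLen-below₀ i i<e = count-initial (inλ (suc (A ℕ.+ i))) C B≤C (λ j _ → ≡.trans (inλ-below i j) (leg₀ B e m i j i<e))

  rowLen-below₁ : ∀ u v → u < B → v < m → rowLen (suc (A ℕ.+ (e ℕ.+ (u ℕ.* m ℕ.+ v)))) ≡ B ∸ suc u
  rowLen-below₁ u v _ v<m = count-initial (inλ (suc (A ℕ.+ (e ℕ.+ (u ℕ.* m ℕ.+ v))))) C (ℕₚ.≤-trans (ℕₚ.m∸n≤m B (suc u)) B≤C)
    (λ j _ → ≡.trans (inλ-below _ j) (leg B e m u v j v<m))

  -- Counted from the far corner of the rectangle, each step back in either direction lengthens the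
  -- hook by one cell and by the m cells that the arm or the leg gains.
  hook-rectangle : ∀ {i j} → i < A → j < B → hook (suc i) (suc j) ≡ suc (d ℕ.+ e) ℕ.+ suc m ℕ.* ((A ∸ suc i) ℕ.+ (B ∸ suc j))
  hook-rectangle {i} {j} i<A j<B = begin
    rowLen (suc i) ℕ.+ colLen (suc j) ℕ.+ 1 ∸ (suc i ℕ.+ suc j)
      ≡⟨ ≡.cong₂ (λ x y → x ℕ.+ y ℕ.+ 1 ∸ (suc i ℕ.+ suc j)) (rowLen-top i<A) (colLen-left j<B) ⟩
    B ℕ.+ (d ℕ.+ w ℕ.* m) ℕ.+ (A ℕ.+ (e ℕ.+ v ℕ.* m)) ℕ.+ 1 ∸ (suc i ℕ.+ suc j)
      ≡⟨ ≡.cong₂ (λ x y → y ℕ.+ (d ℕ.+ w ℕ.* m) ℕ.+ (x ℕ.+ (e ℕ.+ v ℕ.* m)) ℕ.+ 1 ∸ (suc i ℕ.+ suc j)) (≡.sym (ℕₚ.m+[n∸m]≡n i<A)) (≡.sym (ℕₚ.m+[n∸m]≡n j<B)) ⟩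
    suc j ℕ.+ v ℕ.+ (d ℕ.+ w ℕ.* m) ℕ.+ (suc i ℕ.+ w ℕ.+ (e ℕ.+ v ℕ.* m)) ℕ.+ 1 ∸ (suc i ℕ.+ suc j)
      ≡⟨ ≡.cong (_∸ (suc i ℕ.+ suc j)) (arith i j v w d e m) ⟩
    suc i ℕ.+ suc j ℕ.+ (suc (d ℕ.+ e) ℕ.+ suc m ℕ.* (w ℕ.+ v)) ∸ (suc i ℕ.+ suc j)
      ≡⟨ ℕₚ.m+n∸m≡n (suc i ℕ.+ suc j) _ ⟩
    suc (d ℕ.+ e) ℕ.+ suc m ℕ.* (w ℕ.+ v) ∎
    where
    open ≡.≡-Reasoning
    w v : ℕ
    w = A ∸ suc i
    v = B ∸ suc j
    arith : ∀ i j v w d e m → suc j ℕ.+ v ℕ.+ (d ℕ.+ w ℕ.* m) ℕ.+ (suc i ℕ.+ w ℕ.+ (e ℕ.+ v ℕ.* m)) ℕ.+ 1 ≡ suc i ℕ.+ suc j ℕ.+ (suc (d ℕ.+ e) ℕ.+ suc m ℕ.* (w ℕ.+ v))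
    arith = ℕ-solve

  hook-right : ∀ i j → i < A → hook (suc i) (suc (B ℕ.+ j)) ≡ ν (suc i) ℕ.+ colLen (suc (B ℕ.+ j)) ∸ (i ℕ.+ j ℕ.+ 1)
  hook-right i j i<A = ≡.trans (≡.cong (λ x → x ℕ.+ colLen (suc (B ℕ.+ j)) ℕ.+ 1 ∸ (suc i ℕ.+ suc (B ℕ.+ j))) (rowLen-top i<A))
    (≡.trans (≡.cong₂ _∸_ (arith₁ B (ν (suc i)) (colLen (suc (B ℕ.+ j)))) (arith₂ i B j)) (ℕₚ.[m+n]∸[m+o]≡n∸o (B ℕ.+ 1) _ _))
    where
    arith₁ : ∀ B n l → B ℕ.+ n ℕ.+ l ℕ.+ 1 ≡ B ℕ.+ 1 ℕ.+ (n ℕ.+ l)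
    arith₁ = ℕ-solve
    arith₂ : ∀ i B j → suc i ℕ.+ suc (B ℕ.+ j) ≡ B ℕ.+ 1 ℕ.+ (i ℕ.+ j ℕ.+ 1)
    arith₂ = ℕ-solve

  hook-below : ∀ i j → j < B → hook (suc (A ℕ.+ i)) (suc j) ≡ θ (suc j) ℕ.+ rowLen (suc (A ℕ.+ i)) ∸ (j ℕ.+ i ℕ.+ 1)
  hook-below i j j<B = ≡.trans (≡.cong (λ x → rowLen (suc (A ℕ.+ i)) ℕ.+ x ℕ.+ 1 ∸ (suc (A ℕ.+ i) ℕ.+ suc j)) (colLen-left j<B))
    (≡.trans (≡.cong₂ _∸_ (arith₁ A (θ (suc j)) (rowLen (suc (A ℕ.+ i)))) (arith₂ i A j)) (ℕₚ.[m+n]∸[m+o]≡n∸o (A ℕ.+ 1) _ _))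
    where
    arith₁ : ∀ A n l → l ℕ.+ (A ℕ.+ n) ℕ.+ 1 ≡ A ℕ.+ 1 ℕ.+ (n ℕ.+ l)
    arith₁ = ℕ-solve
    arith₂ : ∀ i A j → suc (A ℕ.+ i) ℕ.+ suc j ≡ A ℕ.+ 1 ℕ.+ (j ℕ.+ i ℕ.+ 1)
    arith₂ = ℕ-solve

  private
    flip-bounds : ∀ {α x} → x < α ℕ.+ c → (c ≤ x → α ℕ.+ c ∸ suc x < α) × (α ℕ.+ c ∸ suc x < α → c ≤ x)
    flip-bounds {α} {x} lt =
      (λ c≤x → ℕₚ.+-cancelʳ-< (suc x) _ α (≡.subst (_< α ℕ.+ suc x) (≡.sym (ℕₚ.m∸n+n≡m lt)) (ℕₚ.+-monoʳ-< α (s≤s c≤x)))) ,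
      (λ w<α → ℕₚ.≤-pred (ℕₚ.+-cancelˡ-< α c (suc x) (≡.subst (_< α ℕ.+ suc x) (ℕₚ.m∸n+n≡m lt) (ℕₚ.+-monoˡ-< (suc x) w<α))))

    flip-bounds′ : ∀ {x} → x < B → (x < b → c ≤ B ∸ suc x) × (c ≤ B ∸ suc x → x < b)
    flip-bounds′ {x} lt =
      (λ x<b → ℕₚ.m+n≤o⇒m≤o∸n c (≡.subst (c ℕ.+ suc x ≤_) (ℕₚ.+-comm c b) (ℕₚ.+-monoʳ-≤ c x<b))) ,
      (λ c≤v → ℕₚ.+-cancelʳ-≤ c (suc x) b (≡.subst (_≤ B) (ℕₚ.+-comm c (suc x)) (≡.subst (c ℕ.+ suc x ≤_) (ℕₚ.m∸n+n≡m lt) (ℕₚ.+-monoˡ-≤ (suc x) c≤v))))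

  -- Rows c + 1 to c + a and columns 1 to b become, counted from the far corner, the positions with
  -- w < a and v ≥ c.
  inρ-rectangle : ∀ {i j} → i < A → j < B → inρ (suc i) (suc j) ≡ not ((A ∸ suc i <ᵇ a) ∧ not (B ∸ suc j <ᵇ c))
  inρ-rectangle {i} {j} i<A j<B = ≡.cong₂ (λ x y → x ∧ not y) (≡.trans (inλ-row j i<A) (<ᵇ-true (ℕₚ.<-≤-trans j<B (ℕₚ.m≤m+n B _))))
    (T-iff
      (λ t → let c≤i , rest = ∧-T {c ℕ.+ 1 ≤ᵇ suc i} t
                 _ , j<b = ∧-T {i <ᵇ c ℕ.+ a} rest in
        Equivalence.from T-∧ (ℕₚ.<⇒<ᵇ (proj₁ (flip-bounds i<A) (ℕₚ.≤-pred (≡.subst (_≤ suc i) (ℕₚ.+-comm c 1) (ℕₚ.≤ᵇ⇒≤ _ _ c≤i)))) ,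
          ≡.subst (T ∘ not) (≡.sym (<ᵇ-false (proj₁ (flip-bounds′ j<B) (ℕₚ.<ᵇ⇒< j b j<b)))) _))
      (λ t → let w<a , v≥c = ∧-T {A ∸ suc i <ᵇ a} t in
        Equivalence.from T-∧ (ℕₚ.≤⇒≤ᵇ (≡.subst (_≤ suc i) (ℕₚ.+-comm 1 c) (s≤s (proj₂ (flip-bounds i<A) (ℕₚ.<ᵇ⇒< _ a w<a)))) ,
          Equivalence.from T-∧ (ℕₚ.<⇒<ᵇ (≡.subst (i <_) (ℕₚ.+-comm a c) i<A) ,
            ℕₚ.<⇒<ᵇ (proj₂ (flip-bounds′ j<B) (ℕₚ.≮⇒≥ (λ v<c → ≡.subst (T ∘ not) (<ᵇ-true v<c) v≥c)))))))

  inρ-right : ∀ {i} j → i < A → inρ (suc i) (suc (B ℕ.+ j)) ≡ (j <ᵇ ν (suc i))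
  inρ-right {i} j i<A rewrite inλ-right i j | <ᵇ-true i<A | <ᵇ-false {B ℕ.+ j} {b} (ℕₚ.≤-trans (ℕₚ.m≤m+n b c) (ℕₚ.m≤m+n B j))
    | ∧-zeroʳ (i <ᵇ c ℕ.+ a) | ∧-zeroʳ (c ℕ.+ 1 ≤ᵇ suc i) = ∧-identityʳ _

  inρ-below : ∀ i {j} → j < B → inρ (suc (A ℕ.+ i)) (suc j) ≡ (i <ᵇ θ (suc j))
  inρ-below i {j} j<B rewrite inλ-below i j | <ᵇ-true j<B | <ᵇ-false {A ℕ.+ i} {c ℕ.+ a} (≡.subst (_≤ A ℕ.+ i) (ℕₚ.+-comm a c) (ℕₚ.m≤m+n A i))
    | ∧-zeroʳ (c ℕ.+ 1 ≤ᵇ suc (A ℕ.+ i)) = ∧-identityʳ _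

  inρ-corner : ∀ i j → inρ (suc (A ℕ.+ i)) (suc (B ℕ.+ j)) ≡ false
  inρ-corner i j rewrite inλ-below i (B ℕ.+ j) | <ᵇ-false {B ℕ.+ j} {B} (ℕₚ.m≤m+n B j) = ≡.refl

-- The product over the hooks

module HookProduct (R′ : CommutativeRing 0ℓ 0ℓ) (q : CommutativeRing.Carrier R′) (W : ℕ) (a b c d e m : ℕ) where
  open Products R′ q W
  open Shape a b c d e m hiding (R)
  open Lengths a b c d e m renaming (R′ to rows′)

  hookProduct : Carrier
  hookProduct = foldList (λ { (i , j) → [1- hook i j ] }) cellsρ

  -- The bounding box splits into the rectangle, the two arms and a corner without cells. Each arm
  -- lacks the multiples of m + 1, and the two superfactorials supply them.
  hookProduct-superfac : hookProduct * (superfac (suc m) A * superfac (suc m) B) ≈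
    rectangleHooks a b c d e m * prod (qfac 1) (ends m A d) * prod (qfac 1) (ends m B e)
  hookProduct-superfac = begin
    hookProduct * (superfac (suc m) A * superfac (suc m) B)
      ≈⟨ *-congʳ (trans (foldList-filterᵇ _ _ box) (trans (foldList-grid G (Shape.R a b c d e m) C)
           (trans (reflexive (≡.cong₂ (λ r s → Π< r (λ i → Π< s (g i))) R≡ C≡))
           (trans (Π<-+ A rows′ _) (*-cong (trans (Π<-cong A (λ i → Π<-+ B C′ (g i))) (Π<-* A _ _)) (Π<-cong rows′ (λ i → Π<-+ B C′ (g (A ℕ.+ i))))))))) ⟩
    Π< A (λ i → Π< B (g i)) * Π< A (λ i → Π< C′ (λ j → g i (B ℕ.+ j))) *
      Π< rows′ (λ i → Π< B (g (A ℕ.+ i)) * Π< C′ (λ j → g (A ℕ.+ i) (B ℕ.+ j))) * (superfac (suc m) A * superfac (suc m) B)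
      ≈⟨ *-congʳ (*-cong (*-cong rectangular right) below) ⟩
    rectangleHooks a b c d e m * Qᵁ * Qᴸ * (superfac (suc m) A * superfac (suc m) B)
      ≈⟨ shuffle _ _ _ _ _ ⟩
    rectangleHooks a b c d e m * (Qᵁ * superfac (suc m) A) * (Qᴸ * superfac (suc m) B)
      ≈⟨ *-cong (*-congˡ (arm m A d (λ i j → hook (suc i) (suc (B ℕ.+ j))) (λ j → colLen (suc (B ℕ.+ j))) (λ i j i<A _ → hook-right i j i<A) colLen-right₀ colLen-right₁))
                (arm m B e (λ j i → hook (suc (A ℕ.+ i)) (suc j)) (λ i → rowLen (suc (A ℕ.+ i))) (λ j i j<B _ → hook-below i j j<B) rowLen-below₀ rowLen-below₁) ⟩
    rectangleHooks a b c d e m * prod (qfac 1) (ends m A d) * prod (qfac 1) (ends m B e) ∎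
    where
    shuffle : ∀ r u l x y → r * u * l * (x * y) ≈ r * (u * x) * (l * y)
    shuffle = MonoidSolver.solve 5 (λ r u l x y → (((r ⊕ u) ⊕ l) ⊕ (x ⊕ y)) ⊜ ((r ⊕ (u ⊕ x)) ⊕ (l ⊕ y))) refl
    G : Cell → Carrier
    G (i , j) = if inρ i j then [1- hook i j ] else 1#
    g : ℕ → ℕ → Carrier
    g i j = G (suc i , suc j)
    Qᵁ Qᴸ : Carrier
    Qᵁ = Π< A (λ i → Π< (ν (suc i)) (λ j → [1- hook (suc i) (suc (B ℕ.+ j)) ]))
    Qᴸ = Π< B (λ j → Π< (θ (suc j)) (λ i → [1- hook (suc (A ℕ.+ i)) (suc j) ]))
    F : ℕ → ℕ → Carrier
    F w v = if (w <ᵇ a) ∧ not (v <ᵇ c) then 1# else [1- suc (d ℕ.+ e) ℕ.+ suc m ℕ.* (w ℕ.+ v) ]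
    if-not : ∀ x {y z : Carrier} → (if not x then y else z) ≡ (if x then z else y)
    if-not true  = ≡.refl
    if-not false = ≡.refl
    rectangular : Π< A (λ i → Π< B (g i)) ≈ rectangleHooks a b c d e m
    rectangular = trans (Π<-cong< A (λ i i<A → Π<-cong< B (λ j j<B → reflexive (≡.trans
        (≡.cong₂ (λ x h → if x then [1- h ] else 1#) (inρ-rectangle i<A j<B) (hook-rectangle i<A j<B))
        (if-not ((A ∸ suc i <ᵇ a) ∧ not (B ∸ suc j <ᵇ c)))))))
      (trans (Π<-cong A (λ i → Π<-reverse B (F (A ∸ suc i)))) (trans (Π<-reverse A (λ w → Π< B (F w))) (rectangle-hooks a b c d e m)))
    right : Π< A (λ i → Π< C′ (λ j → g i (B ℕ.+ j))) ≈ Qᵁ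
    right = Π<-cong< A (λ i i<A → trans (Π<-cong C′ (λ j → reflexive (≡.cong (λ x → if x then [1- hook (suc i) (suc (B ℕ.+ j)) ] else 1#) (inρ-right j i<A))))
      (Π<-truncate _ (ν≤C′ (suc i))))
    below : Π< rows′ (λ i → Π< B (g (A ℕ.+ i)) * Π< C′ (λ j → g (A ℕ.+ i) (B ℕ.+ j))) ≈ Qᴸ
    below = trans (Π<-cong rows′ (λ i → trans (*-congˡ (Π<-1 C′ (λ j _ → reflexive (≡.cong (λ x → if x then [1- hook (suc (A ℕ.+ i)) (suc (B ℕ.+ j)) ] else 1#) (inρ-corner i j))))) (*-identityʳ _)))
      (trans (Π<-swap rows′ B _) (Π<-cong< B (λ j j<B → trans (Π<-cong rows′ (λ i → reflexive (≡.cong (λ x → if x then [1- hook (suc (A ℕ.+ i)) (suc j) ] else 1#) (inρ-below i j<B))))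
        (Π<-truncate _ (θ≤R′ (suc j))))))

-- Closed forms for the exponents of q

tri : ℕ → ℕ
tri zero    = 0
tri (suc n) = n ℕ.+ tri n

-- The sum of i + b over i < n: the share of a column with n cells in N + b |π|.
shiftedTri : ℕ → ℕ → ℕ
shiftedTri b n = tri n ℕ.+ n ℕ.* b

triSum : ℕ → ℕ → ℕ → ℕ → ℕ
triSum b m zero    k = 0
triSum b m (suc n) k = shiftedTri b k ℕ.+ triSum b m n (k ℕ.+ m)

module ClosedForms where
  open import Data.Integer using (+_; _+_; _*_; _-_)

  private
    ι : ℕ → ℤ
    ι n = + n

    -- Closed forms are stated for a multiple by 2, 6 or 12, which avoids division, and over ℤ,
    -- which admits subtraction. This lemma and the two after it add such statements, scale them and
    -- raise their multiplier.
    plus : ∀ k x y {p r} → + k * ι x ≡ p → + k * ι y ≡ r → + k * ι (x ℕ.+ y) ≡ p + r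
    plus k x y e e′ = ≡.trans (ℤₚ.*-distribˡ-+ (+ k) (ι x) (ι y)) (≡.cong₂ _+_ e e′)

    scale : ∀ k j {n p} → + k * ι n ≡ p → + k * ι (j ℕ.* n) ≡ ι j * p
    scale k j {n} e = ≡.trans (≡.cong (+ k *_) (ℤₚ.pos-* j n)) (≡.trans (swap (+ k) (ι j) (ι n)) (≡.cong (ι j *_) e))
      where
      swap : ∀ x y z → x * (y * z) ≡ y * (x * z)
      swap = ℤ-solve

    double : ∀ k j {n p} → + k * ι n ≡ p → + (j ℕ.* k) * ι n ≡ + j * p
    double k j {n} e = ≡.trans (≡.cong (_* ι n) (ℤₚ.pos-* j k)) (≡.trans (ℤₚ.*-assoc (+ j) (+ k) (ι n)) (≡.cong (+ j *_) e))

  tri-closed : ∀ n → + 2 * ι (tri n) ≡ ι n * ι n - ι n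
  tri-closed zero    = ≡.refl
  tri-closed (suc n) = ≡.trans (plus 2 n (tri n) ≡.refl (tri-closed n)) (poly (ι n))
    where
    poly : ∀ n → + 2 * n + (n * n - n) ≡ (+ 1 + n) * (+ 1 + n) - (+ 1 + n)
    poly = ℤ-solve

  shiftedTri-closed : ∀ b n → + 2 * ι (shiftedTri b n) ≡ ι n * ι n - ι n + + 2 * (ι n * ι b)
  shiftedTri-closed b n = plus 2 (tri n) (n ℕ.* b) (tri-closed n) (≡.cong (+ 2 *_) (ℤₚ.pos-* n b))

  triSum-closed : ∀ b m n k → + 12 * ι (triSum b m n k) ≡
    + 6 * ι n * ι k * ι k + + 6 * ι k * ι m * (ι n * ι n - ι n) + ι m * ι m * (+ 2 * ι n * ι n * ι n - + 3 * ι n * ι n + ι n)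
    - + 6 * ι n * ι k - + 3 * ι m * (ι n * ι n - ι n) + + 12 * ι b * ι n * ι k + + 6 * ι b * ι m * (ι n * ι n - ι n)
  triSum-closed b m zero    k = poly (ι k) (ι m) (ι b)
    where
    poly : ∀ k m b → + 0 ≡
      + 6 * + 0 * k * k + + 6 * k * m * (+ 0 * + 0 - + 0) + m * m * (+ 2 * + 0 * + 0 * + 0 - + 3 * + 0 * + 0 + + 0)
      - + 6 * + 0 * k - + 3 * m * (+ 0 * + 0 - + 0) + + 12 * b * + 0 * k + + 6 * b * m * (+ 0 * + 0 - + 0)
    poly = ℤ-solve
  triSum-closed b m (suc n) k = ≡.trans (plus 12 (shiftedTri b k) (triSum b m n (k ℕ.+ m)) (double 2 6 {shiftedTri b k} (shiftedTri-closed b k)) (triSum-closed b m n (k ℕ.+ m))) (poly (ι b) (ι m) (ι n) (ι k))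
    where
    poly : ∀ b m n k → + 6 * (k * k - k + + 2 * (k * b)) +
      (+ 6 * n * (k + m) * (k + m) + + 6 * (k + m) * m * (n * n - n) + m * m * (+ 2 * n * n * n - + 3 * n * n + n)
      - + 6 * n * (k + m) - + 3 * m * (n * n - n) + + 12 * b * n * (k + m) + + 6 * b * m * (n * n - n)) ≡
      + 6 * (+ 1 + n) * k * k + + 6 * k * m * ((+ 1 + n) * (+ 1 + n) - (+ 1 + n)) + m * m * (+ 2 * (+ 1 + n) * (+ 1 + n) * (+ 1 + n) - + 3 * (+ 1 + n) * (+ 1 + n) + (+ 1 + n))
      - + 6 * (+ 1 + n) * k - + 3 * m * ((+ 1 + n) * (+ 1 + n) - (+ 1 + n)) + + 12 * b * (+ 1 + n) * k + + 6 * b * m * ((+ 1 + n) * (+ 1 + n) - (+ 1 + n))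
    poly = ℤ-solve

  upFrom-closed : ∀ s n → + 2 * ι (sum (upFrom s n)) ≡ + 2 * ι n * ι s + (ι n * ι n - ι n)
  upFrom-closed s zero    = poly (ι s)
    where
    poly : ∀ s → + 0 ≡ + 2 * + 0 * s + (+ 0 * + 0 - + 0)
    poly = ℤ-solve
  upFrom-closed s (suc n) = ≡.trans (plus 2 s (sum (upFrom (suc s) n)) ≡.refl (upFrom-closed (suc s) n)) (poly (ι s) (ι n))
    where
    poly : ∀ s n → + 2 * s + (+ 2 * n * (+ 1 + s) + (n * n - n)) ≡ + 2 * (+ 1 + n) * s + ((+ 1 + n) * (+ 1 + n) - (+ 1 + n))
    poly = ℤ-solve

  vexp-closed : ∀ s n → + 6 * ι (vexp s n) ≡ + 3 * ι s * (ι n * ι n - ι n) + (ι n * ι n * ι n - + 3 * ι n * ι n + + 2 * ι n)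
  vexp-closed s zero    = poly (ι s)
    where
    poly : ∀ s → + 0 ≡ + 3 * s * (+ 0 * + 0 - + 0) + (+ 0 * + 0 * + 0 - + 3 * + 0 * + 0 + + 2 * + 0)
    poly = ℤ-solve
  vexp-closed s (suc n) = ≡.trans (plus 6 (s ℕ.* n) (vexp (suc s) n) (≡.cong (+ 6 *_) (ℤₚ.pos-* s n)) (vexp-closed (suc s) n)) (poly (ι s) (ι n))
    where
    poly : ∀ s n → + 6 * (s * n) + (+ 3 * (+ 1 + s) * (n * n - n) + (n * n * n - + 3 * n * n + + 2 * n)) ≡
      + 3 * s * ((+ 1 + n) * (+ 1 + n) - (+ 1 + n)) + ((+ 1 + n) * (+ 1 + n) * (+ 1 + n) - + 3 * (+ 1 + n) * (+ 1 + n) + + 2 * (+ 1 + n))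
    poly = ℤ-solve

  twist-closed : ∀ w D → + 2 * ι (twistExp w D) ≡ ι w * (ι D * ι D + ι D)
  twist-closed w zero    = poly (ι w)
    where
    poly : ∀ w → + 0 ≡ w * (+ 0 * + 0 + + 0)
    poly = ℤ-solve
  twist-closed w (suc D) = ≡.trans (plus 2 (w ℕ.* suc D) (twistExp w D) (≡.cong (+ 2 *_) (ℤₚ.pos-* w (suc D))) (twist-closed w D)) (poly (ι w) (ι D))
    where
    poly : ∀ w D → + 2 * (w * (+ 1 + D)) + w * (D * D + D) ≡ w * ((+ 1 + D) * (+ 1 + D) + (+ 1 + D))
    poly = ℤ-solve

  twistSum-closed : ∀ w E S n → + 12 * ι (sum (map (λ i → twistExp w (E ℕ.+ S ℕ.* i)) (rows n))) ≡
    ι w * (+ 6 * ι n * ι E * ι E + + 6 * ι E * ι S * (ι n * ι n - ι n) + ι S * ι S * (+ 2 * ι n * ι n * ι n - + 3 * ι n * ι n + ι n)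
           + + 6 * ι n * ι E + + 3 * ι S * (ι n * ι n - ι n))
  twistSum-closed w E S zero    = poly (ι w) (ι E) (ι S)
    where
    poly : ∀ w E S → + 0 ≡ w * (+ 6 * + 0 * E * E + + 6 * E * S * (+ 0 * + 0 - + 0) + S * S * (+ 2 * + 0 * + 0 * + 0 - + 3 * + 0 * + 0 + + 0)
           + + 6 * + 0 * E + + 3 * S * (+ 0 * + 0 - + 0))
    poly = ℤ-solve
  twistSum-closed w E S (suc n) = ≡.trans
    (≡.cong (λ xs → + 12 * ι (sum (map (λ i → twistExp w (E ℕ.+ S ℕ.* i)) xs))) (rows-suc n))
    (≡.trans (plus 12 (twistExp w (E ℕ.+ S ℕ.* n)) (sum (map (λ i → twistExp w (E ℕ.+ S ℕ.* i)) (rows n)))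
        (≡.trans (double 2 6 {twistExp w (E ℕ.+ S ℕ.* n)} (twist-closed w (E ℕ.+ S ℕ.* n)))
          (≡.cong (λ x → + 6 * (ι w * ((ι E + x) * (ι E + x) + (ι E + x)))) (ℤₚ.pos-* S n))) (twistSum-closed w E S n))
      (poly (ι w) (ι E) (ι S) (ι n)))
    where
    poly : ∀ w E S n → + 6 * (w * ((E + S * n) * (E + S * n) + (E + S * n))) +
      w * (+ 6 * n * E * E + + 6 * E * S * (n * n - n) + S * S * (+ 2 * n * n * n - + 3 * n * n + n) + + 6 * n * E + + 3 * S * (n * n - n)) ≡
      w * (+ 6 * (+ 1 + n) * E * E + + 6 * E * S * ((+ 1 + n) * (+ 1 + n) - (+ 1 + n)) + S * S * (+ 2 * (+ 1 + n) * (+ 1 + n) * (+ 1 + n) - + 3 * (+ 1 + n) * (+ 1 + n) + (+ 1 + n))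
           + + 6 * (+ 1 + n) * E + + 3 * S * ((+ 1 + n) * (+ 1 + n) - (+ 1 + n)))
    poly = ℤ-solve

  ghostWeight-closed : ∀ M x r g → + 6 * ι (ghostWeight M x (suc r) g) ≡
    + 3 * ι x * (ι g * ι g - ι g) + ι M * (((ι g + ι r + + 1) * (ι g + ι r + + 1) * (ι g + ι r + + 1) - + 3 * (ι g + ι r + + 1) * (ι g + ι r + + 1) + + 2 * (ι g + ι r + + 1))
      - ((ι g + + 1) * (ι g + + 1) * (ι g + + 1) - + 3 * (ι g + + 1) * (ι g + + 1) + + 2 * (ι g + + 1)))
  ghostWeight-closed M x zero    g = ≡.trans (plus 6 (x ℕ.* sum (upFrom 0 (g ℕ.+ 0))) 0 (scale 6 x {sum (upFrom 0 (g ℕ.+ 0))} (double 2 3 {sum (upFrom 0 (g ℕ.+ 0))} (upFrom-closed 0 (g ℕ.+ 0)))) ≡.refl) (poly (ι M) (ι x) (ι g))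
    where
    poly : ∀ M x g → x * (+ 3 * (+ 2 * (g + + 0) * + 0 + ((g + + 0) * (g + + 0) - (g + + 0)))) + + 0 ≡
      + 3 * x * (g * g - g) + M * (((g + + 0 + + 1) * (g + + 0 + + 1) * (g + + 0 + + 1) - + 3 * (g + + 0 + + 1) * (g + + 0 + + 1) + + 2 * (g + + 0 + + 1))
        - ((g + + 1) * (g + + 1) * (g + + 1) - + 3 * (g + + 1) * (g + + 1) + + 2 * (g + + 1)))
    poly = ℤ-solve
  ghostWeight-closed M x (suc r) g = ≡.trans (plus 6 (M ℕ.* sum (upFrom 0 (g ℕ.+ suc r))) (ghostWeight M x (suc r) g) (scale 6 M {sum (upFrom 0 (g ℕ.+ suc r))} (double 2 3 {sum (upFrom 0 (g ℕ.+ suc r))} (upFrom-closed 0 (g ℕ.+ suc r)))) (ghostWeight-closed M x r g)) (poly (ι M) (ι x) (ι g) (ι r))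
    where
    poly : ∀ M x g r → M * (+ 3 * (+ 2 * (g + (+ 1 + r)) * + 0 + ((g + (+ 1 + r)) * (g + (+ 1 + r)) - (g + (+ 1 + r))))) +
      (+ 3 * x * (g * g - g) + M * (((g + r + + 1) * (g + r + + 1) * (g + r + + 1) - + 3 * (g + r + + 1) * (g + r + + 1) + + 2 * (g + r + + 1))
        - ((g + + 1) * (g + + 1) * (g + + 1) - + 3 * (g + + 1) * (g + + 1) + + 2 * (g + + 1)))) ≡
      + 3 * x * (g * g - g) + M * (((g + (+ 1 + r) + + 1) * (g + (+ 1 + r) + + 1) * (g + (+ 1 + r) + + 1) - + 3 * (g + (+ 1 + r) + + 1) * (g + (+ 1 + r) + + 1) + + 2 * (g + (+ 1 + r) + + 1))
        - ((g + + 1) * (g + + 1) * (g + + 1) - + 3 * (g + + 1) * (g + + 1) + + 2 * (g + + 1)))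
    poly = ℤ-solve

  module _ (α γ s m : ℕ) (cellOf : ℕ → ℕ → ℕ × ℕ) where
    open Side α γ s m cellOf using (ghosts)

    private
      row-closed : ∀ K j g → + 2 * ι (sum (map (λ i → γ ℕ.+ i ℕ.+ s ℕ.* K) (upFrom j g))) ≡
        + 2 * ι g * (ι γ + ι s * ι K + ι j) + (ι g * ι g - ι g)
      row-closed K j zero    = poly (ι γ + ι s * ι K + ι j)
        where
        poly : ∀ x → + 0 ≡ + 2 * + 0 * x + (+ 0 * + 0 - + 0)
        poly = ℤ-solve
      row-closed K j (suc g) = ≡.trans (plus 2 (γ ℕ.+ j ℕ.+ s ℕ.* K) (sum (map (λ i → γ ℕ.+ i ℕ.+ s ℕ.* K) (upFrom (suc j) g))) (≡.cong (λ x → + 2 * (ι γ + ι j + x)) (ℤₚ.pos-* s K)) (row-closed K (suc j) g)) (poly (ι γ) (ι s * ι K) (ι j) (ι g))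
        where
        poly : ∀ γ x j g → + 2 * (γ + j + x) + (+ 2 * g * (γ + x + (+ 1 + j)) + (g * g - g)) ≡ + 2 * (+ 1 + g) * (γ + x + j) + ((+ 1 + g) * (+ 1 + g) - (+ 1 + g))
        poly = ℤ-solve

    ghosts-closed : ∀ g k → + 6 * ι (ghosts g k) ≡
      + 3 * ι γ * (ι g * ι g - ι g) + ι s * (+ 3 * (ι k + ι g) * (ι g * ι g - ι g) - (+ 2 * ι g * ι g * ι g - + 3 * ι g * ι g + ι g))
      + (ι g * ι g * ι g - + 3 * ι g * ι g + + 2 * ι g)
    ghosts-closed zero    k = poly (ι γ) (ι s) (ι k)
      where
      poly : ∀ γ s k → + 0 ≡ + 3 * γ * (+ 0 * + 0 - + 0) + s * (+ 3 * (k + + 0) * (+ 0 * + 0 - + 0) - (+ 2 * + 0 * + 0 * + 0 - + 3 * + 0 * + 0 + + 0))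
        + (+ 0 * + 0 * + 0 - + 3 * + 0 * + 0 + + 2 * + 0)
      poly = ℤ-solve
    ghosts-closed (suc g) k = ≡.trans (plus 6 (sum (map (λ i → γ ℕ.+ i ℕ.+ s ℕ.* suc k) (upFrom 0 g))) (ghosts g (suc k)) (double 2 3 {sum (map (λ i → γ ℕ.+ i ℕ.+ s ℕ.* suc k) (upFrom 0 g))} (row-closed (suc k) 0 g)) (ghosts-closed g (suc k))) (poly (ι γ) (ι s) (ι g) (ι k))
      where
      poly : ∀ γ s g k → + 3 * (+ 2 * g * (γ + s * (+ 1 + k) + + 0) + (g * g - g)) +
        (+ 3 * γ * (g * g - g) + s * (+ 3 * (+ 1 + k + g) * (g * g - g) - (+ 2 * g * g * g - + 3 * g * g + g)) + (g * g * g - + 3 * g * g + + 2 * g)) ≡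
        + 3 * γ * ((+ 1 + g) * (+ 1 + g) - (+ 1 + g)) + s * (+ 3 * (k + (+ 1 + g)) * ((+ 1 + g) * (+ 1 + g) - (+ 1 + g)) - (+ 2 * (+ 1 + g) * (+ 1 + g) * (+ 1 + g) - + 3 * (+ 1 + g) * (+ 1 + g) + (+ 1 + g)))
        + ((+ 1 + g) * (+ 1 + g) * (+ 1 + g) - + 3 * (+ 1 + g) * (+ 1 + g) + + 2 * (+ 1 + g))
      poly = ℤ-solve

  private
    -- The case c = 0 is separate because `ghostWeight` and `markedBase` branch on it. The two sides
    -- are the expressions that `left-12` and `right-12` assemble.
    polynomial₀ : ∀ a b d e m → (+ 6 * b * (+ 0 + (e + + 0 * m)) * (+ 0 + (e + + 0 * m)) + + 6 * (+ 0 + (e + + 0 * m)) * m * (b * b - b) + m * m * (+ 2 * b * b * b - + 3 * b * b + b) - + 6 * b * (+ 0 + (e + + 0 * m)) - + 3 * m * (b * b - b) + + 12 * b * b * (+ 0 + (e + + 0 * m)) + + 6 * b * m * (b * b - b)) + (+ 6 * + 0 * (a + + 0 + e) * (a + + 0 + e) + + 6 * (a + + 0 + e) * m * (+ 0 * + 0 - + 0) + m * m * (+ 2 * + 0 * + 0 * + 0 - + 3 * + 0 * + 0 + + 0) - + 6 * + 0 * (a + + 0 + e) - + 3 * m * (+ 0 * + 0 - + 0) + + 12 * b * + 0 * (a + + 0 + e) + + 6 * b * m * (+ 0 * + 0 - + 0)) + d * (+ 6 * ((a + + 0) * (a + + 0) - (a + + 0) + + 2 * ((a + + 0) * b))) +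 m * (+ 6 * (a + + 0) * + 0 * + 0 + + 6 * + 0 * + 1 * ((a + + 0) * (a + + 0) - (a + + 0)) + + 1 * + 1 * (+ 2 * (a + + 0) * (a + + 0) * (a + + 0) - + 3 * (a + + 0) * (a + + 0) + (a + + 0)) - + 6 * (a + + 0) * + 0 - + 3 * + 1 * ((a + + 0) * (a + + 0) - (a + + 0)) + + 12 * b * (a + + 0) * + 0 + + 6 * b * + 1 * ((a + + 0) * (a + + 0) - (a + + 0))) + (+ 2 * (+ 3 * b * (a * a - a) + + 0 * (+ 3 * (+ 0 + a) * (a * a - a) - (+ 2 * a * a * a - + 3 * a * a + a)) + (a * a * a - + 3 * a * a + + 2 * a)) + + 2 * (+ 3 * + 0 * (b * b - b) + + 1 * (+ 3 * (+ 0 + b) * (b * b - b) - (+ 2 * b * b * b - + 3 * b * b + b)) + (b * b * b - + 3 * b * b + + 2 * b))) + (+ 0 + (+ 1 + m) * (+ 2 * (+ 3 * + 0 * ((b + a) * (b + a) - (b + a)) + ((b + a) * (b + a) * (b + a) - + 3 * (b + a) * (b + a) + + 2 * (b + a)))) + ((+ 1 + m) * (+ 6 * + 0 * + 0 * + 0 + + 6 * + 0 * + 1 * (+ 0 * + 0 - + 0) + + 1 * + 1 * (+ 2 * + 0 * + 0 * + 0 - + 3 * + 0 * + 0 + + 0) + + 6 * + 0 * + 0 + + 3 * + 1 * (+ 0 * + 0 - + 0)))) ≡ (+ 1 * (+ 6 * (b + + 0) * e * e + + 6 * e * (+ 1 + m) * ((b + + 0) * (b + + 0) - (b + + 0)) +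 (+ 1 + m) * (+ 1 + m) * (+ 2 * (b + + 0) * (b + + 0) * (b + + 0) - + 3 * (b + + 0) * (b + + 0) + (b + + 0)) + + 6 * (b + + 0) * e + + 3 * (+ 1 + m) * ((b + + 0) * (b + + 0) - (b + + 0)))) + (d * (+ 6 * (+ 2 * a * b + (a * a - a))) + e * (+ 6 * (+ 2 * b * + 0 + (b * b - b)))) + (+ 1 + m) * (+ 2 * (+ 3 * b * (a * a - a) + (a * a * a - + 3 * a * a + + 2 * a))) + (+ 1 + m) * (+ 2 * (+ 3 * + 0 * (b * b - b) + (b * b * b - + 3 * b * b + + 2 * b))) + + 0 * (+ 6 * (+ 2 * (b + a + + 0) * + 0 + ((b + a + + 0) * (b + a + + 0) - (b + a + + 0)))) + (+ 1 + m) * (+ 2 * (+ 3 * + 0 * ((b + a + + 0) * (b + a + + 0) - (b + a + + 0)) + ((b + a + + 0) * (b + a + + 0) * (b + a + + 0) - + 3 * (b + a + + 0) * (b + a + + 0) + + 2 * (b + a + + 0))))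
    polynomial₀ = ℤ-solve
    polynomial₁ : ∀ a b c d e m → (+ 6 * b * ((+ 1 + c) + (e + (+ 1 + c) * m)) * ((+ 1 + c) + (e + (+ 1 + c) * m)) + + 6 * ((+ 1 + c) + (e + (+ 1 + c) * m)) * m * (b * b - b) + m * m * (+ 2 * b * b * b - + 3 * b * b + b) - + 6 * b * ((+ 1 + c) + (e + (+ 1 + c) * m)) - + 3 * m * (b * b - b) + + 12 * b * b * ((+ 1 + c) + (e + (+ 1 + c) * m)) + + 6 * b * m * (b * b - b)) + (+ 6 * (+ 1 + c) * (a + (+ 1 + c) + e) * (a + (+ 1 + c) + e) + + 6 * (a + (+ 1 + c) + e) * m * ((+ 1 + c) * (+ 1 + c) - (+ 1 + c)) + m * m * (+ 2 * (+ 1 + c) * (+ 1 + c) * (+ 1 + c) - + 3 * (+ 1 + c) * (+ 1 + c) + (+ 1 + c)) - + 6 * (+ 1 + c) * (a + (+ 1 + c) + e) - + 3 * m * ((+ 1 + c) * (+ 1 + c) - (+ 1 + c)) + + 12 * b * (+ 1 + c) * (a + (+ 1 + c) + e) + + 6 * b * m * ((+ 1 + c) * (+ 1 + c) - (+ 1 + c))) + d * (+ 6 * ((a + (+ 1 + c)) * (a + (+ 1 + c)) - (a + (+ 1 + c)) + + 2 * ((a + (+ 1 + c)) * b))) + m * (+ 6 * (a + (+ 1 + c)) * + 0 * + 0 + + 6 * + 0 * + 1 * ((a + (+ 1 + c)) * (a + (+ 1 + c)) - (a + (+ 1 + c))) + + 1 * + 1 * (+ 2 * (a + (+ 1 + c))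 * (a + (+ 1 + c)) * (a + (+ 1 + c)) - + 3 * (a + (+ 1 + c)) * (a + (+ 1 + c)) + (a + (+ 1 + c))) - + 6 * (a + (+ 1 + c)) * + 0 - + 3 * + 1 * ((a + (+ 1 + c)) * (a + (+ 1 + c)) - (a + (+ 1 + c))) + + 12 * b * (a + (+ 1 + c)) * + 0 + + 6 * b * + 1 * ((a + (+ 1 + c)) * (a + (+ 1 + c)) - (a + (+ 1 + c)))) + (+ 2 * (+ 3 * b * (a * a - a) + + 0 * (+ 3 * (+ 0 + a) * (a * a - a) - (+ 2 * a * a * a - + 3 * a * a + a)) + (a * a * a - + 3 * a * a + + 2 * a)) + + 2 * (+ 3 * + 0 * (b * b - b) + + 1 * (+ 3 * (+ 0 + b) * (b * b - b) - (+ 2 * b * b * b - + 3 * b * b + b)) + (b * b * b - + 3 * b * b + + 2 * b))) + (+ 2 * (+ 3 * (+ 1 + (d + e)) * ((b + a) * (b + a) - (b + a)) + (+ 1 + m) * ((((b + a) + c + + 1) * ((b + a) + c + + 1) * ((b + a) + c + + 1) - + 3 * ((b + a) + c + + 1) * ((b + a) + c + + 1) + + 2 * ((b + a) + c + + 1)) - (((b + a) + + 1) * ((b + a) + + 1) * ((b + a) + + 1) - + 3 * ((b + a) + + 1) * ((b + a) + + 1) + + 2 * ((b + a) + + 1)))) + (+ 1 + m) * (+ 2 * (+ 3 * + 0 * ((b + a) * (b + a) - (b + a)) + ((b + a) * (b + a) * (b + a) - + 3 * (b + a) * (b + a) + + 2 * (b + a)))) + ((+ 1 + m) * (+ 6 *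 (+ 1 + c) * + 0 * + 0 + + 6 * + 0 * + 1 * ((+ 1 + c) * (+ 1 + c) - (+ 1 + c)) + + 1 * + 1 * (+ 2 * (+ 1 + c) * (+ 1 + c) * (+ 1 + c) - + 3 * (+ 1 + c) * (+ 1 + c) + (+ 1 + c)) + + 6 * (+ 1 + c) * + 0 + + 3 * + 1 * ((+ 1 + c) * (+ 1 + c) - (+ 1 + c))))) ≡ (+ 1 * (+ 6 * (b + (+ 1 + c)) * e * e + + 6 * e * (+ 1 + m) * ((b + (+ 1 + c)) * (b + (+ 1 + c)) - (b + (+ 1 + c))) + (+ 1 + m) * (+ 1 + m) * (+ 2 * (b + (+ 1 + c)) * (b + (+ 1 + c)) * (b + (+ 1 + c)) - + 3 * (b + (+ 1 + c)) * (b + (+ 1 + c)) + (b + (+ 1 + c))) + + 6 * (b + (+ 1 + c)) * e + + 3 * (+ 1 + m) * ((b + (+ 1 + c)) * (b + (+ 1 + c)) - (b + (+ 1 + c))))) + (d * (+ 6 * (+ 2 * a * b + (a * a - a))) + e * (+ 6 * (+ 2 * b * + 0 + (b * b - b)))) + (+ 1 + m) * (+ 2 * (+ 3 * b * (a * a - a) + (a * a * a - + 3 * a * a + + 2 * a))) + (+ 1 + m) * (+ 2 * (+ 3 * + 0 * (b * b - b) + (b * b * b - + 3 * b * b + + 2 * b))) + ((+ 1 + (d + e)) + (+ 1 + m) * c) * (+ 6 * (+ 2 * (b + a + (+ 1 + c)) * + 0 + ((b + a + (+ 1 + c)) * (b + a + (+ 1 + c)) - (b + a + (+ 1 + c)))))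 + (+ 1 + m) * (+ 2 * (+ 3 * + 0 * ((b + a + (+ 1 + c)) * (b + a + (+ 1 + c)) - (b + a + (+ 1 + c))) + ((b + a + (+ 1 + c)) * (b + a + (+ 1 + c)) * (b + a + (+ 1 + c)) - + 3 * (b + a + (+ 1 + c)) * (b + a + (+ 1 + c)) + + 2 * (b + a + (+ 1 + c)))))
    polynomial₁ = ℤ-solve

  -- N + b |π| by columns: b columns below the removed rectangle, c columns through the rest of the
  -- rectangle, d columns of height a + c, and m columns of each smaller height.
  columnTotal : (a b c d e m : ℕ) → ℕ
  columnTotal a b c d e m = triSum b m b (c ℕ.+ (e ℕ.+ c ℕ.* m)) ℕ.+ triSum b m c (a ℕ.+ c ℕ.+ e)
    ℕ.+ d ℕ.* shiftedTri b (a ℕ.+ c) ℕ.+ m ℕ.* triSum b 1 (a ℕ.+ c) 0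

  ghostTotal : (a b c d e m : ℕ) → ℕ
  ghostTotal a b c d e m = U.ghosts a 0 ℕ.+ L.ghosts b 0
    where open Tableaux a b c d e m

  private
    module _ (a b c d e m : ℕ) where
      open Tableaux a b c d e m using (cellᵁ; cellᴸ; module U; module L)

      M x n N B A : ℕ
      M = suc m
      x = suc (d ℕ.+ e)
      n = b ℕ.+ a
      N = b ℕ.+ a ℕ.+ c
      B = b ℕ.+ c
      A = a ℕ.+ c

      twist-left : + 12 * ι (sum (map (twistExp M) (rows c))) ≡ _
      twist-left = ≡.trans (≡.cong (λ xs → + 12 * ι (sum xs)) (map-cong (λ i → ≡.cong (twistExp M) (≡.sym (ℕₚ.*-identityˡ i))) (rows c)))
        (twistSum-closed M 0 1 c)

      twist-right : + 12 * ι (sum (map (twistExp 1) (ends m B e))) ≡ _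
      twist-right = ≡.trans (≡.cong (λ xs → + 12 * ι (sum xs)) (≡.trans (≡.cong (map (twistExp 1)) (ends-rows m B e)) (≡.sym (map-∘ (rows B)))))
        (twistSum-closed 1 e M B)

      vexp-12 : ∀ s k → + 12 * ι (M ℕ.* vexp s k) ≡ _
      vexp-12 s k = scale 12 M {vexp s k} (double 6 2 {vexp s k} (vexp-closed s k))

      upFrom-12 : ∀ j s k → + 12 * ι (j ℕ.* sum (upFrom s k)) ≡ _
      upFrom-12 j s k = scale 12 j {sum (upFrom s k)} (double 2 6 {sum (upFrom s k)} (upFrom-closed s k))

      left-12 : ∀ {p} → + 12 * ι (ghostWeight M x c n) ≡ p → + 12 * ι (columnTotal a b c d e m ℕ.+ ghostTotal a b c d e m ℕ.+ leftExponent a b c d e m) ≡ _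
      left-12 gw = plus 12 (columnTotal a b c d e m ℕ.+ ghostTotal a b c d e m) (leftExponent a b c d e m)
        (plus 12 (columnTotal a b c d e m) (ghostTotal a b c d e m)
          (plus 12 (t₁ ℕ.+ t₂ ℕ.+ t₃) t₄ (plus 12 (t₁ ℕ.+ t₂) t₃ (plus 12 t₁ t₂
              (≡.trans (triSum-closed b m b (c ℕ.+ (e ℕ.+ c ℕ.* m))) (≡.cong (λ cm → (+ 6 * ι b * (ι c + (ι e + cm)) * (ι c + (ι e + cm)) + + 6 * (ι c + (ι e + cm)) * ι m * (ι b * ι b - ι b) + ι m * ι m * (+ 2 * ι b * ι b * ι b - + 3 * ι b * ι b + ι b) - + 6 * ι b * (ι c + (ι e + cm)) - + 3 * ι m * (ι b * ι b - ι b) + + 12 * ι b * ι b * (ι c + (ι e + cm)) + + 6 * ι b * ι m * (ι b * ι b - ι b))) (ℤₚ.pos-* c m)))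
              (triSum-closed b m c (a ℕ.+ c ℕ.+ e)))
            (scale 12 d {shiftedTri b A} (double 2 6 {shiftedTri b A} (shiftedTri-closed b A))))
            (scale 12 m {triSum b 1 A 0} (triSum-closed b 1 A 0)))
          (plus 12 (U.ghosts a 0) (L.ghosts b 0)
            (double 6 2 {U.ghosts a 0} (ghosts-closed a b 0 m cellᵁ a 0)) (double 6 2 {L.ghosts b 0} (ghosts-closed b 0 1 m cellᴸ b 0))))
        (plus 12 (ghostWeight M x c n ℕ.+ M ℕ.* vexp 0 n) (sum (map (twistExp M) (rows c)))
          (plus 12 (ghostWeight M x c n) (M ℕ.* vexp 0 n) gw (vexp-12 0 n)) twist-left)
        where
        t₁ t₂ t₃ t₄ : ℕ
        t₁ = triSum b m b (c ℕ.+ (e ℕ.+ c ℕ.* m))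
        t₂ = triSum b m c (a ℕ.+ c ℕ.+ e)
        t₃ = d ℕ.* shiftedTri b A
        t₄ = m ℕ.* triSum b 1 A 0

      right-12 : ∀ {p} → + 12 * ι (markedBase M x c ℕ.* sum (upFrom 0 N)) ≡ p → + 12 * ι (rightExponent a b c d e m) ≡ _
      right-12 mb = plus 12 (r₁ ℕ.+ r₂ ℕ.+ r₃ ℕ.+ r₄ ℕ.+ r₅) (M ℕ.* vexp 0 N) (plus 12 (r₁ ℕ.+ r₂ ℕ.+ r₃ ℕ.+ r₄) r₅ (plus 12 (r₁ ℕ.+ r₂ ℕ.+ r₃) r₄
        (plus 12 (r₁ ℕ.+ r₂) r₃ (plus 12 r₁ r₂ twist-right
          (plus 12 (d ℕ.* sum (upFrom b a)) (e ℕ.* sum (upFrom 0 b)) (upFrom-12 d b a) (upFrom-12 e 0 b)))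
          (vexp-12 b a)) (vexp-12 0 b)) mb) (vexp-12 0 N)
        where
        r₁ r₂ r₃ r₄ r₅ : ℕ
        r₁ = sum (map (twistExp 1) (ends m B e))
        r₂ = d ℕ.* sum (upFrom b a) ℕ.+ e ℕ.* sum (upFrom 0 b)
        r₃ = M ℕ.* vexp b a
        r₄ = M ℕ.* vexp 0 b
        r₅ = markedBase M x c ℕ.* sum (upFrom 0 N)

  -- Twelve clears all denominators. Together with `N+b|π|` this identifies the power of q left over
  -- by the summation as q^N.
  exponent-identity : ∀ a b c d e m →
    columnTotal a b c d e m ℕ.+ ghostTotal a b c d e m ℕ.+ leftExponent a b c d e m ≡ rightExponent a b c d e m
  exponent-identity a b zero    d e m = ℤₚ.+-injective (ℤₚ.*-cancelˡ-≡ (+ 12) _ _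
    (≡.trans (left-12 a b 0 d e m ≡.refl) (≡.trans (polynomial₀ (ι a) (ι b) (ι d) (ι e) (ι m))
      (≡.sym (right-12 a b 0 d e m (upFrom-12 a b 0 d e m 0 0 (b ℕ.+ a ℕ.+ 0)))))))
  exponent-identity a b (suc c) d e m = ℤₚ.+-injective (ℤₚ.*-cancelˡ-≡ (+ 12) _ _
    (≡.trans (left-12 a b (suc c) d e m (double 6 2 {ghostWeight M′ x′ (suc c) (b ℕ.+ a)} (ghostWeight-closed M′ x′ c (b ℕ.+ a))))
      (≡.trans (polynomial₁ (ι a) (ι b) (ι c) (ι d) (ι e) (ι m))
        (≡.sym (right-12 a b (suc c) d e m (≡.trans (upFrom-12 a b (suc c) d e m (x′ ℕ.+ M′ ℕ.* c) 0 N′)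
          (≡.cong (λ y → (ι x′ + y) * (+ 6 * (+ 2 * ι N′ * ι 0 + (ι N′ * ι N′ - ι N′)))) (ℤₚ.pos-* M′ c))))))))
    where
    M′ x′ N′ : ℕ
    M′ = suc m
    x′ = suc (d ℕ.+ e)
    N′ = b ℕ.+ a ℕ.+ suc c

-- The exponent N, column by column

module Columns (a b c d e m : ℕ) where
  open import Data.Nat using (_+_; _*_)
  open ≡ using (refl; sym; trans; cong; cong₂)
  open Shape a b c d e m
  open Lengths a b c d e m
  open Fold ℕₚ.+-0-commutativeMonoid
  open ClosedForms using (columnTotal)

  private
    sum-shift : (f : Cell → ℕ) (cs : List Cell) → sum (map f cs) + b * length cs ≡ foldList (λ x → f x + b) cs
    sum-shift f []       = ℕₚ.*-zeroʳ b
    sum-shift f (x ∷ cs) = trans (arith (f x) (sum (map f cs)) b (length cs)) (cong (f x + b +_) (sum-shift f cs))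
      where
      arith : ∀ y s b l → y + s + b * suc l ≡ y + b + (s + b * l)
      arith = ℕ-solve

    triangle : ∀ k → ⨀ k (λ i → k ∸ suc i + b) ≡ shiftedTri b k
    triangle zero    = refl
    triangle (suc k) = trans (cong (k + b +_) (triangle k)) (arith k b (tri k))
      where
      arith : ∀ k b t → k + b + (t + k * b) ≡ k + t + (b + k * b)
      arith = ℕ-solve

    column : ∀ {k n} → k ≤ n → (p : ℕ → Bool) → (∀ i → p i ≡ (i <ᵇ k)) → ⨀ n (λ i → if p i then k ∸ suc i + b else 0) ≡ shiftedTri b k
    column {k} {n} k≤n p e = trans (⨀-cong n (λ i → cong (λ x → if x then k ∸ suc i + b else 0) (e i))) (trans (⨀-truncate (λ i → k ∸ suc i + b) k≤n) (triangle k))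

    entry : ℕ → ℕ → ℕ
    entry j i = if inπ (suc i) (suc j) then colLen (suc j) ∸ suc i + b else 0

    A≤R : A ≤ R
    A≤R = ≡.subst (A ≤_) (sym R≡) (ℕₚ.m≤m+n A R′)

    -- The removed cells are the top a ones, so the rest counts like a full column of height c + θ.
    column-left : ∀ j → j < b → ⨀ R (entry j) ≡ shiftedTri b (c + θ (suc j))
    column-left j j<b = begin
      ⨀ R (entry j)
        ≡⟨ cong (λ r → ⨀ r (entry j)) (trans R≡ (ℕₚ.+-assoc a c R′)) ⟩
      ⨀ (a + (c + R′)) (entry j)
        ≡⟨ ⨀-+ a (c + R′) (entry j) ⟩
      ⨀ a (entry j) + ⨀ (c + R′) (λ i → entry j (a + i))
        ≡⟨ cong₂ _+_ (⨀-𝟙 a ghost) (⨀-cong (c + R′) (λ i → cong (λ l → if inπ (suc (a + i)) (suc j) then l + b else 0) (shift i))) ⟩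
      ⨀ (c + R′) (λ i → if inπ (suc (a + i)) (suc j) then (c + θ (suc j)) ∸ suc i + b else 0)
        ≡⟨ column (ℕₚ.+-monoʳ-≤ c (θ≤R′ (suc j))) (λ i → inπ (suc (a + i)) (suc j)) real ⟩
      shiftedTri b (c + θ (suc j)) ∎
      where
      open ≡.≡-Reasoning
      j<B : j < B
      j<B = ℕₚ.<-≤-trans j<b (ℕₚ.m≤m+n b c)
      ghost : ∀ i → i < a → entry j i ≡ 0
      ghost i i<a rewrite <ᵇ-true i<a | <ᵇ-true j<b | ∧-zeroʳ (inλ (suc i) (suc j)) = refl
      shift : ∀ i → colLen (suc j) ∸ suc (a + i) ≡ c + θ (suc j) ∸ suc i
      shift i = trans (cong₂ _∸_ (trans (colLen-left j<B) (ℕₚ.+-assoc a c _)) (sym (ℕₚ.+-suc a i))) (ℕₚ.[m+n]∸[m+o]≡n∸o a _ (suc i))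
      real : ∀ i → inπ (suc (a + i)) (suc j) ≡ (i <ᵇ c + θ (suc j))
      real i rewrite inλ-col (a + i) j<B | <ᵇ-false {a + i} {a} (ℕₚ.m≤m+n a i) | ℕₚ.+-assoc a c (θ (suc j)) | <ᵇ-+ a i (c + θ (suc j)) = ∧-identityʳ _

    in-π : ∀ i {j} → b ≤ j → inπ (suc i) (suc j) ≡ inλ (suc i) (suc j)
    in-π i {j} b≤j rewrite <ᵇ-false b≤j | ∧-zeroʳ (i <ᵇ a) = ∧-identityʳ _

    column-middle : ∀ j → j < c → ⨀ R (entry (b + j)) ≡ shiftedTri b (A + θ (suc (b + j)))
    column-middle j j<c rewrite colLen-left (ℕₚ.+-monoʳ-< b j<c) =
      column (≡.subst (A + θ (suc (b + j)) ≤_) (sym R≡) (ℕₚ.+-monoʳ-≤ A (θ≤R′ (suc (b + j))))) (λ i → inπ (suc i) (suc (b + j)))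
        (λ i → trans (in-π i (ℕₚ.m≤m+n b j)) (inλ-col i (ℕₚ.+-monoʳ-< b j<c)))

    b≤B+ : ∀ j → b ≤ B + j
    b≤B+ j = ℕₚ.≤-trans (ℕₚ.m≤m+n b c) (ℕₚ.m≤m+n B j)

    column-right₀ : ∀ j → j < d → ⨀ R (entry (B + j)) ≡ shiftedTri b A
    column-right₀ j j<d rewrite colLen-right₀ j j<d = column A≤R (λ i → inπ (suc i) (suc (B + j)))
      (λ i → trans (in-π i (b≤B+ j)) (trans (inλ-right i j) (leg₀ A d m j i j<d)))

    column-right₁ : ∀ u v → u < A → v < m → ⨀ R (entry (B + (d + (u * m + v)))) ≡ shiftedTri b (A ∸ suc u)
    column-right₁ u v u<A v<m rewrite colLen-right₁ u v u<A v<m =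
      column (ℕₚ.≤-trans (ℕₚ.m∸n≤m A (suc u)) A≤R) (λ i → inπ (suc i) (suc (B + (d + (u * m + v)))))
        (λ i → trans (in-π i (b≤B+ _)) (trans (inλ-right i _) (leg A d m u v i v<m)))

    ⨀-const : ∀ n k → ⨀ n (λ _ → k) ≡ n * k
    ⨀-const zero    k = refl
    ⨀-const (suc n) k = cong (k +_) (⨀-const n k)

    ⨀-*ˡ : ∀ n k f → ⨀ n (λ t → k * f t) ≡ k * ⨀ n f
    ⨀-*ˡ zero    k f = sym (ℕₚ.*-zeroʳ k)
    ⨀-*ˡ (suc n) k f = trans (cong (k * f 0 +_) (⨀-*ˡ n k _)) (sym (ℕₚ.*-distribˡ-+ k (f 0) _))

    progression : ∀ s n k (f : ℕ → ℕ) → (∀ v → f v ≡ k + v * s) → ⨀ n (λ v → shiftedTri b (f v)) ≡ triSum b s n k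
    progression s zero    k f e = refl
    progression s (suc n) k f e = cong₂ _+_ (cong (shiftedTri b) (trans (e 0) (ℕₚ.+-identityʳ k)))
      (progression s n (k + s) (λ v → f (suc v)) (λ v → trans (e (suc v)) (sym (ℕₚ.+-assoc k s (v * s)))))

    left-total : ⨀ b (λ j → ⨀ R (entry j)) ≡ triSum b m b (c + (e + c * m))
    left-total = trans (⨀-cong< b (λ j j<b → trans (column-left j j<b) (cong (λ w → shiftedTri b (c + (e + w * m))) (ℕₚ.+-∸-comm c j<b))))
      (trans (⨀-reverse b (λ v → shiftedTri b (c + (e + (v + c) * m)))) (progression m b _ (λ v → c + (e + (v + c) * m)) (λ v → arith c e m v)))
      where
      arith : ∀ c e m v → c + (e + (v + c) * m) ≡ c + (e + c * m) + v * m
      arith = ℕ-solve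

    middle-total : ⨀ c (λ j → ⨀ R (entry (b + j))) ≡ triSum b m c (a + c + e)
    middle-total = trans (⨀-cong< c (λ j j<c → trans (column-middle j j<c) (cong (λ w → shiftedTri b (A + (e + w * m)))
        (trans (cong (B ∸_) (sym (ℕₚ.+-suc b j))) (ℕₚ.[m+n]∸[m+o]≡n∸o b c (suc j))))))
      (trans (⨀-reverse c (λ v → shiftedTri b (A + (e + v * m)))) (progression m c _ (λ v → A + (e + v * m)) (λ v → sym (ℕₚ.+-assoc A e (v * m)))))

    right-total : ⨀ C′ (λ j → ⨀ R (entry (B + j))) ≡ d * shiftedTri b A + m * triSum b 1 A 0
    right-total = trans (⨀-+ d (A * m) _) (cong₂ _+_
      (trans (⨀-cong< d column-right₀) (⨀-const d _))
      (trans (⨀-blocks A m _) (trans (⨀-cong< A (λ u u<A → trans (⨀-cong< m (λ v v<m → column-right₁ u v u<A v<m)) (⨀-const m _)))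
        (trans (⨀-*ˡ A m _) (cong (m *_) (trans (⨀-reverse A (shiftedTri b)) (progression 1 A 0 (λ v → v) (λ v → sym (ℕₚ.*-identityʳ v)))))))))

  -- The term b |π| is the price of raising all entries by b in the cut; adding it to each cell
  -- before summing keeps the contribution of a column a function of its height alone.
  N+b|π| : N + b * length cellsπ ≡ columnTotal a b c d e m
  N+b|π| = begin
    N + b * length cellsπ
      ≡⟨ sum-shift (λ { (i , j) → colLen j ∸ i }) cellsπ ⟩
    foldList _ cellsπ
      ≡⟨ trans (foldList-filterᵇ _ _ box) (foldList-grid (λ { (i , j) → if inπ i j then colLen j ∸ i + b else 0 }) R C) ⟩
    ⨀ R (λ i → ⨀ C (λ j → entry j i))
      ≡⟨ trans (⨀-swap R C _) (cong (λ n → ⨀ n (λ j → ⨀ R (entry j))) C≡) ⟩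
    ⨀ (B + C′) (λ j → ⨀ R (entry j))
      ≡⟨ trans (⨀-+ B C′ _) (cong (_+ ⨀ C′ (λ j → ⨀ R (entry (B + j)))) (⨀-+ b c _)) ⟩
    ⨀ b (λ j → ⨀ R (entry j)) + ⨀ c (λ j → ⨀ R (entry (b + j))) + ⨀ C′ (λ j → ⨀ R (entry (B + j)))
      ≡⟨ cong₂ _+_ (cong₂ _+_ left-total middle-total) right-total ⟩
    triSum b m b (c + (e + c * m)) + triSum b m c (a + c + e) + (d * shiftedTri b A + m * triSum b 1 A 0)
      ≡⟨ ℕₚ.+-assoc (triSum b m b (c + (e + c * m)) + triSum b m c (a + c + e)) _ _ ⟨
    columnTotal a b c d e m ∎
    where open ≡.≡-Reasoning

-- Cancelling the units

module Conclusion (R : CommutativeRing 0ℓ 0ℓ) (q : CommutativeRing.Carrier R) (W : ℕ) (inv : ℕ → CommutativeRing.Carrier R)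
                  (inverse : ∀ h → CommutativeRing._≈_ R (CommutativeRing._*_ R (Products.[1-_] R q W (suc h)) (inv (suc h))) (CommutativeRing.1# R)) where
  open Products R q W

  private
    [1-q^]-inverse : ∀ h → ∃ λ y → [1- suc h ] * y ≈ 1#
    [1-q^]-inverse h = inv (suc h) , inverse h

    inverse⁺ : ∀ {h} → 0 < h → [1- h ] * inv h ≈ 1#
    inverse⁺ {suc h} _ = inverse h

  -- Truncated power series have zero divisors, so a factor is cancelled only when an inverse is at
  -- hand.
  Unit : Carrier → Set
  Unit x = ∃ λ y → x * y ≈ 1#

  unit-1 : Unit 1#
  unit-1 = 1# , *-identityˡ 1#

  unit-* : ∀ {x y} → Unit x → Unit y → Unit (x * y)
  unit-* {x} {y} (x′ , e) (y′ , e′) = x′ * y′ , trans (shuffle x y x′ y′) (trans (*-cong e e′) (*-identityˡ _))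
    where
    shuffle : ∀ x y z w → x * y * (z * w) ≈ x * z * (y * w)
    shuffle = MonoidSolver.solve 4 (λ x y z w → ((x ⊕ y) ⊕ (z ⊕ w)) ⊜ ((x ⊕ z) ⊕ (y ⊕ w))) refl

  unit-factor : ∀ {x y z} → x * y ≈ z → Unit z → Unit x
  unit-factor {x} {y} e (z′ , e′) = y * z′ , trans (sym (*-assoc _ _ _)) (trans (*-congʳ e) e′)

  unit-cancel : ∀ {x y z} → Unit x → x * y ≈ x * z → y ≈ z
  unit-cancel {x} {y} {z} (x′ , e) eq = trans (sym (undo y)) (trans (*-congˡ eq) (undo z))
    where
    shuffle : ∀ x′ x y → x′ * (x * y) ≈ x * x′ * y
    shuffle = MonoidSolver.solve 3 (λ x′ x y → (x′ ⊕ (x ⊕ y)) ⊜ ((x ⊕ x′) ⊕ y)) refl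
    undo : ∀ y → x′ * (x * y) ≈ y
    undo y = trans (shuffle x′ x y) (trans (*-congʳ e) (*-identityˡ _))

  unit-prod : {A : Set} (f : A → Carrier) (xs : List A) → (∀ x → Unit (f x)) → Unit (prod f xs)
  unit-prod f []       u = unit-1
  unit-prod f (x ∷ xs) u = unit-* (u x) (unit-prod f xs u)

  unit-qfac : ∀ M i → Unit (qfac (suc M) i)
  unit-qfac M zero    = unit-1
  unit-qfac M (suc i) = unit-* ([1-q^]-inverse (i ℕ.+ M ℕ.* suc i)) (unit-qfac M i)

  unit-superfac : ∀ M n → Unit (superfac (suc M) n)
  unit-superfac M n = unit-prod _ (rows n) (unit-qfac M)

  module _ (a b c d e m : ℕ) where
    open HookProduct R q W a b c d e m
    open Shape a b c d e m using (hook; cellsρ; triples)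

    -- Read off from `hookProduct-superfac`, whose right side is a product of units, and not factor
    -- by factor: `hook` uses truncated subtraction, and its positivity is deduced from this lemma.
    unit-hookProduct : Unit hookProduct
    unit-hookProduct = unit-factor hookProduct-superfac (unit-* (unit-*
      (unit-prod _ (rows (b ℕ.+ a ℕ.+ c)) (λ i → unit-prod _ (rows c) (λ t → [1-q^]-inverse (d ℕ.+ e ℕ.+ suc m ℕ.* (t ℕ.+ i)))))
      (unit-prod _ (ends m (a ℕ.+ c) d) (unit-qfac 0))) (unit-prod _ (ends m (b ℕ.+ c) e) (unit-qfac 0)))

    -- A hook length 0 would make the unit hookProduct vanish.
    hooks-positive : ¬ (1# ≈ 0#) → ∀ {i j} → (i , j) ∈ cellsρ → 0 < hook i j
    hooks-positive nontrivial {i} {j} x∈ = ℕₚ.n≢0⇒n>0 λ h≡0 → nontrivial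
      (trans (sym (proj₂ unit-hookProduct)) (trans (*-congʳ (vanish cellsρ x∈ h≡0)) (zeroˡ _)))
      where
      vanish : ∀ cs → (i , j) ∈ cs → hook i j ≡ 0 → foldList (λ { (i , j) → [1- hook i j ] }) cs ≈ 0#
      vanish (x ∷ cs) (here ≡.refl) h≡0 = trans (*-congʳ (trans ([1-]-cong h≡0) (+-inverse 1#))) (zeroˡ _)
      vanish (x ∷ cs) (there x∈)    h≡0 = trans (*-congˡ (vanish cs x∈ h≡0)) (zeroʳ _)

    -- Superfactorials are multiplied in until the hook product, the diagonal sum and the box
    -- product share their terms; what is common to both sides is then a unit and cancels.
    main-identity : ∀ {small} left →
      superfac (suc m) (b ℕ.+ a ℕ.+ c) * (rectangleHooks a b c d e m * prod (qfac 1) (ends m (a ℕ.+ c) d) * prod (qfac 1) (ends m (b ℕ.+ c) e) * superfac (suc m) (b ℕ.+ a)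
          * (left * small)) ≈
        superfac (suc m) (b ℕ.+ a ℕ.+ c) * (q ^ rightExponent a b c d e m * (superfac (suc m) a * superfac (suc m) b * superfac (suc m) c * superfac (suc m) (b ℕ.+ a ℕ.+ c))) →
      hookProduct * boxDenominator (suc m) a b c * (left * small) ≈ q ^ rightExponent a b c d e m * boxNumerator (suc m) a b c
    main-identity {small} left evaluated = unit-cancel
      (unit-* (unit-superfac m (b ℕ.+ a ℕ.+ c)) (unit-* (unit-* (unit-superfac m (b ℕ.+ a)) (unit-superfac m (a ℕ.+ c))) (unit-superfac m (b ℕ.+ c)))) (begin
      sf N * (sf n * sf A * sf B) * (hookProduct * denom * (left * small))
        ≈⟨ shuffle₁ _ _ _ _ _ _ _ ⟩
      denom * (sf N * (hookProduct * (sf A * sf B) * sf n * (left * small)))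
        ≈⟨ *-congˡ (trans (*-congˡ (*-congʳ (*-congʳ hookProduct-superfac))) evaluated) ⟩
      denom * (sf N * (q ^ rightExponent a b c d e m * (sf a * sf b * sf c * sf N)))
        ≈⟨ shuffle₂ _ _ _ _ ⟩
      sf N * (q ^ rightExponent a b c d e m * (denom * (sf a * sf b * sf c * sf N)))
        ≈⟨ *-congˡ (*-congˡ (sym (macMahon (suc m) a b c))) ⟩
      sf N * (q ^ rightExponent a b c d e m * (numer * (sf n * sf A * sf B)))
        ≈⟨ shuffle₃ _ _ _ _ ⟩
      sf N * (sf n * sf A * sf B) * (q ^ rightExponent a b c d e m * numer) ∎)
      where
      denom numer : Carrier
      denom = boxDenominator (suc m) a b c
      numer = boxNumerator (suc m) a b c
      N n A B : ℕ
      n = b ℕ.+ a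
      N = n ℕ.+ c
      A = a ℕ.+ c
      B = b ℕ.+ c
      sf : ℕ → Carrier
      sf = superfac (suc m)
      shuffle₁ : ∀ N n A B h d s → N * (n * A * B) * (h * d * s) ≈ d * (N * (h * (A * B) * n * s))
      shuffle₁ = MonoidSolver.solve 7 (λ N n A B h d s → ((N ⊕ ((n ⊕ A) ⊕ B)) ⊕ ((h ⊕ d) ⊕ s)) ⊜ (d ⊕ (N ⊕ (((h ⊕ (A ⊕ B)) ⊕ n) ⊕ s)))) refl
      shuffle₂ : ∀ d N r s → d * (N * (r * s)) ≈ N * (r * (d * s))
      shuffle₂ = MonoidSolver.solve 4 (λ d N r s → (d ⊕ (N ⊕ (r ⊕ s))) ⊜ (N ⊕ (r ⊕ (d ⊕ s)))) refl
      shuffle₃ : ∀ N r x s → N * (r * (x * s)) ≈ N * s * (r * x)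
      shuffle₃ = MonoidSolver.solve 4 (λ N r x s → (N ⊕ (r ⊕ (x ⊕ s))) ⊜ ((N ⊕ s) ⊕ (r ⊕ x))) refl

    triples-fold : (g : ℕ × ℕ × ℕ → Carrier) → foldList g triples ≈ Π< a (λ i → Π< b (λ j → Π< c (λ k → g (suc i , suc j , suc k))))
    triples-fold g = trans (foldList-concatMap g _ suc a) (Π<-cong a (λ i → trans (foldList-concatMap g _ suc b)
      (Π<-cong b (λ j → trans (foldList-map g _ (range1 c)) (foldList-applyUpTo _ suc c)))))

    numer denomInverse hooksInverse : Carrier
    numer        = foldList (λ { (i , j , k) → [1- (m ℕ.+ 1) ℕ.* (i ℕ.+ j ℕ.+ k ∸ 1) ] }) triples
    denomInverse = foldList (λ { (i , j , k) → inv ((m ℕ.+ 1) ℕ.* (i ℕ.+ j ℕ.+ k ∸ 2)) }) triples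
    hooksInverse = foldList (λ { (i , j) → inv (hook i j) }) cellsρ

    numer-box : boxNumerator (suc m) a b c ≈ numer
    numer-box = sym (trans (triples-fold _) (Π<-cong a (λ i → Π<-cong b (λ j → Π<-cong c (λ k → [1-]-cong (arith m i j k))))))
      where
      arith : ∀ m i j k → (m ℕ.+ 1) ℕ.* (i ℕ.+ suc j ℕ.+ suc k) ≡ suc m ℕ.* (i ℕ.+ j ℕ.+ k ℕ.+ 2)
      arith = ℕ-solve

    denom-inverse : boxDenominator (suc m) a b c * denomInverse ≈ 1#
    denom-inverse = trans (*-congˡ (triples-fold _))
      (trans (sym (Π<-* a _ _)) (Π<-1 a (λ i _ → trans (sym (Π<-* b _ _)) (Π<-1 b (λ j _ → trans (sym (Π<-* c _ _)) (Π<-1 c (λ k _ →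
        trans (*-congˡ (reflexive (≡.cong inv (≡.trans (≡.cong (λ s → (m ℕ.+ 1) ℕ.* (s ∸ 1)) (arith₁ i j k)) (arith₂ m i j k))))) (inverse⁺ (positive i j k)))))))))
      where
      arith₁ : ∀ i j k → i ℕ.+ suc j ℕ.+ suc k ≡ suc (i ℕ.+ j ℕ.+ k ℕ.+ 1)
      arith₁ = ℕ-solve
      arith₂ : ∀ m i j k → (m ℕ.+ 1) ℕ.* (i ℕ.+ j ℕ.+ k ℕ.+ 1) ≡ suc m ℕ.* (i ℕ.+ j ℕ.+ k ℕ.+ 1)
      arith₂ = ℕ-solve
      positive : ∀ i j k → 0 < suc m ℕ.* (i ℕ.+ j ℕ.+ k ℕ.+ 1)
      positive i j k = ℕₚ.≤-trans (ℕₚ.m≤n+m 1 (i ℕ.+ j ℕ.+ k)) (ℕₚ.m≤m+n _ _)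

    hooks-inverse : ¬ (1# ≈ 0#) → hookProduct * hooksInverse ≈ 1#
    hooks-inverse nontrivial = go cellsρ (hooks-positive nontrivial)
      where
      shuffle : ∀ x y z w → x * y * (z * w) ≈ x * z * (y * w)
      shuffle = MonoidSolver.solve 4 (λ x y z w → ((x ⊕ y) ⊕ (z ⊕ w)) ⊜ ((x ⊕ z) ⊕ (y ⊕ w))) refl
      go : ∀ cs → (∀ {i j} → (i , j) ∈ cs → 0 < hook i j) →
        foldList (λ { (i , j) → [1- hook i j ] }) cs * foldList (λ { (i , j) → inv (hook i j) }) cs ≈ 1#
      go []             pos = *-identityˡ _
      go ((i , j) ∷ cs) pos = trans (shuffle _ _ _ _) (trans (*-cong (inverse⁺ (pos (here ≡.refl))) (go cs (pos ∘ there))) (*-identityˡ _))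

    -- The power q^K remains on both sides, since q is nilpotent here; it can be removed only on
    -- coefficients.
    conclusion : ∀ {small} K N → ¬ (1# ≈ 0#) → q ^ W ≈ 0# → b ℕ.+ a ℕ.+ c ≤ W →
      q ^ leftExponent a b c d e m * diagonalSum a b c d e m ≈ q ^ K * small → rightExponent a b c d e m ≡ K ℕ.+ N →
      q ^ K * small ≈ q ^ K * (q ^ N * numer * denomInverse * hooksInverse)
    conclusion {small} K N nontrivial q^W≈0 N≤W cut exponents = unit-cancel (unit-* unit-hookProduct (denomInverse , denom-inverse)) (begin
      hookProduct * denom * (q ^ K * small)
        ≈⟨ main-identity (q ^ K) (trans (*-congˡ (*-congˡ (sym cut))) (diagonalSum-product q^W≈0 a b c d e m N≤W)) ⟩
      q ^ rightExponent a b c d e m * boxNumerator (suc m) a b c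
        ≈⟨ *-cong (trans (^-congʳ q exponents) (^-homo-* q K N)) numer-box ⟩
      q ^ K * q ^ N * numer
        ≈⟨ trans (*-congʳ (trans (*-cong (hooks-inverse nontrivial) denom-inverse) (*-identityˡ _))) (*-identityˡ _) ⟨
      hookProduct * hooksInverse * (denom * denomInverse) * (q ^ K * q ^ N * numer)
        ≈⟨ shuffle _ _ _ _ _ _ _ ⟩
      hookProduct * denom * (q ^ K * (q ^ N * numer * denomInverse * hooksInverse)) ∎)
      where
      denom : Carrier
      denom = boxDenominator (suc m) a b c
      shuffle : ∀ h hi d di k p u → h * hi * (d * di) * (k * p * u) ≈ h * d * (k * (p * u * di * hi))
      shuffle = MonoidSolver.solve 7 (λ h hi d di k p u → (((h ⊕ hi) ⊕ (d ⊕ di)) ⊕ ((k ⊕ p) ⊕ u)) ⊜ ((h ⊕ d) ⊕ (k ⊕ (((p ⊕ u) ⊕ di) ⊕ hi)))) refl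

-- Reading off one coefficient

ε*≈- : (R : CommutativeRing 0ℓ 0ℓ) (x : CommutativeRing.Carrier R) →
       CommutativeRing._≈_ R (CommutativeRing._*_ R (Determinants.ε R) x) (CommutativeRing.-_ R x)
ε*≈- R x = trans (sym (-‿distribˡ-* 1# x)) (-‿cong (*-identityˡ x))
  where
  open CommutativeRing R
  open Algebra.Properties.Ring ring using (-‿distribˡ-*)

count-++ : {A : Set} (p : A → Bool) (xs ys : List A) → countᵇ p (xs ++ ys) ≡ countᵇ p xs ℕ.+ countᵇ p ys
count-++ p []       ys = ≡.refl
count-++ p (x ∷ xs) ys with p x
... | true  = ≡.cong suc (count-++ p xs ys)
... | false = count-++ p xs ys

count-map : {A B : Set} (p : B → Bool) (f : A → B) (xs : List A) → countᵇ p (map f xs) ≡ countᵇ (p ∘ f) xs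
count-map p f []       = ≡.refl
count-map p f (x ∷ xs) with p (f x)
... | true  = ≡.cong suc (count-map p f xs)
... | false = count-map p f xs

count-none : {A : Set} (p : A → Bool) → (∀ x → p x ≡ false) → ∀ xs → countᵇ p xs ≡ 0
count-none p e []       = ≡.refl
count-none p e (x ∷ xs) rewrite e x = count-none p e xs

module Final (a b c d e m : ℕ) where
  open PowerSeries using (truncated; qpow-homo; qpow-≢; qpow-cancel; oneMinusQ-inverse; ⊖_)
  open Shape a b c d e m

  private
    open Fold ℕₚ.+-0-commutativeMonoid using (⨀; ⨀-cong; ⨀-+; ⨀-𝟙)

    count-fillings : ∀ k K (p : List ℕ → Bool) → countᵇ p (fillings (suc k) K) ≡ ⨀ K (λ t → countᵇ (p ∘ (suc t ∷_)) (fillings k K))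
    count-fillings k K p = go suc K
      where
      go : ∀ f n → countᵇ p (concatMap (λ t → map (t ∷_) (fillings k K)) (applyUpTo f n)) ≡ ⨀ n (λ t → countᵇ (p ∘ (f t ∷_)) (fillings k K))
      go f zero    = ≡.refl
      go f (suc n) = ≡.trans (count-++ p (map (f 0 ∷_) (fillings k K)) _) (≡.cong₂ ℕ._+_ (count-map p (f 0 ∷_) (fillings k K)) (go (f ∘ suc) n))

    -- Reconciles the range of entries in `sπ` with the larger window that the cut requires.
    count-range : ∀ k n K (p : List ℕ → Bool) → (∀ ts → Any (n <_) ts → p ts ≡ false) →
      countᵇ p (fillings k (n ℕ.+ K)) ≡ countᵇ p (fillings k n)
    count-range zero    n K p large = ≡.refl
    count-range (suc k) n K p large = begin
      countᵇ p (fillings (suc k) (n ℕ.+ K))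
        ≡⟨ count-fillings k (n ℕ.+ K) p ⟩
      ⨀ (n ℕ.+ K) (λ t → countᵇ (p ∘ (suc t ∷_)) (fillings k (n ℕ.+ K)))
        ≡⟨ ⨀-+ n K _ ⟩
      ⨀ n (λ t → countᵇ (p ∘ (suc t ∷_)) (fillings k (n ℕ.+ K))) ℕ.+ ⨀ K (λ t → countᵇ (p ∘ (suc (n ℕ.+ t) ∷_)) (fillings k (n ℕ.+ K)))
        ≡⟨ ≡.cong₂ ℕ._+_ (⨀-cong n (λ t → count-range k n K (p ∘ (suc t ∷_)) (λ ts any → large _ (there any))))
             (⨀-𝟙 K (λ t _ → count-none _ (λ ts → large _ (here (s≤s (ℕₚ.m≤m+n n t)))) (fillings k (n ℕ.+ K)))) ⟩
      ⨀ n (λ t → countᵇ (p ∘ (suc t ∷_)) (fillings k n)) ℕ.+ 0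
        ≡⟨ ≡.trans (ℕₚ.+-identityʳ _) (≡.sym (count-fillings k n p)) ⟩
      countᵇ p (fillings (suc k) n) ∎
      where open ≡.≡-Reasoning

    weight-large : ∀ n ts → Any (suc n <_) ts → n < weight ts
    weight-large n (t ∷ ts) (here lt)   = ℕₚ.<-≤-trans (ℕₚ.∸-monoˡ-< lt (s≤s z≤n)) (ℕₚ.m≤m+n _ _)
    weight-large n (t ∷ ts) (there any) = ℕₚ.<-≤-trans (weight-large n ts any) (ℕₚ.m≤n+m _ _)

    counted : ℕ → List ℕ → Bool
    counted n ts = isSSYT ts ∧ (weight ts ≡ᵇ n)

    sπ-range : ∀ n K → sπ n ≡ ℤ.+ countᵇ (counted n) (fillings (length cellsπ) (suc n ℕ.+ K))
    sπ-range n K = ≡.cong ℤ.+_ (≡.sym (count-range (length cellsπ) (suc n) K (counted n) (λ ts any →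
      ≡.trans (≡.cong (isSSYT ts ∧_) (not-equal (weight ts) n (ℕₚ.>⇒≢ (weight-large n ts any)))) (∧-zeroʳ _))))
      where
      not-equal : ∀ x y → ¬ x ≡ y → (x ≡ᵇ y) ≡ false
      not-equal x y x≢y with x ≡ᵇ y in eq
      ... | false = ≡.refl
      ... | true  = ⊥-elim (x≢y (ℕₚ.≡ᵇ⇒≡ x y (≡.subst T (≡.sym eq) _)))

  module _ (n : ℕ) where

    private
      -- `K′` is the power of q multiplied onto the tableau sum, and `L` leaves coefficient n
      -- visible once that power is cancelled. `K₀` satisfies b |π| + K₀ = L, so that tableaux with
      -- an entry beyond the window vanish. `W` only has to exceed `L`, the number of ghosts and
      -- free diagonal entries, and the window.
      ghost K′ L K₀ W : ℕ
      ghost = ClosedForms.ghostTotal a b c d e m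
      K′ = leftExponent a b c d e m ℕ.+ (ghost ℕ.+ b ℕ.* length cellsπ)
      L  = K′ ℕ.+ suc n
      K₀ = suc n ℕ.+ (leftExponent a b c d e m ℕ.+ ghost)
      W  = L ℕ.+ (b ℕ.+ a ℕ.+ c) ℕ.+ (b ℕ.+ K₀)

      R′ : CommutativeRing 0ℓ 0ℓ
      R′ = truncated L

      q : PS
      q = qpow 1

    open Products R′ q W
    open Assignments R′ q W using (ΣList)

    private
      q^ : ∀ k → q ^ k ≈ qpow k
      q^ zero    = refl
      q^ (suc k) = trans (*-congˡ {q} {q ^ k} {qpow k} (q^ k)) (λ i _ → ≡.sym (qpow-homo 1 k i))

      q^-vanish : ∀ {k} → L ≤ k → q ^ k ≈ 0#
      q^-vanish {k} L≤k = trans (q^ k) (λ i i<L → qpow-≢ k i (ℕₚ.<⇒≢ (ℕₚ.<-≤-trans i<L L≤k)))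

      oneMinus : ∀ h → [1- h ] ≈ oneMinusQ h
      oneMinus h = +-congˡ {one} {ε * q ^ h} {⊖ qpow h} (trans (*-congˡ {ε} {q ^ h} {qpow h} (q^ h)) (ε*≈- R′ (qpow h)))

      inverse : ∀ h → [1- suc h ] * invOneMinusQ (suc h) ≈ 1#
      inverse h = trans (*-congʳ {invOneMinusQ (suc h)} {[1- suc h ]} {oneMinusQ (suc h)} (oneMinus (suc h))) (λ i _ → oneMinusQ-inverse h i)

      b+a≤W : b ℕ.+ a ≤ W
      b+a≤W = ℕₚ.≤-trans (ℕₚ.m≤m+n (b ℕ.+ a) c) (ℕₚ.≤-trans (ℕₚ.m≤n+m (b ℕ.+ a ℕ.+ c) L) (ℕₚ.m≤m+n (L ℕ.+ (b ℕ.+ a ℕ.+ c)) (b ℕ.+ K₀)))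

      module Cut = CutSum R′ q W a b c d e m b+a≤W
      module Con = Conclusion R′ q W invOneMinusQ inverse

      L≡ : b ℕ.* length cellsπ ℕ.+ K₀ ≡ L
      L≡ = arith (b ℕ.* length cellsπ) (leftExponent a b c d e m) ghost n
        where
        arith : ∀ p l g n → p ℕ.+ (suc n ℕ.+ (l ℕ.+ g)) ≡ l ℕ.+ (g ℕ.+ p) ℕ.+ suc n
        arith = ℕ-solve

      b+K₀≤W : b ℕ.+ K₀ ≤ W
      b+K₀≤W = ℕₚ.m≤n+m (b ℕ.+ K₀) (L ℕ.+ (b ℕ.+ a ℕ.+ c))

      vanish : q ^ (b ℕ.* length cellsπ ℕ.+ K₀) ≈ 0#
      vanish = q^-vanish (ℕₚ.≤-reflexive (≡.sym L≡))

      tableauTerm : List ℕ → PS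
      tableauTerm = Cut.tableauTerm K₀ b+K₀≤W vanish

      small : PS
      small = ΣList tableauTerm (fillings (length cellsπ) K₀)

      n<L : n < L
      n<L = ℕₚ.m≤n+m (suc n) K′

      small-coefficient : small n ≡ ℤ.+ countᵇ (counted n) (fillings (length cellsπ) K₀)
      small-coefficient = go (fillings (length cellsπ) K₀)
        where
        flip : ∀ w n → (n ≡ᵇ w) ≡ (w ≡ᵇ n)
        flip zero    zero    = ≡.refl
        flip zero    (suc n) = ≡.refl
        flip (suc w) zero    = ≡.refl
        flip (suc w) (suc n) = flip w n
        coefficient : ∀ x w → (ind x * q ^ w) n ≡ (if x ∧ (w ≡ᵇ n) then 1ℤ else 0ℤ)
        coefficient true  w = ≡.trans (trans (*-identityˡ (q ^ w)) (q^ w) n n<L) (≡.cong (λ y → if y then 1ℤ else 0ℤ) (flip w n))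
        coefficient false w = zeroˡ (q ^ w) n n<L
        go : ∀ xs → ΣList tableauTerm xs n ≡ ℤ.+ countᵇ (counted n) xs
        go []        = ≡.refl
        go (ts ∷ xs) with counted n ts | coefficient (isSSYT ts) (weight ts)
        ... | true  | eq = ≡.cong₂ ℤ._+_ eq (go xs)
        ... | false | eq = ≡.trans (≡.cong₂ ℤ._+_ eq (go xs)) (ℤₚ.+-identityˡ _)

      prodPS-fold : {A : Set} {f g : A → PS} → (∀ x → f x ≈ g x) → (xs : List A) → foldList f xs ≈ prodPS (map g xs)
      prodPS-fold                 e []       = refl
      prodPS-fold {f = f} {g = g} e (x ∷ xs) = *-cong {f x} {g x} {foldList f xs} {prodPS (map g xs)} (e x) (prodPS-fold e xs)

      numer denomInverse hooksInverse : PS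
      numer        = prodPS (map (λ { (i , j , k) → oneMinusQ ((m ℕ.+ 1) ℕ.* (i ℕ.+ j ℕ.+ k ∸ 1)) }) triples)
      denomInverse = prodPS (map (λ { (i , j , k) → invOneMinusQ ((m ℕ.+ 1) ℕ.* (i ℕ.+ j ℕ.+ k ∸ 2)) }) triples)
      hooksInverse = prodPS (map (λ { (i , j) → invOneMinusQ (hook i j) }) cellsρ)

      rhs≈ : q ^ N * Con.numer a b c d e m * Con.denomInverse a b c d e m * Con.hooksInverse a b c d e m ≈
             qpow N * numer * denomInverse * hooksInverse
      rhs≈ = *-cong {q ^ N * Con.numer a b c d e m * Con.denomInverse a b c d e m} {qpow N * numer * denomInverse} {Con.hooksInverse a b c d e m} {hooksInverse}
        (*-cong {q ^ N * Con.numer a b c d e m} {qpow N * numer} {Con.denomInverse a b c d e m} {denomInverse}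
          (*-cong {q ^ N} {qpow N} {Con.numer a b c d e m} {numer} (q^ N) (prodPS-fold (λ { (i , j , k) → oneMinus _ }) triples))
          (prodPS-fold (λ { (i , j , k) → refl }) triples))
        (prodPS-fold (λ { (i , j) → refl }) cellsρ)

      nontrivial : ¬ (1# ≈ 0#)
      nontrivial eq with eq 0 (ℕₚ.≤-trans (s≤s z≤n) n<L)
      ... | ()

      exponents : rightExponent a b c d e m ≡ K′ ℕ.+ N
      exponents = ≡.trans (≡.sym (ClosedForms.exponent-identity a b c d e m))
        (≡.trans (≡.cong (λ x → x ℕ.+ ghost ℕ.+ leftExponent a b c d e m) (≡.sym (Columns.N+b|π| a b c d e m)))
          (arith N (b ℕ.* length cellsπ) ghost (leftExponent a b c d e m)))
        where
        arith : ∀ N p g l → N ℕ.+ p ℕ.+ g ℕ.+ l ≡ l ℕ.+ (g ℕ.+ p) ℕ.+ N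
        arith = ℕ-solve

      small≈rhs : q ^ K′ * small ≈ q ^ K′ * rhs
      small≈rhs = trans
        (Con.conclusion a b c d e m {small} K′ N nontrivial
          (q^-vanish (ℕₚ.≤-trans (ℕₚ.m≤m+n L (b ℕ.+ a ℕ.+ c)) (ℕₚ.m≤m+n (L ℕ.+ (b ℕ.+ a ℕ.+ c)) (b ℕ.+ K₀))))
          (ℕₚ.≤-trans (ℕₚ.m≤n+m (b ℕ.+ a ℕ.+ c) L) (ℕₚ.m≤m+n (L ℕ.+ (b ℕ.+ a ℕ.+ c)) (b ℕ.+ K₀)))
          (Cut.diagonal-tableaux K₀ b+K₀≤W vanish (leftExponent a b c d e m)) exponents)
        (*-congˡ {q ^ K′} rhs≈)

    sπ≡rhs : sπ n ≡ rhs n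
    sπ≡rhs = ≡.trans (sπ-range n (leftExponent a b c d e m ℕ.+ ghost)) (≡.trans (≡.sym small-coefficient)
      (qpow-cancel K′ {small} {rhs} {suc n}
        (trans (*-congʳ {small} {qpow K′} {q ^ K′} (sym (q^ K′))) (trans small≈rhs (*-congʳ {rhs} {q ^ K′} {qpow K′} (q^ K′)))) n ℕₚ.≤-refl))

theorem4p2 : (a b c d e m : ℕ) → (n : ℕ) →
    Shape.sπ a b c d e m n ≡ Shape.rhs a b c d e m n
theorem4p2 a b c d e m n = Final.sπ≡rhs a b c d e m n
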